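{- Let $H$ be a $d$-regular $r$-uniform hypergraph on $n$ vertices, $r\geq 3$. There is a constant $c=c(r)>0$ depending only on $r$ such that: (i) If $d\leq n^{2/3}$, then $\lambda_2^{(r)}(H)\geq c\sqrt{d}$; in general, for any $p\geq 1$, $\lambda_2^{(p)}(H)\geq c\,n^{1-r/p}\sqrt{d}$. (ii) If $d<\frac{n^2}{4}$, then $\mu^{(r)}(H)\geq c\sqrt{d}$; in general, for any $p\geq 1$, $\mu^{(p)}(H)\geq c\,n^{1-r/p}\sqrt{d}$. (iii) If $r\geq 4$ and $\frac{n^2}{4}\leq d\leq \frac{1}{2}\binom{n-1}{r-1}$, then $\mu^{(r)}(H)\geq \frac{cd}{n}$; in general, for any $p\geq 1$, $\mu^{(p)}(H)\geq c\,d\,n^{ -r/p}$.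
   Context: For an $r$-uniform hypergraph $H$ on vertex set $V$ with $|V|=n$, its adjacency map is the symmetric multilinear function $\tau_H$ on $(\mathbb{C}^V)^r$ given by $$\tau_H(x_1,\dots,x_r)=\frac{1}{(r-1)!}\sum_{\substack{v_1,\dots,v_r\in V\\ \{v_1,\dots,v_r\}\in E(H)}}x_1(v_1)\cdots x_r(v_r).$$ The normalized adjacency map is $\sigma_H=\tau_H-\frac{r|E(H)|}{n^r}J$, where $J(x_1,\dots,x_r)=\sum_{v_1,\dots,v_r\in V}x_1(v_1)\cdots x_r(v_r)$. For $p>0$, $\|x\|_p=(\sum_v|x(v)|^p)^{1/p}$. Define $$\lambda_2^{(p)}(H)=\sup_{x\in\mathbb{R}^V,\ \|x\|_p=1}\sigma_H(x,\dots,x),\qquad \mu^{(p)}(H)=\sup_{\|x_1\|_p=\dots=\|x_r\|_p=1}|\sigma_H(x_1,\dots,x_r)|.$$ $H$ is $d$-regular if every vertex lies in exactly $d$ edges. -}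

module Defs where

open import Algebra.Bundles.Raw using (RawSemiring)
import Algebra.Definitions.RawSemiring as RawSemiringDefs
open import Data.Bool using (if_then_else_)
import Data.Bool.Properties as Bool
open import Data.Fin using (Fin; toℕ)
open import Data.Fin.Subset using (Subset; ∣_∣; ⁅_⁆; ⋃)
open import Data.Fin.Subset.Properties using () renaming (_∈?_ to _∈ˢ?_)
import Data.Integer as ℤ
open import Data.List using (List; length; filter)
open import Data.List.Membership.DecPropositional using (_∈?_)
open import Data.List.Relation.Unary.All using (All)
open import Data.List.Relation.Unary.Unique.Propositional using (Unique)
open import Data.Nat as ℕ using (ℕ; zero; suc; NonZero; _∸_; _!)
import Data.Nat.Properties as ℕ
open import Data.Product using (Σ; ∃; _×_; _,_)
open import Data.Rational as ℚ using (ℚ; 0ℚ; 1ℚ; ½)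
import Data.Rational.Properties as ℚ
open import Data.Rational.Solver using (module +-*-Solver)
open import Data.Sum using (_⊎_)
import Data.Vec.Functional as Vector
open import Data.Vec.Properties using (≡-dec)
open import Level using (0ℓ)
open import Relation.Binary.Definitions using (DecidableEquality)
open import Relation.Binary.PropositionalEquality using (_≡_; refl; sym; trans; cong; cong₂; subst)
open import Relation.Nullary using (yes; no; does; contradiction)

private
  module ℚLemmas where
    open +-*-Solver

    half-pos : ∀ {ε} → 0ℚ ℚ.< ε → 0ℚ ℚ.< ½ ℚ.* ε
    half-pos {ε} 0<ε = subst (ℚ._< ½ ℚ.* ε) (ℚ.*-zeroʳ ½) (ℚ.*-monoʳ-<-pos ½ 0<ε)

    halves : ∀ ε → ½ ℚ.* ε ℚ.+ ½ ℚ.* ε ≡ ε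
    halves ε = trans (sym (ℚ.*-distribʳ-+ ε ½ ½)) (ℚ.*-identityˡ ε)

    *-pos : ∀ {p q} → 0ℚ ℚ.< p → 0ℚ ℚ.< q → 0ℚ ℚ.< p ℚ.* q
    *-pos {p} {q} 0<p 0<q =
      ℚ.positive⁻¹ (p ℚ.* q) {{ℚ.pos*pos⇒pos p {{ℚ.positive 0<p}} q {{ℚ.positive 0<q}}}}

    0≤∣_∣ : ∀ q → 0ℚ ℚ.≤ ℚ.∣ q ∣
    0≤∣ q ∣ = ℚ.nonNegative⁻¹ ℚ.∣ q ∣ {{ℚ.∣-∣-nonNeg q}}

    *-mono-≤ : ∀ {p q r s} → 0ℚ ℚ.≤ q → 0ℚ ℚ.≤ r → p ℚ.≤ q → r ℚ.≤ s → p ℚ.* r ℚ.≤ q ℚ.* s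
    *-mono-≤ {p} {q} {r} {s} 0≤q 0≤r p≤q r≤s =
      ℚ.≤-trans (ℚ.*-monoʳ-≤-nonNeg r {{ℚ.nonNegative 0≤r}} p≤q)
                (ℚ.*-monoˡ-≤-nonNeg q {{ℚ.nonNegative 0≤q}} r≤s)

    +-diff : ∀ a b c d → (a ℚ.+ b) ℚ.- (c ℚ.+ d) ≡ (a ℚ.- c) ℚ.+ (b ℚ.- d)
    +-diff = solve 4 (λ a b c d → (a :+ b) :- (c :+ d) := (a :- c) :+ (b :- d)) refl

    neg-diff : ∀ a b → (ℚ.- a) ℚ.- (ℚ.- b) ≡ ℚ.- (a ℚ.- b)
    neg-diff = solve 2 (λ a b → (:- a) :- (:- b) := :- (a :- b)) refl

    *-diff : ∀ a b c d → (a ℚ.* b) ℚ.- (c ℚ.* d) ≡ a ℚ.* (b ℚ.- d) ℚ.+ (a ℚ.- c) ℚ.* d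
    *-diff = solve 4 (λ a b c d → (a :* b) :- (c :* d) := a :* (b :- d) :+ (a :- c) :* d) refl

    recover : ∀ a b → a ≡ (a ℚ.- b) ℚ.+ b
    recover = solve 2 (λ a b → a := (a :- b) :+ b) refl

    inv-diff : ∀ a b a′ b′ → (a′ ℚ.- b′) ℚ.* (a ℚ.* b) ≡ (a ℚ.* a′) ℚ.* b ℚ.- (b ℚ.* b′) ℚ.* a
    inv-diff = solve 4 (λ a b a′ b′ →
      (a′ :- b′) :* (a :* b) := (a :* a′) :* b :- (b :* b′) :* a) refl

    swap-diff : ∀ a b → 1ℚ ℚ.* b ℚ.- 1ℚ ℚ.* a ≡ ℚ.- (a ℚ.- b)
    swap-diff = solve 2 (λ a b → con 1ℚ :* b :- con 1ℚ :* a := :- (a :- b)) refl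

    cancel½ : ∀ p → (p ℚ.+ ½) ℚ.+ ℚ.- ½ ≡ p
    cancel½ = solve 1 (λ p → (p :+ con ½) :+ con (ℚ.- ½) := p) refl

  open ℚLemmas

-- The real numbers, as the setoid of Cauchy sequences of rationals.  Roots,
-- exponentials, powers, moduli and norms are given by their (functional) graphs
-- IsSqrt, IsExp, IsPow, IsModulus, IsNorm, with the value as last argument.

record ℝ : Set where
  constructor mkℝ
  field
    seq    : ℕ → ℚ
    cauchy : ∀ ε → 0ℚ ℚ.< ε →
             ∃ λ N → ∀ m n → N ℕ.≤ m → N ℕ.≤ n → ℚ.∣ seq m ℚ.- seq n ∣ ℚ.< ε

open ℝ public

infix 4 _≈_ _≤_ _<_

_≈_ : ℝ → ℝ → Set
x ≈ y = ∀ ε → 0ℚ ℚ.< ε → ∃ λ N → ∀ n → N ℕ.≤ n → ℚ.∣ seq x n ℚ.- seq y n ∣ ℚ.≤ ε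

_≤_ : ℝ → ℝ → Set
x ≤ y = ∀ ε → 0ℚ ℚ.< ε → ∃ λ N → ∀ n → N ℕ.≤ n → seq x n ℚ.≤ seq y n ℚ.+ ε

_<_ : ℝ → ℝ → Set
x < y = ∃ λ ε → (0ℚ ℚ.< ε) × ∃ λ N → ∀ n → N ℕ.≤ n → seq x n ℚ.+ ε ℚ.≤ seq y n

fromℚ : ℚ → ℝ
fromℚ q = mkℝ (λ _ → q) λ ε 0<ε →
  0 , λ _ _ _ _ → subst (ℚ._< ε) (sym (cong ℚ.∣_∣ (ℚ.+-inverseʳ q))) 0<ε

fromℕ : ℕ → ℝ
fromℕ n = fromℚ (ℤ.+ n ℚ./ 1)

0ℝ 1ℝ : ℝ
0ℝ = fromℚ 0ℚ
1ℝ = fromℚ 1ℚ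

infixl 6 _+_ _-_
infixl 7 _*_
infix  8 -_

_+_ : ℝ → ℝ → ℝ
x + y = mkℝ (λ n → seq x n ℚ.+ seq y n) λ ε 0<ε →
  let (M , hM) = cauchy x (½ ℚ.* ε) (half-pos 0<ε)
      (N , hN) = cauchy y (½ ℚ.* ε) (half-pos 0<ε)
  in M ℕ.⊔ N , λ m n m≥ n≥ →
    ℚ.≤-<-trans
      (ℚ.≤-trans
        (ℚ.≤-reflexive (cong ℚ.∣_∣ (+-diff (seq x m) (seq y m) (seq x n) (seq y n))))
        (ℚ.∣p+q∣≤∣p∣+∣q∣ (seq x m ℚ.- seq x n) (seq y m ℚ.- seq y n)))
      (subst (_ ℚ.<_) (halves ε)
        (ℚ.+-mono-< (hM m n (ℕ.m⊔n≤o⇒m≤o M N m≥) (ℕ.m⊔n≤o⇒m≤o M N n≥))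
                    (hN m n (ℕ.m⊔n≤o⇒n≤o M N m≥) (ℕ.m⊔n≤o⇒n≤o M N n≥))))

-_ : ℝ → ℝ
- x = mkℝ (λ n → ℚ.- seq x n) λ ε 0<ε →
  let (N , hN) = cauchy x ε 0<ε
  in N , λ m n m≥ n≥ →
    subst (ℚ._< ε)
      (sym (trans (cong ℚ.∣_∣ (neg-diff (seq x m) (seq x n))) (ℚ.∣-p∣≡∣p∣ (seq x m ℚ.- seq x n))))
      (hN m n m≥ n≥)

_-_ : ℝ → ℝ → ℝ
x - y = x + (- y)

private
  eventually-bounded : ∀ x → ∃ λ B → (0ℚ ℚ.< B) × ∃ λ N → ∀ n → N ℕ.≤ n → ℚ.∣ seq x n ∣ ℚ.≤ B
  eventually-bounded x with cauchy x 1ℚ (ℚ.positive⁻¹ 1ℚ)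
  ... | N , hN =
    1ℚ ℚ.+ ℚ.∣ seq x N ∣ ,
    subst (ℚ._< 1ℚ ℚ.+ ℚ.∣ seq x N ∣) (ℚ.+-identityˡ 0ℚ)
      (ℚ.+-mono-<-≤ (ℚ.positive⁻¹ 1ℚ) 0≤∣ seq x N ∣) ,
    N , λ n n≥ →
      ℚ.≤-trans
        (ℚ.≤-trans (ℚ.≤-reflexive (cong ℚ.∣_∣ (recover (seq x n) (seq x N))))
                   (ℚ.∣p+q∣≤∣p∣+∣q∣ (seq x n ℚ.- seq x N) (seq x N)))
        (ℚ.+-monoˡ-≤ ℚ.∣ seq x N ∣ (ℚ.<⇒≤ (hN n N n≥ ℕ.≤-refl)))

  divide : ∀ {B ε} → 0ℚ ℚ.< B → 0ℚ ℚ.< ε → ∃ λ δ → (0ℚ ℚ.< δ) × (B ℚ.* δ ≡ ε)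
  divide {B} {ε} 0<B 0<ε = B⁻¹ ℚ.* ε , *-pos 0<B⁻¹ 0<ε ,
    trans (sym (ℚ.*-assoc B B⁻¹ ε))
      (trans (cong (ℚ._* ε) (ℚ.*-inverseʳ B {{ℚ.pos⇒nonZero B {{B-pos}}}})) (ℚ.*-identityˡ ε))
    where
    B-pos : ℚ.Positive B
    B-pos = ℚ.positive 0<B
    B⁻¹ : ℚ
    B⁻¹ = (ℚ.1/ B) {{ℚ.pos⇒nonZero B {{B-pos}}}}
    0<B⁻¹ : 0ℚ ℚ.< B⁻¹
    0<B⁻¹ = ℚ.positive⁻¹ B⁻¹ {{ℚ.1/pos⇒pos B {{B-pos}}}}

  *-close : ∀ {A B α β ε} xm xn ym yn → 0ℚ ℚ.< A → 0ℚ ℚ.< B →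
            A ℚ.* α ≡ ½ ℚ.* ε → B ℚ.* β ≡ ½ ℚ.* ε →
            ℚ.∣ xm ∣ ℚ.≤ A → ℚ.∣ yn ∣ ℚ.≤ B →
            ℚ.∣ xm ℚ.- xn ∣ ℚ.< β → ℚ.∣ ym ℚ.- yn ∣ ℚ.< α →
            ℚ.∣ xm ℚ.* ym ℚ.- xn ℚ.* yn ∣ ℚ.< ε
  *-close {A} {B} {α} {β} {ε} xm xn ym yn 0<A 0<B Aα Bβ xm≤A yn≤B x-close y-close = begin-strict
    ℚ.∣ xm ℚ.* ym ℚ.- xn ℚ.* yn ∣
      ≡⟨ cong ℚ.∣_∣ (*-diff xm ym xn yn) ⟩
    ℚ.∣ xm ℚ.* (ym ℚ.- yn) ℚ.+ (xm ℚ.- xn) ℚ.* yn ∣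
      ≤⟨ ℚ.∣p+q∣≤∣p∣+∣q∣ (xm ℚ.* (ym ℚ.- yn)) ((xm ℚ.- xn) ℚ.* yn) ⟩
    ℚ.∣ xm ℚ.* (ym ℚ.- yn) ∣ ℚ.+ ℚ.∣ (xm ℚ.- xn) ℚ.* yn ∣
      ≡⟨ cong₂ ℚ._+_ (ℚ.∣p*q∣≡∣p∣*∣q∣ xm (ym ℚ.- yn))
           (trans (ℚ.∣p*q∣≡∣p∣*∣q∣ (xm ℚ.- xn) yn) (ℚ.*-comm ℚ.∣ xm ℚ.- xn ∣ ℚ.∣ yn ∣)) ⟩
    ℚ.∣ xm ∣ ℚ.* ℚ.∣ ym ℚ.- yn ∣ ℚ.+ ℚ.∣ yn ∣ ℚ.* ℚ.∣ xm ℚ.- xn ∣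
      ≤⟨ ℚ.+-mono-≤
           (ℚ.*-monoʳ-≤-nonNeg ℚ.∣ ym ℚ.- yn ∣ {{ℚ.∣-∣-nonNeg (ym ℚ.- yn)}} xm≤A)
           (ℚ.*-monoʳ-≤-nonNeg ℚ.∣ xm ℚ.- xn ∣ {{ℚ.∣-∣-nonNeg (xm ℚ.- xn)}} yn≤B) ⟩
    A ℚ.* ℚ.∣ ym ℚ.- yn ∣ ℚ.+ B ℚ.* ℚ.∣ xm ℚ.- xn ∣
      <⟨ ℚ.+-mono-< (ℚ.*-monoʳ-<-pos A {{ℚ.positive 0<A}} y-close)
                    (ℚ.*-monoʳ-<-pos B {{ℚ.positive 0<B}} x-close) ⟩
    A ℚ.* α ℚ.+ B ℚ.* β
      ≡⟨ trans (cong₂ ℚ._+_ Aα Bβ) (halves ε) ⟩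
    ε ∎
    where open ℚ.≤-Reasoning

  *-cauchy : ∀ x y ε → 0ℚ ℚ.< ε → ∃ λ N → ∀ m n → N ℕ.≤ m → N ℕ.≤ n →
             ℚ.∣ seq x m ℚ.* seq y m ℚ.- seq x n ℚ.* seq y n ∣ ℚ.< ε
  *-cauchy x y ε 0<ε =
    let (A , 0<A , K , hA) = eventually-bounded x
        (B , 0<B , L , hB) = eventually-bounded y
        (α , 0<α , Aα)     = divide 0<A (half-pos 0<ε)
        (β , 0<β , Bβ)     = divide 0<B (half-pos 0<ε)
        (M , hM)           = cauchy x β 0<β
        (N , hN)           = cauchy y α 0<α
    in (K ℕ.⊔ L) ℕ.⊔ (M ℕ.⊔ N) , λ m n m≥ n≥ →
      *-close (seq x m) (seq x n) (seq y m) (seq y n) 0<A 0<B Aα Bβ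
        (hA m (ℕ.m⊔n≤o⇒m≤o K L (ℕ.m⊔n≤o⇒m≤o (K ℕ.⊔ L) (M ℕ.⊔ N) m≥)))
        (hB n (ℕ.m⊔n≤o⇒n≤o K L (ℕ.m⊔n≤o⇒m≤o (K ℕ.⊔ L) (M ℕ.⊔ N) n≥)))
        (hM m n (ℕ.m⊔n≤o⇒m≤o M N (ℕ.m⊔n≤o⇒n≤o (K ℕ.⊔ L) (M ℕ.⊔ N) m≥))
                (ℕ.m⊔n≤o⇒m≤o M N (ℕ.m⊔n≤o⇒n≤o (K ℕ.⊔ L) (M ℕ.⊔ N) n≥)))
        (hN m n (ℕ.m⊔n≤o⇒n≤o M N (ℕ.m⊔n≤o⇒n≤o (K ℕ.⊔ L) (M ℕ.⊔ N) m≥))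
                (ℕ.m⊔n≤o⇒n≤o M N (ℕ.m⊔n≤o⇒n≤o (K ℕ.⊔ L) (M ℕ.⊔ N) n≥)))

_*_ : ℝ → ℝ → ℝ
x * y = mkℝ (λ n → seq x n ℚ.* seq y n) (*-cauchy x y)

invℚ : ℚ → ℚ
invℚ q with q ℚ.≟ 0ℚ
... | yes _   = 0ℚ
... | no  q≢0 = (ℚ.1/ q) {{ℚ.≢-nonZero q≢0}}

private
  invℚ-inverse : ∀ {q} → 0ℚ ℚ.< q → q ℚ.* invℚ q ≡ 1ℚ
  invℚ-inverse {q} 0<q with q ℚ.≟ 0ℚ
  ... | yes q≡0 = contradiction (sym q≡0) (ℚ.<⇒≢ 0<q)
  ... | no  q≢0 = ℚ.*-inverseʳ q {{ℚ.≢-nonZero q≢0}}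

  recip-cauchy : ∀ x → 0ℝ < x → ∀ ε → 0ℚ ℚ.< ε → ∃ λ N → ∀ m n → N ℕ.≤ m → N ℕ.≤ n →
                 ℚ.∣ invℚ (seq x m) ℚ.- invℚ (seq x n) ∣ ℚ.< ε
  recip-cauchy x (η , 0<η , K , hK) ε 0<ε
    with cauchy x (ε ℚ.* (η ℚ.* η)) (*-pos 0<ε (*-pos 0<η 0<η))
  ... | L , hL = K ℕ.⊔ L , proof
    where
    proof : ∀ m n → K ℕ.⊔ L ℕ.≤ m → K ℕ.⊔ L ℕ.≤ n →
            ℚ.∣ invℚ (seq x m) ℚ.- invℚ (seq x n) ∣ ℚ.< ε
    proof m n m≥ n≥ =
      ℚ.*-cancelʳ-<-nonNeg (η ℚ.* η) {{ℚ.nonNegative (ℚ.<⇒≤ (*-pos 0<η 0<η))}} (begin-strict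
        ℚ.∣ a′ ℚ.- b′ ∣ ℚ.* (η ℚ.* η)
          ≤⟨ ℚ.*-monoˡ-≤-nonNeg ℚ.∣ a′ ℚ.- b′ ∣ {{ℚ.∣-∣-nonNeg (a′ ℚ.- b′)}}
               (*-mono-≤ (ℚ.<⇒≤ 0<a) (ℚ.<⇒≤ 0<η) η≤a η≤b) ⟩
        ℚ.∣ a′ ℚ.- b′ ∣ ℚ.* (a ℚ.* b)
          ≡⟨ cong (ℚ.∣ a′ ℚ.- b′ ∣ ℚ.*_) (sym (ℚ.0≤p⇒∣p∣≡p (ℚ.<⇒≤ (*-pos 0<a 0<b)))) ⟩
        ℚ.∣ a′ ℚ.- b′ ∣ ℚ.* ℚ.∣ a ℚ.* b ∣
          ≡⟨ sym (ℚ.∣p*q∣≡∣p∣*∣q∣ (a′ ℚ.- b′) (a ℚ.* b)) ⟩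
        ℚ.∣ (a′ ℚ.- b′) ℚ.* (a ℚ.* b) ∣
          ≡⟨ cong ℚ.∣_∣ (trans (inv-diff a b a′ b′)
               (trans (cong₂ (λ s t → s ℚ.* b ℚ.- t ℚ.* a) (invℚ-inverse 0<a) (invℚ-inverse 0<b))
                      (swap-diff a b))) ⟩
        ℚ.∣ ℚ.- (a ℚ.- b) ∣
          ≡⟨ ℚ.∣-p∣≡∣p∣ (a ℚ.- b) ⟩
        ℚ.∣ a ℚ.- b ∣
          <⟨ hL m n (ℕ.m⊔n≤o⇒n≤o K L m≥) (ℕ.m⊔n≤o⇒n≤o K L n≥) ⟩
        ε ℚ.* (η ℚ.* η) ∎)
      where
      open ℚ.≤-Reasoning
      a b a′ b′ : ℚ
      a  = seq x m
      b  = seq x n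
      a′ = invℚ a
      b′ = invℚ b
      η≤a : η ℚ.≤ a
      η≤a = subst (ℚ._≤ a) (ℚ.+-identityˡ η) (hK m (ℕ.m⊔n≤o⇒m≤o K L m≥))
      η≤b : η ℚ.≤ b
      η≤b = subst (ℚ._≤ b) (ℚ.+-identityˡ η) (hK n (ℕ.m⊔n≤o⇒m≤o K L n≥))
      0<a : 0ℚ ℚ.< a
      0<a = ℚ.<-≤-trans 0<η η≤a
      0<b : 0ℚ ℚ.< b
      0<b = ℚ.<-≤-trans 0<η η≤b

recip : (x : ℝ) → 0ℝ < x → ℝ
recip x 0<x = mkℝ (λ n → invℚ (seq x n)) (recip-cauchy x 0<x)

1≤⇒0< : ∀ x → 1ℝ ≤ x → 0ℝ < x
1≤⇒0< x 1≤x with 1≤x ½ (ℚ.positive⁻¹ ½)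
... | N , hN = ½ , ℚ.positive⁻¹ ½ , N , λ n n≥ →
  subst (½ ℚ.≤_) (cancel½ (seq x n)) (ℚ.+-monoˡ-≤ (ℚ.- ½) (hN n n≥))

0<fromℕ : ∀ {m n} → m ℕ.< n → 0ℝ < fromℕ n
0<fromℕ {n = suc n} _ =
  ℤ.+ suc n ℚ./ 1 , ℚ.positive⁻¹ (ℤ.+ suc n ℚ./ 1) {{ℚ.normalize-pos (suc n) 1}} ,
  0 , λ _ _ → ℚ.≤-reflexive (ℚ.+-identityˡ (ℤ.+ suc n ℚ./ 1))

ℝ-rawSemiring : RawSemiring 0ℓ 0ℓ
ℝ-rawSemiring = record
  { Carrier = ℝ ; _≈_ = _≈_ ; _+_ = _+_ ; _*_ = _*_ ; 0# = 0ℝ ; 1# = 1ℝ }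

module ℝΣ = RawSemiringDefs ℝ-rawSemiring

IsSqrt : ℝ → ℝ → Set
IsSqrt a s = (0ℝ ≤ s) × (s * s ≈ a)

ConvergesTo : (ℕ → ℝ) → ℝ → Set
ConvergesTo a l =
  ∀ ε → 0ℚ ℚ.< ε → ∃ λ N → ∀ n → N ℕ.≤ n → (a n - l ≤ fromℚ ε) × (l - a n ≤ fromℚ ε)

IsExp : ℝ → ℝ → Set
IsExp t y = ConvergesTo partialSum y
  where
  term : ℕ → ℝ
  term k = (t ℝΣ.^ k) * fromℚ ((ℤ.+ 1 ℚ./ (k !)) {{k ℕ.!≢0}})
  partialSum : ℕ → ℝ
  partialSum N = ℝΣ.sum {N} (λ k → term (toℕ k))

-- IsPow x a y means y = x ^ a, for x ≥ 0 and a real exponent a: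
-- 0 ^ a = 0 for a > 0, and x ^ a = exp (a ln x) for x > 0, where t = ln x.
IsPow : ℝ → ℝ → ℝ → Set
IsPow x a y =
    ((x ≈ 0ℝ) × (0ℝ < a) × (y ≈ 0ℝ))
  ⊎ (∃ λ t → IsExp t x × IsExp (a * t) y)

-- An extended real s, given by its lower cut { q ∈ ℚ ∣ q < s }.  Suprema of
-- arbitrary sets of reals exist in this form (sup ∅ being the empty cut, -∞).
LowerReal : Set₁
LowerReal = ℚ → Set

sup : (ℝ → Set) → LowerReal
sup S q = ∃ λ s → S s × (fromℚ q < s)

infix 4 _≤ᴸ_

_≤ᴸ_ : ℝ → LowerReal → Set
b ≤ᴸ s = ∀ q → fromℚ q < b → s q

record ℂ : Set where
  constructor _+i_
  field
    re im : ℝ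

open ℂ public

infix 4 _≈ᶜ_
infixl 6 _+ᶜ_ _-ᶜ_
infixl 7 _*ᶜ_

_≈ᶜ_ : ℂ → ℂ → Set
z ≈ᶜ w = (re z ≈ re w) × (im z ≈ im w)

_+ᶜ_ : ℂ → ℂ → ℂ
z +ᶜ w = (re z + re w) +i (im z + im w)

_-ᶜ_ : ℂ → ℂ → ℂ
z -ᶜ w = (re z - re w) +i (im z - im w)

_*ᶜ_ : ℂ → ℂ → ℂ
z *ᶜ w = (re z * re w - im z * im w) +i (re z * im w + im z * re w)

fromℝ : ℝ → ℂ
fromℝ x = x +i 0ℝ

ℂ-rawSemiring : RawSemiring 0ℓ 0ℓ
ℂ-rawSemiring = record
  { Carrier = ℂ ; _≈_ = _≈ᶜ_ ; _+_ = _+ᶜ_ ; _*_ = _*ᶜ_ ; 0# = fromℝ 0ℝ ; 1# = fromℝ 1ℝ }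

module ℂΣ = RawSemiringDefs ℂ-rawSemiring

IsModulus : ℂ → ℝ → Set
IsModulus z m = IsSqrt (re z * re z + im z * im z) m

-- IsNorm p 0<p x N means N = (∑ᵥ ∣x(v)∣ᵖ)^(1/p); here a v = ∣x(v)∣ and b v = ∣x(v)∣ᵖ.
IsNorm : ∀ {n} (p : ℝ) → 0ℝ < p → (Fin n → ℂ) → ℝ → Set
IsNorm {n} p 0<p x N =
  Σ (Fin n → ℝ) λ a → Σ (Fin n → ℝ) λ b →
    (∀ v → IsModulus (x v) (a v)) ×
    (∀ v → IsPow (a v) p (b v)) ×
    IsPow (ℝΣ.sum b) (recip p 0<p) N

record Hypergraph (r n : ℕ) : Set where
  field
    edges   : List (Subset n)
    unique  : Unique edges
    uniform : All (λ e → ∣ e ∣ ≡ r) edges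

open Hypergraph public

_≟ˢ_ : ∀ {n} → DecidableEquality (Subset n)
_≟ˢ_ = ≡-dec Bool._≟_

degree : ∀ {r n} → Hypergraph r n → Fin n → ℕ
degree H v = length (filter (v ∈ˢ?_) (edges H))

Regular : ∀ {r n} → ℕ → Hypergraph r n → Set
Regular d H = ∀ v → degree H v ≡ d

image : ∀ {r n} → (Fin r → Fin n) → Subset n
image t = ⋃ (Vector.toList (Vector.map ⁅_⁆ t))

∑-tuples : ∀ {n} r → ((Fin r → Fin n) → ℂ) → ℂ
∑-tuples zero    f = f Vector.[]
∑-tuples (suc r) f = ℂΣ.sum (λ v → ∑-tuples r (λ t → f (v Vector.∷ t)))

module _ {r n : ℕ} (H : Hypergraph r n) where

  τ : (Fin r → Fin n → ℂ) → ℂ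
  τ x = fromℝ (fromℚ ((ℤ.+ 1 ℚ./ ((r ∸ 1) !)) {{(r ∸ 1) ℕ.!≢0}})) *ᶜ
        ∑-tuples r (λ t → if does (_∈?_ _≟ˢ_ (image t) (edges H))
                          then ℂΣ.product (λ i → x i (t i))
                          else fromℝ 0ℝ)

J : ∀ {r n} → (Fin r → Fin n → ℂ) → ℂ
J {r} x = ∑-tuples r (λ t → ℂΣ.product (λ i → x i (t i)))

module _ {r n : ℕ} .{{_ : NonZero n}} (H : Hypergraph r n) where

  σ : (Fin r → Fin n → ℂ) → ℂ
  σ x = τ H x -ᶜ
        fromℝ (fromℚ ((ℤ.+ (r ℕ.* length (edges H)) ℚ./ (n ℕ.^ r)) {{ℕ.m^n≢0 n r}})) *ᶜ J x

  λ₂ : (p : ℝ) → 0ℝ < p → LowerReal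
  λ₂ p 0<p = sup λ s → Σ (Fin n → ℝ) λ x →
    IsNorm p 0<p (λ v → fromℝ (x v)) 1ℝ ×
    (σ (λ _ v → fromℝ (x v)) ≈ᶜ fromℝ s)

  μ : (p : ℝ) → 0ℝ < p → LowerReal
  μ p 0<p = sup λ s → Σ (Fin r → Fin n → ℂ) λ x →
    (∀ i → IsNorm p 0<p (x i) 1ℝ) ×
    IsModulus (σ x) s

{-# OPTIONS --safe #-}
module Submission where

-- All lower bounds come from explicit test vectors with entries 0 or of absolute value in [1 , 5],
-- so that normalising them in the p-norm costs at most a factor 5 ^ r * n ^ (r/p).
--
-- (iii) For a random sign vector ε, the average of σ (ε , ε , 1 , … , 1) only sees tuples whose first
-- two entries agree.  These are never edges, so the average is exactly -d.
--
-- (ii) If n < (r-1)! the bound of (iii) suffices.  Otherwise choose r-1 sign vectors at random and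
-- the last one optimally: σ becomes ∑ᵥ ∣fᵥ∣, where each fᵥ is a multilinear form in random signs with
-- second moment of order d and fourth moment at most 3 ^ (r-1) times its square, so that
-- ∣f∣ ≥ f²/s - f⁴/s³ yields 𝔼 ∣fᵥ∣ ≥ c √d.
--
-- (i) For random signs g put x = 3 + g + β z, where zᵥ truncates (∑ᵤ w(u,v) gᵤ) / √d and w(u,v) is the
-- codegree.  Every xᵥ is a nonnegative increasing function of g, so Harris' inequality gives
-- 𝔼 τ(x) ≥ 3 ^ r n d + c n √d, while the variance of ∑ x is O (n d) because z is Lipschitz; as d ≤ n ^ (2/3)
-- the J-term only loses a small multiple of n √d.  For bounded n, signs of product 1 and sum at most 2
-- on a single edge make σ positive.
--
-- Real powers are exp (a ln x), with ln x for x ≥ 1 found by inverting the Taylor sums of exp on finer and finer grids.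

-- The argument stays rational as long as possible: test vectors have rational entries, `σℚ`
-- evaluates the form on them, √d is replaced by an integer t with d ≤ t² ≤ 4d, and constants are
-- explicit naturals. Real numbers enter through √d, the powers of n and the normalising factors,
-- which multilinearity pulls out of σ. Since a supremum is a lower cut, one vector per bound is
-- enough.
--
-- By regularity the J-term at a vector of mean a in every slot is d n a^r. The obstacle in (i) is
-- that the same vector fills all slots, so none is left for an optimal choice: x has to correlate
-- with its own image under the codegree matrix, which is why z is added to g. Truncating z keeps x
-- bounded and makes ∑ z Lipschitz in each sign; the shift by 3 puts the entries in [1 , 5], since
-- Harris needs nonnegative factors. The mean of x is random, and its variance costs order d + β² d²
-- in the J-term, against a gain of order β n √d. Here d² ≤ n √d is the same as d ≤ n ^ (2/3), and a
-- small β makes the gain win.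

open import Data.Fin using (Fin; zero; suc)
import Data.Integer as ℤ
open import Data.Nat as ℕ using (ℕ; zero; suc; s≤s; NonZero; _∸_; _!)
import Data.Nat.Properties as ℕ
open import Data.Nat.Tactic.RingSolver using () renaming (solve-∀ to solveℕ-∀)
open import Data.Product using (Σ; ∃; _×_; _,_; proj₁; proj₂)
open import Data.Sum using (_⊎_; inj₁; inj₂)
open import Data.Vec.Functional as Vector using () renaming (_∷_ to _◂_)
open import Function using (_∘_)
open import Relation.Binary.PropositionalEquality hiding (J)
open import Relation.Nullary using (Dec; yes; no; does; contradiction)
open import Tactic.RingSolver using (solve-∀)

-- Ordered arithmetic of the rationals, and the naturals inside them

module Rationals where
  open import Data.Integer as ℤ using (+_)
  import Data.Integer.Properties as ℤ
  open import Data.Maybe using (Maybe; just; nothing)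
  open import Data.Rational hiding (NonZero)
  open import Data.Rational.Properties
  open import Data.Rational.Unnormalised as ℚᵘ using (mkℚᵘ; *≡*)
  import Data.Rational.Unnormalised.Properties as ℚᵘ
  open import Tactic.RingSolver.Core.AlmostCommutativeRing using (AlmostCommutativeRing; fromCommutativeRing)

  ℚ-ring : AlmostCommutativeRing _ _
  ℚ-ring = fromCommutativeRing +-*-commutativeRing 0≟
    where
    0≟ : ∀ x → Maybe (0ℚ ≡ x)
    0≟ x with 0ℚ ≟ x
    ... | yes p = just p
    ... | no  _ = nothing

  -- The numeral inside `fromℕ`: `fromℕ n` unfolds to `fromℚ (ι n)`.
  ι : ℕ → ℚ
  ι n = + n / 1

  private
    toℚᵘ-/ : ∀ i n → toℚᵘ (i / suc n) ℚᵘ.≃ mkℚᵘ i n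
    toℚᵘ-/ i n = toℚᵘ-fromℚᵘ (mkℚᵘ i n)

    +-/1 : ∀ m n → mkℚᵘ (+ (m ℕ.+ n)) 0 ℚᵘ.≃ mkℚᵘ (+ m) 0 ℚᵘ.+ mkℚᵘ (+ n) 0
    +-/1 m n = *≡* (cong₂ ℤ._*_ (trans (ℤ.pos-+ m n)
      (sym (cong₂ ℤ._+_ (ℤ.*-identityʳ (+ m)) (ℤ.*-identityʳ (+ n))))) refl)

    *-/1 : ∀ m n → mkℚᵘ (+ (m ℕ.* n)) 0 ℚᵘ.≃ mkℚᵘ (+ m) 0 ℚᵘ.* mkℚᵘ (+ n) 0
    *-/1 m n = *≡* (cong (ℤ._* + 1) (ℤ.pos-* m n))

  ι-+ : ∀ m n → ι (m ℕ.+ n) ≡ ι m + ι n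
  ι-+ m n = toℚᵘ-injective (ℚᵘ.≃-trans (toℚᵘ-/ (+ (m ℕ.+ n)) 0) (ℚᵘ.≃-trans (+-/1 m n)
    (ℚᵘ.≃-sym (ℚᵘ.≃-trans (toℚᵘ-homo-+ (ι m) (ι n))
      (ℚᵘ.+-cong (toℚᵘ-/ (+ m) 0) (toℚᵘ-/ (+ n) 0))))))

  ι-* : ∀ m n → ι (m ℕ.* n) ≡ ι m * ι n
  ι-* m n = toℚᵘ-injective (ℚᵘ.≃-trans (toℚᵘ-/ (+ (m ℕ.* n)) 0) (ℚᵘ.≃-trans (*-/1 m n)
    (ℚᵘ.≃-sym (ℚᵘ.≃-trans (toℚᵘ-homo-* (ι m) (ι n))
      (ℚᵘ.*-cong (toℚᵘ-/ (+ m) 0) (toℚᵘ-/ (+ n) 0))))))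

  ι-suc : ∀ n → ι (suc n) ≡ 1ℚ + ι n
  ι-suc n = ι-+ 1 n

  -- Serves to clear the denominators of 1/(r-1)!, r|E|/n^r, d/n and 1/k!.
  /-*-ι : ∀ a b .{{_ : NonZero b}} → (+ a / b) * ι b ≡ ι a
  /-*-ι a (suc b) = toℚᵘ-injective (ℚᵘ.≃-trans (toℚᵘ-homo-* (+ a / suc b) (ι (suc b)))
    (ℚᵘ.≃-trans (ℚᵘ.*-cong (toℚᵘ-/ (+ a) b) (toℚᵘ-/ (+ suc b) 0))
    (ℚᵘ.≃-trans (*≡* eq) (ℚᵘ.≃-sym (toℚᵘ-/ (+ a) 0)))))
    where
    eq : (+ a ℤ.* + suc b) ℤ.* + 1 ≡ + a ℤ.* + suc (b ℕ.* 1)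
    eq = trans (ℤ.*-identityʳ _) (cong (λ z → + a ℤ.* + suc z) (sym (ℕ.*-identityʳ b)))

  0≤1 : 0ℚ ≤ 1ℚ
  0≤1 = nonNegative⁻¹ 1ℚ

  0<1 : 0ℚ < 1ℚ
  0<1 = positive⁻¹ 1ℚ

  0≤+ : ∀ {p q} → 0ℚ ≤ p → 0ℚ ≤ q → 0ℚ ≤ p + q
  0≤+ = +-mono-≤ {0ℚ} {_} {0ℚ}

  0≤* : ∀ {p q} → 0ℚ ≤ p → 0ℚ ≤ q → 0ℚ ≤ p * q
  0≤* {p} {q} 0≤p 0≤q =
    nonNegative⁻¹ (p * q) {{nonNeg*nonNeg⇒nonNeg p {{nonNegative 0≤p}} q {{nonNegative 0≤q}}}}

  0<* : ∀ {p q} → 0ℚ < p → 0ℚ < q → 0ℚ < p * q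
  0<* {p} {q} 0<p 0<q =
    positive⁻¹ (p * q) {{pos*pos⇒pos p {{positive 0<p}} q {{positive 0<q}}}}

  p≤q⇒0≤q-p : ∀ {p q} → p ≤ q → 0ℚ ≤ q - p
  p≤q⇒0≤q-p {p} {q} p≤q = subst (_≤ q - p) (+-inverseʳ p) (+-monoˡ-≤ (- p) p≤q)

  0≤q-p⇒p≤q : ∀ {p q} → 0ℚ ≤ q - p → p ≤ q
  0≤q-p⇒p≤q {p} {q} h = subst₂ _≤_ (+-identityˡ p) (eq q p) (+-monoˡ-≤ p h)
    where
    eq : ∀ q p → q - p + p ≡ q
    eq = solve-∀ ℚ-ring

  *-monoˡ : ∀ {r p q} → 0ℚ ≤ r → p ≤ q → r * p ≤ r * q
  *-monoˡ {r} 0≤r = *-monoˡ-≤-nonNeg r {{nonNegative 0≤r}}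

  *-monoʳ : ∀ {r p q} → 0ℚ ≤ r → p ≤ q → p * r ≤ q * r
  *-monoʳ {r} 0≤r = *-monoʳ-≤-nonNeg r {{nonNegative 0≤r}}

  *-mono : ∀ {p q r s} → 0ℚ ≤ q → 0ℚ ≤ r → p ≤ q → r ≤ s → p * r ≤ q * s
  *-mono 0≤q 0≤r p≤q r≤s = ≤-trans (*-monoʳ 0≤r p≤q) (*-monoˡ 0≤q r≤s)

  *-cancelˡ : ∀ {r p q} → 0ℚ < r → r * p ≤ r * q → p ≤ q
  *-cancelˡ {r} 0<r = *-cancelˡ-≤-pos r {{positive 0<r}}

  *-cancelˡ-≡ : ∀ {r p q} → 0ℚ < r → r * p ≡ r * q → p ≡ q
  *-cancelˡ-≡ 0<r eq = ≤-antisym (*-cancelˡ 0<r (≤-reflexive eq)) (*-cancelˡ 0<r (≤-reflexive (sym eq)))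

  sq : ℚ → ℚ
  sq p = p * p

  neg-* : ∀ p q → - p * - q ≡ p * q
  neg-* = solve-∀ ℚ-ring

  0≤sq : ∀ p → 0ℚ ≤ sq p
  0≤sq p with ≤-total 0ℚ p
  ... | inj₁ 0≤p = 0≤* 0≤p 0≤p
  ... | inj₂ p≤0 = subst (0ℚ ≤_) (neg-* p p) (0≤* 0≤-p 0≤-p)
    where
    0≤-p : 0ℚ ≤ - p
    0≤-p = neg-antimono-≤ p≤0

  sq-cancel-≤ : ∀ {p q} → 0ℚ ≤ q → sq p ≤ sq q → p ≤ q
  sq-cancel-≤ {p} {q} 0≤q h with p ≤? q
  ... | yes p≤q = p≤q
  ... | no  p≰q = contradiction h λ h → <-irrefl refl (<-≤-trans
          (≤-<-trans (*-monoˡ 0≤q (<⇒≤ q<p)) (*-monoˡ-<-pos p {{positive (≤-<-trans 0≤q q<p)}} q<p)) h)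
    where q<p = ≰⇒> p≰q

  0≤ι : ∀ n → 0ℚ ≤ ι n
  0≤ι n = nonNegative⁻¹ (ι n) {{normalize-nonNeg n 1}}

  0<ι : ∀ n → 0ℚ < ι (suc n)
  0<ι n = positive⁻¹ (ι (suc n)) {{normalize-pos (suc n) 1}}

  0<ι′ : ∀ n .{{_ : NonZero n}} → 0ℚ < ι n
  0<ι′ (suc n) = 0<ι n

  1≤ι : ∀ n .{{_ : NonZero n}} → 1ℚ ≤ ι n
  1≤ι (suc n) = subst (1ℚ ≤_) (sym (ι-suc n))
    (subst (_≤ 1ℚ + ι n) (+-identityʳ 1ℚ) (+-monoʳ-≤ 1ℚ (0≤ι n)))

  ι-mono : ∀ {m n} → m ℕ.≤ n → ι m ≤ ι n
  ι-mono {m} {n} m≤n = subst (λ k → ι m ≤ ι k) (ℕ.m+[n∸m]≡n m≤n)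
    (subst (ι m ≤_) (sym (ι-+ m (n ℕ.∸ m)))
      (subst (_≤ ι m + ι (n ℕ.∸ m)) (+-identityʳ (ι m)) (+-monoʳ-≤ (ι m) (0≤ι (n ℕ.∸ m)))))

  ι-mono-< : ∀ {m n} → m ℕ.< n → ι m < ι n
  ι-mono-< {m} {n} m<n = <-≤-trans
    (subst₂ _<_ (+-identityˡ (ι m)) (sym (ι-suc m)) (+-monoˡ-< (ι m) 0<1)) (ι-mono m<n)

  ι-cancel : ∀ {m n} → ι m ≤ ι n → m ℕ.≤ n
  ι-cancel {m} {n} h with m ℕ.≤? n
  ... | yes m≤n = m≤n
  ... | no  m≰n = contradiction (<-≤-trans (ι-mono-< (ℕ.≰⇒> m≰n)) h) (<-irrefl refl)

  ι-injective : ∀ {m n} → ι m ≡ ι n → m ≡ n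
  ι-injective h = ℕ.≤-antisym (ι-cancel (≤-reflexive h)) (ι-cancel (≤-reflexive (sym h)))

  infixr 8 _^_

  _^_ : ℚ → ℕ → ℚ
  q ^ zero  = 1ℚ
  q ^ suc n = q * q ^ n

  ι-^ : ∀ m k → ι (m ℕ.^ k) ≡ ι m ^ k
  ι-^ m zero    = refl
  ι-^ m (suc k) = trans (ι-* m (m ℕ.^ k)) (cong (ι m *_) (ι-^ m k))

  0≤^ : ∀ {q} k → 0ℚ ≤ q → 0ℚ ≤ q ^ k
  0≤^ zero    _   = 0≤1
  0≤^ (suc k) 0≤q = 0≤* 0≤q (0≤^ k 0≤q)

  0<^ : ∀ {q} k → 0ℚ < q → 0ℚ < q ^ k
  0<^ zero    _   = 0<1
  0<^ (suc k) 0<q = 0<* 0<q (0<^ k 0<q)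

  -- 1 / k, with the junk value 0 at k = 0
  rec : ℕ → ℚ
  rec zero    = 0ℚ
  rec (suc k) = + 1 / suc k

  rec-inverse : ∀ k .{{_ : NonZero k}} → rec k * ι k ≡ 1ℚ
  rec-inverse (suc k) = /-*-ι 1 (suc k)

  0≤rec : ∀ k → 0ℚ ≤ rec k
  0≤rec zero    = ≤-refl
  0≤rec (suc k) = nonNegative⁻¹ (rec (suc k)) {{normalize-nonNeg 1 (suc k)}}

  0<rec : ∀ k .{{_ : NonZero k}} → 0ℚ < rec k
  0<rec (suc k) = positive⁻¹ (rec (suc k)) {{normalize-pos 1 (suc k)}}

  ∣∣-≤ : ∀ {p b} → p ≤ b → - b ≤ p → ∣ p ∣ ≤ b
  ∣∣-≤ {p} {b} p≤b -b≤p with ∣p∣≡p∨∣p∣≡-p p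
  ... | inj₁ eq = subst (_≤ b) (sym eq) p≤b
  ... | inj₂ eq = subst (_≤ b) (sym eq) (subst (- p ≤_) (neg-neg b) (neg-antimono-≤ -b≤p))
    where
    neg-neg : ∀ b → - - b ≡ b
    neg-neg = solve-∀ ℚ-ring

  p≤∣p∣ : ∀ p → p ≤ ∣ p ∣
  p≤∣p∣ p with ≤-total 0ℚ p
  ... | inj₁ 0≤p = ≤-reflexive (sym (0≤p⇒∣p∣≡p 0≤p))
  ... | inj₂ p≤0 = ≤-trans p≤0 (0≤∣p∣ p)

  ∣∣-sq : ∀ p → sq ∣ p ∣ ≡ sq p
  ∣∣-sq p with ∣p∣≡p∨∣p∣≡-p p
  ... | inj₁ eq = cong sq eq
  ... | inj₂ eq = trans (cong sq eq) (neg-* p p)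

-- Finite sums and products, and sums over tuples

module FiniteSums where
  open import Algebra.Bundles using (CommutativeRing)
  open import Data.Rational hiding (NonZero)
  open import Data.Rational.Properties
  open import Data.Vec.Functional as Vector using (Vector; _∷_)
  open Rationals

  module ℚΣ where
    open import Algebra.Properties.Semiring.Sum (CommutativeRing.semiring +-*-commutativeRing) public
  open ℚΣ public using (∑-comm) renaming (sum to ∑; sum-cong-≗ to ∑-cong; ∑-distrib-+ to ∑-+; *-distribˡ-sum to ∑-*ˡ; *-distribʳ-sum to ∑-*ʳ)

  module ℚΠ where
    open import Algebra.Properties.CommutativeMonoid.Sum *-1-commutativeMonoid public
  open ℚΠ public using () renaming (sum to ∏; sum-cong-≗ to ∏-cong; ∑-distrib-+ to ∏-*)

  ∑-mono : ∀ {n} {f g : Fin n → ℚ} → (∀ i → f i ≤ g i) → ∑ f ≤ ∑ g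
  ∑-mono {zero}  h = ≤-refl
  ∑-mono {suc n} h = +-mono-≤ (h zero) (∑-mono (h ∘ suc))

  0≤∑ : ∀ {n} {f : Fin n → ℚ} → (∀ i → 0ℚ ≤ f i) → 0ℚ ≤ ∑ f
  0≤∑ {zero}  h = ≤-refl
  0≤∑ {suc n} h = 0≤+ (h zero) (0≤∑ (h ∘ suc))

  ∑-const : ∀ n c → ∑ {n} (λ _ → c) ≡ ι n * c
  ∑-const zero    c = sym (*-zeroˡ c)
  ∑-const (suc n) c = trans (cong (c +_) (∑-const n c))
    (trans (step c (ι n)) (cong (_* c) (sym (ι-suc n))))
    where
    step : ∀ c x → c + x * c ≡ (1ℚ + x) * c
    step = solve-∀ ℚ-ring

  ∑-neg : ∀ {n} (f : Fin n → ℚ) → ∑ (λ i → - f i) ≡ - ∑ f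
  ∑-neg {zero}  f = refl
  ∑-neg {suc n} f = trans (cong (- f zero +_) (∑-neg (f ∘ suc))) (sym (neg-distrib-+ (f zero) (∑ (f ∘ suc))))

  ∑-- : ∀ {n} (f g : Fin n → ℚ) → ∑ (λ i → f i - g i) ≡ ∑ f - ∑ g
  ∑-- f g = trans (∑-+ f (λ i → - g i)) (cong (∑ f +_) (∑-neg g))

  term≤∑ : ∀ {n} (f : Fin n → ℚ) → (∀ i → 0ℚ ≤ f i) → ∀ i → f i ≤ ∑ f
  term≤∑ {suc n} f 0≤f zero = subst (_≤ ∑ f) (+-identityʳ (f zero)) (+-monoʳ-≤ (f zero) (0≤∑ (0≤f ∘ suc)))
  term≤∑ {suc n} f 0≤f (suc i) = ≤-trans (term≤∑ (f ∘ suc) (0≤f ∘ suc) i)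
    (subst (_≤ ∑ f) (+-identityˡ (∑ (f ∘ suc))) (+-monoˡ-≤ (∑ (f ∘ suc)) (0≤f zero)))

  ∏-const : ∀ k c → ∏ {k} (λ _ → c) ≡ c ^ k
  ∏-const zero    c = refl
  ∏-const (suc k) c = cong (c *_) (∏-const k c)

  -- Follows the recursion of `∑-tuples`, so the complex sums in τ and J reduce to it by induction
  -- on the tuple length.
  ∑T : ∀ {n} k → ((Fin k → Fin n) → ℚ) → ℚ
  ∑T zero    f = f Vector.[]
  ∑T (suc k) f = ∑ (λ v → ∑T k (λ t → f (v ∷ t)))

  module _ {n : ℕ} where

    ∑T-cong : ∀ k {f g : (Fin k → Fin n) → ℚ} → (∀ t → f t ≡ g t) → ∑T k f ≡ ∑T k g
    ∑T-cong zero    h = h Vector.[]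
    ∑T-cong (suc k) h = ∑-cong (λ v → ∑T-cong k (λ t → h (v ∷ t)))

    ∑T-mono : ∀ k {f g : (Fin k → Fin n) → ℚ} → (∀ t → f t ≤ g t) → ∑T k f ≤ ∑T k g
    ∑T-mono zero    h = h Vector.[]
    ∑T-mono (suc k) h = ∑-mono (λ v → ∑T-mono k (λ t → h (v ∷ t)))

    ∑T-*ˡ : ∀ k c (f : (Fin k → Fin n) → ℚ) → ∑T k (λ t → c * f t) ≡ c * ∑T k f
    ∑T-*ˡ zero    c f = refl
    ∑T-*ˡ (suc k) c f = trans (∑-cong (λ v → ∑T-*ˡ k c (λ t → f (v ∷ t))))
      (sym (∑-*ˡ c (λ v → ∑T k (λ t → f (v ∷ t)))))

    ∑T-+ : ∀ k (f g : (Fin k → Fin n) → ℚ) → ∑T k (λ t → f t + g t) ≡ ∑T k f + ∑T k g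
    ∑T-+ zero    f g = refl
    ∑T-+ (suc k) f g = trans (∑-cong (λ v → ∑T-+ k (λ t → f (v ∷ t)) (λ t → g (v ∷ t))))
      (∑-+ (λ v → ∑T k (λ t → f (v ∷ t))) (λ v → ∑T k (λ t → g (v ∷ t))))

    ∑T-neg : ∀ k (f : (Fin k → Fin n) → ℚ) → ∑T k (λ t → - f t) ≡ - ∑T k f
    ∑T-neg zero    f = refl
    ∑T-neg (suc k) f = trans (∑-cong (λ v → ∑T-neg k (λ t → f (v ∷ t)))) (∑-neg (λ v → ∑T k (λ t → f (v ∷ t))))

    ∑T-- : ∀ k (f g : (Fin k → Fin n) → ℚ) → ∑T k (λ t → f t - g t) ≡ ∑T k f - ∑T k g
    ∑T-- k f g = trans (∑T-+ k f (λ t → - g t)) (cong (∑T k f +_) (∑T-neg k g))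

    ∑T-const : ∀ k c → ∑T {n} k (λ _ → c) ≡ ι n ^ k * c
    ∑T-const zero    c = sym (*-identityˡ c)
    ∑T-const (suc k) c = trans (∑-cong {n} (λ _ → ∑T-const k c))
      (trans (∑-const n (ι n ^ k * c)) (sym (*-assoc (ι n) (ι n ^ k) c)))

    0≤∑T : ∀ k {f : (Fin k → Fin n) → ℚ} → (∀ t → 0ℚ ≤ f t) → 0ℚ ≤ ∑T k f
    0≤∑T zero    h = h Vector.[]
    0≤∑T (suc k) h = 0≤∑ (λ v → 0≤∑T k (λ t → h (v ∷ t)))

    ∑-∑T-comm : ∀ {m} k (f : Fin m → (Fin k → Fin n) → ℚ) →
                ∑ (λ i → ∑T k (f i)) ≡ ∑T k (λ t → ∑ (λ i → f i t))
    ∑-∑T-comm zero    f = refl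
    ∑-∑T-comm (suc k) f = trans (∑-comm (λ i v → ∑T k (λ t → f i (v ∷ t))))
      (∑-cong (λ v → ∑-∑T-comm k (λ i t → f i (v ∷ t))))

    -- Distributivity, one coordinate at a time. It turns the J-term of a vector into a power of its
    -- coordinate sum.
    ∑T-∏ : ∀ k (x : Fin k → Fin n → ℚ) → ∑T k (λ t → ∏ (λ i → x i (t i))) ≡ ∏ (λ i → ∑ (x i))
    ∑T-∏ zero    x = refl
    ∑T-∏ (suc k) x = trans (∑-cong (λ v → trans (∑T-*ˡ k (x zero v) (λ t → ∏ (λ i → x (suc i) (t i))))
        (cong (x zero v *_) (∑T-∏ k (x ∘ suc)))))
      (sym (∑-*ʳ (∏ (λ i → ∑ (x (suc i)))) (x zero)))

-- Expectation over random signs: Harris' inequality, variance, fourth moments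

module Hypercube where
  open import Data.Bool as Bool using (Bool; true; false; not; b≤b; f≤t)
  open import Data.Rational hiding (NonZero)
  open import Data.Rational.Properties
  open import Data.Unit using (⊤)
  open import Data.Vec.Functional as Vector using (Vector; _∷_)
  open Rationals
  open FiniteSums

  Cube : ℕ → Set
  Cube n = Fin n → Bool

  sg : Bool → ℚ
  sg true  = 1ℚ
  sg false = - 1ℚ

  0≤½ : 0ℚ ≤ ½
  0≤½ = nonNegative⁻¹ ½

  -- Conditioning on the first sign is built into the recursion, so moment estimates go by induction
  -- on n.
  𝔼 : ∀ n → (Cube n → ℚ) → ℚ
  𝔼 zero    f = f Vector.[]
  𝔼 (suc n) f = ½ * (𝔼 n (λ ω → f (false ∷ ω)) + 𝔼 n (λ ω → f (true ∷ ω)))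

  𝔼-cong : ∀ n {f g : Cube n → ℚ} → (∀ ω → f ω ≡ g ω) → 𝔼 n f ≡ 𝔼 n g
  𝔼-cong zero    h = h Vector.[]
  𝔼-cong (suc n) h = cong₂ (λ a b → ½ * (a + b)) (𝔼-cong n (λ ω → h (false ∷ ω))) (𝔼-cong n (λ ω → h (true ∷ ω)))

  𝔼-mono : ∀ n {f g : Cube n → ℚ} → (∀ ω → f ω ≤ g ω) → 𝔼 n f ≤ 𝔼 n g
  𝔼-mono zero    h = h Vector.[]
  𝔼-mono (suc n) h = *-monoˡ 0≤½ (+-mono-≤ (𝔼-mono n (λ ω → h (false ∷ ω))) (𝔼-mono n (λ ω → h (true ∷ ω))))

  𝔼-const : ∀ n c → 𝔼 n (λ _ → c) ≡ c
  𝔼-const zero    c = refl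
  𝔼-const (suc n) c = trans (cong (λ a → ½ * (a + a)) (𝔼-const n c)) (half c)
    where
    half : ∀ c → ½ * (c + c) ≡ c
    half = solve-∀ ℚ-ring

  𝔼-+ : ∀ n (f g : Cube n → ℚ) → 𝔼 n (λ ω → f ω + g ω) ≡ 𝔼 n f + 𝔼 n g
  𝔼-+ zero    f g = refl
  𝔼-+ (suc n) f g = trans
    (cong₂ (λ a b → ½ * (a + b)) (𝔼-+ n (λ ω → f (false ∷ ω)) (λ ω → g (false ∷ ω)))
                                 (𝔼-+ n (λ ω → f (true ∷ ω)) (λ ω → g (true ∷ ω))))
    (eq (𝔼 n (λ ω → f (false ∷ ω))) _ _ _)
    where
    eq : ∀ a b c d → ½ * (a + b + (c + d)) ≡ ½ * (a + c) + ½ * (b + d)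
    eq = solve-∀ ℚ-ring

  𝔼-*ˡ : ∀ n c (f : Cube n → ℚ) → 𝔼 n (λ ω → c * f ω) ≡ c * 𝔼 n f
  𝔼-*ˡ zero    c f = refl
  𝔼-*ˡ (suc n) c f = trans
    (cong₂ (λ a b → ½ * (a + b)) (𝔼-*ˡ n c (λ ω → f (false ∷ ω))) (𝔼-*ˡ n c (λ ω → f (true ∷ ω))))
    (eq c (𝔼 n (λ ω → f (false ∷ ω))) _)
    where
    eq : ∀ c a b → ½ * (c * a + c * b) ≡ c * (½ * (a + b))
    eq = solve-∀ ℚ-ring

  𝔼-neg : ∀ n (f : Cube n → ℚ) → 𝔼 n (λ ω → - f ω) ≡ - 𝔼 n f
  𝔼-neg n f = trans (𝔼-cong n (λ ω → eq (f ω))) (trans (𝔼-*ˡ n (- 1ℚ) f) (sym (eq (𝔼 n f))))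
    where
    eq : ∀ a → - a ≡ - 1ℚ * a
    eq = solve-∀ ℚ-ring

  𝔼-- : ∀ n (f g : Cube n → ℚ) → 𝔼 n (λ ω → f ω - g ω) ≡ 𝔼 n f - 𝔼 n g
  𝔼-- n f g = trans (𝔼-+ n f (λ ω → - g ω)) (cong (𝔼 n f +_) (𝔼-neg n g))

  𝔼-∑ : ∀ n {m} (f : Fin m → Cube n → ℚ) → 𝔼 n (λ ω → ∑ (λ i → f i ω)) ≡ ∑ (λ i → 𝔼 n (f i))
  𝔼-∑ n {zero}  f = 𝔼-const n 0ℚ
  𝔼-∑ n {suc m} f = trans (𝔼-+ n (f zero) (λ ω → ∑ (λ i → f (suc i) ω))) (cong (𝔼 n (f zero) +_) (𝔼-∑ n (f ∘ suc)))

  𝔼-∑T : ∀ n {m} k (f : (Fin k → Fin m) → Cube n → ℚ) →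
         𝔼 n (λ ω → ∑T k (λ t → f t ω)) ≡ ∑T k (λ t → 𝔼 n (f t))
  𝔼-∑T n zero    f = refl
  𝔼-∑T n (suc k) f = trans (𝔼-∑ n (λ v ω → ∑T k (λ t → f (v ∷ t) ω)))
    (∑-cong (λ v → 𝔼-∑T n k (λ t → f (v ∷ t))))

  𝔼-split : ∀ n (f : Cube (suc n) → ℚ) → 𝔼 (suc n) f ≡ 𝔼 n (λ ω → ½ * (f (false ∷ ω) + f (true ∷ ω)))
  𝔼-split n f = sym (trans (𝔼-*ˡ n ½ (λ ω → f (false ∷ ω) + f (true ∷ ω)))
    (cong (½ *_) (𝔼-+ n (λ ω → f (false ∷ ω)) (λ ω → f (true ∷ ω)))))

  -- One of the two halves of the cube has an average at least that of the whole; halving down to a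
  -- point extracts a witness.
  𝔼-attained : ∀ n (f : Cube n → ℚ) {B} → B ≤ 𝔼 n f → ∃ λ ω → B ≤ f ω
  𝔼-attained zero    f h = Vector.[] , h
  𝔼-attained (suc n) f {B} h with B ≤? 𝔼 n (λ ω → f (false ∷ ω)) | B ≤? 𝔼 n (λ ω → f (true ∷ ω))
  ... | yes p | _ = let ω , q = 𝔼-attained n _ p in false ∷ ω , q
  ... | no _ | yes p = let ω , q = 𝔼-attained n _ p in true ∷ ω , q
  ... | no p | no q = contradiction (≤-<-trans h (<-≤-trans
        (*-monoʳ-<-pos ½ (+-mono-< (≰⇒> p) (≰⇒> q))) (≤-reflexive (half B)))) (<-irrefl refl)
    where
    half : ∀ c → ½ * (c + c) ≡ c
    half = solve-∀ ℚ-ring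

  infix 4 _⊑_

  _⊑_ : ∀ {n} → Cube n → Cube n → Set
  ω ⊑ ω′ = ∀ v → ω v Bool.≤ ω′ v

  Mono : ∀ n → (Cube n → ℚ) → Set
  Mono n f = ∀ {ω ω′} → ω ⊑ ω′ → f ω ≤ f ω′

  ∷-mono : ∀ {n b b′} {ω ω′ : Cube n} → b Bool.≤ b′ → ω ⊑ ω′ → (b ∷ ω) ⊑ (b′ ∷ ω′)
  ∷-mono p q zero    = p
  ∷-mono p q (suc v) = q v

  ⊑-refl : ∀ {n} {ω : Cube n} → ω ⊑ ω
  ⊑-refl _ = b≤b

  -- Induction on the two halves, followed by Chebyshev's inequality for the half averages: both
  -- increase with the first sign, so a quarter of the product of their differences is the
  -- nonnegative slack.
  harris : ∀ n {f g : Cube n → ℚ} → Mono n f → Mono n g → 𝔼 n f * 𝔼 n g ≤ 𝔼 n (λ ω → f ω * g ω)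
  harris zero    mf mg = ≤-refl
  harris (suc n) {f} {g} mf mg = ≤-trans
    (0≤q-p⇒p≤q (subst (0ℚ ≤_) (eq (𝔼 n (λ ω → f (false ∷ ω))) _ _ _)
      (0≤* (0≤* 0≤½ 0≤½) (0≤* (diff mf) (diff mg)))))
    (*-monoˡ 0≤½ (+-mono-≤ (harris n (λ h → mf (∷-mono b≤b h)) (λ h → mg (∷-mono b≤b h)))
                           (harris n (λ h → mf (∷-mono b≤b h)) (λ h → mg (∷-mono b≤b h)))))
    where
    diff : ∀ {f} → Mono (suc n) f → 0ℚ ≤ 𝔼 n (λ ω → f (true ∷ ω)) - 𝔼 n (λ ω → f (false ∷ ω))
    diff mf = p≤q⇒0≤q-p (𝔼-mono n (λ ω → mf (∷-mono f≤t ⊑-refl)))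
    eq : ∀ a b c d → ½ * ½ * ((b - a) * (d - c)) ≡ ½ * (a * c + b * d) - ½ * (a + b) * (½ * (c + d))
    eq = solve-∀ ℚ-ring

  *-Mono : ∀ n {f g : Cube n → ℚ} → (∀ ω → 0ℚ ≤ f ω) → (∀ ω → 0ℚ ≤ g ω) →
           Mono n f → Mono n g → Mono n (λ ω → f ω * g ω)
  *-Mono n pf pg mf mg h = *-mono (pf _) (pg _) (mf h) (mg h)

  ∏-Mono : ∀ n {k} (f : Fin k → Cube n → ℚ) → (∀ i ω → 0ℚ ≤ f i ω) → (∀ i → Mono n (f i)) →
           (∀ ω → 0ℚ ≤ ∏ (λ i → f i ω)) × Mono n (λ ω → ∏ (λ i → f i ω))
  ∏-Mono n {zero}  f p m = (λ _ → 0≤1) , (λ _ → ≤-refl)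
  ∏-Mono n {suc k} f p m with ∏-Mono n (f ∘ suc) (p ∘ suc) (m ∘ suc)
  ... | p′ , m′ = (λ ω → 0≤* (p zero ω) (p′ ω)) ,
                  *-Mono n {f zero} {λ ω → ∏ (λ i → f (suc i) ω)} (p zero) p′ (m zero) m′

  -- Harris peels off one factor at a time; by `∏-Mono` the remaining product is again nonnegative
  -- and increasing.
  harris-∏ : ∀ n {k} (f : Fin k → Cube n → ℚ) → (∀ i ω → 0ℚ ≤ f i ω) → (∀ i → Mono n (f i)) →
             ∀ {c} → 0ℚ ≤ c → (∀ i → 𝔼 n (f i) ≡ c) → c ^ k ≤ 𝔼 n (λ ω → ∏ (λ i → f i ω))
  harris-∏ n {zero}  f p m 0≤c e = ≤-reflexive (sym (𝔼-const n 1ℚ))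
  harris-∏ n {suc k} f p m {c} 0≤c e = ≤-trans
    (subst (λ a → c * c ^ k ≤ a * 𝔼 n (λ ω → ∏ (λ i → f (suc i) ω))) (sym (e zero))
      (*-monoˡ 0≤c (harris-∏ n (f ∘ suc) (p ∘ suc) (m ∘ suc) 0≤c (e ∘ suc))))
    (harris n (m zero) (proj₂ (∏-Mono n (f ∘ suc) (p ∘ suc) (m ∘ suc))))

  -- Flipping any one sign changes F by at most C. Asked of the first sign and then of both
  -- restrictions, to match the recursion of `𝔼`.
  BoundedDiff : ℚ → ∀ n → (Cube n → ℚ) → Set
  BoundedDiff C zero    F = ⊤
  BoundedDiff C (suc n) F =
    (∀ ω → (F (true ∷ ω) - F (false ∷ ω) ≤ C) × (- C ≤ F (true ∷ ω) - F (false ∷ ω))) ×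
    (∀ b → BoundedDiff C n (λ ω → F (b ∷ ω)))

  sq-bound : ∀ {x C} → x ≤ C → - C ≤ x → sq x ≤ sq C
  sq-bound {x} {C} x≤C -C≤x = 0≤q-p⇒p≤q (subst (0ℚ ≤_) (eq x C)
    (0≤* (p≤q⇒0≤q-p x≤C) (p≤q⇒0≤q-p -C≤x)))
    where
    eq : ∀ x C → (C - x) * (x - - C) ≡ C * C - x * x
    eq = solve-∀ ℚ-ring

  -- Law of total variance: splitting off the first sign leaves the variances of the two halves and
  -- a quarter of the squared difference of their means, which is at most C²/4. This is the
  -- Efron-Stein bound.
  variance-bound : ∀ n F {C} → BoundedDiff C n F →
                   𝔼 n (λ ω → sq (F ω)) ≤ sq (𝔼 n F) + ½ * ½ * (ι n * sq C)
  variance-bound zero    F {C} _ = ≤-reflexive (sym (eq (F Vector.[]) (sq C)))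
    where
    eq : ∀ a c → a * a + ½ * ½ * (0ℚ * c) ≡ a * a
    eq = solve-∀ ℚ-ring
  variance-bound (suc n) F {C} (h , hb) = ≤-trans
    (*-monoˡ 0≤½ (+-mono-≤ (variance-bound n _ (hb false)) (variance-bound n _ (hb true))))
    (≤-trans (≤-reflexive (eq a b (ι n) (sq C)))
    (≤-trans (+-monoʳ-≤ (sq (½ * (a + b)) + ½ * ½ * (ι n * sq C))
      (*-monoˡ (0≤* 0≤½ 0≤½) (sq-bound b-a≤C -C≤b-a)))
    (≤-reflexive (trans (eq′ (sq (½ * (a + b))) (ι n) (sq C))
      (cong (λ s → sq (½ * (a + b)) + ½ * ½ * (s * sq C)) (sym (ι-suc n)))))))
    where
    a = 𝔼 n (λ ω → F (false ∷ ω))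
    b = 𝔼 n (λ ω → F (true ∷ ω))
    b-a : 𝔼 n (λ ω → F (true ∷ ω) - F (false ∷ ω)) ≡ b - a
    b-a = 𝔼-- n (λ ω → F (true ∷ ω)) (λ ω → F (false ∷ ω))
    b-a≤C : b - a ≤ C
    b-a≤C = subst₂ _≤_ b-a (𝔼-const n C) (𝔼-mono n (λ ω → proj₁ (h ω)))
    -C≤b-a : - C ≤ b - a
    -C≤b-a = subst₂ _≤_ (𝔼-const n (- C)) b-a (𝔼-mono n (λ ω → proj₂ (h ω)))
    eq : ∀ a b s c → ½ * (a * a + ½ * ½ * (s * c) + (b * b + ½ * ½ * (s * c))) ≡
         ½ * (a + b) * (½ * (a + b)) + ½ * ½ * (s * c) + ½ * ½ * ((b - a) * (b - a))
    eq = solve-∀ ℚ-ring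
    eq′ : ∀ e s c → e + ½ * ½ * (s * c) + ½ * ½ * c ≡ e + ½ * ½ * ((1ℚ + s) * c)
    eq′ = solve-∀ ℚ-ring

  -- The opposite point is described pointwise because points of the cube are functions and only
  -- their values are compared.
  𝔼-opposite : ∀ n {f g : Cube n → ℚ} → (∀ {ω ω′} → (∀ v → ω′ v ≡ not (ω v)) → g ω′ ≡ - f ω) →
               𝔼 n g ≡ - 𝔼 n f
  𝔼-opposite zero    h = h (λ ())
  𝔼-opposite (suc n) {f} {g} h = trans
    (cong₂ (λ a b → ½ * (a + b))
      (𝔼-opposite n {λ ω → f (true ∷ ω)} (λ o → h (λ { zero → refl ; (suc v) → o v })))
      (𝔼-opposite n {λ ω → f (false ∷ ω)} (λ o → h (λ { zero → refl ; (suc v) → o v }))))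
    (eq (𝔼 n (λ ω → f (true ∷ ω))) (𝔼 n (λ ω → f (false ∷ ω))))
    where
    eq : ∀ a b → ½ * (- a + - b) ≡ - (½ * (b + a))
    eq = solve-∀ ℚ-ring

  𝔼-odd : ∀ n {f : Cube n → ℚ} → (∀ {ω ω′} → (∀ v → ω′ v ≡ not (ω v)) → f ω′ ≡ - f ω) → 𝔼 n f ≡ 0ℚ
  𝔼-odd n {f} h = trans (eq (𝔼 n f)) (trans (cong (λ a → ½ * (𝔼 n f + a)) (𝔼-opposite n h)) (eq′ (𝔼 n f)))
    where
    eq : ∀ a → a ≡ ½ * (a + a)
    eq = solve-∀ ℚ-ring
    eq′ : ∀ a → ½ * (a + - a) ≡ 0ℚ
    eq′ = solve-∀ ℚ-ring

  sg-not : ∀ b → sg (not b) ≡ - sg b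
  sg-not true  = refl
  sg-not false = refl

  lin : ∀ {n} → (Fin n → ℚ) → Cube n → ℚ
  lin a ω = ∑ (λ u → a u * sg (ω u))

  lin-opposite : ∀ {n} (a : Fin n → ℚ) {ω ω′} → (∀ v → ω′ v ≡ not (ω v)) → lin a ω′ ≡ - lin a ω
  lin-opposite a {ω} {ω′} h = trans
    (∑-cong (λ u → trans (cong (a u *_) (trans (cong sg (h u)) (sg-not (ω u)))) (sym (neg-distribʳ-* (a u) (sg (ω u))))))
    (∑-neg (λ u → a u * sg (ω u)))

  𝔼-lin² : ∀ n (a : Fin n → ℚ) → 𝔼 n (λ ω → sq (lin a ω)) ≡ ∑ (λ u → sq (a u))
  𝔼-lin² zero    a = refl
  𝔼-lin² (suc n) a = trans (𝔼-split n (λ ω → sq (lin a ω)))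
    (trans (𝔼-cong n (λ ω → eq (a zero) (lin (a ∘ suc) ω)))
    (trans (𝔼-+ n (λ _ → sq (a zero)) (λ ω → sq (lin (a ∘ suc) ω)))
      (cong₂ _+_ (𝔼-const n (sq (a zero))) (𝔼-lin² n (a ∘ suc)))))
    where
    eq : ∀ a l → ½ * ((a * - 1ℚ + l) * (a * - 1ℚ + l) + (a * 1ℚ + l) * (a * 1ℚ + l)) ≡ a * a + l * l
    eq = solve-∀ ℚ-ring

  3ℚ : ℚ
  3ℚ = ι 3

  0≤3 : 0ℚ ≤ 3ℚ
  0≤3 = nonNegative⁻¹ 3ℚ

  -- Fourth moment bound for a pair of Rademacher sums in the same signs. The mixed form is what the
  -- induction for `chaos` needs, where two different coefficient vectors meet.
  𝔼-lin²lin² : ∀ n (a b : Fin n → ℚ) →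
               𝔼 n (λ ω → sq (lin a ω) * sq (lin b ω)) ≤ 3ℚ * (∑ (λ u → sq (a u)) * ∑ (λ u → sq (b u)))
  𝔼-lin²lin² zero    a b = ≤-refl
  𝔼-lin²lin² (suc n) a b = begin
    𝔼 (suc n) (λ ω → sq (lin a ω) * sq (lin b ω))
      ≡⟨ 𝔼-split n (λ ω → sq (lin a ω) * sq (lin b ω)) ⟩
    𝔼 n (λ ω → ½ * (sq (a₀ * - 1ℚ + L ω) * sq (b₀ * - 1ℚ + M ω) + sq (a₀ * 1ℚ + L ω) * sq (b₀ * 1ℚ + M ω)))
      ≤⟨ 𝔼-mono n (λ ω → pointwise a₀ b₀ (L ω) (M ω)) ⟩
    𝔼 n (λ ω → sq (L ω) * sq (M ω) + (3ℚ * sq a₀ * sq (M ω) + (3ℚ * sq b₀ * sq (L ω) + sq a₀ * sq b₀)))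
      ≡⟨ trans (𝔼-+ n (λ ω → sq (L ω) * sq (M ω)) _)
          (cong (𝔼 n (λ ω → sq (L ω) * sq (M ω)) +_) (trans (𝔼-+ n (λ ω → 3ℚ * sq a₀ * sq (M ω)) _)
          (cong₂ _+_ (trans (𝔼-*ˡ n (3ℚ * sq a₀) (λ ω → sq (M ω))) (cong (3ℚ * sq a₀ *_) (𝔼-lin² n b′)))
            (trans (𝔼-+ n (λ ω → 3ℚ * sq b₀ * sq (L ω)) (λ _ → sq a₀ * sq b₀))
              (cong₂ _+_ (trans (𝔼-*ˡ n (3ℚ * sq b₀) (λ ω → sq (L ω))) (cong (3ℚ * sq b₀ *_) (𝔼-lin² n a′)))
                         (𝔼-const n (sq a₀ * sq b₀))))))) ⟩
    𝔼 n (λ ω → sq (L ω) * sq (M ω)) + (3ℚ * sq a₀ * B + (3ℚ * sq b₀ * A + sq a₀ * sq b₀))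
      ≤⟨ +-monoˡ-≤ (3ℚ * sq a₀ * B + (3ℚ * sq b₀ * A + sq a₀ * sq b₀)) (𝔼-lin²lin² n a′ b′) ⟩
    3ℚ * (A * B) + (3ℚ * sq a₀ * B + (3ℚ * sq b₀ * A + sq a₀ * sq b₀))
      ≤⟨ 0≤q-p⇒p≤q (subst (0ℚ ≤_) (eq (sq a₀) (sq b₀) A B)
           (0≤* (nonNegative⁻¹ (ι 2)) (0≤* (0≤sq a₀) (0≤sq b₀)))) ⟩
    3ℚ * ((sq a₀ + A) * (sq b₀ + B)) ∎
    where
    open ≤-Reasoning
    a₀ = a zero
    b₀ = b zero
    a′ = a ∘ suc
    b′ = b ∘ suc
    L = lin a′
    M = lin b′
    A = ∑ (λ u → sq (a′ u))
    B = ∑ (λ u → sq (b′ u))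
    eq : ∀ x y A B → ι 2 * (x * y) ≡
         3ℚ * ((x + A) * (y + B)) - (3ℚ * (A * B) + (3ℚ * x * B + (3ℚ * y * A + x * y)))
    eq = solve-∀ ℚ-ring
    -- Averaging over the first sign leaves the cross term 4ablm. It is at most 2a²m² + 2b²l², and
    -- the slack is the square on the left.
    eq₂ : ∀ a b l m → ι 2 * ((a * m - b * l) * (a * m - b * l)) ≡
      l * l * (m * m) + (3ℚ * (a * a) * (m * m) + (3ℚ * (b * b) * (l * l) + a * a * (b * b)))
      - ½ * ((a * - 1ℚ + l) * (a * - 1ℚ + l) * ((b * - 1ℚ + m) * (b * - 1ℚ + m))
           + (a * 1ℚ + l) * (a * 1ℚ + l) * ((b * 1ℚ + m) * (b * 1ℚ + m)))
    eq₂ = solve-∀ ℚ-ring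
    pointwise : ∀ a b l m →
      ½ * (sq (a * - 1ℚ + l) * sq (b * - 1ℚ + m) + sq (a * 1ℚ + l) * sq (b * 1ℚ + m)) ≤
      sq l * sq m + (3ℚ * sq a * sq m + (3ℚ * sq b * sq l + sq a * sq b))
    pointwise a b l m = 0≤q-p⇒p≤q (subst (0ℚ ≤_) (eq₂ a b l m)
      (0≤* (nonNegative⁻¹ (ι 2)) (0≤sq (a * m - b * l))))

  module _ {n : ℕ} where

    𝔼K : ∀ k → ((Fin k → Cube n) → ℚ) → ℚ
    𝔼K zero    F = F Vector.[]
    𝔼K (suc k) F = 𝔼 n (λ ε → 𝔼K k (λ ω → F (ε ∷ ω)))

    𝔼K-cong : ∀ k {F G : (Fin k → Cube n) → ℚ} → (∀ ω → F ω ≡ G ω) → 𝔼K k F ≡ 𝔼K k G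
    𝔼K-cong zero    h = h Vector.[]
    𝔼K-cong (suc k) h = 𝔼-cong n (λ ε → 𝔼K-cong k (λ ω → h (ε ∷ ω)))

    𝔼K-mono : ∀ k {F G : (Fin k → Cube n) → ℚ} → (∀ ω → F ω ≤ G ω) → 𝔼K k F ≤ 𝔼K k G
    𝔼K-mono zero    h = h Vector.[]
    𝔼K-mono (suc k) h = 𝔼-mono n (λ ε → 𝔼K-mono k (λ ω → h (ε ∷ ω)))

    𝔼K-*ˡ : ∀ k c (F : (Fin k → Cube n) → ℚ) → 𝔼K k (λ ω → c * F ω) ≡ c * 𝔼K k F
    𝔼K-*ˡ zero    c F = refl
    𝔼K-*ˡ (suc k) c F = trans (𝔼-cong n (λ ε → 𝔼K-*ˡ k c (λ ω → F (ε ∷ ω)))) (𝔼-*ˡ n c (λ ε → 𝔼K k (λ ω → F (ε ∷ ω))))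

    𝔼K-- : ∀ k (F G : (Fin k → Cube n) → ℚ) → 𝔼K k (λ ω → F ω - G ω) ≡ 𝔼K k F - 𝔼K k G
    𝔼K-- zero    F G = refl
    𝔼K-- (suc k) F G = trans (𝔼-cong n (λ ε → 𝔼K-- k (λ ω → F (ε ∷ ω)) (λ ω → G (ε ∷ ω))))
      (𝔼-- n (λ ε → 𝔼K k (λ ω → F (ε ∷ ω))) (λ ε → 𝔼K k (λ ω → G (ε ∷ ω))))

    𝔼K-∑ : ∀ k {m} (F : Fin m → (Fin k → Cube n) → ℚ) → 𝔼K k (λ ω → ∑ (λ i → F i ω)) ≡ ∑ (λ i → 𝔼K k (F i))
    𝔼K-∑ zero    F = refl
    𝔼K-∑ (suc k) F = trans (𝔼-cong n (λ ε → 𝔼K-∑ k (λ i ω → F i (ε ∷ ω)))) (𝔼-∑ n (λ i ε → 𝔼K k (λ ω → F i (ε ∷ ω))))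

    𝔼K-attained : ∀ k (F : (Fin k → Cube n) → ℚ) {B} → B ≤ 𝔼K k F → ∃ λ ω → B ≤ F ω
    𝔼K-attained zero    F h = Vector.[] , h
    𝔼K-attained (suc k) F h with 𝔼-attained n _ h
    ... | ε , h′ with 𝔼K-attained k _ h′
    ... | ω , h″ = ε ∷ ω , h″

    -- Decoupled Rademacher chaos of order k: each tuple position has its own independent sign
    -- vector.
    chaos : ∀ {k} → ((Fin k → Fin n) → ℚ) → (Fin k → Cube n) → ℚ
    chaos {k} A ω = ∑T k (λ t → A t * ∏ (λ i → sg (ω i (t i))))

    -- Once the first sign vector is fixed, a chaos of order k + 1 is a chaos of order k whose
    -- coefficients are linear forms in those signs. Both moment computations below rest on this.
    chaos-∷ : ∀ {k} (A : (Fin (suc k) → Fin n) → ℚ) ε ω →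
              chaos A (ε ∷ ω) ≡ chaos (λ t → lin (λ v → A (v ∷ t)) ε) ω
    chaos-∷ {k} A ε ω = trans (∑-∑T-comm k (λ v t → A (v ∷ t) * (sg (ε v) * ∏ (λ i → sg (ω i (t i))))))
      (∑T-cong k (λ t → trans (∑-cong (λ v → sym (*-assoc (A (v ∷ t)) (sg (ε v)) _)))
        (sym (∑-*ʳ (∏ (λ i → sg (ω i (t i)))) (λ v → A (v ∷ t) * sg (ε v))))))

    𝔼K-chaos² : ∀ k (A : (Fin k → Fin n) → ℚ) → 𝔼K k (λ ω → sq (chaos A ω)) ≡ ∑T k (λ t → sq (A t))
    𝔼K-chaos² zero    A = cong sq (*-identityʳ (A Vector.[]))
    𝔼K-chaos² (suc k) A = begin
      𝔼 n (λ ε → 𝔼K k (λ ω → sq (chaos A (ε ∷ ω))))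
        ≡⟨ 𝔼-cong n (λ ε → trans (𝔼K-cong k (λ ω → cong sq (chaos-∷ A ε ω)))
             (𝔼K-chaos² k (λ t → lin (λ v → A (v ∷ t)) ε))) ⟩
      𝔼 n (λ ε → ∑T k (λ t → sq (lin (λ v → A (v ∷ t)) ε)))
        ≡⟨ 𝔼-∑T n k (λ t ε → sq (lin (λ v → A (v ∷ t)) ε)) ⟩
      ∑T k (λ t → 𝔼 n (λ ε → sq (lin (λ v → A (v ∷ t)) ε)))
        ≡⟨ ∑T-cong k (λ t → 𝔼-lin² n (λ v → A (v ∷ t))) ⟩
      ∑T k (λ t → ∑ (λ v → sq (A (v ∷ t))))
        ≡⟨ sym (∑-∑T-comm k (λ v t → sq (A (v ∷ t)))) ⟩
      ∑ (λ v → ∑T k (λ t → sq (A (v ∷ t)))) ∎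
      where open ≡-Reasoning

    ∑T-*-∑T : ∀ {m} k (f g : (Fin k → Fin m) → ℚ) → ∑T k (λ t → ∑T k (λ s → f t * g s)) ≡ ∑T k f * ∑T k g
    ∑T-*-∑T k f g = trans (∑T-cong k (λ t → trans (∑T-*ˡ k (f t) g) (*-comm (f t) (∑T k g))))
      (trans (∑T-*ˡ k (∑T k g) f) (*-comm (∑T k g) (∑T k f)))

    -- Hypercontractivity at exponent 4: each sign vector that is averaged out costs one factor 3,
    -- from `𝔼-lin²lin²` applied to every pair of remaining tuples.
    𝔼K-chaos²chaos² : ∀ k (A B : (Fin k → Fin n) → ℚ) →
      𝔼K k (λ ω → sq (chaos A ω) * sq (chaos B ω)) ≤ 3ℚ ^ k * (∑T k (λ t → sq (A t)) * ∑T k (λ t → sq (B t)))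
    𝔼K-chaos²chaos² zero    A B = ≤-reflexive (trans
      (cong₂ (λ a b → sq a * sq b) (*-identityʳ (A Vector.[])) (*-identityʳ (B Vector.[])))
      (sym (*-identityˡ (sq (A Vector.[]) * sq (B Vector.[])))))
    𝔼K-chaos²chaos² (suc k) A B = begin
      𝔼 n (λ ε → 𝔼K k (λ ω → sq (chaos A (ε ∷ ω)) * sq (chaos B (ε ∷ ω))))
        ≤⟨ 𝔼-mono n (λ ε → ≤-trans
             (≤-reflexive (𝔼K-cong k (λ ω → cong₂ (λ a b → sq a * sq b) (chaos-∷ A ε ω) (chaos-∷ B ε ω))))
             (𝔼K-chaos²chaos² k (λ t → L t ε) (λ t → M t ε))) ⟩
      𝔼 n (λ ε → 3ℚ ^ k * (∑T k (λ t → sq (L t ε)) * ∑T k (λ s → sq (M s ε))))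
        ≡⟨ trans (𝔼-*ˡ n (3ℚ ^ k) _) (cong (3ℚ ^ k *_) (trans
             (𝔼-cong n (λ ε → sym (∑T-*-∑T k (λ t → sq (L t ε)) (λ s → sq (M s ε)))))
             (trans (𝔼-∑T n k (λ t ε → ∑T k (λ s → sq (L t ε) * sq (M s ε))))
               (∑T-cong k (λ t → 𝔼-∑T n k (λ s ε → sq (L t ε) * sq (M s ε))))))) ⟩
      3ℚ ^ k * ∑T k (λ t → ∑T k (λ s → 𝔼 n (λ ε → sq (L t ε) * sq (M s ε))))
        ≤⟨ *-monoˡ (0≤^ k 0≤3) (∑T-mono k (λ t → ∑T-mono k (λ s → 𝔼-lin²lin² n (λ v → A (v ∷ t)) (λ v → B (v ∷ s))))) ⟩
      3ℚ ^ k * ∑T k (λ t → ∑T k (λ s → 3ℚ * (α t * β s)))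
        ≡⟨ cong (3ℚ ^ k *_) (trans (∑T-cong k (λ t → ∑T-*ˡ k 3ℚ (λ s → α t * β s)))
             (trans (∑T-*ˡ k 3ℚ (λ t → ∑T k (λ s → α t * β s))) (cong (3ℚ *_) (∑T-*-∑T k α β)))) ⟩
      3ℚ ^ k * (3ℚ * (∑T k α * ∑T k β))
        ≡⟨ trans (sym (*-assoc (3ℚ ^ k) 3ℚ _)) (cong₂ _*_ (*-comm (3ℚ ^ k) 3ℚ)
             (sym (cong₂ _*_ (∑-∑T-comm k (λ v t → sq (A (v ∷ t)))) (∑-∑T-comm k (λ v t → sq (B (v ∷ t))))))) ⟩
      3ℚ * 3ℚ ^ k * (∑ (λ v → ∑T k (λ t → sq (A (v ∷ t)))) * ∑ (λ v → ∑T k (λ t → sq (B (v ∷ t))))) ∎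
      where
      open ≤-Reasoning
      L M : (Fin k → Fin n) → Cube n → ℚ
      L t = lin (λ v → A (v ∷ t))
      M t = lin (λ v → B (v ∷ t))
      α β : (Fin k → Fin n) → ℚ
      α t = ∑ (λ v → sq (A (v ∷ t)))
      β t = ∑ (λ v → sq (B (v ∷ t)))

-- Tuples enumerating an edge, and double counting

module EdgeCounting where
  open import Data.Bool using (Bool; true; false)
  open import Data.Fin.Subset using (Subset; ∣_∣; ⁅_⁆; _∪_; _∈_; _∉_)
  open import Data.Fin.Subset.Properties using (∪-identityˡ; ∪-assoc; ∪-comm; ∪-idem; x∈⁅x⁆; p⊆p∪q; ∣⊥∣≡0) renaming (_∈?_ to _∈ˢ?_)
  open import Data.List as List using (List; []; _∷_; length; filter)
  open import Data.List.Membership.DecPropositional using (_∈?_)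
  open import Data.List.Relation.Unary.All as All using (All; []; _∷_)
  open import Data.List.Relation.Unary.AllPairs using ([]; _∷_)
  open import Data.List.Relation.Unary.Any using (here; there)
  open import Data.List.Relation.Unary.Unique.Propositional using (Unique)
  open import Data.Rational hiding (NonZero; ∣_∣)
  open import Data.Rational.Properties hiding (_≟_)
  open import Data.Vec as Vec using ([]; _∷_; here; there)
  open import Function using (_⇔_; mk⇔)
  open import Relation.Nullary.Decidable using (does-⇔; dec-true; dec-false)
  open import Defs using (Hypergraph; edges; unique; uniform; degree; Regular; image; _≟ˢ_)
  open Rationals
  open FiniteSums

  𝟙 : Bool → ℚ
  𝟙 true  = 1ℚ
  𝟙 false = 0ℚ

  0≤𝟙 : ∀ b → 0ℚ ≤ 𝟙 b
  0≤𝟙 true  = 0≤1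
  0≤𝟙 false = ≤-refl

  𝟙-idem : ∀ b → 𝟙 b * 𝟙 b ≡ 𝟙 b
  𝟙-idem true  = refl
  𝟙-idem false = refl

  𝟙-⇔ : ∀ {A B : Set} → A ⇔ B → (a? : Dec A) (b? : Dec B) → 𝟙 (does a?) ≡ 𝟙 (does b?)
  𝟙-⇔ A⇔B a? b? = cong 𝟙 (does-⇔ A⇔B a? b?)

  del : ∀ {n} → Fin n → Subset n → Subset n
  del zero    (b ∷ e) = false ∷ e
  del (suc v) (b ∷ e) = b ∷ del v e

  add-del : ∀ {n} {v : Fin n} {e} → v ∈ e → ⁅ v ⁆ ∪ del v e ≡ e
  add-del {e = _ ∷ e} here      = cong (true ∷_) (∪-identityˡ e)
  add-del             (there p) = cong (_ ∷_) (add-del p)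

  del-add : ∀ {n} (v : Fin n) s → del v (⁅ v ⁆ ∪ s) ≡ del v s
  del-add zero    (b ∷ s) = cong (false ∷_) (∪-identityˡ s)
  del-add (suc v) (b ∷ s) = cong (b ∷_) (del-add v s)

  del-∉ : ∀ {n} (v : Fin n) s → v ∉ s → del v s ≡ s
  del-∉ zero    (true  ∷ s) v∉ = contradiction here v∉
  del-∉ zero    (false ∷ s) v∉ = refl
  del-∉ (suc v) (b ∷ s)     v∉ = cong (b ∷_) (del-∉ v s (v∉ ∘ there))

  add-∈ : ∀ {n} (v : Fin n) s → v ∈ s → ⁅ v ⁆ ∪ s ≡ s
  add-∈ zero    (_ ∷ s) here      = cong (true ∷_) (∪-identityˡ s)
  add-∈ (suc v) (b ∷ s) (there p) = cong (b ∷_) (add-∈ v s p)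

  ∣del∣ : ∀ {n} {v : Fin n} {e} → v ∈ e → ∣ e ∣ ≡ suc ∣ del v e ∣
  ∣del∣ here = refl
  ∣del∣ {e = true  ∷ e} (there p) = cong suc (∣del∣ p)
  ∣del∣ {e = false ∷ e} (there p) = ∣del∣ p

  ∣add∣ : ∀ {n} (v : Fin n) s → ∣ ⁅ v ⁆ ∪ s ∣ ℕ.≤ suc ∣ s ∣
  ∣add∣ zero    (true  ∷ s) = ℕ.≤-trans (ℕ.≤-reflexive (cong (suc ∘ ∣_∣) (∪-identityˡ s))) (ℕ.n≤1+n _)
  ∣add∣ zero    (false ∷ s) = ℕ.≤-reflexive (cong (suc ∘ ∣_∣) (∪-identityˡ s))
  ∣add∣ (suc v) (true  ∷ s) = ℕ.s≤s (∣add∣ v s)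
  ∣add∣ (suc v) (false ∷ s) = ∣add∣ v s

  ∣image∣ : ∀ {n} k (t : Fin k → Fin n) → ∣ image t ∣ ℕ.≤ k
  ∣image∣ {n} zero t = ℕ.≤-reflexive (∣⊥∣≡0 n)
  ∣image∣ (suc k) t = ℕ.≤-trans (∣add∣ (t zero) (image (t ∘ suc))) (ℕ.s≤s (∣image∣ k (t ∘ suc)))

  -- If v already occurs in t, the image of v ◂ t has at most k elements and cannot be e. Otherwise
  -- deleting v from both sides loses nothing.
  fiber : ∀ {n k} (v : Fin n) {e} → ∣ e ∣ ≡ suc k → (t : Fin k → Fin n) →
          𝟙 (does (image (v ◂ t) ≟ˢ e)) ≡ 𝟙 (does (v ∈ˢ? e)) * 𝟙 (does (image t ≟ˢ del v e))
  fiber {k = k} v {e} ∣e∣ t with v ∈ˢ? e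
  ... | no  v∉e = trans (cong 𝟙 (dec-false (image (v ◂ t) ≟ˢ e)
          (λ eq → v∉e (subst (v ∈_) eq (p⊆p∪q (image t) (x∈⁅x⁆ v)))))) (sym (*-zeroˡ (𝟙 (does (image t ≟ˢ del v e)))))
  ... | yes v∈e = trans (𝟙-⇔ (mk⇔ to (λ eq → trans (cong (⁅ v ⁆ ∪_) eq) (add-del v∈e)))
          (image (v ◂ t) ≟ˢ e) (image t ≟ˢ del v e)) (sym (*-identityˡ _))
    where
    to : image (v ◂ t) ≡ e → image t ≡ del v e
    to eq with v ∈ˢ? image t
    ... | yes v∈t = contradiction (subst (ℕ._≤ k) (trans (cong ∣_∣ (trans (sym (add-∈ v _ v∈t)) eq)) ∣e∣) (∣image∣ k t)) ℕ.1+n≰n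
    ... | no  v∉t = trans (sym (del-∉ v _ v∉t)) (trans (sym (del-add v _)) (cong (del v) eq))

  -- The monomial of the vertex set e.
  P : ∀ {n} → Subset n → (Fin n → ℚ) → ℚ
  P []          x = 1ℚ
  P (true  ∷ e) x = x zero * P e (x ∘ suc)
  P (false ∷ e) x = P e (x ∘ suc)

  P-1 : ∀ {n} (e : Subset n) → P e (λ _ → 1ℚ) ≡ 1ℚ
  P-1 []          = refl
  P-1 (true  ∷ e) = trans (*-identityˡ _) (P-1 e)
  P-1 (false ∷ e) = P-1 e

  P-del : ∀ {n} {v : Fin n} {e} → v ∈ e → ∀ x → P e x ≡ x v * P (del v e) x
  P-del here x = refl
  P-del {v = suc v} {true ∷ e} (there p) x = trans (cong (x zero *_) (P-del p (x ∘ suc))) (swap (x zero) (x (suc v)) _)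
    where
    swap : ∀ a b c → a * (b * c) ≡ b * (a * c)
    swap = solve-∀ ℚ-ring
  P-del {e = false ∷ e} (there p) x = P-del p (x ∘ suc)

  ∑-∈ : ∀ {n} (e : Subset n) → ∑ (λ v → 𝟙 (does (v ∈ˢ? e))) ≡ ι ∣ e ∣
  ∑-∈ []          = refl
  ∑-∈ (true  ∷ e) = trans (cong (1ℚ +_) (trans (∑-cong (λ v → 𝟙-there v)) (∑-∈ e))) (sym (ι-suc ∣ e ∣))
    where
    𝟙-there : ∀ v → 𝟙 (does (suc v ∈ˢ? (true ∷ e))) ≡ 𝟙 (does (v ∈ˢ? e))
    𝟙-there v = 𝟙-⇔ (mk⇔ (λ { (there p) → p }) there) (suc v ∈ˢ? (true ∷ e)) (v ∈ˢ? e)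
  ∑-∈ (false ∷ e) = trans (cong (0ℚ +_) (trans (∑-cong (λ v → 𝟙-there v)) (∑-∈ e))) (+-identityˡ _)
    where
    𝟙-there : ∀ v → 𝟙 (does (suc v ∈ˢ? (false ∷ e))) ≡ 𝟙 (does (v ∈ˢ? e))
    𝟙-there v = 𝟙-⇔ (mk⇔ (λ { (there p) → p }) there) (suc v ∈ˢ? (false ∷ e)) (v ∈ˢ? e)

  -- The k! orderings of e all carry the weight `P e x`. Induction on k: choose the first entry v in
  -- e, then order the rest with `fiber`.
  ∑T-image : ∀ {n} k (e : Subset n) → ∣ e ∣ ≡ k → ∀ x →
             ∑T k (λ t → 𝟙 (does (image t ≟ˢ e)) * ∏ (λ i → x (t i))) ≡ ι (k !) * P e x
  ∑T-image zero e ∣e∣ x = trans (cong (λ b → 𝟙 b * 1ℚ) (dec-true (image {0} Vector.[] ≟ˢ e) (empty e ∣e∣)))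
    (cong (1ℚ *_) (P-∅ e ∣e∣ x))
    where
    empty : ∀ {n} (e : Subset n) → ∣ e ∣ ≡ 0 → image {0} Vector.[] ≡ e
    empty []          _  = refl
    empty (false ∷ e) eq = cong (false ∷_) (empty e eq)
    P-∅ : ∀ {n} (e : Subset n) → ∣ e ∣ ≡ 0 → ∀ x → 1ℚ ≡ P e x
    P-∅ []          _  x = refl
    P-∅ (false ∷ e) eq x = P-∅ e eq (x ∘ suc)
  ∑T-image (suc k) e ∣e∣ x = begin
    ∑ (λ v → ∑T k (λ t → 𝟙 (does (image (v ◂ t) ≟ˢ e)) * (x v * ∏ (λ i → x (t i)))))
      ≡⟨ ∑-cong (λ v → trans (∑T-cong k (λ t → trans (cong (_* (x v * ∏ (λ i → x (t i)))) (fiber v ∣e∣ t))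
           (shuffle (𝟙 (does (v ∈ˢ? e))) _ (x v) _)))
           (trans (∑T-*ˡ k (𝟙 (does (v ∈ˢ? e)) * x v) _) (at v))) ⟩
    ∑ (λ v → 𝟙 (does (v ∈ˢ? e)) * (ι (k !) * P e x))
      ≡⟨ sym (∑-*ʳ (ι (k !) * P e x) (λ v → 𝟙 (does (v ∈ˢ? e)))) ⟩
    ∑ (λ v → 𝟙 (does (v ∈ˢ? e))) * (ι (k !) * P e x)
      ≡⟨ cong (_* (ι (k !) * P e x)) (trans (∑-∈ e) (cong ι ∣e∣)) ⟩
    ι (suc k) * (ι (k !) * P e x)
      ≡⟨ trans (sym (*-assoc (ι (suc k)) (ι (k !)) (P e x))) (cong (_* P e x) (sym (ι-* (suc k) (k !)))) ⟩
    ι (suc k !) * P e x ∎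
    where
    open ≡-Reasoning
    shuffle : ∀ a b c d → a * b * (c * d) ≡ a * c * (b * d)
    shuffle = solve-∀ ℚ-ring
    swap : ∀ a b c → 1ℚ * a * (b * c) ≡ 1ℚ * (b * (a * c))
    swap = solve-∀ ℚ-ring
    at : ∀ v → 𝟙 (does (v ∈ˢ? e)) * x v * ∑T k (λ t → 𝟙 (does (image t ≟ˢ del v e)) * ∏ (λ i → x (t i)))
             ≡ 𝟙 (does (v ∈ˢ? e)) * (ι (k !) * P e x)
    at v with v ∈ˢ? e
    ... | no  _   = trans (cong (_* S) (*-zeroˡ (x v))) (trans (*-zeroˡ S) (sym (*-zeroˡ (ι (k !) * P e x))))
      where S = ∑T k (λ t → 𝟙 (does (image t ≟ˢ del v e)) * ∏ (λ i → x (t i)))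
    ... | yes v∈e = trans (cong (1ℚ * x v *_) (∑T-image k (del v e) (ℕ.suc-injective (trans (sym (∣del∣ v∈e)) ∣e∣)) x))
          (trans (swap (x v) (ι (k !)) _) (cong (λ a → 1ℚ * (ι (k !) * a)) (sym (P-del v∈e x))))

  ∑T-image₁ : ∀ {n} k (e : Subset n) → ∣ e ∣ ≡ k → ∑T k (λ t → 𝟙 (does (image t ≟ˢ e))) ≡ ι (k !)
  ∑T-image₁ k e ∣e∣ = trans (∑T-cong k (λ t → sym (trans (cong (𝟙 (does (image t ≟ˢ e)) *_)
      (trans (∏-const k 1ℚ) (1^ k))) (*-identityʳ _))))
    (trans (∑T-image k e ∣e∣ (λ _ → 1ℚ)) (trans (cong (ι (k !) *_) (P-1 e)) (*-identityʳ _)))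
    where
    1^ : ∀ k → 1ℚ ^ k ≡ 1ℚ
    1^ zero    = refl
    1^ (suc k) = trans (*-identityˡ _) (1^ k)

  ∑L : ∀ {A : Set} → List A → (A → ℚ) → ℚ
  ∑L []       f = 0ℚ
  ∑L (a ∷ as) f = f a + ∑L as f

  ∑T-∑L : ∀ {A : Set} {n} k (as : List A) (f : A → (Fin k → Fin n) → ℚ) →
          ∑T k (λ t → ∑L as (λ a → f a t)) ≡ ∑L as (λ a → ∑T k (f a))
  ∑T-∑L {n = n} k []       f = trans (∑T-const k 0ℚ) (*-zeroʳ (ι n ^ k))
  ∑T-∑L k (a ∷ as) f = trans (∑T-+ k (f a) (λ t → ∑L as (λ a → f a t))) (cong (∑T k (f a) +_) (∑T-∑L k as f))

  ∑L-cong : ∀ {A : Set} {as : List A} {f g : A → ℚ} → All (λ a → f a ≡ g a) as → ∑L as f ≡ ∑L as g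
  ∑L-cong []       = refl
  ∑L-cong (h ∷ hs) = cong₂ _+_ h (∑L-cong hs)

  ∑L-*ʳ : ∀ {A : Set} (as : List A) (f : A → ℚ) c → ∑L as (λ a → f a * c) ≡ ∑L as f * c
  ∑L-*ʳ []       f c = sym (*-zeroˡ c)
  ∑L-*ʳ (a ∷ as) f c = trans (cong (f a * c +_) (∑L-*ʳ as f c)) (sym (*-distribʳ-+ c (f a) (∑L as f)))

  ∑L-const : ∀ {A : Set} (as : List A) c → ∑L as (λ _ → c) ≡ ι (length as) * c
  ∑L-const []       c = sym (*-zeroˡ c)
  ∑L-const (a ∷ as) c = trans (cong (c +_) (∑L-const as c))
    (trans (step c (ι (length as))) (cong (_* c) (sym (ι-suc (length as)))))
    where
    step : ∀ c x → c + x * c ≡ (1ℚ + x) * c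
    step = solve-∀ ℚ-ring

  -- Since edges are listed without repetition, at most one summand is 1. This makes edge tuples
  -- countable edge by edge.
  𝟙-∈ : ∀ {n} (s : Subset n) {es} → Unique es →
        𝟙 (does (_∈?_ _≟ˢ_ s es)) ≡ ∑L es (λ e → 𝟙 (does (s ≟ˢ e)))
  𝟙-∈ s [] = refl
  𝟙-∈ s {e ∷ es} (e∉ ∷ u) with s ≟ˢ e
  ... | no  _    = trans (𝟙-∈ s u) (sym (+-identityˡ _))
  ... | yes refl = cong (1ℚ +_) (trans (cong 𝟙 (sym (dec-false (_∈?_ _≟ˢ_ s es) (λ s∈ → All.lookup e∉ s∈ refl)))) (𝟙-∈ s u))

  length-filter : ∀ {n} (v : Fin n) es → ι (length (filter (v ∈ˢ?_) es)) ≡ ∑L es (λ e → 𝟙 (does (v ∈ˢ? e)))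
  length-filter v [] = refl
  length-filter v (e ∷ es) with does (v ∈ˢ? e)
  ... | true  = trans (ι-suc (length (filter (v ∈ˢ?_) es))) (cong (1ℚ +_) (length-filter v es))
  ... | false = trans (length-filter v es) (sym (+-identityˡ _))

  module _ {k n : ℕ} (H : Hypergraph (suc k) n) where

    edge : (Fin (suc k) → Fin n) → ℚ
    edge t = 𝟙 (does (_∈?_ _≟ˢ_ (image t) (edges H)))

    0≤edge : ∀ t → 0ℚ ≤ edge t
    0≤edge t = 0≤𝟙 (does (_∈?_ _≟ˢ_ (image t) (edges H)))

    edge-idem : ∀ t → edge t * edge t ≡ edge t
    edge-idem t = 𝟙-idem (does (_∈?_ _≟ˢ_ (image t) (edges H)))

    edge-∑ : ∀ t → edge t ≡ ∑L (edges H) (λ e → 𝟙 (does (image t ≟ˢ e)))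
    edge-∑ t = 𝟙-∈ (image t) (unique H)

    ∑-edge-at : ∀ v → ∑T k (λ t → edge (v ◂ t)) ≡ ι (degree H v) * ι (k !)
    ∑-edge-at v = begin
      ∑T k (λ t → edge (v ◂ t))
        ≡⟨ ∑T-cong k (λ t → edge-∑ (v ◂ t)) ⟩
      ∑T k (λ t → ∑L (edges H) (λ e → 𝟙 (does (image (v ◂ t) ≟ˢ e))))
        ≡⟨ ∑T-∑L k (edges H) (λ e t → 𝟙 (does (image (v ◂ t) ≟ˢ e))) ⟩
      ∑L (edges H) (λ e → ∑T k (λ t → 𝟙 (does (image (v ◂ t) ≟ˢ e))))
        ≡⟨ ∑L-cong (All.map at (uniform H)) ⟩
      ∑L (edges H) (λ e → 𝟙 (does (v ∈ˢ? e)) * ι (k !))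
        ≡⟨ ∑L-*ʳ (edges H) (λ e → 𝟙 (does (v ∈ˢ? e))) (ι (k !)) ⟩
      ∑L (edges H) (λ e → 𝟙 (does (v ∈ˢ? e))) * ι (k !)
        ≡⟨ cong (_* ι (k !)) (sym (length-filter v (edges H))) ⟩
      ι (degree H v) * ι (k !) ∎
      where
      open ≡-Reasoning
      at : ∀ {e} → ∣ e ∣ ≡ suc k → ∑T k (λ t → 𝟙 (does (image (v ◂ t) ≟ˢ e))) ≡ 𝟙 (does (v ∈ˢ? e)) * ι (k !)
      at {e} ∣e∣ = trans (∑T-cong k (fiber v ∣e∣)) (trans (∑T-*ˡ k (𝟙 (does (v ∈ˢ? e))) _) lemma)
        where
        lemma : 𝟙 (does (v ∈ˢ? e)) * ∑T k (λ t → 𝟙 (does (image t ≟ˢ del v e))) ≡ 𝟙 (does (v ∈ˢ? e)) * ι (k !)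
        lemma with v ∈ˢ? e
        ... | no  _   = trans (*-zeroˡ (∑T k (λ t → 𝟙 (does (image t ≟ˢ del v e))))) (sym (*-zeroˡ (ι (k !))))
        ... | yes v∈e = cong (1ℚ *_) (∑T-image₁ k (del v e) (ℕ.suc-injective (trans (sym (∣del∣ v∈e)) ∣e∣)))

    -- Counts edge tuples twice: each edge gives r! of them, each first entry d (r-1)!. The common
    -- factor (r-1)! cancels.
    handshake : ∀ {d} → Regular d H → suc k ℕ.* length (edges H) ≡ d ℕ.* n
    handshake {d} reg = ι-injective (*-cancelˡ-≡ (0<ι′ (k !) {{k ℕ.!≢0}}) (begin
      ι (k !) * ι (suc k ℕ.* length (edges H))
        ≡⟨ trans (cong (ι (k !) *_) (ι-* (suc k) (length (edges H)))) (trans (shuffle (ι (k !)) (ι (suc k)) (ι (length (edges H))))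
             (cong (ι (length (edges H)) *_) (sym (ι-* (suc k) (k !))))) ⟩
      ι (length (edges H)) * ι (suc k !)
        ≡⟨ sym (∑L-const (edges H) (ι (suc k !))) ⟩
      ∑L (edges H) (λ _ → ι (suc k !))
        ≡⟨ sym (∑L-cong (All.map (λ {e} ∣e∣ → ∑T-image₁ (suc k) e ∣e∣) (uniform H))) ⟩
      ∑L (edges H) (λ e → ∑T (suc k) (λ t → 𝟙 (does (image t ≟ˢ e))))
        ≡⟨ sym (∑T-∑L (suc k) (edges H) (λ e t → 𝟙 (does (image t ≟ˢ e)))) ⟩
      ∑T (suc k) (λ t → ∑L (edges H) (λ e → 𝟙 (does (image t ≟ˢ e))))
        ≡⟨ sym (∑T-cong (suc k) edge-∑) ⟩
      ∑ (λ v → ∑T k (λ t → edge (v ◂ t)))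
        ≡⟨ ∑-cong (λ v → trans (∑-edge-at v) (cong (λ d → ι d * ι (k !)) (reg v))) ⟩
      ∑ {n} (λ v → ι d * ι (k !))
        ≡⟨ trans (∑-const n _) (trans (shuffle′ (ι n) (ι d) (ι (k !))) (cong (ι (k !) *_) (sym (ι-* d n)))) ⟩
      ι (k !) * ι (d ℕ.* n) ∎))
      where
      open ≡-Reasoning
      shuffle : ∀ a b c → a * (b * c) ≡ c * (b * a)
      shuffle = solve-∀ ℚ-ring
      shuffle′ : ∀ a b c → a * (b * c) ≡ c * (b * a)
      shuffle′ = solve-∀ ℚ-ring

  module _ {k n : ℕ} (H : Hypergraph (suc (suc k)) n) where

    edge-swap : ∀ u v t → edge H (u ◂ (v ◂ t)) ≡ edge H (v ◂ (u ◂ t))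
    edge-swap u v t = cong (λ s → 𝟙 (does (_∈?_ _≟ˢ_ s (edges H))))
      (trans (sym (∪-assoc ⁅ u ⁆ ⁅ v ⁆ (image t)))
      (trans (cong (_∪ image t) (∪-comm ⁅ u ⁆ ⁅ v ⁆)) (∪-assoc ⁅ v ⁆ ⁅ u ⁆ (image t))))

    -- With a repeated entry the image has at most r - 1 elements, too few for an edge.
    edge-loop : ∀ u t → edge H (u ◂ (u ◂ t)) ≡ 0ℚ
    edge-loop u t = cong 𝟙 (dec-false (_∈?_ _≟ˢ_ (image (u ◂ (u ◂ t))) (edges H)) (λ s∈ →
      ℕ.1+n≰n (subst (ℕ._≤ suc k) (All.lookup (uniform H) s∈)
        (subst (λ s → ∣ s ∣ ℕ.≤ suc k) (sym (trans (sym (∪-assoc ⁅ u ⁆ ⁅ u ⁆ (image t))) (cong (_∪ image t) (∪-idem ⁅ u ⁆))))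
          (∣image∣ (suc k) (u ◂ t))))))

-- An integer stand-in for the square root

module IntegerSqrt where
  open import Data.Nat
  open import Data.Nat.Properties

  4* : ∀ d → 4 * d ≡ d + 3 * d
  4* = solveℕ-∀

  -- Replaces √d up to a factor 2, so that all combinatorial estimates remain statements about
  -- naturals and rationals.
  sqrt-approx : ∀ d → ∃ λ t → d ≤ t * t × t * t ≤ 4 * d
  sqrt-approx zero = 0 , z≤n , z≤n
  sqrt-approx (suc d) with sqrt-approx d
  ... | t , d≤ , ≤4d with suc d ≤? t * t
  ... | yes h = t , h , ≤-trans ≤4d (*-monoʳ-≤ 4 (n≤1+n d))
  -- Here t² equals the old d exactly, so (t + 1)² = d + 1 + 2t, and 2t ≤ 3t² keeps it below 4 (d +
  -- 1).
  ... | no  h = suc t , ≤-trans (s≤s d≤) (≤-trans (m≤m+n (suc (t * t)) (2 * t)) (≤-reflexive (eq t))) ,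
      ≤-trans (≤-reflexive (sym (eq t))) (subst (λ a → suc a + 2 * t ≤ 4 * suc d) (sym t²≡d)
        (≤-trans (s≤s (+-monoʳ-≤ d (subst (2 * t ≤_) (cong (3 *_) t²≡d) (2t≤3t² t)))) bound))
    where
    t²≡d : t * t ≡ d
    t²≡d = ≤-antisym (≤-pred (≰⇒> h)) d≤
    eq : ∀ t → suc (t * t) + 2 * t ≡ suc t * suc t
    eq = solveℕ-∀
    2t≤3t² : ∀ t → 2 * t ≤ 3 * (t * t)
    2t≤3t² zero      = z≤n
    2t≤3t² t@(suc _) = *-mono-≤ (s≤s (s≤s (z≤n {1}))) (m≤m*n t t)
    bound : suc (d + 3 * d) ≤ 4 * suc d
    bound = ≤-trans (s≤s (≤-reflexive (sym (4* d)))) (≤-trans (+-monoˡ-≤ (4 * d) {1} {4} (s≤s z≤n)) (≤-reflexive (eq′ d)))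
      where
      eq′ : ∀ d → 4 + 4 * d ≡ 4 * suc d
      eq′ = solveℕ-∀

  sq-cancel-≤ℕ : ∀ {a b} → a * a ≤ b * b → a ≤ b
  sq-cancel-≤ℕ {a} {b} h with a ≤? b
  ... | yes p = p
  ... | no  p = contradiction (≤-trans (*-mono-< (≰⇒> p) (≰⇒> p)) h) (<-irrefl refl)

-- Sign vectors for the lower bounds on μ

module SignVectors where
  open import Data.Bool using (true; false)
  open import Data.List using (length)
  open import Data.Rational hiding (NonZero)
  open import Data.Rational.Properties hiding (_≟_)
  open import Defs using (Hypergraph; edges; Regular)
  open Rationals
  open FiniteSums
  open Hypercube
  open EdgeCounting

  ∣sg∣ : ∀ b → ∣ sg b ∣ ≡ 1ℚ
  ∣sg∣ true  = refl
  ∣sg∣ false = refl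

  -- Distinct signs are uncorrelated, so only the diagonal survives.
  𝔼-quadratic : ∀ n (Q : Fin n → Fin n → ℚ) →
    𝔼 n (λ ω → ∑ (λ u → ∑ (λ v → Q u v * (sg (ω u) * sg (ω v))))) ≡ ∑ (λ u → Q u u)
  𝔼-quadratic zero    Q = refl
  𝔼-quadratic (suc n) Q = begin
    𝔼 (suc n) F
      ≡⟨ 𝔼-split n F ⟩
    𝔼 n (λ ω → ½ * (F (false ◂ ω) + F (true ◂ ω)))
      ≡⟨ 𝔼-cong n (λ ω → trans (cong₂ (λ a b → ½ * (a + b)) (expand false ω) (expand true ω))
           (average (Q zero zero) (A ω) (B ω) (R ω))) ⟩
    𝔼 n (λ ω → Q zero zero + R ω)
      ≡⟨ trans (𝔼-+ n (λ _ → Q zero zero) R)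
           (cong₂ _+_ (𝔼-const n (Q zero zero)) (𝔼-quadratic n (λ u v → Q (suc u) (suc v)))) ⟩
    Q zero zero + ∑ (λ u → Q (suc u) (suc u)) ∎
    where
    open ≡-Reasoning
    F : Cube (suc n) → ℚ
    F ω = ∑ (λ u → ∑ (λ v → Q u v * (sg (ω u) * sg (ω v))))
    A B R : Cube n → ℚ
    A ω = ∑ (λ v → Q zero (suc v) * sg (ω v))
    B ω = ∑ (λ u → Q (suc u) zero * sg (ω u))
    R ω = ∑ (λ u → ∑ (λ v → Q (suc u) (suc v) * (sg (ω u) * sg (ω v))))
    move : ∀ q s g → q * (s * g) ≡ s * (q * g)
    move = solve-∀ ℚ-ring
    move′ : ∀ q s g → q * (g * s) ≡ s * (q * g)
    move′ = solve-∀ ℚ-ring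
    expand : ∀ b ω → F (b ◂ ω) ≡ Q zero zero * (sg b * sg b) + sg b * A ω + (sg b * B ω + R ω)
    expand b ω = cong₂ _+_
      (cong (Q zero zero * (sg b * sg b) +_) (trans (∑-cong (λ v → move (Q zero (suc v)) (sg b) (sg (ω v))))
        (sym (∑-*ˡ (sg b) (λ v → Q zero (suc v) * sg (ω v))))))
      (trans (∑-+ (λ u → Q (suc u) zero * (sg (ω u) * sg b)) (λ u → ∑ (λ v → Q (suc u) (suc v) * (sg (ω u) * sg (ω v)))))
        (cong (_+ R ω) (trans (∑-cong (λ u → move′ (Q (suc u) zero) (sg b) (sg (ω u))))
          (sym (∑-*ˡ (sg b) (λ u → Q (suc u) zero * sg (ω u)))))))
    average : ∀ q a b r → ½ * (q * (- 1ℚ * - 1ℚ) + - 1ℚ * a + (- 1ℚ * b + r) + (q * (1ℚ * 1ℚ) + 1ℚ * a + (1ℚ * b + r))) ≡ q + r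
    average = solve-∀ ℚ-ring

  module _ {k n : ℕ} .{{_ : NonZero n}} (H : Hypergraph (suc k) n) where

    opaque
      -- Opaque, so that factorials and powers of n are not evaluated. The facts needed are proved
      -- in this block, and `α-def`, `κ-def` reconnect with `τ` and `σ`.
      α κ : ℚ
      α = (ℤ.+ 1 / ((suc k ℕ.∸ 1) !)) {{(suc k ℕ.∸ 1) ℕ.!≢0}}
      κ = (ℤ.+ (suc k ℕ.* length (edges H)) / (n ℕ.^ suc k)) {{ℕ.m^n≢0 n (suc k)}}

      α-def : (ℤ.+ 1 / ((suc k ℕ.∸ 1) !)) {{(suc k ℕ.∸ 1) ℕ.!≢0}} ≡ α
      α-def = refl

      κ-def : (ℤ.+ (suc k ℕ.* length (edges H)) / (n ℕ.^ suc k)) {{ℕ.m^n≢0 n (suc k)}} ≡ κ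
      κ-def = refl

      α-inverse : α * ι (k !) ≡ 1ℚ
      α-inverse = /-*-ι 1 (k !) {{k ℕ.!≢0}}

      κ-inverse : κ * ι (n ℕ.^ suc k) ≡ ι (suc k ℕ.* length (edges H))
      κ-inverse = /-*-ι (suc k ℕ.* length (edges H)) (n ℕ.^ suc k) {{ℕ.m^n≢0 n (suc k)}}

      0≤α : 0ℚ ≤ α
      0≤α = nonNegative⁻¹ α {{normalize-nonNeg 1 (k !) {{k ℕ.!≢0}}}}

      0≤κ : 0ℚ ≤ κ
      0≤κ = nonNegative⁻¹ κ {{normalize-nonNeg (suc k ℕ.* length (edges H)) (n ℕ.^ suc k) {{ℕ.m^n≢0 n (suc k)}}}}

    σℚ : (Fin (suc k) → Fin n → ℚ) → ℚ
    σℚ x = α * ∑T (suc k) (λ t → edge H t * ∏ (λ i → x i (t i))) - κ * ∑T (suc k) (λ t → ∏ (λ i → x i (t i)))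

    coef : (Fin (suc k) → Fin n) → ℚ
    coef t = α * edge H t - κ

    σℚ-coef : ∀ x → σℚ x ≡ ∑T (suc k) (λ t → coef t * ∏ (λ i → x i (t i)))
    σℚ-coef x = sym (trans (∑T-cong (suc k) (λ t → expand α (edge H t) κ (∏ (λ i → x i (t i)))))
      (trans (∑T-- (suc k) (λ t → α * (edge H t * ∏ (λ i → x i (t i)))) (λ t → κ * ∏ (λ i → x i (t i))))
        (cong₂ _-_ (∑T-*ˡ (suc k) α (λ t → edge H t * ∏ (λ i → x i (t i)))) (∑T-*ˡ (suc k) κ (λ t → ∏ (λ i → x i (t i)))))))
      where
      expand : ∀ a e b p → (a * e - b) * p ≡ a * (e * p) - b * p
      expand = solve-∀ ℚ-ring

    0<n : 0ℚ < ι n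
    0<n = 0<ι′ n

    α≤1 : α ≤ 1ℚ
    α≤1 = subst₂ _≤_ (*-identityʳ α) α-inverse (*-monoˡ 0≤α (1≤ι (k !) {{k ℕ.!≢0}}))

    module _ {d : ℕ} (reg : Regular d H) where

      -- `handshake` rewrites r|E|/n^r as d/n^(r-1). Regularity mostly acts through this and
      -- `∑-edge-const`.
      κ-scaled : κ * ι n ^ k ≡ ι d
      κ-scaled = *-cancelˡ-≡ 0<n (begin
        ι n * (κ * ι n ^ k)   ≡⟨ swap (ι n) κ (ι n ^ k) ⟩
        κ * (ι n * ι n ^ k)   ≡⟨ cong (κ *_) (sym (ι-^ n (suc k))) ⟩
        κ * ι (n ℕ.^ suc k)   ≡⟨ κ-inverse ⟩
        ι (suc k ℕ.* length (edges H)) ≡⟨ cong ι (handshake H reg) ⟩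
        ι (d ℕ.* n)           ≡⟨ trans (ι-* d n) (*-comm (ι d) (ι n)) ⟩
        ι n * ι d             ∎)
        where
        open ≡-Reasoning
        swap : ∀ a b c → a * (b * c) ≡ b * (a * c)
        swap = solve-∀ ℚ-ring

      ∑-edge-const : ∀ v → ∑T k (λ t → edge H (v ◂ t)) ≡ ι d * ι (k !)
      ∑-edge-const v = trans (∑-edge-at H v) (cong (λ d → ι d * ι (k !)) (reg v))

      -- Second moment of the chaos obtained by freezing the first slot at v. Indicators are
      -- idempotent, so the square expands into dα - 2dκ + dκ.
      ∑-coef² : ∀ v → ∑T k (λ t → sq (coef (v ◂ t))) ≡ ι d * (α - κ)
      ∑-coef² v = begin
        ∑T k (λ t → sq (coef (v ◂ t)))
          ≡⟨ ∑T-cong k (λ t → trans (expand α κ (edge H (v ◂ t)))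
               (cong (λ e → α * α * e - ι 2 * α * κ * edge H (v ◂ t) + κ * κ) (edge-idem H (v ◂ t)))) ⟩
        ∑T k (λ t → α * α * edge H (v ◂ t) - ι 2 * α * κ * edge H (v ◂ t) + κ * κ)
          ≡⟨ ∑T-cong k (λ t → collect α κ (edge H (v ◂ t))) ⟩
        ∑T k (λ t → (α * α - ι 2 * α * κ) * edge H (v ◂ t) + κ * κ)
          ≡⟨ trans (∑T-+ k (λ t → (α * α - ι 2 * α * κ) * edge H (v ◂ t)) (λ _ → κ * κ))
               (cong₂ _+_ (trans (∑T-*ˡ k (α * α - ι 2 * α * κ) (λ t → edge H (v ◂ t)))
                 (cong ((α * α - ι 2 * α * κ) *_) (∑-edge-const v))) (∑T-const k (κ * κ))) ⟩
        (α * α - ι 2 * α * κ) * (ι d * ι (k !)) + ι n ^ k * (κ * κ)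
          ≡⟨ regroup α κ (ι d) (ι (k !)) (ι n ^ k) ⟩
        (α - ι 2 * κ) * ι d * (α * ι (k !)) + κ * (κ * ι n ^ k)
          ≡⟨ cong₂ (λ a b → (α - ι 2 * κ) * ι d * a + κ * b) α-inverse κ-scaled ⟩
        (α - ι 2 * κ) * ι d * 1ℚ + κ * ι d
          ≡⟨ finish α κ (ι d) ⟩
        ι d * (α - κ) ∎
        where
        open ≡-Reasoning
        expand : ∀ a b e → (a * e - b) * (a * e - b) ≡ a * a * (e * e) - ι 2 * a * b * e + b * b
        expand = solve-∀ ℚ-ring
        collect : ∀ a b e → a * a * e - ι 2 * a * b * e + b * b ≡ (a * a - ι 2 * a * b) * e + b * b
        collect = solve-∀ ℚ-ring
        regroup : ∀ a b d m N → (a * a - ι 2 * a * b) * (d * m) + N * (b * b) ≡ (a - ι 2 * b) * d * (a * m) + b * (b * N)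
        regroup = solve-∀ ℚ-ring
        finish : ∀ a b d → (a - ι 2 * b) * d * 1ℚ + b * d ≡ d * (a - b)
        finish = solve-∀ ℚ-ring

  Signs : ∀ {n} {I : Set} → (I → Fin n → ℚ) → Set
  Signs x = ∀ i v → ∣ x i v ∣ ≡ 1ℚ

  module _ {j n : ℕ} .{{_ : NonZero n}} (H : Hypergraph (suc (suc j)) n) {d : ℕ} (reg : Regular d H) where

    -- The minus sign in the first slot turns the average -d into d, so no absolute value is needed.
    repeated : Cube n → Fin (suc (suc j)) → Fin n → ℚ
    repeated ω zero          v = - sg (ω v)
    repeated ω (suc zero)    v = sg (ω v)
    repeated ω (suc (suc i)) v = 1ℚ

    -- Averaging over ω kills every tuple but those with equal first two entries, none of which is an edge.
    𝔼-repeated : 𝔼 n (λ ω → σℚ H (repeated ω)) ≡ ι d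
    𝔼-repeated = begin
      𝔼 n (λ ω → σℚ H (repeated ω))
        ≡⟨ 𝔼-cong n (λ ω → trans (σℚ-coef H (repeated ω)) (∑-cong (λ u → ∑-cong (λ v → at ω u v)))) ⟩
      𝔼 n (λ ω → ∑ (λ u → ∑ (λ v → Q u v * (sg (ω u) * sg (ω v)))))
        ≡⟨ 𝔼-quadratic n Q ⟩
      ∑ (λ u → Q u u)
        ≡⟨ ∑-cong diagonal ⟩
      ∑ {n} (λ _ → κ H * ι n ^ j)
        ≡⟨ trans (∑-const n (κ H * ι n ^ j)) (swap (ι n) (κ H) (ι n ^ j)) ⟩
      κ H * ι n ^ suc j
        ≡⟨ κ-scaled H reg ⟩
      ι d ∎
      where
      open ≡-Reasoning
      Q : Fin n → Fin n → ℚ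
      Q u v = - ∑T j (λ t → coef H (u ◂ (v ◂ t)))
      swap : ∀ a b c → a * (b * c) ≡ b * (a * c)
      swap = solve-∀ ℚ-ring
      1^ : ∏ {j} (λ _ → 1ℚ) ≡ 1ℚ
      1^ = ones j
        where
        ones : ∀ j → ∏ {j} (λ _ → 1ℚ) ≡ 1ℚ
        ones zero    = refl
        ones (suc j) = trans (*-identityˡ _) (ones j)
      rearr : ∀ c s t → c * (- s * (t * 1ℚ)) ≡ - (s * t) * c
      rearr = solve-∀ ℚ-ring
      rearr′ : ∀ s c → - s * c ≡ - c * s
      rearr′ = solve-∀ ℚ-ring
      at : ∀ ω u v → ∑T j (λ t → coef H (u ◂ (v ◂ t)) * (- sg (ω u) * (sg (ω v) * ∏ {j} (λ _ → 1ℚ)))) ≡ Q u v * (sg (ω u) * sg (ω v))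
      at ω u v = trans (∑T-cong j (λ t → trans (cong (λ p → coef H (u ◂ (v ◂ t)) * (- sg (ω u) * (sg (ω v) * p))) 1^)
          (rearr (coef H (u ◂ (v ◂ t))) (sg (ω u)) (sg (ω v)))))
        (trans (∑T-*ˡ j (- (sg (ω u) * sg (ω v))) (λ t → coef H (u ◂ (v ◂ t)))) (rearr′ (sg (ω u) * sg (ω v)) (∑T j (λ t → coef H (u ◂ (v ◂ t))))))
      loop : ∀ a b → a * 0ℚ - b ≡ - b
      loop = solve-∀ ℚ-ring
      neg-neg : ∀ a b → - (b * - a) ≡ a * b
      neg-neg = solve-∀ ℚ-ring
      diagonal : ∀ u → Q u u ≡ κ H * ι n ^ j
      diagonal u = trans (cong -_ (trans (∑T-cong j (λ t → trans (cong (λ e → α H * e - κ H) (edge-loop H u t)) (loop (α H) (κ H))))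
        (∑T-const j (- κ H)))) (neg-neg (κ H) (ι n ^ j))

    repeated-signs : ∀ ω → Signs (repeated ω)
    repeated-signs ω zero          v = trans (∣-p∣≡∣p∣ (sg (ω v))) (∣sg∣ (ω v))
    repeated-signs ω (suc zero)    v = ∣sg∣ (ω v)
    repeated-signs ω (suc (suc i)) v = refl

    signs-≥-d : ∃ λ x → Signs x × (ι d ≤ σℚ H x)
    signs-≥-d =
      let ω , h = 𝔼-attained n (λ ω → σℚ H (repeated ω)) (≤-reflexive (sym 𝔼-repeated))
      in repeated ω , repeated-signs ω , h

  -- With u = i |f| this is u² - u⁴ ≤ u, that is 1 - u + u³ ≥ 0 for u ≥ 0. It bounds a first
  -- absolute moment by even moments.
  ∣∣-lower : ∀ f {i} → 0ℚ ≤ i → i * sq f - i * i * i * (sq f * sq f) ≤ ∣ f ∣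
  ∣∣-lower f {i} 0≤i = 0≤q-p⇒p≤q (subst (0ℚ ≤_)
      (trans (eq ∣ f ∣ i) (cong (λ s → ∣ f ∣ - (i * s - i * i * i * (s * s))) (∣∣-sq f)))
      (0≤* (0≤∣p∣ f) cubic))
    where
    u = ∣ f ∣ * i
    0≤u : 0ℚ ≤ u
    0≤u = 0≤* (0≤∣p∣ f) 0≤i
    eq : ∀ a i → a * (1ℚ - a * i + a * i * (a * i) * (a * i)) ≡ a - (i * (a * a) - i * i * i * ((a * a) * (a * a)))
    eq = solve-∀ ℚ-ring
    eq₁ : ∀ u → 1ℚ - u + u * u * u ≡ (1ℚ - u) + u * u * u
    eq₁ = solve-∀ ℚ-ring
    eq₂ : ∀ u → 1ℚ + u * ((u - 1ℚ) * (u + 1ℚ)) ≡ 1ℚ - u + u * u * u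
    eq₂ = solve-∀ ℚ-ring
    cubic : 0ℚ ≤ 1ℚ - u + u * u * u
    cubic with ≤-total u 1ℚ
    ... | inj₁ u≤1 = 0≤+ (p≤q⇒0≤q-p u≤1) (0≤* (0≤* 0≤u 0≤u) 0≤u)
    ... | inj₂ 1≤u = subst (0ℚ ≤_) (eq₂ u) (0≤+ 0≤1 (0≤* 0≤u (0≤* (p≤q⇒0≤q-p 1≤u) (0≤+ 0≤u 0≤1))))

  -- The value at 0 is 1, so that the result is a sign vector everywhere.
  sgn : ℚ → ℚ
  sgn f with 0ℚ ≤? f
  ... | yes _ = 1ℚ
  ... | no  _ = - 1ℚ

  ∣sgn∣ : ∀ f → ∣ sgn f ∣ ≡ 1ℚ
  ∣sgn∣ f with 0ℚ ≤? f
  ... | yes _ = refl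
  ... | no  _ = refl

  sgn-* : ∀ f → ∣ f ∣ ≤ sgn f * f
  sgn-* f with 0ℚ ≤? f
  ... | yes 0≤f = ≤-reflexive (trans (0≤p⇒∣p∣≡p 0≤f) (sym (*-identityˡ f)))
  ... | no  0≰f = ≤-reflexive (trans (sym (∣-p∣≡∣p∣ f)) (trans (0≤p⇒∣p∣≡p (neg-antimono-≤ (<⇒≤ (≰⇒> 0≰f)))) (eq f)))
    where
    eq : ∀ f → - f ≡ - 1ℚ * f
    eq = solve-∀ ℚ-ring

  module _ {k n : ℕ} .{{_ : NonZero n}} (H : Hypergraph (suc k) n) {d t : ℕ} (reg : Regular d H)
           (1≤k : 1 ℕ.≤ k) (sparse : 2 ℕ.* (k ! ℕ.* d) ℕ.≤ n ℕ.^ k) (0<t : 0 ℕ.< t)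
           (d≤t² : d ℕ.≤ t ℕ.* t) (t²≤4d : t ℕ.* t ℕ.≤ 4 ℕ.* d) where

    private
      T s : ℕ
      T = 3 ℕ.^ k
      -- Where `∣∣-lower` is applied, 1/i is this s = 3^k t. The fourth moment is at most 3^k A²
      -- with A ≤ d ≤ t², so its share i² 3^k A is at most 3^(-k), below a half.
      s = T ℕ.* t

      instance
        T≢0 : NonZero T
        T≢0 = ℕ.m^n≢0 3 k
        s≢0 : NonZero s
        s≢0 = ℕ.m*n≢0 T t {{T≢0}} {{ℕ.>-nonZero 0<t}}

      i : ℚ
      i = rec s

      f : Fin n → (Fin k → Cube n) → ℚ
      f v = chaos (λ t → coef H (v ◂ t))

      A : ℚ
      A = ι d * (α H - κ H)

      -- After clearing denominators this is `sparse`. It keeps the second moment A = d (α - κ) of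
      -- order α d.
      2κ≤α : ι 2 * κ H ≤ α H
      2κ≤α = *-cancelˡ (0<* (0<ι′ (k !) {{k ℕ.!≢0}}) (0<^ k (0<n H))) (begin
        ι (k !) * ι n ^ k * (ι 2 * κ H)      ≡⟨ eq₁ (ι (k !)) (ι n ^ k) (ι 2) (κ H) ⟩
        ι 2 * (ι (k !) * (κ H * ι n ^ k))    ≡⟨ cong (λ a → ι 2 * (ι (k !) * a)) (κ-scaled H reg) ⟩
        ι 2 * (ι (k !) * ι d)                ≡⟨ sym (trans (ι-* 2 (k ! ℕ.* d)) (cong (ι 2 *_) (ι-* (k !) d))) ⟩
        ι (2 ℕ.* (k ! ℕ.* d))                ≤⟨ ι-mono sparse ⟩
        ι (n ℕ.^ k)                          ≡⟨ trans (ι-^ n k) (sym (*-identityʳ (ι n ^ k))) ⟩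
        ι n ^ k * 1ℚ                         ≡⟨ cong (ι n ^ k *_) (sym (α-inverse H)) ⟩
        ι n ^ k * (α H * ι (k !))            ≡⟨ eq₂ (ι n ^ k) (α H) (ι (k !)) ⟩
        ι (k !) * ι n ^ k * α H              ∎)
        where
        open ≤-Reasoning
        eq₁ : ∀ m N a b → m * N * (a * b) ≡ a * (m * (b * N))
        eq₁ = solve-∀ ℚ-ring
        eq₂ : ∀ N a m → N * (a * m) ≡ m * N * a
        eq₂ = solve-∀ ℚ-ring

      0≤α-κ : 0ℚ ≤ α H - κ H
      0≤α-κ = subst (0ℚ ≤_) (eq (α H) (κ H)) (0≤+ (p≤q⇒0≤q-p 2κ≤α) (0≤κ H))
        where
        eq : ∀ a b → a - ι 2 * b + b ≡ a - b
        eq = solve-∀ ℚ-ring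

      0≤A : 0ℚ ≤ A
      0≤A = 0≤* (0≤ι d) 0≤α-κ

      A≤d : A ≤ ι d
      A≤d = subst (A ≤_) (*-identityʳ (ι d)) (*-monoˡ (0≤ι d)
        (≤-trans (subst (α H - κ H ≤_) (+-identityʳ (α H)) (+-monoʳ-≤ (α H) (neg-antimono-≤ (0≤κ H)))) (α≤1 H)))

      αd≤2A : α H * ι d ≤ ι 2 * A
      αd≤2A = 0≤q-p⇒p≤q (subst (0ℚ ≤_) (eq (ι d) (α H) (κ H)) (0≤* (0≤ι d) (p≤q⇒0≤q-p 2κ≤α)))
        where
        eq : ∀ d a b → d * (a - ι 2 * b) ≡ ι 2 * (d * (a - b)) - a * d
        eq = solve-∀ ℚ-ring

      is≡1 : i * (ι T * ι t) ≡ 1ℚ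
      is≡1 = trans (cong (i *_) (sym (ι-* T t))) (rec-inverse s)

      0≤i : 0ℚ ≤ i
      0≤i = 0≤rec s

      2≤T : 2 ℕ.≤ T
      2≤T = ℕ.≤-trans (ℕ.s≤s (ℕ.s≤s ℕ.z≤n)) (ℕ.^-monoʳ-≤ 3 1≤k)

      small : ι 2 * (i * i * ι T * A) ≤ 1ℚ
      small = begin
        ι 2 * (i * i * ι T * A)
          ≤⟨ *-monoʳ (0≤* (0≤* (0≤* 0≤i 0≤i) (0≤ι T)) 0≤A) (ι-mono 2≤T) ⟩
        ι T * (i * i * ι T * A)
          ≤⟨ *-monoˡ (0≤ι T) (*-monoˡ (0≤* (0≤* 0≤i 0≤i) (0≤ι T)) (≤-trans A≤d (≤-trans (ι-mono d≤t²) (≤-reflexive (ι-* t t))))) ⟩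
        ι T * (i * i * ι T * (ι t * ι t))
          ≡⟨ eq (ι T) i (ι t) ⟩
        (i * (ι T * ι t)) * (i * (ι T * ι t))
          ≡⟨ cong sq is≡1 ⟩
        1ℚ ∎
        where
        open ≤-Reasoning
        eq : ∀ T i t → T * (i * i * T * (t * t)) ≡ (i * (T * t)) * (i * (T * t))
        eq = solve-∀ ℚ-ring

      -- 16 = 2 · 2 · 4: the fourth moment takes half, A is at least α d / 2, and d is at least t² /
      -- 4. The factors (r-1)! and 3^k come from 1/α and from s.
      16mT : ℕ
      16mT = 16 ℕ.* (k ! ℕ.* T)

      main : ι t ≤ ι 16mT * (i * A - i * i * i * (ι T * (A * A)))
      main = begin
        ι t                                      ≡⟨ trans (sym (*-identityˡ (ι t))) (cong (_* ι t) (sym is≡1)) ⟩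
        i * (ι T * ι t) * ι t                    ≡⟨ eq₁ i (ι T) (ι t) ⟩
        i * ι T * (ι t * ι t)                    ≤⟨ *-monoˡ (0≤* 0≤i (0≤ι T)) (subst₂ _≤_ (ι-* t t) (ι-* 4 d) (ι-mono t²≤4d)) ⟩
        i * ι T * (ι 4 * ι d)                    ≡⟨ trans (sym (*-identityʳ _)) (cong (i * ι T * (ι 4 * ι d) *_) (sym (α-inverse H))) ⟩
        i * ι T * (ι 4 * ι d) * (α H * ι (k !))  ≡⟨ eq₂ i (ι T) (ι d) (α H) (ι (k !)) ⟩
        i * ι T * ι (k !) * ι 4 * (α H * ι d)    ≤⟨ *-monoˡ (0≤* (0≤* (0≤* 0≤i (0≤ι T)) (0≤ι (k !))) (0≤ι 4)) αd≤2A ⟩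
        i * ι T * ι (k !) * ι 4 * (ι 2 * A)      ≡⟨ trans (sym (*-identityʳ _)) (eq₃ i (ι T) (ι (k !)) A) ⟩
        ι 16 * (ι (k !) * ι T) * (i * A) * (1ℚ - ½)
          ≤⟨ *-monoˡ (0≤* (0≤* (0≤ι 16) (0≤* (0≤ι (k !)) (0≤ι T))) (0≤* 0≤i 0≤A)) (+-monoʳ-≤ 1ℚ (neg-antimono-≤ half)) ⟩
        ι 16 * (ι (k !) * ι T) * (i * A) * (1ℚ - i * i * ι T * A)
          ≡⟨ trans (eq₄ (ι 16 * (ι (k !) * ι T)) i A (ι T))
               (cong (_* (i * A - i * i * i * (ι T * (A * A)))) (sym (trans (ι-* 16 (k ! ℕ.* T)) (cong (ι 16 *_) (ι-* (k !) T))))) ⟩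
        ι 16mT * (i * A - i * i * i * (ι T * (A * A))) ∎
        where
        open ≤-Reasoning
        eq₁ : ∀ i T t → i * (T * t) * t ≡ i * T * (t * t)
        eq₁ = solve-∀ ℚ-ring
        eq₂ : ∀ i T d a m → i * T * (ι 4 * d) * (a * m) ≡ i * T * m * ι 4 * (a * d)
        eq₂ = solve-∀ ℚ-ring
        eq₃ : ∀ i T m A → i * T * m * ι 4 * (ι 2 * A) * 1ℚ ≡ ι 16 * (m * T) * (i * A) * (1ℚ - ½)
        eq₃ = solve-∀ ℚ-ring
        eq₄ : ∀ c i A T → c * (i * A) * (1ℚ - i * i * T * A) ≡ c * (i * A - i * i * i * (T * (A * A)))
        eq₄ = solve-∀ ℚ-ring
        half : i * i * ι T * A ≤ ½
        half = subst (_≤ ½) (eq (i * i * ι T * A)) (*-monoˡ 0≤½ small)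
          where
          eq : ∀ a → ½ * (ι 2 * a) ≡ a
          eq = solve-∀ ℚ-ring

      at : ∀ v → i * A - i * i * i * (ι T * (A * A)) ≤ 𝔼K k (λ ω → i * sq (f v ω) - i * i * i * (sq (f v ω) * sq (f v ω)))
      at v = begin
        i * A - i * i * i * (ι T * (A * A))
          ≡⟨ cong₂ (λ a b → i * a - i * i * i * (b * (a * a))) (sym (∑-coef² H reg v)) (ι-^ 3 k) ⟩
        i * A′ - i * i * i * (3ℚ ^ k * (A′ * A′))
          ≤⟨ +-monoʳ-≤ (i * A′) (neg-antimono-≤ (*-monoˡ (0≤* (0≤* 0≤i 0≤i) 0≤i)
               (𝔼K-chaos²chaos² k (λ t → coef H (v ◂ t)) (λ t → coef H (v ◂ t))))) ⟩
        i * A′ - i * i * i * 𝔼K k (λ ω → sq (f v ω) * sq (f v ω))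
          ≡⟨ cong (λ a → i * a - i * i * i * 𝔼K k (λ ω → sq (f v ω) * sq (f v ω))) (sym (𝔼K-chaos² k (λ t → coef H (v ◂ t)))) ⟩
        i * 𝔼K k (λ ω → sq (f v ω)) - i * i * i * 𝔼K k (λ ω → sq (f v ω) * sq (f v ω))
          ≡⟨ sym (trans (𝔼K-- k (λ ω → i * sq (f v ω)) (λ ω → i * i * i * (sq (f v ω) * sq (f v ω))))
               (cong₂ _-_ (𝔼K-*ˡ k i (λ ω → sq (f v ω))) (𝔼K-*ˡ k (i * i * i) (λ ω → sq (f v ω) * sq (f v ω))))) ⟩
        𝔼K k (λ ω → i * sq (f v ω) - i * i * i * (sq (f v ω) * sq (f v ω))) ∎
        where
        open ≤-Reasoning
        A′ = ∑T k (λ t → sq (coef H (v ◂ t)))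

      average : ι n * ι t ≤ 𝔼K k (λ ω → ι 16mT * ∑ (λ v → ∣ f v ω ∣))
      average = begin
        ι n * ι t                                           ≡⟨ sym (∑-const n (ι t)) ⟩
        ∑ {n} (λ _ → ι t)                                   ≤⟨ ∑-mono {n} (λ v → ≤-trans main (*-monoˡ (0≤ι 16mT) (≤-trans (at v)
                                                                 (𝔼K-mono k (λ ω → ∣∣-lower (f v ω) 0≤i))))) ⟩
        ∑ (λ v → ι 16mT * 𝔼K k (λ ω → ∣ f v ω ∣))           ≡⟨ sym (∑-*ˡ (ι 16mT) (λ v → 𝔼K k (λ ω → ∣ f v ω ∣))) ⟩
        ι 16mT * ∑ (λ v → 𝔼K k (λ ω → ∣ f v ω ∣))           ≡⟨ cong (ι 16mT *_) (sym (𝔼K-∑ k (λ v ω → ∣ f v ω ∣))) ⟩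
        ι 16mT * 𝔼K k (λ ω → ∑ (λ v → ∣ f v ω ∣))           ≡⟨ sym (𝔼K-*ˡ k (ι 16mT) (λ ω → ∑ (λ v → ∣ f v ω ∣))) ⟩
        𝔼K k (λ ω → ι 16mT * ∑ (λ v → ∣ f v ω ∣))           ∎
        where open ≤-Reasoning

      -- σ is linear in the first slot with gradient `f`, so the signs of `f` there turn σ into ∑ |f
      -- v|.
      aligned : (Fin k → Cube n) → Fin (suc k) → Fin n → ℚ
      aligned ω zero    v = sgn (f v ω)
      aligned ω (suc i) v = sg (ω i v)

      aligned-signs : ∀ ω → Signs (aligned ω)
      aligned-signs ω zero    v = ∣sgn∣ (f v ω)
      aligned-signs ω (suc i) v = ∣sg∣ (ω i v)

      σℚ-aligned : ∀ ω → σℚ H (aligned ω) ≡ ∑ (λ v → sgn (f v ω) * f v ω)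
      σℚ-aligned ω = trans (σℚ-coef H (aligned ω)) (∑-cong (λ v → trans
        (∑T-cong k (λ t → swap (coef H (v ◂ t)) (sgn (f v ω)) (∏ (λ i → sg (ω i (t i))))))
        (∑T-*ˡ k (sgn (f v ω)) (λ t → coef H (v ◂ t) * ∏ (λ i → sg (ω i (t i)))))))
        where
        swap : ∀ a b c → a * (b * c) ≡ b * (a * c)
        swap = solve-∀ ℚ-ring

    signs-sparse : ∃ λ x → Signs x × (ι n * ι t ≤ ι (16 ℕ.* (k ! ℕ.* 3 ℕ.^ k)) * σℚ H x)
    signs-sparse =
      let ω , h = 𝔼K-attained k (λ ω → ι 16mT * ∑ (λ v → ∣ f v ω ∣)) average
      in aligned ω , aligned-signs ω ,
         ≤-trans h (*-monoˡ (0≤ι 16mT) (≤-trans (∑-mono (λ v → sgn-* (f v ω))) (≤-reflexive (sym (σℚ-aligned ω)))))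

-- Clamping to [-1 , 1]

module Truncation where
  open import Data.Rational hiding (NonZero)
  open import Data.Rational.Properties
  open Rationals
  open SignVectors using (∣∣-lower)

  φ : ℚ → ℚ
  φ c with 1ℚ ≤? c | c ≤? - 1ℚ
  ... | yes _ | _     = 1ℚ
  ... | no  _ | yes _ = - 1ℚ
  ... | no  _ | no  _ = c

  -- The three regimes with weak inequalities. They overlap at the endpoints, where by `φ-unique`
  -- the values agree.
  data View (c : ℚ) : ℚ → Set where
    high : 1ℚ ≤ c → View c 1ℚ
    low  : c ≤ - 1ℚ → View c (- 1ℚ)
    mid  : c ≤ 1ℚ → - 1ℚ ≤ c → View c c

  φ-view : ∀ c → View c (φ c)
  φ-view c with 1ℚ ≤? c | c ≤? - 1ℚ
  ... | yes p | _     = high p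
  ... | no  _ | yes q = low q
  ... | no  p | no  q = mid (<⇒≤ (≰⇒> p)) (<⇒≤ (≰⇒> q))

  -1<1 : - 1ℚ < 1ℚ
  -1<1 = neg<pos (- 1ℚ) 1ℚ

  -1≤1 : - 1ℚ ≤ 1ℚ
  -1≤1 = <⇒≤ -1<1

  φ≤1 : ∀ c → φ c ≤ 1ℚ
  φ≤1 c with φ c | φ-view c
  ... | _ | high _  = ≤-refl
  ... | _ | low _   = -1≤1
  ... | _ | mid p _ = p

  -1≤φ : ∀ c → - 1ℚ ≤ φ c
  -1≤φ c with φ c | φ-view c
  ... | _ | high _  = -1≤1
  ... | _ | low _   = ≤-refl
  ... | _ | mid _ q = q

  φ-mono : ∀ {a b} → a ≤ b → φ a ≤ φ b
  φ-mono {a} {b} a≤b with φ a | φ-view a | φ b | φ-view b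
  ... | _ | high p  | _ | high _  = ≤-refl
  ... | _ | high p  | _ | low q   = contradiction (≤-trans p (≤-trans a≤b q)) (λ h → <-irrefl refl (<-≤-trans -1<1 h))
  ... | _ | high p  | _ | mid _ _ = ≤-trans p a≤b
  ... | _ | low _   | _ | high _  = -1≤1
  ... | _ | low _   | _ | low _   = ≤-refl
  ... | _ | low _   | _ | mid _ q = q
  ... | _ | mid p _ | _ | high _  = p
  ... | _ | mid _ q | _ | low q′  = ≤-trans a≤b q′
  ... | _ | mid _ _ | _ | mid _ _ = a≤b

  φ-lipschitz : ∀ {a b} → a ≤ b → φ b - φ a ≤ b - a
  φ-lipschitz {a} {b} a≤b with φ a | φ-view a | φ b | φ-view b
  ... | _ | high p  | _ | high _  = p≤q⇒0≤q-p a≤b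
  ... | _ | high p  | _ | low q   = ≤-trans (+-monoˡ-≤ (- 1ℚ) -1≤1) (p≤q⇒0≤q-p a≤b)
  ... | _ | high p  | _ | mid b≤1 _ = ≤-trans (+-monoˡ-≤ (- 1ℚ) b≤1) (p≤q⇒0≤q-p a≤b)
  ... | _ | low p   | _ | high q  = +-mono-≤ q (neg-antimono-≤ p)
  ... | _ | low p   | _ | low _   = p≤q⇒0≤q-p a≤b
  ... | _ | low p   | _ | mid _ q = +-monoʳ-≤ b (neg-antimono-≤ p)
  ... | _ | mid p _ | _ | high q  = +-monoˡ-≤ (- a) q
  ... | _ | mid _ q | _ | low q′  = ≤-trans (+-monoˡ-≤ (- a) q) (≤-trans (≤-reflexive (+-inverseʳ a)) (p≤q⇒0≤q-p a≤b))
  ... | _ | mid _ _ | _ | mid _ _ = ≤-refl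

  private
    neg-neg : ∀ a → - - a ≡ a
    neg-neg = solve-∀ ℚ-ring

  φ-unique : ∀ {c a b} → View c a → View c b → a ≡ b
  φ-unique (high p)  (high _)   = refl
  φ-unique (high p)  (low q)    = contradiction (<-≤-trans -1<1 (≤-trans p q)) (<-irrefl refl)
  φ-unique (high p)  (mid q _)  = ≤-antisym p q
  φ-unique (low p)   (high q)   = contradiction (<-≤-trans -1<1 (≤-trans q p)) (<-irrefl refl)
  φ-unique (low p)   (low _)    = refl
  φ-unique (low p)   (mid _ q)  = ≤-antisym q p
  φ-unique (mid p _) (high q)   = ≤-antisym p q
  φ-unique (mid _ p) (low q)    = ≤-antisym q p
  φ-unique (mid _ _) (mid _ _)  = refl

  φ-odd : ∀ c → φ (- c) ≡ - φ c
  φ-odd c = φ-unique (φ-view (- c)) (flip (φ-view c))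
    where
    flip : ∀ {a} → View c a → View (- c) (- a)
    flip (high p)  = low (neg-antimono-≤ p)
    flip (low p)   = high (neg-antimono-≤ p)
    flip (mid p q) = mid (neg-antimono-≤ q) (neg-antimono-≤ p)

  -- Where the clamp acts, c φ(i c) is |c| and `∣∣-lower` applies; elsewhere it is i c², which is at
  -- least i′ c². Two scales are needed: i is common to all vertices for the sake of the Lipschitz
  -- bound, while i′ is fitted to the second moment at one vertex.
  *-φ-lower : ∀ c {i i′} → 0ℚ ≤ i′ → i′ ≤ i → i′ * sq c - i′ * i′ * i′ * (sq c * sq c) ≤ c * φ (i * c)
  *-φ-lower c {i} {i′} 0≤i′ i′≤i with φ (i * c) | φ-view (i * c)
  ... | _ | high p = ≤-trans (∣∣-lower c 0≤i′) (≤-reflexive (trans (0≤p⇒∣p∣≡p 0≤c) (sym (*-identityʳ c))))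
    where
    0≤c : 0ℚ ≤ c
    0≤c with ≤-total 0ℚ c
    ... | inj₁ h = h
    ... | inj₂ h = contradiction (≤-trans p (subst (i * c ≤_) (*-zeroʳ i) (*-monoˡ (≤-trans 0≤i′ i′≤i) h)))
                     (λ q → <-irrefl refl (<-≤-trans 0<1 q))
  ... | _ | low p = ≤-trans (∣∣-lower c 0≤i′) (≤-reflexive (trans (sym (∣-p∣≡∣p∣ c)) (trans (0≤p⇒∣p∣≡p (neg-antimono-≤ c≤0)) (eq c))))
    where
    eq : ∀ c → - c ≡ c * - 1ℚ
    eq = solve-∀ ℚ-ring
    c≤0 : c ≤ 0ℚ
    c≤0 with ≤-total 0ℚ c
    ... | inj₂ h = h
    ... | inj₁ h = contradiction (≤-trans (0≤* (≤-trans 0≤i′ i′≤i) h) p) (λ q → <-irrefl refl (≤-<-trans q (negative⁻¹ (- 1ℚ))))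
  ... | _ | mid _ _ = begin
    i′ * sq c - i′ * i′ * i′ * (sq c * sq c)
      ≤⟨ +-monoʳ-≤ (i′ * sq c) (neg-antimono-≤ (0≤* (0≤* (0≤* 0≤i′ 0≤i′) 0≤i′) (0≤* (0≤sq c) (0≤sq c)))) ⟩
    i′ * sq c - 0ℚ ≡⟨ +-identityʳ (i′ * sq c) ⟩
    i′ * sq c      ≤⟨ *-monoʳ (0≤sq c) i′≤i ⟩
    i * (c * c)    ≡⟨ eq i c ⟩
    c * (i * c)    ∎
    where
    open ≤-Reasoning
    eq : ∀ i c → i * (c * c) ≡ c * (i * c)
    eq = solve-∀ ℚ-ring

-- Integrality of codegrees, bounded differences of clamped sums, a quadratic bound for powers

module LipschitzSums where
  open import Data.Bool as Bool using (Bool; true; false)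
  open import Data.Rational hiding (NonZero)
  open import Data.Rational.Properties hiding (_≟_)
  open import Data.Unit using (tt)
  open import Data.List.Membership.DecPropositional using (_∈?_)
  open import Defs using (Hypergraph; edges; image; _≟ˢ_)
  open Rationals
  open IntegerSqrt
  open FiniteSums
  open Hypercube
  open EdgeCounting
  open SignVectors
  open Truncation

  IsNat : ℚ → Set
  IsNat q = ∃ λ a → q ≡ ι a

  IsNat-+ : ∀ {p q} → IsNat p → IsNat q → IsNat (p + q)
  IsNat-+ (a , p≡) (b , q≡) = a ℕ.+ b , trans (cong₂ _+_ p≡ q≡) (sym (ι-+ a b))

  IsNat-∑ : ∀ {n} {f : Fin n → ℚ} → (∀ i → IsNat (f i)) → IsNat (∑ f)
  IsNat-∑ {zero}  h = 0 , refl
  IsNat-∑ {suc n} h = IsNat-+ (h zero) (IsNat-∑ (h ∘ suc))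

  IsNat-∑T : ∀ {n} k {f : (Fin k → Fin n) → ℚ} → (∀ t → IsNat (f t)) → IsNat (∑T k f)
  IsNat-∑T zero    h = h Vector.[]
  IsNat-∑T (suc k) h = IsNat-∑ (λ v → IsNat-∑T k (λ t → h (v ◂ t)))

  IsNat-sq : ∀ {q} → IsNat q → IsNat (sq q)
  IsNat-sq (a , q≡) = a ℕ.* a , trans (cong sq q≡) (sym (ι-* a a))

  IsNat-𝟙 : ∀ b → IsNat (𝟙 b)
  IsNat-𝟙 true  = 1 , refl
  IsNat-𝟙 false = 0 , refl

  IsNat-edge : ∀ {k n} (H : Hypergraph (suc k) n) t → IsNat (edge H t)
  IsNat-edge H t = IsNat-𝟙 (does (_∈?_ _≟ˢ_ (image t) (edges H)))

  -- Integrality of codegrees enters here: it bounds their sum of squares below by their sum.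
  IsNat-≤-sq : ∀ {q} → IsNat q → q ≤ sq q
  IsNat-≤-sq (zero  , q≡) = ≤-reflexive (trans q≡ (sym (cong sq q≡)))
  IsNat-≤-sq (suc a , q≡) = subst (λ q → q ≤ sq q) (sym q≡)
    (subst (ι (suc a) ≤_) (ι-* (suc a) (suc a)) (ι-mono (ℕ.m≤m*n (suc a) (suc a))))

  module _ {N : ℕ} (i : ℚ) (0≤i : 0ℚ ≤ i) where

    -- The offset c collects the contribution of signs already fixed, which makes the family closed
    -- under restriction.
    clampSum : ∀ {n} → (Fin N → ℚ) → (Fin n → Fin N → ℚ) → Cube n → ℚ
    clampSum c w ω = ∑ (λ v → φ (i * (c v + lin (λ u → w u v) ω)))

    -- Raising the sign of u moves the v-th argument up by 2 i w(u,v). The clamp is increasing and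
    -- 1-Lipschitz, so the total change lies between 0 and 2 i W.
    clampSum-diff : ∀ n c (w : Fin n → Fin N → ℚ) {W} → (∀ u v → 0ℚ ≤ w u v) → (∀ u → ∑ (w u) ≤ W) →
                    BoundedDiff (ι 2 * (i * W)) n (clampSum c w)
    clampSum-diff zero    c w 0≤w w≤W = tt
    clampSum-diff (suc n) c w {W} 0≤w w≤W = (λ ω → upper ω , lower ω) ,
      λ b → subst-BD (λ ω → ∑-cong (λ v → cong (λ a → φ (i * a)) (assoc (c v) (w zero v * sg b) (lin (λ u → w (suc u) v) ω))))
        (clampSum-diff n (λ v → c v + w zero v * sg b) (w ∘ suc) (0≤w ∘ suc) (w≤W ∘ suc))
      where
      assoc : ∀ a b c → a + (b + c) ≡ a + b + c
      assoc = solve-∀ ℚ-ring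
      subst-BD : ∀ {C n F G} → (∀ ω → G ω ≡ F ω) → BoundedDiff C n F → BoundedDiff C n G
      subst-BD {n = zero}  eq h        = tt
      subst-BD {C} {suc n} {F} {G} eq (h , hb) =
        (λ ω → subst (λ a → (a ≤ C) × (- C ≤ a)) (sym (cong₂ _-_ (eq (true ◂ ω)) (eq (false ◂ ω)))) (h ω)) ,
        (λ b → subst-BD (λ ω → eq (b ◂ ω)) (hb b))
      arg : Bool → Cube n → Fin N → ℚ
      arg b ω v = i * (c v + (w zero v * sg b + lin (λ u → w (suc u) v) ω))
      step : ∀ i c w l → i * (c + (w * 1ℚ + l)) - i * (c + (w * - 1ℚ + l)) ≡ ι 2 * i * w
      step = solve-∀ ℚ-ring
      ordered : ∀ ω v → arg false ω v ≤ arg true ω v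
      ordered ω v = 0≤q-p⇒p≤q (subst (0ℚ ≤_) (sym (step i (c v) (w zero v) (lin (λ u → w (suc u) v) ω)))
        (0≤* (0≤* (0≤ι 2) 0≤i) (0≤w zero v)))
      0≤W : 0ℚ ≤ W
      0≤W = ≤-trans (0≤∑ (0≤w zero)) (w≤W zero)
      eq : ∀ ω → clampSum c w (true ◂ ω) - clampSum c w (false ◂ ω) ≡ ∑ (λ v → φ (arg true ω v) - φ (arg false ω v))
      eq ω = sym (∑-- (λ v → φ (arg true ω v)) (λ v → φ (arg false ω v)))
      upper : ∀ ω → clampSum c w (true ◂ ω) - clampSum c w (false ◂ ω) ≤ ι 2 * (i * W)
      upper ω = begin
        clampSum c w (true ◂ ω) - clampSum c w (false ◂ ω)       ≡⟨ eq ω ⟩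
        ∑ (λ v → φ (arg true ω v) - φ (arg false ω v))           ≤⟨ ∑-mono (λ v → φ-lipschitz (ordered ω v)) ⟩
        ∑ (λ v → arg true ω v - arg false ω v)                   ≡⟨ ∑-cong (λ v → step i (c v) (w zero v) (lin (λ u → w (suc u) v) ω)) ⟩
        ∑ (λ v → ι 2 * i * w zero v)                             ≡⟨ sym (∑-*ˡ (ι 2 * i) (w zero)) ⟩
        ι 2 * i * ∑ (w zero)                                     ≤⟨ *-monoˡ (0≤* (0≤ι 2) 0≤i) (w≤W zero) ⟩
        ι 2 * i * W                                              ≡⟨ *-assoc (ι 2) i W ⟩
        ι 2 * (i * W)                                            ∎
        where open ≤-Reasoning
      lower : ∀ ω → - (ι 2 * (i * W)) ≤ clampSum c w (true ◂ ω) - clampSum c w (false ◂ ω)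
      lower ω = ≤-trans (neg-antimono-≤ (0≤* (0≤ι 2) (0≤* 0≤i 0≤W)))
        (subst (0ℚ ≤_) (sym (eq ω)) (0≤∑ (λ v → p≤q⇒0≤q-p (φ-mono (ordered ω v)))))

  -- Taylor coefficients bounding (3 + S) ^ r from above by 3 ^ r + ℓ r * S + C r * S ^ 2 on -3 ≤ S ≤ 2.
  ℓ C : ℕ → ℕ
  ℓ zero    = 0
  ℓ (suc r) = 3 ℕ.^ r ℕ.+ 3 ℕ.* ℓ r
  C zero    = 1
  C (suc r) = suc (ℓ r ℕ.+ 5 ℕ.* C r)

  -- The inductive step multiplies by 3 + S ≥ 0. The cubic term is absorbed through S ≤ 2, which
  -- explains the 5 = 3 + 2 in the recursion for `C`.
  power-bound : ∀ r {S} → 0ℚ ≤ 3ℚ + S → S ≤ ι 2 → (3ℚ + S) ^ r ≤ ι (3 ℕ.^ r) + ι (ℓ r) * S + ι (C r) * sq S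
  power-bound zero    {S} _ _ = 0≤q-p⇒p≤q (subst (0ℚ ≤_) (eq S) (0≤sq S))
    where
    eq : ∀ S → S * S ≡ 1ℚ + 0ℚ * S + 1ℚ * (S * S) - 1ℚ
    eq = solve-∀ ℚ-ring
  power-bound (suc r) {S} 0≤3+S S≤2 = ≤-trans (*-monoˡ 0≤3+S (power-bound r 0≤3+S S≤2))
    (0≤q-p⇒p≤q (subst (0ℚ ≤_) eq (0≤+ (0≤sq S) (0≤* (0≤* (0≤ι (C r)) (0≤sq S)) (p≤q⇒0≤q-p S≤2)))))
    where
    identity : ∀ S t l c → S * S + c * (S * S) * (ι 2 - S) ≡
      ι 3 * t + (t + ι 3 * l) * S + (1ℚ + (l + ι 5 * c)) * (S * S) - (3ℚ + S) * (t + l * S + c * (S * S))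
    identity = solve-∀ ℚ-ring
    eq : sq S + ι (C r) * sq S * (ι 2 - S) ≡
         ι (3 ℕ.^ suc r) + ι (ℓ (suc r)) * S + ι (C (suc r)) * sq S
           - (3ℚ + S) * (ι (3 ℕ.^ r) + ι (ℓ r) * S + ι (C r) * sq S)
    eq = trans (identity S (ι (3 ℕ.^ r)) (ι (ℓ r)) (ι (C r)))
      (cong (_- (3ℚ + S) * (ι (3 ℕ.^ r) + ι (ℓ r) * S + ι (C r) * sq S))
        (cong₂ _+_ (cong₂ (λ a b → a + b * S) (sym (ι-* 3 (3 ℕ.^ r)))
            (sym (trans (ι-+ (3 ℕ.^ r) (3 ℕ.* ℓ r)) (cong (ι (3 ℕ.^ r) +_) (ι-* 3 (ℓ r))))))
          (cong (_* sq S) (sym (trans (ι-suc (ℓ r ℕ.+ 5 ℕ.* C r)) (cong (1ℚ +_) (trans (ι-+ (ℓ r) (5 ℕ.* C r))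
            (cong (ι (ℓ r) +_) (ι-* 5 (C r))))))))))

-- The correlated random vector: expectation of σ on its diagonal

module PositiveDiscrepancy where
  open import Data.Bool as Bool using (Bool; true; false; not; b≤b; f≤t)
  open import Data.Rational hiding (NonZero)
  open import Data.Rational.Properties hiding (_≟_)
  open import Defs using (Hypergraph; Regular)
  open Rationals
  open IntegerSqrt
  open FiniteSums
  open Hypercube
  open EdgeCounting
  open SignVectors
  open Truncation
  open LipschitzSums

  -- With g a uniformly random sign vector, the test vector is x = 3 + g + β z, where z v is a
  -- truncation of L v = ∑ u , w u v * g u and w u v counts the edge tuples starting with u , v.
  -- Every x v is a nonnegative increasing function of g, so Harris' inequality bounds the τ-part
  -- from below; the J-part is controlled by the variance of ∑ x.
  module _ {j n : ℕ} .{{_ : NonZero n}} (H : Hypergraph (suc (suc j)) n) {d t : ℕ} (reg : Regular d H)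
           (0<d : 0 ℕ.< d) (0<t : 0 ℕ.< t) (d≤t² : d ℕ.≤ t ℕ.* t) (t²≤4d : t ℕ.* t ℕ.≤ 4 ℕ.* d)
           (β : ℚ) (0≤β : 0ℚ ≤ β) (β≤1 : β ≤ 1ℚ) where

    m r : ℕ
    m = suc j !
    r = suc (suc j)

    W i : ℚ
    W = ι d * ι m
    i = rec t

    w : Fin n → Fin n → ℚ
    w u v = ∑T j (λ t → edge H (u ◂ (v ◂ t)))

    private
      instance
        t≢0 : NonZero t
        t≢0 = ℕ.>-nonZero 0<t

      0≤i : 0ℚ ≤ i
      0≤i = 0≤rec t

      it≡1 : i * ι t ≡ 1ℚ
      it≡1 = rec-inverse t

      w-nat : ∀ u v → IsNat (w u v)
      w-nat u v = IsNat-∑T j (λ t → IsNat-edge H (u ◂ (v ◂ t)))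

      0≤w : ∀ u v → 0ℚ ≤ w u v
      0≤w u v = 0≤∑T j (λ t → 0≤edge H (u ◂ (v ◂ t)))

      ∑-row : ∀ u → ∑ (w u) ≡ W
      ∑-row = ∑-edge-const H reg

      ∑-col : ∀ v → ∑ (λ u → w u v) ≡ W
      ∑-col v = trans (∑-cong (λ u → ∑T-cong j (edge-swap H u v))) (∑-row v)

    L z x : Fin n → Cube n → ℚ
    L v = lin (λ u → w u v)
    z v ω = φ (i * L v ω)
    x v ω = 3ℚ + (sg (ω v) + β * z v ω)

    Λ V : ℚ
    Λ = ∑ (λ v → 𝔼 n (λ ω → L v ω * z v ω))
    V = 1ℚ + β * β * (ι d * (ι m * ι m))

    private
      sg-mono : ∀ {b b′} → b Bool.≤ b′ → sg b ≤ sg b′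
      sg-mono b≤b = ≤-refl
      sg-mono f≤t = -1≤1

      z-mono : ∀ v → Mono n (z v)
      z-mono v h = φ-mono (*-monoˡ 0≤i (∑-mono (λ u → *-monoˡ (0≤w u v) (sg-mono (h u)))))

      x-mono : ∀ v → Mono n (x v)
      x-mono v h = +-monoʳ-≤ 3ℚ (+-mono-≤ (sg-mono (h v)) (*-monoˡ 0≤β (z-mono v h)))

      sg≤1 : ∀ b → sg b ≤ 1ℚ
      sg≤1 true  = ≤-refl
      sg≤1 false = -1≤1

      -1≤sg : ∀ b → - 1ℚ ≤ sg b
      -1≤sg true  = -1≤1
      -1≤sg false = ≤-refl

      βz≤1 : ∀ v ω → β * z v ω ≤ 1ℚ
      βz≤1 v ω = ≤-trans (*-monoˡ 0≤β (φ≤1 (i * L v ω))) (subst (_≤ 1ℚ) (sym (*-identityʳ β)) β≤1)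

      -1≤βz : ∀ v ω → - 1ℚ ≤ β * z v ω
      -1≤βz v ω = ≤-trans (neg-antimono-≤ β≤1) (≤-trans (≤-reflexive (eq β)) (*-monoˡ 0≤β (-1≤φ (i * L v ω))))
        where
        eq : ∀ β → - β ≡ β * - 1ℚ
        eq = solve-∀ ℚ-ring

    1≤x : ∀ v ω → 1ℚ ≤ x v ω
    1≤x v ω = +-monoʳ-≤ 3ℚ (+-mono-≤ (-1≤sg (ω v)) (-1≤βz v ω))

    x≤5 : ∀ v ω → x v ω ≤ ι 5
    x≤5 v ω = +-monoʳ-≤ 3ℚ (+-mono-≤ (sg≤1 (ω v)) (βz≤1 v ω))

    private
      0≤x : ∀ v ω → 0ℚ ≤ x v ω
      0≤x v ω = ≤-trans 0≤1 (1≤x v ω)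

      𝔼-sg : ∀ v → 𝔼 n (λ ω → sg (ω v)) ≡ 0ℚ
      𝔼-sg v = 𝔼-odd n (λ {ω} h → trans (cong sg (h v)) (sg-not (ω v)))

      z-odd : ∀ v {ω ω′ : Cube n} → (∀ u → ω′ u ≡ not (ω u)) → z v ω′ ≡ - z v ω
      z-odd v {ω} h = trans (cong (λ a → φ (i * a)) (lin-opposite (λ u → w u v) h))
        (trans (cong φ (sym (neg-distribʳ-* i (L v ω)))) (φ-odd (i * L v ω)))

      𝔼-z : ∀ v → 𝔼 n (z v) ≡ 0ℚ
      𝔼-z v = 𝔼-odd n (z-odd v)

      𝔼-shift : ∀ c (f : Cube n → ℚ) → 𝔼 n f ≡ 0ℚ → 𝔼 n (λ ω → c + f ω) ≡ c
      𝔼-shift c f h = trans (𝔼-+ n (λ _ → c) f) (trans (cong₂ _+_ (𝔼-const n c) h) (+-identityʳ c))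

      𝔼-y : ∀ v → 𝔼 n (λ ω → sg (ω v) + β * z v ω) ≡ 0ℚ
      𝔼-y v = trans (𝔼-+ n (λ ω → sg (ω v)) (λ ω → β * z v ω))
        (cong₂ _+_ (𝔼-sg v) (trans (𝔼-*ˡ n β (z v)) (trans (cong (β *_) (𝔼-z v)) (*-zeroʳ β))))

      𝔼-x : ∀ v → 𝔼 n (x v) ≡ 3ℚ
      𝔼-x v = 𝔼-shift 3ℚ (λ ω → sg (ω v) + β * z v ω) (𝔼-y v)

      e : Fin n → Fin n → ℚ
      e u v = 𝔼 n (λ ω → sg (ω u) * z v ω)

      -- Of the three pieces of x u · x v, Harris gives at least 9 for x u (3 + g v) and at least 0
      -- for z v (3 + β z u), as z v has mean 0. The remaining piece β g u z v is kept exactly: it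
      -- is the gain.
      𝔼-pair : ∀ u v → ι 9 + β * e u v ≤ 𝔼 n (λ ω → x u ω * x v ω)
      𝔼-pair u v = begin
        ι 9 + β * e u v
          ≤⟨ +-mono-≤ first (subst (_≤ β * 𝔼 n (λ ω → z v ω * (3ℚ + β * z u ω)) + β * e u v)
               (+-identityˡ (β * e u v)) (+-monoˡ-≤ (β * e u v) (subst (_≤ β * 𝔼 n (λ ω → z v ω * (3ℚ + β * z u ω))) (*-zeroʳ β) (*-monoˡ 0≤β second)))) ⟩
        𝔼 n (λ ω → x u ω * (3ℚ + sg (ω v))) + (β * 𝔼 n (λ ω → z v ω * (3ℚ + β * z u ω)) + β * e u v)
          ≡⟨ sym (trans (𝔼-+ n (λ ω → x u ω * (3ℚ + sg (ω v))) (λ ω → β * (z v ω * (3ℚ + β * z u ω)) + β * (sg (ω u) * z v ω)))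
               (cong (𝔼 n (λ ω → x u ω * (3ℚ + sg (ω v))) +_) (trans (𝔼-+ n (λ ω → β * (z v ω * (3ℚ + β * z u ω))) (λ ω → β * (sg (ω u) * z v ω)))
                 (cong₂ _+_ (𝔼-*ˡ n β (λ ω → z v ω * (3ℚ + β * z u ω))) (𝔼-*ˡ n β (λ ω → sg (ω u) * z v ω)))))) ⟩
        𝔼 n (λ ω → x u ω * (3ℚ + sg (ω v)) + (β * (z v ω * (3ℚ + β * z u ω)) + β * (sg (ω u) * z v ω)))
          ≡⟨ 𝔼-cong n (λ ω → expand (sg (ω u)) (z u ω) (sg (ω v)) (z v ω) β) ⟩
        𝔼 n (λ ω → x u ω * x v ω) ∎
        where
        open ≤-Reasoning
        expand : ∀ g z g′ z′ β → (3ℚ + (g + β * z)) * (3ℚ + g′) + (β * (z′ * (3ℚ + β * z)) + β * (g * z′)) ≡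
                                 (3ℚ + (g + β * z)) * (3ℚ + (g′ + β * z′))
        expand = solve-∀ ℚ-ring
        first : ι 9 ≤ 𝔼 n (λ ω → x u ω * (3ℚ + sg (ω v)))
        first = subst (_≤ 𝔼 n (λ ω → x u ω * (3ℚ + sg (ω v))))
          (cong₂ _*_ (𝔼-x u) (𝔼-shift 3ℚ (λ ω → sg (ω v)) (𝔼-sg v)))
          (harris n (x-mono u) (λ h → +-monoʳ-≤ 3ℚ (sg-mono (h v))))
        second : 0ℚ ≤ 𝔼 n (λ ω → z v ω * (3ℚ + β * z u ω))
        second = subst (_≤ 𝔼 n (λ ω → z v ω * (3ℚ + β * z u ω)))
          (trans (cong (_* 𝔼 n (λ ω → 3ℚ + β * z u ω)) (𝔼-z v)) (*-zeroˡ (𝔼 n (λ ω → 3ℚ + β * z u ω))))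
          (harris n (z-mono v) (λ h → +-monoʳ-≤ 3ℚ (*-monoˡ 0≤β (z-mono u h))))

      0≤𝔼-pair : ∀ u v → 0ℚ ≤ 𝔼 n (λ ω → x u ω * x v ω)
      0≤𝔼-pair u v = subst (_≤ 𝔼 n (λ ω → x u ω * x v ω)) (𝔼-const n 0ℚ) (𝔼-mono n (λ ω → 0≤* (0≤x u ω) (0≤x v ω)))

      -- Harris decouples the first two entries from the other j, each of which has mean 3.
      𝔼-tuple : ∀ u v (t : Fin j → Fin n) →
        3ℚ ^ j * (ι 9 + β * e u v) ≤ 𝔼 n (λ ω → x u ω * (x v ω * ∏ (λ i → x (t i) ω)))
      𝔼-tuple u v t = begin
        3ℚ ^ j * (ι 9 + β * e u v)                            ≤⟨ *-monoˡ (0≤^ j 0≤3) (𝔼-pair u v) ⟩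
        3ℚ ^ j * 𝔼 n (λ ω → x u ω * x v ω)                     ≡⟨ *-comm (3ℚ ^ j) (𝔼 n (λ ω → x u ω * x v ω)) ⟩
        𝔼 n (λ ω → x u ω * x v ω) * 3ℚ ^ j                     ≤⟨ *-monoˡ (0≤𝔼-pair u v) (harris-∏ n (λ i → x (t i)) (λ i → 0≤x (t i)) (λ i → x-mono (t i)) 0≤3 (λ i → 𝔼-x (t i))) ⟩
        𝔼 n (λ ω → x u ω * x v ω) * 𝔼 n (λ ω → ∏ (λ i → x (t i) ω))
          ≤⟨ harris n (*-Mono n (0≤x u) (0≤x v) (x-mono u) (x-mono v)) (proj₂ (∏-Mono n (λ i → x (t i)) (λ i → 0≤x (t i)) (λ i → x-mono (t i)))) ⟩
        𝔼 n (λ ω → x u ω * x v ω * ∏ (λ i → x (t i) ω))        ≡⟨ 𝔼-cong n (λ ω → *-assoc (x u ω) (x v ω) (∏ (λ i → x (t i) ω))) ⟩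
        𝔼 n (λ ω → x u ω * (x v ω * ∏ (λ i → x (t i) ω)))      ∎
        where open ≤-Reasoning

      -- Summed against the codegrees, the correlations of z v with single signs recombine into the
      -- correlation of z v with the form it truncates.
      ∑-e : ∀ v → ∑ (λ u → w u v * e u v) ≡ 𝔼 n (λ ω → L v ω * z v ω)
      ∑-e v = sym (trans (𝔼-cong n (λ ω → trans (∑-*ʳ (z v ω) (λ u → w u v * sg (ω u))) (∑-cong (λ u → *-assoc (w u v) (sg (ω u)) (z v ω)))))
        (trans (𝔼-∑ n (λ u ω → w u v * (sg (ω u) * z v ω))) (∑-cong (λ u → 𝔼-*ˡ n (w u v) (λ ω → sg (ω u) * z v ω)))))

      double-sum : ∀ c → ∑ (λ u → ∑ (λ v → w u v * (c * (ι 9 + β * e u v)))) ≡ c * (ι 9 * (ι n * W) + β * Λ)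
      double-sum c = begin
        ∑ (λ u → ∑ (λ v → w u v * (c * (ι 9 + β * e u v))))
          ≡⟨ ∑-cong (λ u → trans (∑-cong (λ v → split (w u v) c β (e u v)))
               (trans (∑-+ (λ v → c * ι 9 * w u v) (λ v → c * β * (w u v * e u v)))
                 (cong₂ _+_ (trans (sym (∑-*ˡ (c * ι 9) (w u))) (cong (c * ι 9 *_) (∑-row u))) (sym (∑-*ˡ (c * β) (λ v → w u v * e u v)))))) ⟩
        ∑ (λ u → c * ι 9 * W + c * β * ∑ (λ v → w u v * e u v))
          ≡⟨ trans (∑-+ {n} (λ u → c * ι 9 * W) (λ u → c * β * ∑ (λ v → w u v * e u v)))
               (cong₂ _+_ (∑-const n (c * ι 9 * W)) (sym (∑-*ˡ (c * β) (λ u → ∑ (λ v → w u v * e u v))))) ⟩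
        ι n * (c * ι 9 * W) + c * β * ∑ (λ u → ∑ (λ v → w u v * e u v))
          ≡⟨ cong (λ a → ι n * (c * ι 9 * W) + c * β * a) (trans (∑-comm (λ u v → w u v * e u v)) (∑-cong ∑-e)) ⟩
        ι n * (c * ι 9 * W) + c * β * Λ
          ≡⟨ collect (ι n) c W β Λ ⟩
        c * (ι 9 * (ι n * W) + β * Λ) ∎
        where
        open ≡-Reasoning
        split : ∀ w c b e → w * (c * (ι 9 + b * e)) ≡ c * ι 9 * w + c * b * (w * e)
        split = solve-∀ ℚ-ring
        collect : ∀ n c W b l → n * (c * ι 9 * W) + c * b * l ≡ c * (ι 9 * (n * W) + b * l)
        collect = solve-∀ ℚ-ring

      τ-part : 3ℚ ^ j * (ι 9 * (ι n * W) + β * Λ) ≤ 𝔼 n (λ ω → ∑T r (λ t → edge H t * ∏ (λ i → x (t i) ω)))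
      τ-part = begin
        3ℚ ^ j * (ι 9 * (ι n * W) + β * Λ)
          ≡⟨ sym (double-sum (3ℚ ^ j)) ⟩
        ∑ (λ u → ∑ (λ v → w u v * (3ℚ ^ j * (ι 9 + β * e u v))))
          ≡⟨ ∑-cong (λ u → ∑-cong (λ v → trans (*-comm (w u v) (3ℚ ^ j * (ι 9 + β * e u v)))
               (sym (∑T-*ˡ j (3ℚ ^ j * (ι 9 + β * e u v)) (λ t → edge H (u ◂ (v ◂ t))))))) ⟩
        ∑ (λ u → ∑ (λ v → ∑T j (λ t → 3ℚ ^ j * (ι 9 + β * e u v) * edge H (u ◂ (v ◂ t)))))
          ≤⟨ ∑-mono (λ u → ∑-mono (λ v → ∑T-mono j (λ t → ≤-trans (*-monoʳ (0≤edge H (u ◂ (v ◂ t))) (𝔼-tuple u v t))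
               (≤-reflexive (trans (*-comm (𝔼 n (λ ω → x u ω * (x v ω * ∏ (λ i → x (t i) ω)))) (edge H (u ◂ (v ◂ t))))
                 (sym (𝔼-*ˡ n (edge H (u ◂ (v ◂ t))) (λ ω → x u ω * (x v ω * ∏ (λ i → x (t i) ω)))))))))) ⟩
        ∑T r (λ t → 𝔼 n (λ ω → edge H t * ∏ (λ i → x (t i) ω)))
          ≡⟨ sym (𝔼-∑T n r (λ t ω → edge H t * ∏ (λ i → x (t i) ω))) ⟩
        𝔼 n (λ ω → ∑T r (λ t → edge H t * ∏ (λ i → x (t i) ω))) ∎
        where open ≤-Reasoning

      -- Moments of L v give at least i′ D - 3 i′³ D², where D is the sum of squared codegrees at v
      -- and i′ = 1/s. This is at least i′ D / 2, hence at least s / 48.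
      𝔼-Lz : ∀ v → ι t ≤ ι 48 * 𝔼 n (λ ω → L v ω * z v ω)
      𝔼-Lz v = begin
        ι t                                                    ≤⟨ ι-mono t≤s ⟩
        ι s                                                    ≡⟨ trans (sym (*-identityˡ (ι s))) (cong (_* ι s) (sym is≡1)) ⟩
        i′ * ι s * ι s                                         ≡⟨ *-assoc i′ (ι s) (ι s) ⟩
        i′ * (ι s * ι s)                                       ≤⟨ *-monoˡ 0≤i′ s²≤24D ⟩
        i′ * (ι 24 * D)                                        ≡⟨ eq₁ i′ D ⟩
        ι 48 * (i′ * D) * (1ℚ - ½)                             ≤⟨ *-monoˡ (0≤* (0≤ι 48) (0≤* 0≤i′ 0≤D)) (+-monoʳ-≤ 1ℚ (neg-antimono-≤ half)) ⟩
        ι 48 * (i′ * D) * (1ℚ - ι 3 * (i′ * i′ * D))           ≡⟨ eq₂ i′ D ⟩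
        ι 48 * (i′ * D - i′ * i′ * i′ * (3ℚ * (D * D)))        ≤⟨ *-monoˡ (0≤ι 48) (+-monoʳ-≤ (i′ * D) (neg-antimono-≤ (*-monoˡ (0≤* (0≤* 0≤i′ 0≤i′) 0≤i′)
                                                                    (𝔼-lin²lin² n (λ u → w u v) (λ u → w u v))))) ⟩
        ι 48 * (i′ * D - i′ * i′ * i′ * 𝔼 n (λ ω → sq (L v ω) * sq (L v ω)))
          ≡⟨ cong (λ a → ι 48 * (i′ * a - i′ * i′ * i′ * 𝔼 n (λ ω → sq (L v ω) * sq (L v ω)))) (sym (𝔼-lin² n (λ u → w u v))) ⟩
        ι 48 * (i′ * 𝔼 n (λ ω → sq (L v ω)) - i′ * i′ * i′ * 𝔼 n (λ ω → sq (L v ω) * sq (L v ω)))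
          ≡⟨ cong (ι 48 *_) (sym (trans (𝔼-- n (λ ω → i′ * sq (L v ω)) (λ ω → i′ * i′ * i′ * (sq (L v ω) * sq (L v ω))))
               (cong₂ _-_ (𝔼-*ˡ n i′ (λ ω → sq (L v ω))) (𝔼-*ˡ n (i′ * i′ * i′) (λ ω → sq (L v ω) * sq (L v ω)))))) ⟩
        ι 48 * 𝔼 n (λ ω → i′ * sq (L v ω) - i′ * i′ * i′ * (sq (L v ω) * sq (L v ω)))
          ≤⟨ *-monoˡ (0≤ι 48) (𝔼-mono n (λ ω → *-φ-lower (L v ω) 0≤i′ i′≤i)) ⟩
        ι 48 * 𝔼 n (λ ω → L v ω * z v ω) ∎
        where
        open ≤-Reasoning
        D : ℚ
        D = ∑ (λ u → sq (w u v))
        D-nat : IsNat D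
        D-nat = IsNat-∑ (λ u → IsNat-sq (w-nat u v))
        Dℕ s : ℕ
        Dℕ = proj₁ D-nat
        -- The 6 makes 3 i′² D at most a half. D may be much larger than d, so s depends on v; t ≤ s
        -- still gives the uniform bound t / 48.
        s = proj₁ (sqrt-approx (6 ℕ.* Dℕ))
        D≡ : D ≡ ι Dℕ
        D≡ = proj₂ D-nat
        0≤D : 0ℚ ≤ D
        0≤D = 0≤∑ (λ u → 0≤sq (w u v))
        -- Codegrees are naturals, so D is at least the column sum d (r-1)!.
        d≤D : d ℕ.≤ Dℕ
        d≤D = ι-cancel (≤-trans (≤-trans (≤-reflexive (sym (*-identityʳ (ι d)))) (*-monoˡ (0≤ι d) (1≤ι m {{suc j ℕ.!≢0}})))
          (≤-trans (≤-reflexive (sym (∑-col v))) (≤-trans (∑-mono (λ u → IsNat-≤-sq (w-nat u v))) (≤-reflexive D≡))))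
        t≤s : t ℕ.≤ s
        t≤s = sq-cancel-≤ℕ (ℕ.≤-trans t²≤4d (ℕ.≤-trans (ℕ.*-mono-≤ {4} {6} (ℕ.s≤s (ℕ.s≤s (ℕ.s≤s (ℕ.s≤s ℕ.z≤n)))) d≤D)
          (proj₁ (proj₂ (sqrt-approx (6 ℕ.* Dℕ))))))
        instance
          s≢0 : NonZero s
          s≢0 = ℕ.>-nonZero (ℕ.<-≤-trans 0<t t≤s)
        i′ : ℚ
        i′ = rec s
        0≤i′ : 0ℚ ≤ i′
        0≤i′ = 0≤rec s
        is≡1 : i′ * ι s ≡ 1ℚ
        is≡1 = rec-inverse s
        i′≤i : i′ ≤ i
        i′≤i = begin
          i′                   ≡⟨ trans (sym (*-identityʳ i′)) (cong (i′ *_) (sym it≡1)) ⟩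
          i′ * (i * ι t)       ≤⟨ *-monoˡ 0≤i′ (*-monoˡ 0≤i (ι-mono t≤s)) ⟩
          i′ * (i * ι s)       ≡⟨ swap i′ i (ι s) ⟩
          i * (i′ * ι s)       ≡⟨ trans (cong (i *_) is≡1) (*-identityʳ i) ⟩
          i                    ∎
          where
          swap : ∀ a b c → a * (b * c) ≡ b * (a * c)
          swap = solve-∀ ℚ-ring
        s²≤24D : ι s * ι s ≤ ι 24 * D
        s²≤24D = subst₂ _≤_ (ι-* s s) (trans (ι-* 4 (6 ℕ.* Dℕ)) (trans (cong (ι 4 *_) (trans (ι-* 6 Dℕ) (cong (ι 6 *_) (sym D≡)))) (eq D)))
          (ι-mono (proj₂ (proj₂ (sqrt-approx (6 ℕ.* Dℕ)))))
          where
          eq : ∀ D → ι 4 * (ι 6 * D) ≡ ι 24 * D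
          eq = solve-∀ ℚ-ring
        6D≤s² : ι 6 * D ≤ ι s * ι s
        6D≤s² = subst₂ _≤_ (trans (ι-* 6 Dℕ) (cong (ι 6 *_) (sym D≡))) (ι-* s s) (ι-mono (proj₁ (proj₂ (sqrt-approx (6 ℕ.* Dℕ)))))
        half : ι 3 * (i′ * i′ * D) ≤ ½
        half = begin
          ι 3 * (i′ * i′ * D)        ≡⟨ eq i′ D ⟩
          ½ * (i′ * i′ * (ι 6 * D))  ≤⟨ *-monoˡ 0≤½ (*-monoˡ (0≤* 0≤i′ 0≤i′) 6D≤s²) ⟩
          ½ * (i′ * i′ * (ι s * ι s)) ≡⟨ eq′ i′ (ι s) ⟩
          ½ * ((i′ * ι s) * (i′ * ι s)) ≡⟨ cong (λ a → ½ * (a * a)) is≡1 ⟩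
          ½                          ∎
          where
          eq : ∀ i D → ι 3 * (i * i * D) ≡ ½ * (i * i * (ι 6 * D))
          eq = solve-∀ ℚ-ring
          eq′ : ∀ i s → ½ * (i * i * (s * s)) ≡ ½ * ((i * s) * (i * s))
          eq′ = solve-∀ ℚ-ring
        eq₁ : ∀ i D → i * (ι 24 * D) ≡ ι 48 * (i * D) * (1ℚ - ½)
        eq₁ = solve-∀ ℚ-ring
        eq₂ : ∀ i D → ι 48 * (i * D) * (1ℚ - ι 3 * (i * i * D)) ≡ ι 48 * (i * D - i * i * i * (3ℚ * (D * D)))
        eq₂ = solve-∀ ℚ-ring

    nt≤48Λ : ι n * ι t ≤ ι 48 * Λ
    nt≤48Λ = ≤-trans (≤-reflexive (sym (∑-const n (ι t)))) (≤-trans (∑-mono 𝔼-Lz) (≤-reflexive (sym (∑-*ˡ (ι 48) (λ v → 𝔼 n (λ ω → L v ω * z v ω))))))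

    private
      G Z Y : Cube n → ℚ
      G = lin (λ _ → 1ℚ)
      Z = clampSum i 0≤i (λ _ → 0ℚ) w
      Y ω = G ω + β * Z ω

      Z-∑ : ∀ ω → Z ω ≡ ∑ (λ v → z v ω)
      Z-∑ ω = ∑-cong (λ v → cong (λ a → φ (i * a)) (+-identityˡ (L v ω)))

      ∑-x : ∀ ω → ∑ (λ v → x v ω) ≡ ι n * 3ℚ + Y ω
      ∑-x ω = trans (∑-+ {n} (λ _ → 3ℚ) (λ v → sg (ω v) + β * z v ω)) (cong₂ _+_ (∑-const n 3ℚ)
        (trans (∑-+ (λ v → sg (ω v)) (λ v → β * z v ω)) (cong₂ _+_ (∑-cong (λ v → sym (*-identityˡ (sg (ω v)))))
          (trans (sym (∑-*ˡ β (λ v → z v ω))) (cong (β *_) (sym (Z-∑ ω)))))))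

      𝔼-Z : 𝔼 n Z ≡ 0ℚ
      𝔼-Z = 𝔼-odd n (λ {ω} {ω′} h → trans (Z-∑ ω′) (trans (∑-cong (λ v → z-odd v h)) (trans (∑-neg (λ v → z v ω)) (cong -_ (sym (Z-∑ ω))))))

      𝔼-Y : 𝔼 n Y ≡ 0ℚ
      𝔼-Y = trans (𝔼-+ n G (λ ω → β * Z ω)) (cong₂ _+_ (𝔼-odd n (lin-opposite (λ _ → 1ℚ)))
        (trans (𝔼-*ˡ n β Z) (trans (cong (β *_) 𝔼-Z) (*-zeroʳ β))))

      -- Z has mean 0 and bounded differences 2 i W = 2 d (r-1)! / t. The variance bound gives n d²
      -- (r-1)!² / t², and d ≤ t² removes one factor d.
      𝔼-Z² : 𝔼 n (λ ω → sq (Z ω)) ≤ ι n * (ι d * (ι m * ι m))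
      𝔼-Z² = begin
        𝔼 n (λ ω → sq (Z ω))
          ≤⟨ variance-bound n Z (clampSum-diff i 0≤i n (λ _ → 0ℚ) w 0≤w (λ u → ≤-reflexive (∑-row u))) ⟩
        sq (𝔼 n Z) + ½ * ½ * (ι n * sq (ι 2 * (i * W)))
          ≡⟨ cong (λ a → sq a + ½ * ½ * (ι n * sq (ι 2 * (i * W)))) 𝔼-Z ⟩
        sq 0ℚ + ½ * ½ * (ι n * sq (ι 2 * (i * W)))
          ≡⟨ eq (ι n) i (ι d) (ι m) ⟩
        ι n * (ι d * (ι m * ι m)) * (i * i * ι d)
          ≤⟨ *-monoˡ (0≤* (0≤ι n) (0≤* (0≤ι d) (0≤* (0≤ι m) (0≤ι m)))) (*-monoˡ (0≤* 0≤i 0≤i) (≤-trans (ι-mono d≤t²) (≤-reflexive (ι-* t t)))) ⟩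
        ι n * (ι d * (ι m * ι m)) * (i * i * (ι t * ι t))
          ≡⟨ cong (ι n * (ι d * (ι m * ι m)) *_) (trans (eq′ i (ι t)) (cong sq it≡1)) ⟩
        ι n * (ι d * (ι m * ι m)) * 1ℚ
          ≡⟨ *-identityʳ (ι n * (ι d * (ι m * ι m))) ⟩
        ι n * (ι d * (ι m * ι m)) ∎
        where
        open ≤-Reasoning
        eq : ∀ n i d m → 0ℚ * 0ℚ + ½ * ½ * (n * ((ι 2 * (i * (d * m))) * (ι 2 * (i * (d * m))))) ≡ n * (d * (m * m)) * (i * i * d)
        eq = solve-∀ ℚ-ring
        eq′ : ∀ i t → i * i * (t * t) ≡ (i * t) * (i * t)
        eq′ = solve-∀ ℚ-ring

      𝔼-Y² : 𝔼 n (λ ω → sq (Y ω)) ≤ ι 2 * (ι n * V)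
      𝔼-Y² = begin
        𝔼 n (λ ω → sq (Y ω))
          ≤⟨ 𝔼-mono n (λ ω → 0≤q-p⇒p≤q (subst (0ℚ ≤_) (eq (G ω) β (Z ω)) (0≤sq (G ω - β * Z ω)))) ⟩
        𝔼 n (λ ω → ι 2 * (sq (G ω) + β * β * sq (Z ω)))
          ≡⟨ trans (𝔼-*ˡ n (ι 2) (λ ω → sq (G ω) + β * β * sq (Z ω))) (cong (ι 2 *_) (trans (𝔼-+ n (λ ω → sq (G ω)) (λ ω → β * β * sq (Z ω)))
               (cong₂ _+_ (trans (𝔼-lin² n (λ _ → 1ℚ)) (∑-const n (sq 1ℚ))) (𝔼-*ˡ n (β * β) (λ ω → sq (Z ω)))))) ⟩
        ι 2 * (ι n * sq 1ℚ + β * β * 𝔼 n (λ ω → sq (Z ω)))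
          ≤⟨ *-monoˡ (0≤ι 2) (+-monoʳ-≤ (ι n * sq 1ℚ) (*-monoˡ (0≤* 0≤β 0≤β) 𝔼-Z²)) ⟩
        ι 2 * (ι n * sq 1ℚ + β * β * (ι n * (ι d * (ι m * ι m))))
          ≡⟨ eq′ (ι n) β (ι d * (ι m * ι m)) ⟩
        ι 2 * (ι n * V) ∎
        where
        open ≤-Reasoning
        eq : ∀ g b z → (g - b * z) * (g - b * z) ≡ ι 2 * (g * g + b * b * (z * z)) - (g + b * z) * (g + b * z)
        eq = solve-∀ ℚ-ring
        eq′ : ∀ n b c → ι 2 * (n * (1ℚ * 1ℚ) + b * b * (n * c)) ≡ ι 2 * (n * (1ℚ + b * b * c))
        eq′ = solve-∀ ℚ-ring

      ν : ℚ
      ν = rec n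

      νn≡1 : ν * ι n ≡ 1ℚ
      νn≡1 = rec-inverse n

      0≤ν : 0ℚ ≤ ν
      0≤ν = 0≤rec n

      -- So ν Y is the deviation of the mean of x from 3. As the entries lie in [1 , 5], it meets
      -- the range conditions of `power-bound`.
      3+νY : ∀ ω → 3ℚ + ν * Y ω ≡ ν * ∑ (λ v → x v ω)
      3+νY ω = sym (trans (cong (ν *_) (∑-x ω)) (trans (eq ν (ι n) (Y ω)) (cong (λ a → a * 3ℚ + ν * Y ω) νn≡1)))
        where
        eq : ∀ v n Y → v * (n * 3ℚ + Y) ≡ v * n * 3ℚ + v * Y
        eq = solve-∀ ℚ-ring

      0≤3+νY : ∀ ω → 0ℚ ≤ 3ℚ + ν * Y ω
      0≤3+νY ω = subst (0ℚ ≤_) (sym (3+νY ω)) (0≤* 0≤ν (0≤∑ (λ v → 0≤x v ω)))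

      νY≤2 : ∀ ω → ν * Y ω ≤ ι 2
      νY≤2 ω = subst₂ _≤_ (eq (ν * Y ω)) refl (+-monoʳ-≤ (- 3ℚ) (begin
        3ℚ + ν * Y ω             ≡⟨ 3+νY ω ⟩
        ν * ∑ (λ v → x v ω)      ≤⟨ *-monoˡ 0≤ν (∑-mono (λ v → x≤5 v ω)) ⟩
        ν * ∑ {n} (λ _ → ι 5)    ≡⟨ trans (cong (ν *_) (∑-const n (ι 5))) (trans (sym (*-assoc ν (ι n) (ι 5))) (cong (_* ι 5) νn≡1)) ⟩
        ι 5                      ∎))
        where
        open ≤-Reasoning
        eq : ∀ a → - 3ℚ + (3ℚ + a) ≡ a
        eq = solve-∀ ℚ-ring

      *-^ : ∀ a b k → (a * b) ^ k ≡ a ^ k * b ^ k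
      *-^ a b zero    = refl
      *-^ a b (suc k) = trans (cong (a * b *_) (*-^ a b k)) (eq a b (a ^ k) (b ^ k))
        where
        eq : ∀ a b c d → a * b * (c * d) ≡ a * c * (b * d)
        eq = solve-∀ ℚ-ring

      J-eq : ∀ ω → ∑T r (λ t → ∏ (λ i → x (t i) ω)) ≡ ι n ^ r * (3ℚ + ν * Y ω) ^ r
      J-eq ω = trans (∑T-∏ r (λ _ v → x v ω)) (trans (∏-const r (∑ (λ v → x v ω)))
        (trans (cong (_^ r) (sym (trans (cong (ι n *_) (3+νY ω)) (trans (sym (*-assoc (ι n) ν (∑ (λ v → x v ω))))
          (trans (cong (_* ∑ (λ v → x v ω)) (trans (*-comm (ι n) ν) νn≡1)) (*-identityˡ (∑ (λ v → x v ω))))))))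
          (*-^ (ι n) (3ℚ + ν * Y ω) r)))

      κn^r : κ H * ι n ^ r ≡ ι d * ι n
      κn^r = trans (swap (κ H) (ι n) (ι n ^ suc j)) (trans (cong (ι n *_) (κ-scaled H reg)) (*-comm (ι n) (ι d)))
        where
        swap : ∀ a b c → a * (b * c) ≡ b * (a * c)
        swap = solve-∀ ℚ-ring

      -- Y has mean 0, so the linear term of `power-bound` disappears and only the second moment of
      -- the coordinate mean, at most 2 V / n, is paid for.
      J-part : κ H * 𝔼 n (λ ω → ∑T r (λ t → ∏ (λ i → x (t i) ω))) ≤ ι d * ι n * ι (3 ℕ.^ r) + ι 2 * (ι (C r) * (ι d * V))
      J-part = begin
        κ H * 𝔼 n (λ ω → ∑T r (λ t → ∏ (λ i → x (t i) ω)))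
          ≡⟨ cong (κ H *_) (trans (𝔼-cong n J-eq) (𝔼-*ˡ n (ι n ^ r) (λ ω → (3ℚ + ν * Y ω) ^ r))) ⟩
        κ H * (ι n ^ r * 𝔼 n (λ ω → (3ℚ + ν * Y ω) ^ r))
          ≡⟨ trans (sym (*-assoc (κ H) (ι n ^ r) _)) (cong (_* 𝔼 n (λ ω → (3ℚ + ν * Y ω) ^ r)) κn^r) ⟩
        ι d * ι n * 𝔼 n (λ ω → (3ℚ + ν * Y ω) ^ r)
          ≤⟨ *-monoˡ (0≤* (0≤ι d) (0≤ι n)) (𝔼-mono n (λ ω → power-bound r (0≤3+νY ω) (νY≤2 ω))) ⟩
        ι d * ι n * 𝔼 n (λ ω → a + b * (ν * Y ω) + c * sq (ν * Y ω))
          ≡⟨ cong (ι d * ι n *_) moments ⟩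
        ι d * ι n * (a + c * (ν * ν * 𝔼 n (λ ω → sq (Y ω))))
          ≤⟨ *-monoˡ (0≤* (0≤ι d) (0≤ι n)) (+-monoʳ-≤ a (*-monoˡ (0≤ι (C r)) (*-monoˡ (0≤* 0≤ν 0≤ν) 𝔼-Y²))) ⟩
        ι d * ι n * (a + c * (ν * ν * (ι 2 * (ι n * V))))
          ≡⟨ eq₃ (ι d) (ι n) a c ν V ⟩
        ι d * ι n * a + ι 2 * (c * (ι d * V)) * ((ν * ι n) * (ν * ι n))
          ≡⟨ cong (λ s → ι d * ι n * a + s) (trans (cong (λ s → ι 2 * (c * (ι d * V)) * (s * s)) νn≡1) (*-identityʳ (ι 2 * (c * (ι d * V))))) ⟩
        ι d * ι n * a + ι 2 * (c * (ι d * V)) ∎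
        where
        open ≤-Reasoning
        a b c : ℚ
        a = ι (3 ℕ.^ r)
        b = ι (ℓ r)
        c = ι (C r)
        eq₀ : ∀ a b c v Y → a + b * (v * Y) + c * ((v * Y) * (v * Y)) ≡ a + (b * v * Y + c * (v * v) * (Y * Y))
        eq₀ = solve-∀ ℚ-ring
        eq₁ : ∀ a b c v E → a + (b * v * 0ℚ + c * (v * v) * E) ≡ a + c * (v * v * E)
        eq₁ = solve-∀ ℚ-ring
        moments : 𝔼 n (λ ω → a + b * (ν * Y ω) + c * sq (ν * Y ω)) ≡ a + c * (ν * ν * 𝔼 n (λ ω → sq (Y ω)))
        moments = trans (𝔼-cong n (λ ω → eq₀ a b c ν (Y ω)))
          (trans (𝔼-+ n (λ _ → a) (λ ω → b * ν * Y ω + c * (ν * ν) * sq (Y ω)))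
          (trans (cong₂ _+_ (𝔼-const n a) (trans (𝔼-+ n (λ ω → b * ν * Y ω) (λ ω → c * (ν * ν) * sq (Y ω)))
            (cong₂ _+_ (trans (𝔼-*ˡ n (b * ν) Y) (cong (b * ν *_) 𝔼-Y)) (𝔼-*ˡ n (c * (ν * ν)) (λ ω → sq (Y ω))))))
            (eq₁ a b c ν (𝔼 n (λ ω → sq (Y ω))))))
        eq₃ : ∀ d n a c v V → d * n * (a + c * (v * v * (ι 2 * (n * V)))) ≡ d * n * a + ι 2 * (c * (d * V)) * ((v * n) * (v * n))
        eq₃ = solve-∀ ℚ-ring

    -- The main terms 3^r n d of the τ-part and the J-part cancel exactly, leaving the correlation
    -- gain minus the variance loss.
    average-lower : α H * (3ℚ ^ j * (β * Λ)) - ι 2 * (ι (C r) * (ι d * V)) ≤ 𝔼 n (λ ω → σℚ H (λ _ v → x v ω))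
    average-lower = begin
      α H * (3ℚ ^ j * (β * Λ)) - loss
        ≡⟨ sym (trans (cong (λ s → α H * (3ℚ ^ j * (ι 9 * (ι n * W) + β * Λ)) - (ι d * ι n * s + loss)) 3^r)
             (trans (eq (α H) (3ℚ ^ j) (ι n) (ι d) (ι m) (β * Λ) loss)
               (trans (cong (λ s → s * (3ℚ ^ j * ι 9 * (ι n * ι d)) + (α H * (3ℚ ^ j * (β * Λ)) - ι d * ι n * (ι 9 * 3ℚ ^ j) - loss)) (α-inverse H))
                 (eq′ (3ℚ ^ j) (ι n) (ι d) (α H * (3ℚ ^ j * (β * Λ))) loss)))) ⟩
      α H * (3ℚ ^ j * (ι 9 * (ι n * W) + β * Λ)) - (ι d * ι n * ι (3 ℕ.^ r) + loss)
        ≤⟨ +-mono-≤ (*-monoˡ (0≤α H) τ-part) (neg-antimono-≤ J-part) ⟩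
      α H * 𝔼 n (λ ω → ∑T r (λ t → edge H t * ∏ (λ i → x (t i) ω))) - κ H * 𝔼 n (λ ω → ∑T r (λ t → ∏ (λ i → x (t i) ω)))
        ≡⟨ sym (trans (𝔼-- n (λ ω → α H * ∑T r (λ t → edge H t * ∏ (λ i → x (t i) ω))) (λ ω → κ H * ∑T r (λ t → ∏ (λ i → x (t i) ω))))
             (cong₂ _-_ (𝔼-*ˡ n (α H) (λ ω → ∑T r (λ t → edge H t * ∏ (λ i → x (t i) ω)))) (𝔼-*ˡ n (κ H) (λ ω → ∑T r (λ t → ∏ (λ i → x (t i) ω)))))) ⟩
      𝔼 n (λ ω → σℚ H (λ _ v → x v ω)) ∎
      where
      open ≤-Reasoning
      loss : ℚ
      loss = ι 2 * (ι (C r) * (ι d * V))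
      3^r : ι (3 ℕ.^ r) ≡ ι 9 * 3ℚ ^ j
      3^r = trans (ι-^ 3 r) (sym (*-assoc 3ℚ 3ℚ (3ℚ ^ j)))
      eq : ∀ a p n d m b l → a * (p * (ι 9 * (n * (d * m)) + b)) - (d * n * (ι 9 * p) + l) ≡
           (a * m) * (p * ι 9 * (n * d)) + (a * (p * b) - d * n * (ι 9 * p) - l)
      eq = solve-∀ ℚ-ring
      eq′ : ∀ p n d s l → 1ℚ * (p * ι 9 * (n * d)) + (s - d * n * (ι 9 * p) - l) ≡ s - l
      eq′ = solve-∀ ℚ-ring

-- Part (i) for large n: choice of the weight β

module LargeOrder where
  open import Data.Rational hiding (NonZero)
  open import Data.Rational.Properties hiding (_≟_)
  open import Defs using (Hypergraph; Regular)
  open Rationals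
  open IntegerSqrt
  open FiniteSums
  open Hypercube
  open EdgeCounting
  open SignVectors
  open LipschitzSums
  open PositiveDiscrepancy using (Λ; V; 1≤x; x≤5; nt≤48Λ; average-lower) renaming (x to testVector)

  Bounded : ∀ {n} → (Fin n → ℚ) → Set
  Bounded x = ∀ v → (x v ≡ 0ℚ) ⊎ (1ℚ ≤ ∣ x v ∣ × ∣ x v ∣ ≤ ι 5)

  private
    scaled : ∀ a x y z → ι (a ℕ.* (x ℕ.* (y ℕ.* z))) ≡ ι a * (ι x * (ι y * ι z))
    scaled a x y z = trans (ι-* a (x ℕ.* (y ℕ.* z))) (cong (ι a *_) (trans (ι-* x (y ℕ.* z)) (cong (ι x *_) (ι-* y z))))

    *≢0 : ∀ {a b} → NonZero a → NonZero b → NonZero (a ℕ.* b)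
    *≢0 {a} {b} p q = ℕ.m*n≢0 a b {{p}} {{q}}

    C≢0 : ∀ r → NonZero (C r)
    C≢0 zero    = _
    C≢0 (suc r) = _

  -- β = 1 / b-of j is the weight of the truncated part in the test vector of PositiveDiscrepancy:
  -- small enough for half of the variance term to be absorbed by the gain, the other half being
  -- absorbed as soon as n ≥ (M-of j)².
  abstract
    b-of M-of K-of : ℕ → ℕ
    b-of j = 384 ℕ.* (C (suc (suc j)) ℕ.* (suc j ! ℕ.* (suc j ! ℕ.* suc j !)))
    M-of j = 384 ℕ.* (C (suc (suc j)) ℕ.* (suc j ! ℕ.* b-of j))
    K-of j = 96 ℕ.* (suc j ! ℕ.* b-of j)

    ι-b : ∀ j → ι (b-of j) ≡ ι 384 * (ι (C (suc (suc j))) * (ι (suc j !) * (ι (suc j !) * ι (suc j !))))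
    ι-b j = trans (scaled 384 (C (suc (suc j))) (suc j !) (suc j ! ℕ.* suc j !))
      (cong (λ p → ι 384 * (ι (C (suc (suc j))) * (ι (suc j !) * p))) (ι-* (suc j !) (suc j !)))

    ι-M : ∀ j → ι (M-of j) ≡ ι 384 * (ι (C (suc (suc j))) * (ι (suc j !) * ι (b-of j)))
    ι-M j = scaled 384 (C (suc (suc j))) (suc j !) (b-of j)

    ι-K : ∀ j → ι (K-of j) ≡ ι 96 * (ι (suc j !) * ι (b-of j))
    ι-K j = trans (ι-* 96 (suc j ! ℕ.* b-of j)) (cong (ι 96 *_) (ι-* (suc j !) (b-of j)))

    b≢0 : ∀ j → NonZero (b-of j)
    b≢0 j = *≢0 {384} _ (*≢0 (C≢0 (suc (suc j))) (*≢0 (suc j ℕ.!≢0) (*≢0 (suc j ℕ.!≢0) (suc j ℕ.!≢0))))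

    K≢0 : ∀ j → NonZero (K-of j)
    K≢0 j = *≢0 {96} _ (*≢0 (suc j ℕ.!≢0) (b≢0 j))

  module _ {j n : ℕ} .{{_ : NonZero n}} (H : Hypergraph (suc (suc j)) n) {d t : ℕ} (reg : Regular d H)
           (0<d : 0 ℕ.< d) (0<t : 0 ℕ.< t) (d≤t² : d ℕ.≤ t ℕ.* t) (t²≤4d : t ℕ.* t ℕ.≤ 4 ℕ.* d)
           (d≤n : d ℕ.≤ n) (d³≤n² : d ℕ.* (d ℕ.* d) ℕ.≤ n ℕ.* n) (M²≤n : M-of j ℕ.* M-of j ℕ.≤ n) where

    private
      b M mm r : ℕ
      b = b-of j
      M = M-of j
      mm = suc j !
      r = suc (suc j)

      instance
        b≢0′ : NonZero b
        b≢0′ = b≢0 j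

      β : ℚ
      β = rec b

      0≤β : 0ℚ ≤ β
      0≤β = 0≤rec b

      βb≡1 : β * ι b ≡ 1ℚ
      βb≡1 = rec-inverse b

      β≤1 : β ≤ 1ℚ
      β≤1 = subst₂ _≤_ (*-identityʳ β) βb≡1 (*-monoˡ 0≤β (1≤ι b))

      open import Data.Nat using () renaming (_*_ to _·_)

      -- The exponent 2/3 enters here: d⁴ = d · d³ ≤ t² n². It controls the part of the loss that is
      -- quadratic in d.
      d²≤nt : d · d ℕ.≤ n · t
      d²≤nt = sq-cancel-≤ℕ (ℕ.≤-trans (ℕ.≤-reflexive (eq₁ d)) (ℕ.≤-trans (ℕ.*-mono-≤ d≤t² d³≤n²) (ℕ.≤-reflexive (eq₂ t n))))
        where
        eq₁ : ∀ d → (d · d) · (d · d) ≡ d · (d · (d · d))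
        eq₁ = solveℕ-∀
        eq₂ : ∀ t n → (t · t) · (n · n) ≡ (n · t) · (n · t)
        eq₂ = solveℕ-∀

      -- M² ≤ n and d² ≤ n t² multiply to the square of the claim. It controls the part of the loss
      -- that is linear in d.
      Md≤nt : M · d ℕ.≤ n · t
      Md≤nt = sq-cancel-≤ℕ (ℕ.≤-trans (ℕ.≤-reflexive (eq₁ M d)) (ℕ.≤-trans (ℕ.*-mono-≤ M²≤n (ℕ.*-mono-≤ d≤n d≤t²)) (ℕ.≤-reflexive (eq₂ t n))))
        where
        eq₁ : ∀ M d → (M · d) · (M · d) ≡ (M · M) · (d · d)
        eq₁ = solveℕ-∀
        eq₂ : ∀ t n → n · (n · (t · t)) ≡ (n · t) · (n · t)
        eq₂ = solveℕ-∀

      c : ℚ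
      c = ι (C r)

      ιb : ι b ≡ ι 384 * (c * (ι mm * (ι mm * ι mm)))
      ιb = ι-b j

      ιM : ι M ≡ ι 384 * (c * (ι mm * ι b))
      ιM = ι-M j

      nt : ℚ
      nt = ι n * ι t

      ιMd≤nt : ι 384 * (c * (ι mm * ι b)) * ι d ≤ nt
      ιMd≤nt = subst₂ _≤_ (trans (ι-* M d) (cong (_* ι d) ιM)) (ι-* n t) (ι-mono Md≤nt)

      ιd²≤nt : ι d * ι d ≤ nt
      ιd²≤nt = subst₂ _≤_ (ι-* d d) (ι-* n t) (ι-mono d²≤nt)

      lam v : ℚ
      lam = Λ H reg 0<d 0<t d≤t² t²≤4d β 0≤β β≤1
      v = V H reg 0<d 0<t d≤t² t²≤4d β 0≤β β≤1

      X : Fin n → Cube n → ℚ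
      X = testVector H reg 0<d 0<t d≤t² t²≤4d β 0≤β β≤1

      K : ℚ
      K = ι 96 * (ι mm * ι b)

      0≤K : 0ℚ ≤ K
      0≤K = 0≤* (0≤ι 96) (0≤* (0≤ι mm) (0≤ι b))

      0≤nt : 0ℚ ≤ nt
      0≤nt = 0≤* (0≤ι n) (0≤ι t)

      nt≤48 : nt ≤ ι 48 * lam
      nt≤48 = nt≤48Λ H reg 0<d 0<t d≤t² t²≤4d β 0≤β β≤1

      0≤lam : 0ℚ ≤ lam
      0≤lam = *-cancelˡ (0<ι 47) (≤-trans (≤-reflexive (*-zeroʳ (ι 48))) (≤-trans 0≤nt nt≤48))

      -- K = 96 (r-1)! b undoes α and β and supplies 2 · 48, with 48 from `nt≤48Λ`.
      gain : ι 2 * nt ≤ K * (α H * (3ℚ ^ j * (β * lam)))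
      gain = begin
        ι 2 * nt                                 ≤⟨ *-monoˡ (0≤ι 2) nt≤48 ⟩
        ι 2 * (ι 48 * lam)                       ≡⟨ eq₁ lam ⟩
        ι 96 * lam * 1ℚ                          ≤⟨ *-monoˡ (0≤* (0≤ι 96) 0≤lam) (1≤3^ j) ⟩
        ι 96 * lam * 3ℚ ^ j                      ≡⟨ sym (trans (eq₂ (ι mm) (ι b) (α H) (3ℚ ^ j) β lam)
                                                      (trans (cong₂ (λ p q → p * q * (ι 96 * lam * 3ℚ ^ j)) (α-inverse H) βb≡1) (*-identityˡ (ι 96 * lam * 3ℚ ^ j)))) ⟩
        K * (α H * (3ℚ ^ j * (β * lam)))         ∎
        where
        open ≤-Reasoning
        eq₁ : ∀ l → ι 2 * (ι 48 * l) ≡ ι 96 * l * 1ℚ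
        eq₁ = solve-∀ ℚ-ring
        eq₂ : ∀ m b a p β l → ι 96 * (m * b) * (a * (p * (β * l))) ≡ (a * m) * (β * b) * (ι 96 * l * p)
        eq₂ = solve-∀ ℚ-ring
        1≤3^ : ∀ j → 1ℚ ≤ 3ℚ ^ j
        1≤3^ j = subst (1ℚ ≤_) (ι-^ 3 j) (1≤ι (3 ℕ.^ j) {{ℕ.m^n≢0 3 j}})

      -- V = 1 + β² d (r-1)!² splits the loss into half of M d and half of d²; `M-of` and `b-of` are
      -- defined so that both coefficients come out as a half.
      loss : K * (ι 2 * (c * (ι d * v))) ≤ nt
      loss = begin
        K * (ι 2 * (c * (ι d * v)))
          ≡⟨ eq₁ (ι mm) (ι b) c (ι d) β ⟩
        ½ * (ι 384 * (c * (ι mm * ι b)) * ι d) + ½ * (β * ι b) * (β * (ι 384 * (c * (ι mm * (ι mm * ι mm))))) * (ι d * ι d)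
          ≡⟨ cong (λ p → ½ * (ι 384 * (c * (ι mm * ι b)) * ι d) + p * (ι d * ι d))
               (cong₂ (λ p q → ½ * p * q) βb≡1 (trans (cong (β *_) (sym ιb)) βb≡1)) ⟩
        ½ * (ι 384 * (c * (ι mm * ι b)) * ι d) + ½ * 1ℚ * 1ℚ * (ι d * ι d)
          ≤⟨ +-mono-≤ (*-monoˡ 0≤½ ιMd≤nt) (*-monoˡ 0≤½ ιd²≤nt) ⟩
        ½ * nt + ½ * nt
          ≡⟨ eq₂ nt ⟩
        nt ∎
        where
        open ≤-Reasoning
        eq₁ : ∀ m b c d β → ι 96 * (m * b) * (ι 2 * (c * (d * (1ℚ + β * β * (d * (m * m)))))) ≡
              ½ * (ι 384 * (c * (m * b)) * d) + ½ * (β * b) * (β * (ι 384 * (c * (m * (m * m))))) * (d * d)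
        eq₁ = solve-∀ ℚ-ring
        eq₂ : ∀ a → ½ * a + ½ * a ≡ a
        eq₂ = solve-∀ ℚ-ring

      average : nt ≤ 𝔼 n (λ ω → K * σℚ H (λ _ v → X v ω))
      average = begin
        nt                                                           ≡⟨ eq₁ nt ⟩
        ι 2 * nt - nt                                                ≤⟨ +-mono-≤ gain (neg-antimono-≤ loss) ⟩
        K * (α H * (3ℚ ^ j * (β * lam))) - K * (ι 2 * (c * (ι d * v))) ≡⟨ eq₂ K _ _ ⟩
        K * (α H * (3ℚ ^ j * (β * lam)) - ι 2 * (c * (ι d * v)))     ≤⟨ *-monoˡ 0≤K (average-lower H reg 0<d 0<t d≤t² t²≤4d β 0≤β β≤1) ⟩
        K * 𝔼 n (λ ω → σℚ H (λ _ v → X v ω))                         ≡⟨ sym (𝔼-*ˡ n K (λ ω → σℚ H (λ _ v → X v ω))) ⟩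
        𝔼 n (λ ω → K * σℚ H (λ _ v → X v ω))                         ∎
        where
        open ≤-Reasoning
        eq₁ : ∀ a → a ≡ ι 2 * a - a
        eq₁ = solve-∀ ℚ-ring
        eq₂ : ∀ k a b → k * a - k * b ≡ k * (a - b)
        eq₂ = solve-∀ ℚ-ring

      X-bounded : ∀ ω → Bounded (λ v → X v ω)
      X-bounded ω v = inj₂ (subst (λ a → 1ℚ ≤ a × a ≤ ι 5) (sym (0≤p⇒∣p∣≡p (≤-trans 0≤1 lo)))
        (lo , x≤5 H reg 0<d 0<t d≤t² t²≤4d β 0≤β β≤1 v ω))
        where lo = 1≤x H reg 0<d 0<t d≤t² t²≤4d β 0≤β β≤1 v ω

    bounded-large : ∃ λ y → Bounded y × (∀ v → 1ℚ ≤ ∣ y v ∣) × (ι n * ι t ≤ ι (K-of j) * σℚ H (λ _ → y))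
    bounded-large =
      let ω , h = 𝔼-attained n (λ ω → K * σℚ H (λ _ v → X v ω)) average
      in (λ v → X v ω) , X-bounded ω ,
         (λ v → ≤-trans (1≤x H reg 0<d 0<t d≤t² t²≤4d β 0≤β β≤1 v ω) (p≤∣p∣ (X v ω))) ,
         subst (λ K → nt ≤ K * σℚ H (λ _ v → X v ω)) (sym (ι-K j)) h

-- Part (i) for bounded n: signs on a single edge

module SmallOrder where
  open import Data.Bool using (true; false)
  open import Data.Fin.Subset using (Subset; ∣_∣)
  open import Data.Fin.Subset.Properties using (∣p∣≤n) renaming (_∈?_ to _∈ˢ?_)
  open import Data.List using (List; []; _∷_; length; filter)
  open import Data.List.Membership.Propositional using (_∈_)
  open import Data.List.Relation.Unary.All as All using (All; []; _∷_)
  open import Data.List.Relation.Unary.Any using (here; there)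
  open import Data.Rational hiding (NonZero; ∣_∣)
  import Data.Rational as ℚ
  open import Data.Rational.Properties hiding (_≟_)
  open import Data.Vec using ([]; _∷_)
  open import Defs using (Hypergraph; edges; uniform; image; Regular; _≟ˢ_)
  open Rationals
  open IntegerSqrt
  open FiniteSums
  open Hypercube
  open EdgeCounting
  open SignVectors
  open LargeOrder using (Bounded)

  -- The first q vertices of e receive -1, its other vertices 1, and everything outside e is 0.
  signed : ∀ {n} → ℕ → Subset n → Fin n → ℚ
  signed q       (false ∷ e) zero    = 0ℚ
  signed zero    (true  ∷ e) zero    = 1ℚ
  signed (suc q) (true  ∷ e) zero    = - 1ℚ
  signed q       (false ∷ e) (suc v) = signed q e v
  signed zero    (true  ∷ e) (suc v) = signed zero e v
  signed (suc q) (true  ∷ e) (suc v) = signed q e v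

  ∑-signed : ∀ {n} q (e : Subset n) → q ℕ.≤ ∣ e ∣ → ∑ (signed q e) ≡ ι ∣ e ∣ - ι 2 * ι q
  ∑-signed zero    []          _ = refl
  ∑-signed zero    (true  ∷ e) _ = trans (cong (1ℚ +_) (∑-signed zero e ℕ.z≤n))
    (trans (eq (ι ∣ e ∣)) (cong (_- ι 2 * ι 0) (sym (ι-suc ∣ e ∣))))
    where
    eq : ∀ a → 1ℚ + (a - ι 2 * 0ℚ) ≡ 1ℚ + a - ι 2 * 0ℚ
    eq = solve-∀ ℚ-ring
  ∑-signed (suc q) (true  ∷ e) (ℕ.s≤s h) = trans (cong (- 1ℚ +_) (∑-signed q e h))
    (trans (eq (ι ∣ e ∣) (ι q)) (cong₂ (λ a b → a - ι 2 * b) (sym (ι-suc ∣ e ∣)) (sym (ι-suc q))))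
    where
    eq : ∀ a b → - 1ℚ + (a - ι 2 * b) ≡ 1ℚ + a - ι 2 * (1ℚ + b)
    eq = solve-∀ ℚ-ring
  ∑-signed zero    (false ∷ e) h = trans (+-identityˡ (∑ (signed zero e))) (∑-signed zero e h)
  ∑-signed (suc q) (false ∷ e) h = trans (+-identityˡ (∑ (signed (suc q) e))) (∑-signed (suc q) e h)

  P-signed : ∀ {n} q (e : Subset n) → q ℕ.≤ ∣ e ∣ → P e (signed q e) ≡ (- 1ℚ) ^ q
  P-signed zero    []          _ = refl
  P-signed zero    (true  ∷ e) _ = trans (*-identityˡ _) (P-signed zero e ℕ.z≤n)
  P-signed (suc q) (true  ∷ e) (ℕ.s≤s h) = cong (- 1ℚ *_) (P-signed q e h)
  P-signed zero    (false ∷ e) h = P-signed zero e h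
  P-signed (suc q) (false ∷ e) h = P-signed (suc q) e h

  signed-values : ∀ {n} q (e : Subset n) v → (signed q e v ≡ 0ℚ) ⊎ (ℚ.∣ signed q e v ∣ ≡ 1ℚ)
  signed-values zero    (false ∷ e) zero    = inj₁ refl
  signed-values (suc q) (false ∷ e) zero    = inj₁ refl
  signed-values zero    (true  ∷ e) zero    = inj₂ refl
  signed-values (suc q) (true  ∷ e) zero    = inj₂ refl
  signed-values zero    (false ∷ e) (suc v) = signed-values zero e v
  signed-values (suc q) (false ∷ e) (suc v) = signed-values (suc q) e v
  signed-values zero    (true  ∷ e) (suc v) = signed-values zero e v
  signed-values (suc q) (true  ∷ e) (suc v) = signed-values q e v

  signed-nonzero : ∀ {n} q (e : Subset n) → 0 ℕ.< ∣ e ∣ → ∃ λ v → ℚ.∣ signed q e v ∣ ≡ 1ℚ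
  signed-nonzero zero    (true  ∷ e) h = zero , refl
  signed-nonzero (suc q) (true  ∷ e) h = zero , refl
  signed-nonzero zero    (false ∷ e) h = let v , p = signed-nonzero zero e h in suc v , p
  signed-nonzero (suc q) (false ∷ e) h = let v , p = signed-nonzero (suc q) e h in suc v , p

  -- The vector vanishes off e, so a nonzero monomial belongs to a subset of e, and a subset of
  -- equal size is e itself. Hence no other edge contributes.
  P-signed-other : ∀ {n} q (e e′ : Subset n) →
    (P e′ (signed q e) ≡ 0ℚ) ⊎ ((∣ e′ ∣ ℕ.≤ ∣ e ∣) × (∣ e′ ∣ ≡ ∣ e ∣ → e′ ≡ e))
  P-signed-other q       []          []           = inj₂ (ℕ.z≤n , λ _ → refl)
  P-signed-other zero    (false ∷ e) (true  ∷ e′) = inj₁ (*-zeroˡ (P e′ (signed zero e)))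
  P-signed-other (suc q) (false ∷ e) (true  ∷ e′) = inj₁ (*-zeroˡ (P e′ (signed (suc q) e)))
  P-signed-other zero    (false ∷ e) (false ∷ e′) with P-signed-other zero e e′
  ... | inj₁ p       = inj₁ p
  ... | inj₂ (l , f) = inj₂ (l , λ h → cong (false ∷_) (f h))
  P-signed-other (suc q) (false ∷ e) (false ∷ e′) with P-signed-other (suc q) e e′
  ... | inj₁ p       = inj₁ p
  ... | inj₂ (l , f) = inj₂ (l , λ h → cong (false ∷_) (f h))
  P-signed-other zero    (true ∷ e) (true ∷ e′) with P-signed-other zero e e′
  ... | inj₁ p       = inj₁ (trans (cong (1ℚ *_) p) refl)
  ... | inj₂ (l , f) = inj₂ (ℕ.s≤s l , λ h → cong (true ∷_) (f (ℕ.suc-injective h)))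
  P-signed-other (suc q) (true ∷ e) (true ∷ e′) with P-signed-other q e e′
  ... | inj₁ p       = inj₁ (trans (cong (- 1ℚ *_) p) refl)
  ... | inj₂ (l , f) = inj₂ (ℕ.s≤s l , λ h → cong (true ∷_) (f (ℕ.suc-injective h)))
  P-signed-other zero    (true ∷ e) (false ∷ e′) with P-signed-other zero e e′
  ... | inj₁ p       = inj₁ p
  ... | inj₂ (l , f) = inj₂ (ℕ.m≤n⇒m≤1+n l , λ h → contradiction (subst (ℕ._≤ ∣ e ∣) h l) ℕ.1+n≰n)
  P-signed-other (suc q) (true ∷ e) (false ∷ e′) with P-signed-other q e e′
  ... | inj₁ p       = inj₁ p
  ... | inj₂ (l , f) = inj₂ (ℕ.m≤n⇒m≤1+n l , λ h → contradiction (subst (ℕ._≤ ∣ e ∣) h l) ℕ.1+n≰n)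

  -- Giving 2 p of the r vertices of an edge the sign -1 makes the product of the signs 1 and
  -- their sum r - 4 p small.
  quarter : ∀ r → ∃ λ p → (2 ℕ.* p ℕ.≤ r) × (4 ℕ.* p ℕ.≤ 1 ℕ.+ r) × (r ℕ.≤ 2 ℕ.+ 4 ℕ.* p)
  quarter 0 = 0 , ℕ.z≤n , ℕ.z≤n , ℕ.z≤n
  quarter 1 = 0 , ℕ.z≤n , ℕ.z≤n , ℕ.s≤s ℕ.z≤n
  quarter 2 = 0 , ℕ.z≤n , ℕ.z≤n , ℕ.s≤s (ℕ.s≤s ℕ.z≤n)
  quarter 3 = 1 , ℕ.s≤s (ℕ.s≤s ℕ.z≤n) , ℕ.≤-refl , ℕ.s≤s (ℕ.s≤s (ℕ.s≤s ℕ.z≤n))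
  quarter (suc (suc (suc (suc r)))) with quarter r
  ... | p , a , b , c = suc p ,
    ℕ.≤-trans (ℕ.≤-reflexive (eq₂ p)) (ℕ.+-mono-≤ {2} {4} (ℕ.s≤s (ℕ.s≤s ℕ.z≤n)) a) ,
    ℕ.≤-trans (ℕ.≤-reflexive (eq₄ p)) (ℕ.+-monoʳ-≤ 4 b) ,
    ℕ.≤-trans (ℕ.+-monoʳ-≤ 4 c) (ℕ.≤-reflexive (eq₆ p))
    where
    eq₂ : ∀ p → 2 ℕ.* suc p ≡ 2 ℕ.+ 2 ℕ.* p
    eq₂ = solveℕ-∀
    eq₄ : ∀ p → 4 ℕ.* suc p ≡ 4 ℕ.+ 4 ℕ.* p
    eq₄ = solveℕ-∀
    eq₆ : ∀ p → 4 ℕ.+ (2 ℕ.+ 4 ℕ.* p) ≡ 2 ℕ.+ 4 ℕ.* suc p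
    eq₆ = solveℕ-∀

  even-power : ∀ p → (- 1ℚ) ^ (2 ℕ.* p) ≡ 1ℚ
  even-power zero    = refl
  even-power (suc p) = trans (cong ((- 1ℚ) ^_) (eq p)) (trans (cong (λ a → - 1ℚ * (- 1ℚ * a)) (even-power p)) refl)
    where
    eq : ∀ p → 2 ℕ.* suc p ≡ 2 ℕ.+ 2 ℕ.* p
    eq = solveℕ-∀

  ∣^∣≤ : ∀ {S B} k → 0ℚ ≤ B → ℚ.∣ S ∣ ≤ B → ℚ.∣ S ^ k ∣ ≤ B ^ k
  ∣^∣≤ zero    0≤B h = ≤-refl
  ∣^∣≤ {S} (suc k) 0≤B h = ≤-trans (≤-reflexive (∣p*q∣≡∣p∣*∣q∣ S (S ^ k)))
    (*-mono 0≤B (0≤∣p∣ (S ^ k)) h (∣^∣≤ k 0≤B h))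

  term≤∑L : ∀ {A : Set} {as : List A} {f : A → ℚ} → All (λ a → 0ℚ ≤ f a) as → ∀ {a} → a ∈ as → f a ≤ ∑L as f
  term≤∑L {as = _ ∷ as} {f} (h ∷ hs) {a} (here refl) = subst (_≤ f a + ∑L as f) (+-identityʳ (f a)) (+-monoʳ-≤ (f a) (0≤∑L hs))
    where
    0≤∑L : ∀ {as} → All (λ a → 0ℚ ≤ f a) as → 0ℚ ≤ ∑L as f
    0≤∑L []       = ≤-refl
    0≤∑L (h ∷ hs) = 0≤+ h (0≤∑L hs)
  term≤∑L {as = b ∷ as} {f} (h ∷ hs) (there a∈) = ≤-trans (term≤∑L hs a∈)
    (subst (_≤ f b + ∑L as f) (+-identityˡ (∑L as f)) (+-monoˡ-≤ (∑L as f) h))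

  some-edge : ∀ {r n} .{{_ : NonZero n}} (H : Hypergraph r n) {d} → Regular d H → 0 ℕ.< d → ∃ λ e → e ∈ edges H
  some-edge {n = suc n} H reg 0<d = nonempty (edges H) (subst (0 ℕ.<_) (sym (reg zero)) 0<d)
    where
    nonempty : ∀ es → 0 ℕ.< length (filter (zero ∈ˢ?_) es) → ∃ λ e → e ∈ es
    nonempty (e ∷ es) _ = e , here refl

  module _ {l n : ℕ} .{{_ : NonZero n}} (H : Hypergraph (suc (suc (suc l))) n) {d : ℕ} (reg : Regular d H)
           (d≤n : d ℕ.≤ n) {e : Subset n} (e∈ : e ∈ edges H) where

    private
      r k p : ℕ
      r = 3 ℕ.+ l
      k = 2 ℕ.+ l
      p = proj₁ (quarter r)

      ∣e∣ : ∣ e ∣ ≡ r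
      ∣e∣ = All.lookup (uniform H) e∈

      2p≤∣e∣ : 2 ℕ.* p ℕ.≤ ∣ e ∣
      2p≤∣e∣ = subst (2 ℕ.* p ℕ.≤_) (sym ∣e∣) (proj₁ (proj₂ (quarter r)))

      y : Fin n → ℚ
      y = signed (2 ℕ.* p) e

      Pe≡1 : P e y ≡ 1ℚ
      Pe≡1 = trans (P-signed (2 ℕ.* p) e 2p≤∣e∣) (even-power p)

      0≤P : ∀ {e′} → ∣ e′ ∣ ≡ r → 0ℚ ≤ ι (r !) * P e′ y
      0≤P {e′} h with P-signed-other (2 ℕ.* p) e e′
      ... | inj₁ eq      = 0≤* (0≤ι (r !)) (≤-reflexive (sym eq))
      ... | inj₂ (_ , f) = 0≤* (0≤ι (r !)) (subst (λ s → 0ℚ ≤ P s y) (sym (f (trans h (sym ∣e∣)))) (subst (0ℚ ≤_) (sym Pe≡1) 0≤1))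

      -- No edge contributes negatively, and e contributes α r! = r.
      τ-lower : ι r ≤ α H * ∑T r (λ t → edge H t * ∏ (λ i → y (t i)))
      τ-lower = begin
        ι r                                   ≡⟨ trans (sym (*-identityʳ (ι r))) (cong (ι r *_) (sym (α-inverse H))) ⟩
        ι r * (α H * ι (k !))                 ≡⟨ swap (ι r) (α H) (ι (k !)) ⟩
        α H * (ι r * ι (k !))                 ≡⟨ cong (α H *_) (sym (ι-* r (k !))) ⟩
        α H * ι (r !)                         ≡⟨ cong (α H *_) (trans (sym (*-identityʳ (ι (r !)))) (cong (ι (r !) *_) (sym Pe≡1))) ⟩
        α H * (ι (r !) * P e y)               ≤⟨ *-monoˡ (0≤α H) (term≤∑L {f = λ e → ι (r !) * P e y} (All.map (λ {e} → 0≤P {e}) (uniform H)) e∈) ⟩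
        α H * ∑L (edges H) (λ e → ι (r !) * P e y)
          ≡⟨ cong (α H *_) (sym (∑L-cong (All.map (λ {e} h → ∑T-image r e h y) (uniform H)))) ⟩
        α H * ∑L (edges H) (λ e → ∑T r (λ t → 𝟙 (does (image t ≟ˢ e)) * ∏ (λ i → y (t i))))
          ≡⟨ cong (α H *_) (sym (∑T-∑L r (edges H) (λ e t → 𝟙 (does (image t ≟ˢ e)) * ∏ (λ i → y (t i))))) ⟩
        α H * ∑T r (λ t → ∑L (edges H) (λ e → 𝟙 (does (image t ≟ˢ e)) * ∏ (λ i → y (t i))))
          ≡⟨ cong (α H *_) (∑T-cong r (λ t → trans (∑L-*ʳ (edges H) (λ e → 𝟙 (does (image t ≟ˢ e))) (∏ (λ i → y (t i))))
               (cong (_* ∏ (λ i → y (t i))) (sym (edge-∑ H t))))) ⟩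
        α H * ∑T r (λ t → edge H t * ∏ (λ i → y (t i))) ∎
        where
        open ≤-Reasoning
        swap : ∀ a b c → a * (b * c) ≡ b * (a * c)
        swap = solve-∀ ℚ-ring

      ∑y : ∑ y ≡ ι r - ι (4 ℕ.* p)
      ∑y = trans (∑-signed (2 ℕ.* p) e 2p≤∣e∣) (cong₂ (λ a b → ι a - b) ∣e∣ (trans (sym (ι-* 2 (2 ℕ.* p))) (cong ι (eq p))))
        where
        eq : ∀ p → 2 ℕ.* (2 ℕ.* p) ≡ 4 ℕ.* p
        eq = solveℕ-∀

      ∣∑y∣≤2 : ℚ.∣ ∑ y ∣ ≤ ι 2
      ∣∑y∣≤2 = ∣∣-≤
        (subst (_≤ ι 2) (sym ∑y) (subst (ι r - ι (4 ℕ.* p) ≤_) (eq (ι 2) (ι (4 ℕ.* p)))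
          (+-monoˡ-≤ (- ι (4 ℕ.* p)) (≤-trans (ι-mono (proj₂ (proj₂ (proj₂ (quarter r))))) (≤-reflexive (ι-+ 2 (4 ℕ.* p)))))))
        (≤-trans (neg-antimono-≤ (ι-mono {1} {2} (ℕ.s≤s ℕ.z≤n)))
          (subst (- 1ℚ ≤_) (sym ∑y) (subst (_≤ ι r - ι (4 ℕ.* p)) (eq′ (ι r))
            (+-monoʳ-≤ (ι r) (neg-antimono-≤ (≤-trans (ι-mono (proj₁ (proj₂ (proj₂ (quarter r))))) (≤-reflexive (ι-suc r))))))))
        where
        eq : ∀ a b → a + b + - b ≡ a
        eq = solve-∀ ℚ-ring
        eq′ : ∀ a → a + - (1ℚ + a) ≡ - 1ℚ
        eq′ = solve-∀ ℚ-ring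

      r≤n : r ℕ.≤ n
      r≤n = subst (ℕ._≤ n) ∣e∣ (∣p∣≤n e)

      -- Product of 9 ≤ r n, 2^l ≤ n^l and d ≤ n, where r = 3 + l.
      count : 9 ℕ.* 2 ℕ.^ r ℕ.* d ℕ.≤ 8 ℕ.* r ℕ.* n ℕ.^ k
      count = ℕ.≤-trans (ℕ.≤-reflexive (eq₁ (2 ℕ.^ l) d)) (ℕ.≤-trans
        (ℕ.*-mono-≤ {9} {r ℕ.* n} (ℕ.*-mono-≤ 3≤r (ℕ.≤-trans 3≤r r≤n)) (ℕ.*-monoʳ-≤ 8 (ℕ.*-mono-≤ (ℕ.^-monoˡ-≤ l 2≤n) d≤n)))
        (ℕ.≤-reflexive (eq₂ r n (n ℕ.^ l))))
        where
        3≤r : 3 ℕ.≤ r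
        3≤r = ℕ.m≤m+n 3 l
        2≤n : 2 ℕ.≤ n
        2≤n = ℕ.≤-trans (ℕ.s≤s (ℕ.s≤s ℕ.z≤n)) r≤n
        eq₁ : ∀ a d → 9 ℕ.* (2 ℕ.* (2 ℕ.* (2 ℕ.* a))) ℕ.* d ≡ 9 ℕ.* (8 ℕ.* (a ℕ.* d))
        eq₁ = solveℕ-∀
        eq₂ : ∀ r n a → r ℕ.* n ℕ.* (8 ℕ.* (a ℕ.* n)) ≡ 8 ℕ.* r ℕ.* (n ℕ.* (n ℕ.* a))
        eq₂ = solveℕ-∀

      κ-small : ι 9 * (κ H * ι 2 ^ r) ≤ ι 8 * ι r
      κ-small = *-cancelˡ (0<^ k (0<n H)) (begin
        ι n ^ k * (ι 9 * (κ H * ι 2 ^ r))     ≡⟨ eq₁ (ι n ^ k) (κ H) (ι 2 ^ r) ⟩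
        ι 9 * ι 2 ^ r * (κ H * ι n ^ k)       ≡⟨ cong₂ (λ a b → ι 9 * a * b) (sym (ι-^ 2 r)) (κ-scaled H reg) ⟩
        ι 9 * ι (2 ℕ.^ r) * ι d               ≡⟨ sym (trans (ι-* (9 ℕ.* 2 ℕ.^ r) d) (cong (_* ι d) (ι-* 9 (2 ℕ.^ r)))) ⟩
        ι (9 ℕ.* 2 ℕ.^ r ℕ.* d)               ≤⟨ ι-mono count ⟩
        ι (8 ℕ.* r ℕ.* n ℕ.^ k)               ≡⟨ trans (ι-* (8 ℕ.* r) (n ℕ.^ k)) (cong₂ _*_ (ι-* 8 r) (ι-^ n k)) ⟩
        ι 8 * ι r * ι n ^ k                   ≡⟨ *-comm (ι 8 * ι r) (ι n ^ k) ⟩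
        ι n ^ k * (ι 8 * ι r)                 ∎)
        where
        open ≤-Reasoning
        eq₁ : ∀ N a b → N * (ι 9 * (a * b)) ≡ ι 9 * b * (a * N)
        eq₁ = solve-∀ ℚ-ring

      J-upper : κ H * ∑T r (λ t → ∏ (λ i → y (t i))) ≤ κ H * ι 2 ^ r
      J-upper = *-monoˡ (0≤κ H) (subst (_≤ ι 2 ^ r) (sym (trans (∑T-∏ r (λ _ → y)) (∏-const r (∑ y))))
        (≤-trans (p≤∣p∣ (∑ y ^ r)) (∣^∣≤ r (0≤ι 2) ∣∑y∣≤2)))

      -- The J-term is at most κ 2^r, hence at most 8r/9 by `κ-small`. Of the τ-part r there remains
      -- r/9, which is at least 1/3.
      σ-lower : 1ℚ ≤ ι 3 * σℚ H (λ _ → y)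
      σ-lower = *-cancelˡ (0<ι 2) (begin
        3ℚ * 1ℚ                                              ≤⟨ ι-mono (ℕ.m≤m+n 3 l) ⟩
        ι r                                                  ≡⟨ eq₁ (ι r) ⟩
        ι 9 * ι r - ι 8 * ι r                                ≤⟨ +-mono-≤ (*-monoˡ (0≤ι 9) τ-lower) (neg-antimono-≤ (≤-trans (*-monoˡ (0≤ι 9) J-upper) κ-small)) ⟩
        ι 9 * (α H * ∑T r (λ t → edge H t * ∏ (λ i → y (t i)))) - ι 9 * (κ H * ∑T r (λ t → ∏ (λ i → y (t i))))
          ≡⟨ eq₂ (α H * ∑T r (λ t → edge H t * ∏ (λ i → y (t i)))) (κ H * ∑T r (λ t → ∏ (λ i → y (t i)))) ⟩
        3ℚ * (ι 3 * σℚ H (λ _ → y))                          ∎)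
        where
        open ≤-Reasoning
        eq₁ : ∀ r → r ≡ ι 9 * r - ι 8 * r
        eq₁ = solve-∀ ℚ-ring
        eq₂ : ∀ a b → ι 9 * a - ι 9 * b ≡ 3ℚ * (ι 3 * (a - b))
        eq₂ = solve-∀ ℚ-ring

    bounded-small : ∃ λ y → Bounded y × (∃ λ v → 1ℚ ≤ ℚ.∣ y v ∣) × (1ℚ ≤ ι 3 * σℚ H (λ _ → y))
    bounded-small = y , y-bounded , nonzero , σ-lower
      where
      y-bounded : Bounded y
      y-bounded v with signed-values (2 ℕ.* p) e v
      ... | inj₁ eq = inj₁ eq
      ... | inj₂ eq = inj₂ (subst (λ a → 1ℚ ≤ a × a ≤ ι 5) (sym eq) (≤-refl , ι-mono {1} {5} (ℕ.s≤s ℕ.z≤n)))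
      nonzero : ∃ λ v → 1ℚ ≤ ℚ.∣ y v ∣
      nonzero = let v , eq = signed-nonzero (2 ℕ.* p) e (subst (0 ℕ.<_) (sym ∣e∣) (ℕ.s≤s ℕ.z≤n)) in v , ≤-reflexive (sym eq)

-- Case distinctions and uniform constants for the rational bounds

module TestVectors where
  open import Data.Rational hiding (NonZero)
  open import Data.Rational.Properties hiding (_≟_)
  open import Defs using (Hypergraph; Regular)
  open Rationals
  open IntegerSqrt
  open FiniteSums
  open EdgeCounting
  open SignVectors
  open LargeOrder
  open SmallOrder

  abstract
    -- `K₁` adds the constant for large n to 6 M⁴, which serves n ≤ M². `K₂` is the constant of the
    -- sparse case and also exceeds the 2 (r-1)! needed by `dense`.
    K₁ K₂ : ℕ → ℕ
    K₁ l = K-of (suc l) ℕ.+ 6 ℕ.* (M-of (suc l) ℕ.* M-of (suc l) ℕ.* (M-of (suc l) ℕ.* M-of (suc l)))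
    K₂ l = 16 ℕ.* ((2 ℕ.+ l) ! ℕ.* 3 ℕ.^ (2 ℕ.+ l))

    K₁≢0 : ∀ l → NonZero (K₁ l)
    K₁≢0 l = ℕ.>-nonZero (ℕ.<-≤-trans (ℕ.>-nonZero⁻¹ (K-of (suc l)) {{K≢0 (suc l)}}) (ℕ.m≤m+n (K-of (suc l)) _))

    K₂≢0 : ∀ l → NonZero (K₂ l)
    K₂≢0 l = ℕ.m*n≢0 16 _ {{_}} {{ℕ.m*n≢0 ((2 ℕ.+ l) !) (3 ℕ.^ (2 ℕ.+ l)) {{(2 ℕ.+ l) ℕ.!≢0}} {{ℕ.m^n≢0 3 (2 ℕ.+ l)}}}}

    K-of≤K₁ : ∀ l → K-of (suc l) ℕ.≤ K₁ l
    K-of≤K₁ l = ℕ.m≤m+n (K-of (suc l)) _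

    N²≤K₁ : ∀ l → let N = M-of (suc l) ℕ.* M-of (suc l) in 6 ℕ.* (N ℕ.* N) ℕ.≤ K₁ l
    N²≤K₁ l = ℕ.m≤n+m _ (K-of (suc l))

    K₂-≡ : ∀ l → K₂ l ≡ 16 ℕ.* ((2 ℕ.+ l) ! ℕ.* 3 ℕ.^ (2 ℕ.+ l))
    K₂-≡ l = refl

    2m≤K₂ : ∀ l → 2 ℕ.* (2 ℕ.+ l) ! ℕ.≤ K₂ l
    2m≤K₂ l = ℕ.*-mono-≤ {2} {16} (ℕ.s≤s (ℕ.s≤s ℕ.z≤n)) (ℕ.m≤m*n ((2 ℕ.+ l) !) (3 ℕ.^ (2 ℕ.+ l)) {{ℕ.m^n≢0 3 (2 ℕ.+ l)}})

  module _ {l n : ℕ} .{{_ : NonZero n}} (H : Hypergraph (3 ℕ.+ l) n) {d t : ℕ} (reg : Regular d H)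
           (d≤t² : d ℕ.≤ t ℕ.* t) (t²≤4d : t ℕ.* t ℕ.≤ 4 ℕ.* d) where

    private
      k m : ℕ
      k = 2 ℕ.+ l
      m = k !

      0<t⇒0<d : 0 ℕ.< t → 0 ℕ.< d
      0<t⇒0<d 0<t with d ℕ.≟ 0
      ... | no  d≢0  = ℕ.n≢0⇒n>0 d≢0
      ... | yes refl = contradiction t²≤4d (ℕ.<⇒≱ (ℕ.*-mono-< 0<t 0<t))

      t≤2d : t ℕ.≤ 2 ℕ.* d
      t≤2d = sq-cancel-≤ℕ (ℕ.≤-trans t²≤4d (ℕ.≤-trans (ℕ.*-monoʳ-≤ 4 (d≤d² d)) (ℕ.≤-reflexive (eq d))))
        where
        d≤d² : ∀ d → d ℕ.≤ d ℕ.* d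
        d≤d² zero      = ℕ.z≤n
        d≤d² d@(suc _) = ℕ.m≤m*n d d
        eq : ∀ d → 4 ℕ.* (d ℕ.* d) ≡ 2 ℕ.* d ℕ.* (2 ℕ.* d)
        eq = solveℕ-∀

      nt : ℚ
      nt = ι n * ι t

      0≤nt : 0ℚ ≤ nt
      0≤nt = 0≤* (0≤ι n) (0≤ι t)

      raise : ∀ {K K′ s} → .{{NonZero K}} → K ℕ.≤ K′ → nt ≤ ι K * s → nt ≤ ι K′ * s
      raise {K} {K′} {s} K≤K′ h = ≤-trans h (*-monoʳ (*-cancelˡ (0<ι′ K) (≤-trans (≤-reflexive (*-zeroʳ (ι K))) (≤-trans 0≤nt h))) (ι-mono K≤K′))

    -- For n ≤ (r-1)! and t ≤ 2d, the target n t is at most 2 (r-1)! d, so vectors with σ ≥ d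
    -- suffice.
    dense : n ℕ.≤ m → ∃ λ x → Signs x × (nt ≤ ι (K₂ l) * σℚ H x)
    dense n≤m = let x , s , h = signs-≥-d H reg in x , s , (begin
      nt                      ≡⟨ sym (ι-* n t) ⟩
      ι (n ℕ.* t)             ≤⟨ ι-mono (ℕ.≤-trans (ℕ.*-mono-≤ n≤m t≤2d) (ℕ.≤-trans (ℕ.≤-reflexive (eq m d)) (ℕ.*-monoˡ-≤ d (2m≤K₂ l)))) ⟩
      ι (K₂ l ℕ.* d)          ≡⟨ ι-* (K₂ l) d ⟩
      ι (K₂ l) * ι d          ≤⟨ *-monoˡ (0≤ι (K₂ l)) h ⟩
      ι (K₂ l) * σℚ H x       ∎)
      where
      open ≤-Reasoning
      eq : ∀ m d → m ℕ.* (2 ℕ.* d) ≡ 2 ℕ.* m ℕ.* d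
      eq = solveℕ-∀

    part-ii : 4 ℕ.* d ℕ.< n ℕ.^ 2 → ∃ λ x → Signs x × (ι n * ι t ≤ ι (K₂ l) * σℚ H x)
    part-ii 4d<n² = cases (n ℕ.≤? m) (t ℕ.≟ 0)
      where
      -- For r = 3 this is 4d < n² itself. For larger r, one factor n absorbs (r-1)! and 4d ≤ n²
      -- does the rest.
      sparse-at : ∀ l → (2 ℕ.+ l) ! ℕ.≤ n → 2 ℕ.* ((2 ℕ.+ l) ! ℕ.* d) ℕ.≤ n ℕ.^ (2 ℕ.+ l)
      sparse-at zero    _ = ℕ.≤-trans (ℕ.≤-reflexive (eq d)) (ℕ.<⇒≤ 4d<n²)
        where
        eq : ∀ d → 2 ℕ.* (2 ℕ.* d) ≡ 4 ℕ.* d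
        eq = solveℕ-∀
      sparse-at (suc l) h = ℕ.≤-trans (ℕ.*-mono-≤ {2} {4} (ℕ.s≤s (ℕ.s≤s ℕ.z≤n)) (ℕ.*-monoˡ-≤ d h))
        (ℕ.≤-trans (ℕ.≤-reflexive (eq n d)) (ℕ.≤-trans (ℕ.*-monoʳ-≤ n (ℕ.<⇒≤ 4d<n²)) (ℕ.^-monoʳ-≤ n {3} {3 ℕ.+ l} (ℕ.s≤s (ℕ.s≤s (ℕ.s≤s ℕ.z≤n))))))
        where
        eq : ∀ n d → 4 ℕ.* (n ℕ.* d) ≡ n ℕ.* (4 ℕ.* d)
        eq = solveℕ-∀
      cases : Dec (n ℕ.≤ m) → Dec (t ≡ 0) → ∃ λ x → Signs x × (nt ≤ ι (K₂ l) * σℚ H x)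
      cases (yes n≤m) _         = dense n≤m
      cases (no  n≰m) (no  t≢0) =
        let x , s , h = signs-sparse H reg (ℕ.s≤s ℕ.z≤n) (sparse-at l (ℕ.<⇒≤ (ℕ.≰⇒> n≰m))) (ℕ.n≢0⇒n>0 t≢0) d≤t² t²≤4d
        in x , s , subst (λ K → nt ≤ ι K * σℚ H x) (sym (K₂-≡ l)) h
      -- The target is 0, but vectors with σ ≥ 0 still have to be exhibited.
      cases (no  _)   (yes t≡0) =
        let x , s , h = signs-≥-d H reg
        in x , s , subst (_≤ ι (K₂ l) * σℚ H x) (sym (trans (cong (λ t → ι n * ι t) t≡0) (*-zeroʳ (ι n))))
                     (0≤* (0≤ι (K₂ l)) (≤-trans (0≤ι d) h))

    private
      N : ℕ
      N = M-of (suc l) ℕ.* M-of (suc l)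

      d≤n : d ℕ.* (d ℕ.* d) ℕ.≤ n ℕ.* n → d ℕ.≤ n
      d≤n h with d ℕ.≤? n
      ... | yes p = p
      ... | no  p = contradiction h (ℕ.<⇒≱ (ℕ.<-≤-trans (ℕ.*-mono-< n<d n<d)
                      (ℕ.m≤n*m (d ℕ.* d) d {{ℕ.>-nonZero (ℕ.≤-<-trans ℕ.z≤n n<d)}})))
        where n<d = ℕ.≰⇒> p

      Result : Set
      Result = ∃ λ y → Bounded y × (∃ λ v → 1ℚ ≤ ∣ y v ∣) × (nt ≤ ι (K₁ l) * σℚ H (λ _ → y))

      vertex : ∀ n → .{{NonZero n}} → Fin n
      vertex (suc n) = zero

      -- t = 0 forces d = 0, so the J-term vanishes and the all-ones vector has σ ≥ 0.
      trivial : t ≡ 0 → Result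
      trivial t≡0 = (λ _ → 1ℚ) , (λ _ → inj₂ (≤-refl , ι-mono {1} {5} (ℕ.s≤s ℕ.z≤n))) , (vertex n , ≤-refl) ,
        subst (_≤ ι (K₁ l) * σℚ H (λ _ _ → 1ℚ)) (sym (trans (cong (λ t → ι n * ι t) t≡0) (*-zeroʳ (ι n)))) (0≤* (0≤ι (K₁ l)) 0≤σ)
        where
        d≡0 : d ≡ 0
        d≡0 = ℕ.n≤0⇒n≡0 (subst (λ t → d ℕ.≤ t ℕ.* t) t≡0 d≤t²)
        ones : ∀ j → ∏ {j} (λ _ → 1ℚ) ≡ 1ℚ
        ones zero    = refl
        ones (suc j) = trans (*-identityˡ (∏ {j} (λ _ → 1ℚ))) (ones j)
        J≡0 : κ H * ∑T {n} (suc k) (λ t → ∏ {suc k} (λ _ → 1ℚ)) ≡ 0ℚ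
        J≡0 = trans (cong (κ H *_) (trans (∑T-const {n} (suc k) (∏ {suc k} (λ _ → 1ℚ))) (cong (ι n ^ suc k *_) (ones (suc k)))))
          (trans (eq (κ H) (ι n) (ι n ^ k)) (trans (cong (ι n *_) (trans (κ-scaled H reg) (cong ι d≡0))) (*-zeroʳ (ι n))))
          where
          eq : ∀ a b c → a * (b * c * 1ℚ) ≡ b * (a * c)
          eq = solve-∀ ℚ-ring
        0≤σ : 0ℚ ≤ σℚ H (λ _ _ → 1ℚ)
        0≤σ = p≤q⇒0≤q-p (subst (_≤ α H * ∑T (suc k) (λ t → edge H t * ∏ {suc k} (λ _ → 1ℚ))) (sym J≡0)
          (0≤* (0≤α H) (0≤∑T (suc k) (λ t → 0≤* (0≤edge H t) (subst (0ℚ ≤_) (sym (ones (suc k))) 0≤1)))))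

      -- For n ≤ N the target n t is at most 2 N², while one edge provides σ ≥ 1/3; hence the 6 N²
      -- inside `K₁`.
      small : 0 ℕ.< d → d ℕ.≤ n → n ℕ.≤ N → Result
      small 0<d d≤n n≤N =
        let e , e∈ = some-edge H reg 0<d
            y , b , nz , h = bounded-small H reg d≤n e∈
        in y , b , nz , (begin
          nt                                 ≡⟨ trans (sym (ι-* n t)) (sym (*-identityʳ (ι (n ℕ.* t)))) ⟩
          ι (n ℕ.* t) * 1ℚ                   ≤⟨ *-mono (0≤ι (2 ℕ.* (N ℕ.* N))) 0≤1 (ι-mono n·t≤) h ⟩
          ι (2 ℕ.* (N ℕ.* N)) * (ι 3 * σℚ H (λ _ → y))  ≡⟨ trans (sym (*-assoc (ι (2 ℕ.* (N ℕ.* N))) (ι 3) (σℚ H (λ _ → y))))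
                                                             (cong (_* σℚ H (λ _ → y)) (trans (sym (ι-* (2 ℕ.* (N ℕ.* N)) 3)) (cong ι (eq₂ (N ℕ.* N))))) ⟩
          ι (6 ℕ.* (N ℕ.* N)) * σℚ H (λ _ → y)  ≤⟨ *-monoʳ (*-cancelˡ (0<ι 2) (≤-trans 0≤1 h)) (ι-mono (N²≤K₁ l)) ⟩
          ι (K₁ l) * σℚ H (λ _ → y)          ∎)
        where
        open ≤-Reasoning
        eq₁ : ∀ n → n ℕ.* (2 ℕ.* n) ≡ 2 ℕ.* (n ℕ.* n)
        eq₁ = solveℕ-∀
        eq₂ : ∀ a → 2 ℕ.* a ℕ.* 3 ≡ 6 ℕ.* a
        eq₂ = solveℕ-∀
        n·t≤ : n ℕ.* t ℕ.≤ 2 ℕ.* (N ℕ.* N)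
        n·t≤ = ℕ.≤-trans (ℕ.*-mono-≤ n≤N (ℕ.≤-trans t≤2d (ℕ.*-monoʳ-≤ 2 (ℕ.≤-trans d≤n n≤N)))) (ℕ.≤-reflexive (eq₁ N))

    part-i : d ℕ.* (d ℕ.* d) ℕ.≤ n ℕ.* n →
             ∃ λ y → Bounded y × (∃ λ v → 1ℚ ≤ ∣ y v ∣) × (ι n * ι t ≤ ι (K₁ l) * σℚ H (λ _ → y))
    part-i d³≤n² = cases (t ℕ.≟ 0) (N ℕ.≤? n)
      where
      cases : Dec (t ≡ 0) → Dec (N ℕ.≤ n) → Result
      cases (yes t≡0) _         = trivial t≡0
      cases (no  t≢0) (no  N≰n) = small (0<t⇒0<d (ℕ.n≢0⇒n>0 t≢0)) (d≤n d³≤n²) (ℕ.<⇒≤ (ℕ.≰⇒> N≰n))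
      cases (no  t≢0) (yes N≤n) =
        let 0<t = ℕ.n≢0⇒n>0 t≢0
            y , b , nz , h = bounded-large H reg (0<t⇒0<d 0<t) 0<t d≤t² t²≤4d (d≤n d³≤n²) d³≤n² N≤n
        in y , b , (vertex n , nz (vertex n)) , raise {{K≢0 (suc l)}} (K-of≤K₁ l) h

-- Order and ring laws for Cauchy reals

module Reals where
  open import Data.Integer as ℤ using ()
  open import Data.Rational hiding (NonZero)
  import Data.Rational as ℚ
  open import Data.Rational.Properties
  import Defs as D
  open import Defs using (ℝ; mkℝ; seq; cauchy; fromℚ; 0ℝ; 1ℝ; recip; invℚ)
  open Rationals

  infix 4 _≈_ _≤ᴿ_

  -- The relations of Defs, wrapped in records so that their arguments can be inferred.
  record _≈_ (x y : ℝ) : Set where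
    constructor eqv
    field ≈-out : x D.≈ y

  record _≤ᴿ_ (x y : ℝ) : Set where
    constructor leq
    field ≤-out : x D.≤ y

  open _≈_ public
  open _≤ᴿ_ public

  -- "Eventually": `_<&>_` and `_∧_` do the bookkeeping of thresholds in all limit arguments.
  Ev : (ℕ → Set) → Set
  Ev P = ∃ λ N → ∀ n → N ℕ.≤ n → P n

  infixl 4 _<&>_

  _<&>_ : ∀ {P Q : ℕ → Set} → Ev P → (∀ {n} → P n → Q n) → Ev Q
  (N , h) <&> f = N , λ n N≤n → f (h n N≤n)

  infixr 5 _∧_

  _∧_ : ∀ {P Q : ℕ → Set} → Ev P → Ev Q → Ev (λ n → P n × Q n)
  (M , p) ∧ (N , q) = M ℕ.⊔ N , λ n h → p n (ℕ.m⊔n≤o⇒m≤o M N h) , q n (ℕ.m⊔n≤o⇒n≤o M N h)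

  always : ∀ {P : ℕ → Set} → (∀ n → P n) → Ev P
  always h = 0 , λ n _ → h n

  0<½ : 0ℚ < ½
  0<½ = positive⁻¹ ½

  half : ∀ {ε} → 0ℚ < ε → 0ℚ < ½ * ε
  half = 0<* 0<½

  halves : ∀ ε → ½ * ε + ½ * ε ≡ ε
  halves = solve-∀ ℚ-ring

  abstract
    -- Division by C + 1 instead of C avoids a case distinction at C = 0.
    share : ∀ C {ε} → 0ℚ < ε → ∃ λ δ → (0ℚ < δ) × (ι C * δ ≤ ε)
    share C {ε} 0<ε = rec (suc C) * ε , 0<* (0<rec (suc C)) 0<ε , ≤-trans
      (*-monoʳ (<⇒≤ (0<* (0<rec (suc C)) 0<ε)) (ι-mono (ℕ.n≤1+n C)))
      (≤-reflexive (trans (eq (ι (suc C)) (rec (suc C)) ε) (trans (cong (_* ε) (rec-inverse (suc C))) (*-identityˡ ε))))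
      where
      eq : ∀ a b c → a * (b * c) ≡ b * a * c
      eq = solve-∀ ℚ-ring

  abstract
    archimedean : ∀ q → ∃ λ B → q ≤ ι B
    archimedean q with ≤-total 0ℚ q
    ... | inj₂ q≤0 = 0 , q≤0
    archimedean q@(mkℚ (ℤ.+ n) d-1 c) | inj₁ 0≤q = n , (begin
      q                       ≡⟨ sym (*-identityʳ q) ⟩
      q * 1ℚ                  ≤⟨ *-monoˡ 0≤q (1≤ι (suc d-1)) ⟩
      q * ι (suc d-1)         ≡⟨ cong (_* ι (suc d-1)) (sym (↥p/↧p≡p q)) ⟩
      (ℤ.+ n / suc d-1) * ι (suc d-1) ≡⟨ /-*-ι n (suc d-1) ⟩
      ι n                     ∎)
      where open ≤-Reasoning
    archimedean (mkℚ (ℤ.-[1+ n ]) d-1 c) | inj₁ (*≤* ())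

  abstract
    rec-null : ∀ ε → 0ℚ < ε → Ev (λ k → rec (suc k) ≤ ε)
    rec-null ε 0<ε = let A , h = archimedean ε⁻¹ in A , λ k A≤k → *-cancelˡ (0<ι k)
        (≤-trans (≤-reflexive (trans (*-comm (ι (suc k)) (rec (suc k))) (rec-inverse (suc k))))
          (≤-trans (≤-reflexive (sym (*-inverseˡ ε {{ε≢0}}))) (*-monoʳ (<⇒≤ 0<ε) (≤-trans h (ι-mono (ℕ.≤-trans A≤k (ℕ.n≤1+n k)))))))
      where
      ε≢0 : ℚ.NonZero ε
      ε≢0 = pos⇒nonZero ε {{positive 0<ε}}
      ε⁻¹ : ℚ
      ε⁻¹ = (1/ ε) {{ε≢0}}

  ∣-∣-sym : ∀ a b → ∣ a - b ∣ ≡ ∣ b - a ∣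
  ∣-∣-sym a b = trans (sym (∣-p∣≡∣p∣ (a - b))) (cong ∣_∣ (eq a b))
    where
    eq : ∀ a b → - (a - b) ≡ b - a
    eq = solve-∀ ℚ-ring

  ∣-∣-triangle : ∀ a b c → ∣ a - c ∣ ≤ ∣ a - b ∣ + ∣ b - c ∣
  ∣-∣-triangle a b c = ≤-trans (≤-reflexive (cong ∣_∣ (eq a b c))) (∣p+q∣≤∣p∣+∣q∣ (a - b) (b - c))
    where
    eq : ∀ a b c → a - c ≡ (a - b) + (b - c)
    eq = solve-∀ ℚ-ring

  ∣∣≤⇒ : ∀ {a b ε} → ∣ a - b ∣ ≤ ε → a ≤ b + ε
  ∣∣≤⇒ {a} {b} {ε} h = ≤-trans (≤-reflexive (eq a b)) (+-monoʳ-≤ b (≤-trans (p≤∣p∣ (a - b)) h))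
    where
    eq : ∀ a b → a ≡ b + (a - b)
    eq = solve-∀ ℚ-ring

  ⇒∣∣≤ : ∀ {a b ε} → a ≤ b + ε → b ≤ a + ε → ∣ a - b ∣ ≤ ε
  ⇒∣∣≤ {a} {b} {ε} h h′ = ∣∣-≤
    (subst (a - b ≤_) (eq b ε) (+-monoˡ-≤ (- b) h))
    (subst₂ _≤_ (eq₁ b ε) (eq₂ a b ε) (+-monoˡ-≤ (- b - ε) h′))
    where
    eq : ∀ b ε → b + ε - b ≡ ε
    eq = solve-∀ ℚ-ring
    eq₁ : ∀ b ε → b + (- b - ε) ≡ - ε
    eq₁ = solve-∀ ℚ-ring
    eq₂ : ∀ a b ε → a + ε + (- b - ε) ≡ a - b
    eq₂ = solve-∀ ℚ-ring

  -- Weak estimates suffice: halving ε recovers the strict inequality demanded by `cauchy`.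
  limit : (f : ℕ → ℚ) → (∀ ε → 0ℚ < ε → ∃ λ N → ∀ m n → N ℕ.≤ m → N ℕ.≤ n → ∣ f m - f n ∣ ≤ ε) → ℝ
  limit f h = mkℝ f λ ε 0<ε →
    let N , g = h (½ * ε) (half 0<ε)
    in N , λ m n p q → ≤-<-trans (g m n p q) (half< 0<ε)
    where
    half< : ∀ {ε} → 0ℚ < ε → ½ * ε < ε
    half< {ε} 0<ε = subst₂ _<_ (+-identityʳ (½ * ε)) (halves ε) (+-monoʳ-< (½ * ε) (half 0<ε))

  abstract
    bounded : ∀ x → ∃ λ B → Ev (λ n → ∣ seq x n ∣ ≤ ι B)
    bounded x = let N , h = cauchy x 1ℚ 0<1
                    B , b = archimedean (∣ seq x N ∣ + 1ℚ)
                in B , N , λ n p → ≤-trans (≤-trans (≤-reflexive (cong ∣_∣ (eq (seq x n) (seq x N))))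
                     (≤-trans (∣p+q∣≤∣p∣+∣q∣ (seq x N) (seq x n - seq x N)) (+-monoʳ-≤ ∣ seq x N ∣ (<⇒≤ (h n N p ℕ.≤-refl))))) b
      where
      eq : ∀ a b → a ≡ b + (a - b)
      eq = solve-∀ ℚ-ring

  pointwise : ∀ {x y} → (∀ n → seq x n ≡ seq y n) → x ≈ y
  pointwise {x} {y} h = eqv λ ε 0<ε → 0 , λ n _ →
    subst (_≤ ε) (sym (trans (cong (λ a → ∣ a - seq y n ∣) (h n)) (cong ∣_∣ (+-inverseʳ (seq y n))))) (<⇒≤ 0<ε)

  eventually-≡ : ∀ {x y} → Ev (λ n → seq x n ≡ seq y n) → x ≈ y
  eventually-≡ {x} {y} (N , h) = eqv λ ε 0<ε → N , λ n p →
    subst (_≤ ε) (sym (trans (cong (λ a → ∣ a - seq y n ∣) (h n p)) (cong ∣_∣ (+-inverseʳ (seq y n))))) (<⇒≤ 0<ε)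

  ≈-refl : ∀ {x} → x ≈ x
  ≈-refl = pointwise (λ _ → refl)

  ≈-sym : ∀ {x y} → x ≈ y → y ≈ x
  ≈-sym {x} {y} (eqv h) = eqv λ ε 0<ε → h ε 0<ε <&> λ {n} p → subst (_≤ ε) (∣-∣-sym (seq x n) (seq y n)) p

  ≈-trans : ∀ {x y z} → x ≈ y → y ≈ z → x ≈ z
  ≈-trans {x} {y} {z} (eqv h) (eqv g) = eqv λ ε 0<ε → (h (½ * ε) (half 0<ε) ∧ g (½ * ε) (half 0<ε)) <&> λ {n} (p , q) →
    ≤-trans (∣-∣-triangle (seq x n) (seq y n) (seq z n)) (subst (_ ≤_) (halves ε) (+-mono-≤ p q))

  ≈⇒≤ : ∀ {x y} → x ≈ y → x ≤ᴿ y
  ≈⇒≤ (eqv h) = leq λ ε 0<ε → h ε 0<ε <&> ∣∣≤⇒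

  ≤ᴿ-trans : ∀ {x y z} → x ≤ᴿ y → y ≤ᴿ z → x ≤ᴿ z
  ≤ᴿ-trans {x} {y} {z} (leq h) (leq g) = leq λ ε 0<ε → (h (½ * ε) (half 0<ε) ∧ g (½ * ε) (half 0<ε)) <&> λ {n} (p , q) →
    ≤-trans p (≤-trans (+-monoˡ-≤ (½ * ε) q) (≤-reflexive (trans (+-assoc (seq z n) (½ * ε) (½ * ε)) (cong (seq z n +_) (halves ε)))))

  pointwise-≤ : ∀ {x y} → (∀ n → seq x n ≤ seq y n) → x ≤ᴿ y
  pointwise-≤ {x} {y} h = leq λ ε 0<ε → always λ n → ≤-trans (h n) (subst (_≤ seq y n + ε) (+-identityʳ (seq y n)) (+-monoʳ-≤ (seq y n) (<⇒≤ 0<ε)))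

  ≤ᴿ-refl : ∀ {x} → x ≤ᴿ x
  ≤ᴿ-refl = pointwise-≤ (λ _ → ≤-refl)

  <-≤ᴿ-trans : ∀ {x y z} → x D.< y → y ≤ᴿ z → x D.< z
  <-≤ᴿ-trans {x} {y} {z} (ε , 0<ε , h) (leq g) = ½ * ε , half 0<ε , ((h ∧ g (½ * ε) (half 0<ε)) <&> λ {n} (p , q) →
    subst₂ _≤_ (eq₁ (seq x n) ε) (eq₂ (seq z n) ε) (+-monoˡ-≤ (- (½ * ε)) (≤-trans p q)))
    where
    eq₁ : ∀ a ε → a + ε + - (½ * ε) ≡ a + ½ * ε
    eq₁ = solve-∀ ℚ-ring
    eq₂ : ∀ a ε → a + ½ * ε + - (½ * ε) ≡ a
    eq₂ = solve-∀ ℚ-ring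

  infixl 6 _+ᴿ_ _-ᴿ_
  infixl 7 _*ᴿ_
  infix  8 -ᴿ_

  -- Opaque, so that the Cauchy proofs inside the operations of Defs are never compared.
  opaque
    _+ᴿ_ _*ᴿ_ : ℝ → ℝ → ℝ
    _+ᴿ_ = D._+_
    _*ᴿ_ = D._*_

    -ᴿ_ : ℝ → ℝ
    -ᴿ_ = D.-_

    *ᴿ-def : ∀ x y → x *ᴿ y ≡ x D.* y
    *ᴿ-def x y = refl

    seq-* : ∀ x y n → seq (x *ᴿ y) n ≡ seq x n * seq y n
    seq-* x y n = refl

  _-ᴿ_ : ℝ → ℝ → ℝ
  x -ᴿ y = x +ᴿ (-ᴿ y)

  0≤⇒ : ∀ {x} → 0ℝ ≤ᴿ x → ∀ ε → 0ℚ < ε → Ev (λ n → - ε ≤ seq x n)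
  0≤⇒ {x} (leq h) ε 0<ε = h ε 0<ε <&> λ {n} p → subst₂ _≤_ (+-identityˡ (- ε)) (eq (seq x n) ε) (+-monoˡ-≤ (- ε) p)
    where
    eq : ∀ a ε → a + ε + - ε ≡ a
    eq = solve-∀ ℚ-ring

  opaque
    unfolding _+ᴿ_

    +ᴿ-cong : ∀ {x x′ y y′} → x ≈ x′ → y ≈ y′ → x +ᴿ y ≈ x′ +ᴿ y′
    +ᴿ-cong {x} {x′} {y} {y′} (eqv h) (eqv g) = eqv λ ε 0<ε → (h (½ * ε) (half 0<ε) ∧ g (½ * ε) (half 0<ε)) <&> λ {n} (p , q) →
      ≤-trans (≤-reflexive (cong ∣_∣ (eq (seq x n) (seq y n) (seq x′ n) (seq y′ n))))
        (≤-trans (∣p+q∣≤∣p∣+∣q∣ (seq x n - seq x′ n) (seq y n - seq y′ n)) (subst (_ ≤_) (halves ε) (+-mono-≤ p q)))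
      where
      eq : ∀ a b c d → (a + b) - (c + d) ≡ (a - c) + (b - d)
      eq = solve-∀ ℚ-ring

    -ᴿ-cong : ∀ {x y} → x ≈ y → -ᴿ x ≈ -ᴿ y
    -ᴿ-cong {x} {y} (eqv h) = eqv λ ε 0<ε → h ε 0<ε <&> λ {n} p →
      subst (_≤ ε) (trans (sym (∣-p∣≡∣p∣ (seq x n - seq y n))) (cong ∣_∣ (eq (seq x n) (seq y n)))) p
      where
      eq : ∀ a b → - (a - b) ≡ - a - - b
      eq = solve-∀ ℚ-ring

    *ᴿ-cong : ∀ {x x′ y y′} → x ≈ x′ → y ≈ y′ → x *ᴿ y ≈ x′ *ᴿ y′
    *ᴿ-cong {x} {x′} {y} {y′} (eqv h) (eqv g) = eqv λ ε 0<ε →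
      let A , a = bounded x
          B , b = bounded y′
          δ , 0<δ , δ≤ = share (A ℕ.+ B) 0<ε
      in (a ∧ b ∧ h δ 0<δ ∧ g δ 0<δ) <&> λ {n} (p , q , u , v) → begin
        ∣ seq x n * seq y n - seq x′ n * seq y′ n ∣
          ≡⟨ cong ∣_∣ (eq (seq x n) (seq y n) (seq x′ n) (seq y′ n)) ⟩
        ∣ seq x n * (seq y n - seq y′ n) + (seq x n - seq x′ n) * seq y′ n ∣
          ≤⟨ ∣p+q∣≤∣p∣+∣q∣ (seq x n * (seq y n - seq y′ n)) ((seq x n - seq x′ n) * seq y′ n) ⟩
        ∣ seq x n * (seq y n - seq y′ n) ∣ + ∣ (seq x n - seq x′ n) * seq y′ n ∣
          ≡⟨ cong₂ _+_ (∣p*q∣≡∣p∣*∣q∣ (seq x n) (seq y n - seq y′ n))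
               (trans (∣p*q∣≡∣p∣*∣q∣ (seq x n - seq x′ n) (seq y′ n)) (*-comm ∣ seq x n - seq x′ n ∣ ∣ seq y′ n ∣)) ⟩
        ∣ seq x n ∣ * ∣ seq y n - seq y′ n ∣ + ∣ seq y′ n ∣ * ∣ seq x n - seq x′ n ∣
          ≤⟨ +-mono-≤ (*-mono (0≤ι A) (0≤∣p∣ (seq y n - seq y′ n)) p v) (*-mono (0≤ι B) (0≤∣p∣ (seq x n - seq x′ n)) q u) ⟩
        ι A * δ + ι B * δ
          ≡⟨ trans (sym (*-distribʳ-+ δ (ι A) (ι B))) (cong (_* δ) (sym (ι-+ A B))) ⟩
        ι (A ℕ.+ B) * δ
          ≤⟨ δ≤ ⟩
        ε ∎
      where
      open ≤-Reasoning
      eq : ∀ a b c d → a * b - c * d ≡ a * (b - d) + (a - c) * d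
      eq = solve-∀ ℚ-ring

    +ᴿ-mono : ∀ {x x′ y y′} → x ≤ᴿ x′ → y ≤ᴿ y′ → x +ᴿ y ≤ᴿ x′ +ᴿ y′
    +ᴿ-mono {x} {x′} {y} {y′} (leq h) (leq g) = leq λ ε 0<ε → (h (½ * ε) (half 0<ε) ∧ g (½ * ε) (half 0<ε)) <&> λ {n} (p , q) →
      ≤-trans (+-mono-≤ p q) (≤-reflexive (eq (seq x′ n) (seq y′ n) ε))
      where
      eq : ∀ a b ε → a + ½ * ε + (b + ½ * ε) ≡ a + b + ε
      eq = solve-∀ ℚ-ring

    -- Approximations of nonnegative reals may dip to -δ. With the factors bounded by A and B, the
    -- product is still at least -(A + B) δ.
    0≤ᴿ* : ∀ {x y} → 0ℝ ≤ᴿ x → 0ℝ ≤ᴿ y → 0ℝ ≤ᴿ x *ᴿ y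
    0≤ᴿ* {x} {y} h g = leq λ ε 0<ε →
      let A , a = bounded x
          B , b = bounded y
          δ , 0<δ , δ≤ = share (A ℕ.+ B) 0<ε
      in (a ∧ b ∧ 0≤⇒ {x} h δ 0<δ ∧ 0≤⇒ {y} g δ 0<δ) <&> λ {n} (p , q , u , v) →
         ≤-trans (nonneg-product (seq x n) (seq y n) δ A B (<⇒≤ 0<δ) p q u v) (+-monoʳ-≤ (seq x n * seq y n) δ≤)
      where
      nonneg-product : ∀ a b δ A B → 0ℚ ≤ δ → ∣ a ∣ ≤ ι A → ∣ b ∣ ≤ ι B → - δ ≤ a → - δ ≤ b → 0ℚ ≤ a * b + ι (A ℕ.+ B) * δ
      nonneg-product a b δ A B 0≤δ a≤ b≤ δ≤a δ≤b = subst (0ℚ ≤_) (cong (λ s → a * b + s * δ) (sym (ι-+ A B))) (cases (≤-total 0ℚ a) (≤-total 0ℚ b))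
        where
        shift : ∀ {c} → - δ ≤ c → 0ℚ ≤ c + δ
        shift {c} h = subst (_≤ c + δ) (+-inverseˡ δ) (+-monoˡ-≤ δ h)
        A-a : 0ℚ ≤ ι A - a
        A-a = p≤q⇒0≤q-p (≤-trans (p≤∣p∣ a) a≤)
        B-b : 0ℚ ≤ ι B - b
        B-b = p≤q⇒0≤q-p (≤-trans (p≤∣p∣ b) b≤)
        e₁ : ∀ a b A B δ → a * (b + δ) + (A - a) * δ + B * δ ≡ a * b + (A + B) * δ
        e₁ = solve-∀ ℚ-ring
        e₂ : ∀ a b A B δ → b * (a + δ) + (B - b) * δ + A * δ ≡ a * b + (A + B) * δ
        e₂ = solve-∀ ℚ-ring
        e₃ : ∀ a b A B δ → - a * - b + (A + B) * δ ≡ a * b + (A + B) * δ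
        e₃ = solve-∀ ℚ-ring
        cases : (0ℚ ≤ a) ⊎ (a ≤ 0ℚ) → (0ℚ ≤ b) ⊎ (b ≤ 0ℚ) → 0ℚ ≤ a * b + (ι A + ι B) * δ
        cases (inj₁ 0≤a) _ = subst (0ℚ ≤_) (e₁ a b (ι A) (ι B) δ) (0≤+ (0≤+ (0≤* 0≤a (shift δ≤b)) (0≤* A-a 0≤δ)) (0≤* (0≤ι B) 0≤δ))
        cases (inj₂ _) (inj₁ 0≤b) = subst (0ℚ ≤_) (e₂ a b (ι A) (ι B) δ) (0≤+ (0≤+ (0≤* 0≤b (shift δ≤a)) (0≤* B-b 0≤δ)) (0≤* (0≤ι A) 0≤δ))
        cases (inj₂ a≤0) (inj₂ b≤0) = subst (0ℚ ≤_) (e₃ a b (ι A) (ι B) δ)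
          (0≤+ (0≤* (neg-antimono-≤ a≤0) (neg-antimono-≤ b≤0)) (0≤* (0≤+ (0≤ι A) (0≤ι B)) 0≤δ))

    ≤⇒0≤- : ∀ {x y} → x ≤ᴿ y → 0ℝ ≤ᴿ y -ᴿ x
    ≤⇒0≤- {x} {y} (leq h) = leq λ ε 0<ε → h ε 0<ε <&> λ {n} p →
      subst₂ _≤_ (+-inverseˡ (seq x n)) (eq (seq x n) (seq y n) ε) (+-monoʳ-≤ (- seq x n) p)
      where
      eq : ∀ a b ε → - a + (b + ε) ≡ b + - a + ε
      eq = solve-∀ ℚ-ring

    0≤-⇒≤ : ∀ {x y} → 0ℝ ≤ᴿ y -ᴿ x → x ≤ᴿ y
    0≤-⇒≤ {x} {y} (leq h) = leq λ ε 0<ε → h ε 0<ε <&> λ {n} p →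
      subst₂ _≤_ (+-identityʳ (seq x n)) (eq (seq x n) (seq y n) ε) (+-monoʳ-≤ (seq x n) p)
      where
      eq : ∀ a b ε → a + (b + - a + ε) ≡ b + ε
      eq = solve-∀ ℚ-ring

  opaque
    unfolding _+ᴿ_

    +ᴿ-comm : ∀ x y → x +ᴿ y ≈ y +ᴿ x
    +ᴿ-comm x y = pointwise (λ n → +-comm (seq x n) (seq y n))

    +ᴿ-identityˡ : ∀ x → 0ℝ +ᴿ x ≈ x
    +ᴿ-identityˡ x = pointwise (λ n → +-identityˡ (seq x n))

    +ᴿ-inverseˡ : ∀ x → -ᴿ x +ᴿ x ≈ 0ℝ
    +ᴿ-inverseˡ x = pointwise (λ n → +-inverseˡ (seq x n))

    *ᴿ-comm : ∀ x y → x *ᴿ y ≈ y *ᴿ x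
    *ᴿ-comm x y = pointwise (λ n → *-comm (seq x n) (seq y n))

    *ᴿ-identityˡ : ∀ x → 1ℝ *ᴿ x ≈ x
    *ᴿ-identityˡ x = pointwise (λ n → *-identityˡ (seq x n))

    fromℚ-* : ∀ p q → fromℚ p *ᴿ fromℚ q ≈ fromℚ (p * q)
    fromℚ-* p q = pointwise (λ _ → refl)

  *ᴿ-monoˡ : ∀ {x y z} → 0ℝ ≤ᴿ x → y ≤ᴿ z → x *ᴿ y ≤ᴿ x *ᴿ z
  *ᴿ-monoˡ {x} {y} {z} 0≤x h = 0≤-⇒≤ (≤ᴿ-trans (0≤ᴿ* 0≤x (≤⇒0≤- h)) (≈⇒≤ (eq x y z)))
    where
    opaque
      unfolding _+ᴿ_
      eq : ∀ x y z → x *ᴿ (z -ᴿ y) ≈ x *ᴿ z -ᴿ x *ᴿ y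
      eq x y z = pointwise (λ n → eqℚ (seq x n) (seq y n) (seq z n))
        where
        eqℚ : ∀ a b c → a * (c + - b) ≡ a * c + - (a * b)
        eqℚ = solve-∀ ℚ-ring

  *ᴿ-mono : ∀ {x x′ y y′} → 0ℝ ≤ᴿ x′ → 0ℝ ≤ᴿ y → x ≤ᴿ x′ → y ≤ᴿ y′ → x *ᴿ y ≤ᴿ x′ *ᴿ y′
  *ᴿ-mono {x} {x′} {y} {y′} 0≤x′ 0≤y h g = ≤ᴿ-trans
    (≤ᴿ-trans (≈⇒≤ (*ᴿ-comm x y)) (≤ᴿ-trans (*ᴿ-monoˡ 0≤y h) (≈⇒≤ (*ᴿ-comm y x′))))
    (*ᴿ-monoˡ 0≤x′ g)

  fromℚ-mono : ∀ {p q} → p ≤ q → fromℚ p ≤ᴿ fromℚ q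
  fromℚ-mono h = pointwise-≤ (λ _ → h)

  fromℚ-cancel : ∀ {p q} → fromℚ p ≤ᴿ fromℚ q → p ≤ q
  fromℚ-cancel {p} {q} (leq h) with p ≤? q
  ... | yes p≤q = p≤q
  ... | no  p≰q = contradiction (proj₂ (h (½ * (p - q)) 0<δ) _ ℕ.≤-refl) (λ q → <-irrefl refl (<-≤-trans lt q))
    where
    0<p-q : 0ℚ < p - q
    0<p-q = subst (_< p - q) (+-inverseʳ q) (+-monoˡ-< (- q) (≰⇒> p≰q))
    0<δ : 0ℚ < ½ * (p - q)
    0<δ = half 0<p-q
    eq : ∀ p q → q + ½ * (p - q) + ½ * (p - q) ≡ p
    eq = solve-∀ ℚ-ring
    lt : q + ½ * (p - q) < p
    lt = subst₂ _<_ (+-identityʳ (q + ½ * (p - q))) (eq p q) (+-monoʳ-< (q + ½ * (p - q)) 0<δ)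

  opaque
    unfolding _+ᴿ_

    -- Apply the hypothesis with slack ε² and use t² + ε² ≤ (t + ε)².
    sq-cancelᴿ : ∀ {x t} → 0ℚ ≤ t → x *ᴿ x ≤ᴿ fromℚ (t * t) → x ≤ᴿ fromℚ t
    sq-cancelᴿ {x} {t} 0≤t (leq h) = leq λ ε 0<ε → h (ε * ε) (0<* 0<ε 0<ε) <&> λ {n} p →
      sq-cancel-≤ (0≤+ 0≤t (<⇒≤ 0<ε)) (≤-trans p (0≤q-p⇒p≤q (subst (0ℚ ≤_) (eq t ε) (0≤* (0≤ι 2) (0≤* 0≤t (<⇒≤ 0<ε))))))
      where
      eq : ∀ t ε → ι 2 * (t * ε) ≡ (t + ε) * (t + ε) - (t * t + ε * ε)
      eq = solve-∀ ℚ-ring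

    recip-inverse : ∀ x 0<x → recip x 0<x *ᴿ x ≈ 1ℝ
    recip-inverse x 0<x@(ε , 0<ε , N , h) = eventually-≡ {recip x 0<x *ᴿ x} {1ℝ} (N , λ n p → inverse (<-≤-trans 0<ε (subst (_≤ seq x n) (+-identityˡ ε) (h n p))))
      where
      inverse : ∀ {q} → 0ℚ < q → invℚ q * q ≡ 1ℚ
      inverse {q} 0<q with q ≟ 0ℚ
      ... | yes q≡0 = contradiction (sym q≡0) (<⇒≢ 0<q)
      ... | no  q≢0 = *-inverseˡ q {{≢-nonZero q≢0}}

  0≤recip : ∀ x 0<x → 0ℝ ≤ᴿ recip x 0<x
  0≤recip x 0<x@(η , 0<η , N , h) = leq λ ε 0<ε → N , λ n p → ≤-trans (nonneg (<-≤-trans 0<η (subst (_≤ seq x n) (+-identityˡ η) (h n p))))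
      (subst (_≤ invℚ (seq x n) + ε) (+-identityʳ (invℚ (seq x n))) (+-monoʳ-≤ (invℚ (seq x n)) (<⇒≤ 0<ε)))
    where
    nonneg : ∀ {q} → 0ℚ < q → 0ℚ ≤ invℚ q
    nonneg {q} 0<q with q ≟ 0ℚ
    ... | yes q≡0 = ≤-refl
    ... | no  q≢0 = <⇒≤ (positive⁻¹ ((1/ q) {{≢-nonZero q≢0}}) {{1/pos⇒pos q {{positive 0<q}}}})

-- Taylor sums of the exponential over the rationals

module ExponentialSums where
  open import Data.Rational hiding (NonZero)
  open import Data.Rational.Properties
  open Rationals
  open Reals using (share; archimedean; rec-null; ∣-∣-sym)

  -- q ^ k / k !
  D : ℕ → ℚ → ℚ
  D zero    q = 1ℚ
  D (suc k) q = rec (suc k) * (q * D k q)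

  D-suc : ∀ k q → ι (suc k) * D (suc k) q ≡ q * D k q
  D-suc k q = trans (eq (ι (suc k)) (rec (suc k)) (q * D k q))
    (trans (cong (_* (q * D k q)) (rec-inverse (suc k))) (*-identityˡ (q * D k q)))
    where
    eq : ∀ a b c → a * (b * c) ≡ b * a * c
    eq = solve-∀ ℚ-ring

  PS : (ℕ → ℚ) → ℕ → ℚ
  PS f zero    = 0ℚ
  PS f (suc N) = f 0 + PS (f ∘ suc) N

  PS-snoc : ∀ f N → PS f (suc N) ≡ PS f N + f N
  PS-snoc f zero    = +-comm (f 0) 0ℚ
  PS-snoc f (suc N) = trans (cong (f 0 +_) (PS-snoc (f ∘ suc) N)) (sym (+-assoc (f 0) (PS (f ∘ suc) N) (f (suc N))))

  0≤PS : ∀ {f} → (∀ i → 0ℚ ≤ f i) → ∀ N → 0ℚ ≤ PS f N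
  0≤PS h zero    = ≤-refl
  0≤PS h (suc N) = 0≤+ (h 0) (0≤PS (h ∘ suc) N)

  PS-mono : ∀ {f} → (∀ i → 0ℚ ≤ f i) → ∀ {M N} → M ℕ.≤ N → PS f M ≤ PS f N
  PS-mono h {N = N} ℕ.z≤n = 0≤PS h N
  PS-mono {f} h (ℕ.s≤s p) = +-monoʳ-≤ (f 0) (PS-mono (h ∘ suc) p)

  PS-cong : ∀ {f g} → (∀ i → f i ≡ g i) → ∀ N → PS f N ≡ PS g N
  PS-cong h zero    = refl
  PS-cong h (suc N) = cong₂ _+_ (h 0) (PS-cong (h ∘ suc) N)

  PS-diff : ∀ {f f̂} → (∀ i → ∣ f i ∣ ≤ f̂ i) → ∀ {M N} → M ℕ.≤ N → ∣ PS f N - PS f M ∣ ≤ PS f̂ N - PS f̂ M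
  PS-diff {f} {f̂} h {zero} {zero} ℕ.z≤n = ≤-refl
  PS-diff {f} {f̂} h {zero} {suc N} ℕ.z≤n = ≤-trans (≤-reflexive (cong ∣_∣ (eq (f 0) (PS (f ∘ suc) N))))
    (≤-trans (∣p+q∣≤∣p∣+∣q∣ (f 0) (PS (f ∘ suc) N - 0ℚ)) (≤-trans (+-mono-≤ (h 0) (PS-diff (h ∘ suc) {zero} {N} ℕ.z≤n)) (≤-reflexive (sym (eq (f̂ 0) (PS (f̂ ∘ suc) N))))))
    where
    eq : ∀ a b → a + b - 0ℚ ≡ a + (b - 0ℚ)
    eq = solve-∀ ℚ-ring
  PS-diff {f} {f̂} h {suc M} {suc N} (ℕ.s≤s p) = subst₂ _≤_ (cong ∣_∣ (sym (eq (f 0) _ _))) (sym (eq (f̂ 0) _ _)) (PS-diff (h ∘ suc) p)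
    where
    eq : ∀ a b c → a + b - (a + c) ≡ b - c
    eq = solve-∀ ℚ-ring

  E : ℕ → ℚ → ℚ
  E N q = PS (λ k → D k q) N

  0≤D : ∀ k {q} → 0ℚ ≤ q → 0ℚ ≤ D k q
  0≤D zero    _   = 0≤1
  0≤D (suc k) 0≤q = 0≤* (0≤rec (suc k)) (0≤* 0≤q (0≤D k 0≤q))

  D-majorant : ∀ {q b} → ∣ q ∣ ≤ b → ∀ k → ∣ D k q ∣ ≤ D k b
  D-majorant h zero = ≤-refl
  D-majorant {q} {b} h (suc k) = ≤-trans (≤-reflexive (trans (∣p*q∣≡∣p∣*∣q∣ (rec (suc k)) (q * D k q))
      (cong₂ _*_ (0≤p⇒∣p∣≡p (0≤rec (suc k))) (∣p*q∣≡∣p∣*∣q∣ q (D k q)))))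
    (*-monoˡ (0≤rec (suc k)) (*-mono (≤-trans (0≤∣p∣ q) h) (0≤∣p∣ (D k q)) h (D-majorant h k)))

  module _ (B : ℕ) where

    private
      b : ℚ
      b = ι B

      0≤Db : ∀ k → 0ℚ ≤ D k b
      0≤Db k = 0≤D k (0≤ι B)

    D-halves : ∀ k → 2 ℕ.* B ℕ.≤ suc k → ι 2 * D (suc k) b ≤ D k b
    D-halves k h = *-cancelˡ (0<ι k) (begin
      ι (suc k) * (ι 2 * D (suc k) b)  ≡⟨ swap (ι (suc k)) (ι 2) (D (suc k) b) ⟩
      ι 2 * (ι (suc k) * D (suc k) b)  ≡⟨ cong (ι 2 *_) (D-suc k b) ⟩
      ι 2 * (b * D k b)                ≡⟨ trans (sym (*-assoc (ι 2) b (D k b))) (cong (_* D k b) (sym (ι-* 2 B))) ⟩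
      ι (2 ℕ.* B) * D k b              ≤⟨ *-monoʳ (0≤Db k) (ι-mono h) ⟩
      ι (suc k) * D k b                ∎)
      where
      open ≤-Reasoning
      swap : ∀ a b c → a * (b * c) ≡ b * (a * c)
      swap = solve-∀ ℚ-ring

    -- Once terms at least halve, E + 2 D no longer increases, so twice the first omitted term
    -- bounds every tail.
    tail-telescope : ∀ {N} → 2 ℕ.* B ℕ.≤ N → ∀ j → E (j ℕ.+ N) b + ι 2 * D (j ℕ.+ N) b ≤ E N b + ι 2 * D N b
    tail-telescope h zero    = ≤-refl
    tail-telescope {N} h (suc j) = ≤-trans (begin
      E (suc M) b + ι 2 * D (suc M) b   ≡⟨ cong (_+ ι 2 * D (suc M) b) (PS-snoc (λ k → D k b) M) ⟩
      E M b + D M b + ι 2 * D (suc M) b ≤⟨ +-monoʳ-≤ (E M b + D M b) (D-halves M (ℕ.≤-trans h (ℕ.≤-trans (ℕ.m≤n+m N j) (ℕ.n≤1+n M)))) ⟩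
      E M b + D M b + D M b             ≡⟨ eq (E M b) (D M b) ⟩
      E M b + ι 2 * D M b               ∎) (tail-telescope h j)
      where
      open ≤-Reasoning
      M = j ℕ.+ N
      eq : ∀ a d → a + d + d ≡ a + ι 2 * d
      eq = solve-∀ ℚ-ring

    tail-bound : ∀ {N M} → 2 ℕ.* B ℕ.≤ N → N ℕ.≤ M → E M b ≤ E N b + ι 2 * D N b
    tail-bound {N} {M} h p = ≤-trans
      (subst (_≤ E M b + ι 2 * D M b) (+-identityʳ (E M b)) (+-monoʳ-≤ (E M b) (0≤* (0≤ι 2) (0≤Db M))))
      (subst (λ M → E M b + ι 2 * D M b ≤ E N b + ι 2 * D N b) (ℕ.m∸n+n≡m p) (tail-telescope h (M ℕ.∸ N)))

    abstract
      E-bounded : ∃ λ G → ∀ N → E N b ≤ ι G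
      E-bounded = let G , h = archimedean (E (2 ℕ.* B) b + ι 2 * D (2 ℕ.* B) b) in G , λ N → ≤-trans (bound N) h
        where
        bound : ∀ N → E N b ≤ E (2 ℕ.* B) b + ι 2 * D (2 ℕ.* B) b
        bound N with ℕ.≤-total (2 ℕ.* B) N
        ... | inj₁ p = tail-bound ℕ.≤-refl p
        ... | inj₂ p = ≤-trans (PS-mono 0≤Db p)
          (subst (_≤ E (2 ℕ.* B) b + ι 2 * D (2 ℕ.* B) b) (+-identityʳ (E (2 ℕ.* B) b)) (+-monoʳ-≤ (E (2 ℕ.* B) b) (0≤* (0≤ι 2) (0≤Db (2 ℕ.* B)))))

    D-decreasing : ∀ j → D (j ℕ.+ 2 ℕ.* B) b ≤ D (2 ℕ.* B) b
    D-decreasing zero    = ≤-refl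
    D-decreasing (suc j) = ≤-trans (≤-trans (0≤q-p⇒p≤q (subst (0ℚ ≤_) (eq d) (0≤Db (suc (j ℕ.+ 2 ℕ.* B)))))
        (D-halves (j ℕ.+ 2 ℕ.* B) (ℕ.≤-trans (ℕ.m≤n+m (2 ℕ.* B) j) (ℕ.n≤1+n _)))) (D-decreasing j)
      where
      d = D (suc (j ℕ.+ 2 ℕ.* B)) b
      eq : ∀ d → d ≡ ι 2 * d - d
      eq = solve-∀ ℚ-ring

    abstract
      -- From index 2B on the terms decrease, so (n + 1) D (n + 1) = B · D n stays bounded, and
      -- dividing by a large n + 1 gives the claim.
      D-null : ∀ ε → 0ℚ < ε → ∃ λ N → (2 ℕ.* B ℕ.≤ N) × (ι 2 * D N b ≤ ε)
      D-null ε 0<ε = suc (A ℕ.+ 2 ℕ.* B) , ℕ.≤-trans (ℕ.m≤n+m (2 ℕ.* B) A) (ℕ.n≤1+n _) ,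
        *-cancelˡ (0<ι n) (begin
          ι (suc n) * (ι 2 * D (suc n) b)   ≡⟨ swap (ι (suc n)) (ι 2) (D (suc n) b) ⟩
          ι 2 * (ι (suc n) * D (suc n) b)   ≡⟨ cong (ι 2 *_) (D-suc n b) ⟩
          ι 2 * (b * D n b)                 ≤⟨ *-monoˡ (0≤ι 2) (*-monoˡ (0≤ι B) (D-decreasing A)) ⟩
          c                                 ≤⟨ proj₂ (archimedean c) ⟩
          ι A₀                              ≡⟨ trans (sym (*-identityʳ (ι A₀))) (cong (ι A₀ *_) (sym 1≡)) ⟩
          ι A₀ * (δ * ι (suc A₁))           ≤⟨ *-monoˡ (0≤ι A₀) (*-monoˡ (<⇒≤ 0<δ) (ι-mono (ℕ.n≤1+n (suc A₁)))) ⟩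
          ι A₀ * (δ * ι (suc (suc A₁)))     ≡⟨ eq (ι A₀) δ (ι (suc (suc A₁))) ⟩
          ι A₀ * ι (suc (suc A₁)) * δ       ≡⟨ cong (_* δ) (sym (ι-* A₀ (suc (suc A₁)))) ⟩
          ι A * δ                           ≤⟨ *-mono (0≤ι (suc n)) (<⇒≤ 0<δ) (ι-mono (ℕ.≤-trans (ℕ.m≤m+n A (2 ℕ.* B)) (ℕ.n≤1+n n))) δ≤ε ⟩
          ι (suc n) * ε                     ∎)
        where
        open ≤-Reasoning
        c : ℚ
        c = ι 2 * (b * D (2 ℕ.* B) b)
        A₀ : ℕ
        A₀ = proj₁ (archimedean c)
        inverse : ∃ λ A₁ → rec (suc A₁) ≤ ε
        inverse = let A₁ , h = rec-null ε 0<ε in A₁ , h A₁ ℕ.≤-refl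
        A₁ : ℕ
        A₁ = proj₁ inverse
        δ : ℚ
        δ = rec (suc A₁)
        δ≤ε : δ ≤ ε
        δ≤ε = proj₂ inverse
        0<δ : 0ℚ < δ
        0<δ = 0<rec (suc A₁)
        1≡ : δ * ι (suc A₁) ≡ 1ℚ
        1≡ = rec-inverse (suc A₁)
        A n : ℕ
        A = A₀ ℕ.* suc (suc A₁)
        n = A ℕ.+ 2 ℕ.* B
        swap : ∀ a b c → a * (b * c) ≡ b * (a * c)
        swap = solve-∀ ℚ-ring
        eq : ∀ a b c → a * (b * c) ≡ a * c * b
        eq = solve-∀ ℚ-ring

    abstract
      E-cauchyᵇ : ∀ ε → 0ℚ < ε → ∃ λ N → ∀ M → N ℕ.≤ M → E M b - E N b ≤ ε
      E-cauchyᵇ ε 0<ε = let N , h , g = D-null ε 0<ε in N , λ M p →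
        ≤-trans (≤-trans (+-monoˡ-≤ (- E N b) (tail-bound h p)) (≤-reflexive (eq (E N b) (ι 2 * D N b)))) g
        where
        eq : ∀ a d → a + d - a ≡ d
        eq = solve-∀ ℚ-ring

    abstract
      E-cauchy : ∀ ε → 0ℚ < ε → ∃ λ N → ∀ M M′ → N ℕ.≤ M → N ℕ.≤ M′ → ∀ {q} → ∣ q ∣ ≤ b → ∣ E M q - E M′ q ∣ ≤ ε
      E-cauchy ε 0<ε = let N , h = E-cauchyᵇ ε 0<ε in N , λ M M′ p p′ {q} q≤b → go N h M M′ p p′ q≤b
        where
        ordered : ∀ N → (∀ M → N ℕ.≤ M → E M b - E N b ≤ ε) → ∀ M M′ → N ℕ.≤ M → M ℕ.≤ M′ → ∀ {q} → ∣ q ∣ ≤ b → ∣ E M′ q - E M q ∣ ≤ ε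
        ordered N h M M′ p p′ q≤b = ≤-trans (PS-diff (D-majorant q≤b) p′)
          (≤-trans (+-monoʳ-≤ (E M′ b) (neg-antimono-≤ (PS-mono 0≤Db p))) (h M′ (ℕ.≤-trans p p′)))
        go : ∀ N → (∀ M → N ℕ.≤ M → E M b - E N b ≤ ε) → ∀ M M′ → N ℕ.≤ M → N ℕ.≤ M′ → ∀ {q} → ∣ q ∣ ≤ b → ∣ E M q - E M′ q ∣ ≤ ε
        go N h M M′ p p′ {q} q≤b with ℕ.≤-total M M′
        ... | inj₁ M≤M′ = subst (_≤ ε) (∣-∣-sym (E M′ q) (E M q)) (ordered N h M M′ p M≤M′ q≤b)
        ... | inj₂ M′≤M = ordered N h M′ M p′ M′≤M q≤b

    -- The derivative of q^(k+1)/(k+1)! is q^k/k!. Proved without calculus, by multiplying with the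
    -- index and using `D-suc`.
    D-lipschitz : ∀ k {a c} → ∣ a ∣ ≤ b → ∣ c ∣ ≤ b → ∣ D (suc k) a - D (suc k) c ∣ ≤ ∣ a - c ∣ * D k b
    D-lipschitz zero {a} {c} _ _ = ≤-reflexive (trans (cong ∣_∣ (eq a c)) (sym (*-identityʳ ∣ a - c ∣)))
      where
      eq : ∀ a c → 1ℚ * (a * 1ℚ) - 1ℚ * (c * 1ℚ) ≡ a - c
      eq = solve-∀ ℚ-ring
    D-lipschitz (suc k) {a} {c} a≤ c≤ = *-cancelˡ (0<ι (suc k)) (begin
      ι (2 ℕ.+ k) * ∣ D (2 ℕ.+ k) a - D (2 ℕ.+ k) c ∣
        ≡⟨ cong (_* ∣ D (2 ℕ.+ k) a - D (2 ℕ.+ k) c ∣) (sym (0≤p⇒∣p∣≡p (0≤ι (2 ℕ.+ k)))) ⟩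
      ∣ ι (2 ℕ.+ k) ∣ * ∣ D (2 ℕ.+ k) a - D (2 ℕ.+ k) c ∣
        ≡⟨ sym (∣p*q∣≡∣p∣*∣q∣ (ι (2 ℕ.+ k)) (D (2 ℕ.+ k) a - D (2 ℕ.+ k) c)) ⟩
      ∣ ι (2 ℕ.+ k) * (D (2 ℕ.+ k) a - D (2 ℕ.+ k) c) ∣
        ≡⟨ cong ∣_∣ (trans (distrib (ι (2 ℕ.+ k)) (D (2 ℕ.+ k) a) (D (2 ℕ.+ k) c)) (trans (cong₂ _-_ (D-suc (suc k) a) (D-suc (suc k) c)) (split a c (D (suc k) a) (D (suc k) c)))) ⟩
      ∣ a * (D (suc k) a - D (suc k) c) + (a - c) * D (suc k) c ∣
        ≤⟨ ∣p+q∣≤∣p∣+∣q∣ (a * (D (suc k) a - D (suc k) c)) ((a - c) * D (suc k) c) ⟩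
      ∣ a * (D (suc k) a - D (suc k) c) ∣ + ∣ (a - c) * D (suc k) c ∣
        ≡⟨ cong₂ _+_ (∣p*q∣≡∣p∣*∣q∣ a (D (suc k) a - D (suc k) c)) (∣p*q∣≡∣p∣*∣q∣ (a - c) (D (suc k) c)) ⟩
      ∣ a ∣ * ∣ D (suc k) a - D (suc k) c ∣ + ∣ a - c ∣ * ∣ D (suc k) c ∣
        ≤⟨ +-mono-≤ (*-mono (0≤ι B) (0≤∣p∣ (D (suc k) a - D (suc k) c)) a≤ (D-lipschitz k a≤ c≤)) (*-monoˡ (0≤∣p∣ (a - c)) (D-majorant c≤ (suc k))) ⟩
      b * (∣ a - c ∣ * D k b) + ∣ a - c ∣ * D (suc k) b
        ≡⟨ regroup b ∣ a - c ∣ (D k b) (D (suc k) b) ⟩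
      ∣ a - c ∣ * (D (suc k) b + b * D k b)
        ≡⟨ cong (λ e → ∣ a - c ∣ * (D (suc k) b + e)) (sym (D-suc k b)) ⟩
      ∣ a - c ∣ * (D (suc k) b + ι (suc k) * D (suc k) b)
        ≡⟨ trans (finish ∣ a - c ∣ (D (suc k) b) (ι (suc k))) (cong (_* (∣ a - c ∣ * D (suc k) b)) (sym (ι-suc (suc k)))) ⟩
      ι (2 ℕ.+ k) * (∣ a - c ∣ * D (suc k) b) ∎)
      where
      open ≤-Reasoning
      distrib : ∀ n x y → n * (x - y) ≡ n * x - n * y
      distrib = solve-∀ ℚ-ring
      split : ∀ a c x y → a * x - c * y ≡ a * (x - y) + (a - c) * y
      split = solve-∀ ℚ-ring
      regroup : ∀ b x d d′ → b * (x * d) + x * d′ ≡ x * (d′ + b * d)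
      regroup = solve-∀ ℚ-ring
      finish : ∀ x d n → x * (d + n * d) ≡ (1ℚ + n) * (x * d)
      finish = solve-∀ ℚ-ring

    E-lipschitz : ∀ N {a c} → ∣ a ∣ ≤ b → ∣ c ∣ ≤ b → ∣ E N a - E N c ∣ ≤ ∣ a - c ∣ * E N b
    E-lipschitz zero    {a} {c} _ _ = 0≤* (0≤∣p∣ (a - c)) ≤-refl
    E-lipschitz (suc N) {a} {c} a≤ c≤ = ≤-trans (shifted N) (*-monoˡ (0≤∣p∣ (a - c)) (PS-mono 0≤Db (ℕ.n≤1+n N)))
      where
      eq : ∀ x y x′ y′ → x + y - (x′ + y′) ≡ (x - x′) + (y - y′)
      eq = solve-∀ ℚ-ring
      zero-case : ∀ c → 1ℚ + 0ℚ - (1ℚ + 0ℚ) ≡ c * 0ℚ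
      zero-case = solve-∀ ℚ-ring
      shifted : ∀ N → ∣ E (suc N) a - E (suc N) c ∣ ≤ ∣ a - c ∣ * E N b
      shifted zero    = ≤-reflexive (zero-case ∣ a - c ∣)
      shifted (suc N) = begin
        ∣ E (suc (suc N)) a - E (suc (suc N)) c ∣
          ≡⟨ cong ∣_∣ (trans (cong₂ _-_ (PS-snoc (λ k → D k a) (suc N)) (PS-snoc (λ k → D k c) (suc N))) (eq (E (suc N) a) (D (suc N) a) (E (suc N) c) (D (suc N) c))) ⟩
        ∣ (E (suc N) a - E (suc N) c) + (D (suc N) a - D (suc N) c) ∣
          ≤⟨ ∣p+q∣≤∣p∣+∣q∣ (E (suc N) a - E (suc N) c) (D (suc N) a - D (suc N) c) ⟩
        ∣ E (suc N) a - E (suc N) c ∣ + ∣ D (suc N) a - D (suc N) c ∣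
          ≤⟨ +-mono-≤ (shifted N) (D-lipschitz N a≤ c≤) ⟩
        ∣ a - c ∣ * E N b + ∣ a - c ∣ * D N b
          ≡⟨ trans (sym (*-distribˡ-+ ∣ a - c ∣ (E N b) (D N b))) (cong (∣ a - c ∣ *_) (sym (PS-snoc (λ k → D k b) N))) ⟩
        ∣ a - c ∣ * E (suc N) b ∎
        where open ≤-Reasoning

  -- `conv` is the N-th Cauchy product coefficient, and `T` sums f i · g j over the triangle i + j <
  -- N.
  conv T : (ℕ → ℚ) → (ℕ → ℚ) → ℕ → ℚ
  conv f g zero    = f 0 * g 0
  conv f g (suc N) = f 0 * g (suc N) + conv (f ∘ suc) g N
  T f g zero    = 0ℚ
  T f g (suc N) = f 0 * PS g (suc N) + T (f ∘ suc) g N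

  δ : (ℕ → ℚ) → ℕ → ℚ
  δ f i = ι (suc i) * f (suc i)

  conv-cong : ∀ {f f′ g g′} → (∀ i → f i ≡ f′ i) → (∀ i → g i ≡ g′ i) → ∀ N → conv f g N ≡ conv f′ g′ N
  conv-cong h h′ zero    = cong₂ _*_ (h 0) (h′ 0)
  conv-cong h h′ (suc N) = cong₂ _+_ (cong₂ _*_ (h 0) (h′ (suc N))) (conv-cong (h ∘ suc) h′ N)

  conv-+ˡ : ∀ f f′ g N → conv (λ i → f i + f′ i) g N ≡ conv f g N + conv f′ g N
  conv-+ˡ f f′ g zero    = *-distribʳ-+ (g 0) (f 0) (f′ 0)
  conv-+ˡ f f′ g (suc N) = trans (cong ((f 0 + f′ 0) * g (suc N) +_) (conv-+ˡ (f ∘ suc) (f′ ∘ suc) g N))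
    (eq (f 0) (f′ 0) (g (suc N)) (conv (f ∘ suc) g N) (conv (f′ ∘ suc) g N))
    where
    eq : ∀ a b g c d → (a + b) * g + (c + d) ≡ a * g + c + (b * g + d)
    eq = solve-∀ ℚ-ring

  conv-*ˡ : ∀ c f g N → conv (λ i → c * f i) g N ≡ c * conv f g N
  conv-*ˡ c f g zero    = *-assoc c (f 0) (g 0)
  conv-*ˡ c f g (suc N) = trans (cong (c * f 0 * g (suc N) +_) (conv-*ˡ c (f ∘ suc) g N)) (eq c (f 0) (g (suc N)) (conv (f ∘ suc) g N))
    where
    eq : ∀ c f g r → c * f * g + c * r ≡ c * (f * g + r)
    eq = solve-∀ ℚ-ring

  conv-*ʳ : ∀ c f g N → conv f (λ i → c * g i) N ≡ c * conv f g N
  conv-*ʳ c f g zero    = eq c (f 0) (g 0)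
    where
    eq : ∀ c f g → f * (c * g) ≡ c * (f * g)
    eq = solve-∀ ℚ-ring
  conv-*ʳ c f g (suc N) = trans (cong (f 0 * (c * g (suc N)) +_) (conv-*ʳ c (f ∘ suc) g N)) (eq c (f 0) (g (suc N)) (conv (f ∘ suc) g N))
    where
    eq : ∀ c f g r → f * (c * g) + c * r ≡ c * (f * g + r)
    eq = solve-∀ ℚ-ring

  -- Product rule for formal power series, with `δ` the coefficient form of the derivative.
  leibniz : ∀ f g N → ι (suc N) * conv f g (suc N) ≡ conv (δ f) g N + conv f (δ g) N
  leibniz f g zero    = eq (f 0) (f 1) (g 0) (g 1)
    where
    eq : ∀ a b c d → 1ℚ * (a * d + b * c) ≡ 1ℚ * b * c + a * (1ℚ * d)
    eq = solve-∀ ℚ-ring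
  leibniz f g (suc N) = begin
    ι (2 ℕ.+ N) * (f 0 * g (2 ℕ.+ N) + conv f₁ g (suc N))
      ≡⟨ trans (*-distribˡ-+ (ι (2 ℕ.+ N)) (f 0 * g (2 ℕ.+ N)) (conv f₁ g (suc N)))
           (cong (ι (2 ℕ.+ N) * (f 0 * g (2 ℕ.+ N)) +_) (trans (cong (_* conv f₁ g (suc N)) (ι-suc (suc N))) (trans (*-distribʳ-+ (conv f₁ g (suc N)) 1ℚ (ι (suc N)))
             (cong₂ _+_ (*-identityˡ (conv f₁ g (suc N))) (leibniz f₁ g N))))) ⟩
    ι (2 ℕ.+ N) * (f 0 * g (2 ℕ.+ N)) + (f 1 * g (suc N) + conv (f₁ ∘ suc) g N + (conv (δ f₁) g N + conv f₁ (δ g) N))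
      ≡⟨ eq (ι (2 ℕ.+ N)) (f 0) (g (2 ℕ.+ N)) (f 1) (g (suc N)) (conv (f₁ ∘ suc) g N) (conv (δ f₁) g N) (conv f₁ (δ g) N) ⟩
    (1ℚ * f 1 * g (suc N) + (conv (f₁ ∘ suc) g N + conv (δ f₁) g N)) + (f 0 * (ι (2 ℕ.+ N) * g (2 ℕ.+ N)) + conv f₁ (δ g) N)
      ≡⟨ cong (λ c → (1ℚ * f 1 * g (suc N) + c) + (f 0 * (ι (2 ℕ.+ N) * g (2 ℕ.+ N)) + conv f₁ (δ g) N))
           (sym (trans (conv-cong {g = g} {g′ = g} (λ i → δ-suc i) (λ _ → refl) N) (conv-+ˡ (f₁ ∘ suc) (δ f₁) g N))) ⟩
    conv (δ f) g (suc N) + conv f (δ g) (suc N) ∎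
    where
    open ≡-Reasoning
    f₁ = f ∘ suc
    δ-suc : ∀ i → δ f (suc i) ≡ f₁ (suc i) + δ f₁ i
    δ-suc i = trans (cong (_* f (2 ℕ.+ i)) (ι-suc (suc i))) (trans (*-distribʳ-+ (f (2 ℕ.+ i)) 1ℚ (ι (suc i))) (cong (_+ ι (suc i) * f (2 ℕ.+ i)) (*-identityˡ (f (2 ℕ.+ i)))))
    eq : ∀ n a g b h c d e → n * (a * g) + (b * h + c + (d + e)) ≡ (1ℚ * b * h + (c + d)) + (a * (n * g) + e)
    eq = solve-∀ ℚ-ring

  -- The binomial theorem divided by N!, obtained from the differential equation: `leibniz` makes
  -- both sides satisfy (N + 1) u (N + 1) = (a + c) u N.
  conv-D : ∀ a c N → conv (λ k → D k a) (λ k → D k c) N ≡ D N (a + c)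
  conv-D a c zero    = refl
  conv-D a c (suc N) = *-cancelˡ-≡ (0<ι N) (begin
    ι (suc N) * conv f g (suc N)
      ≡⟨ leibniz f g N ⟩
    conv (δ f) g N + conv f (δ g) N
      ≡⟨ cong₂ _+_ (trans (conv-cong {g = g} {g′ = g} (λ i → D-suc i a) (λ _ → refl) N) (conv-*ˡ a f g N))
                   (trans (conv-cong {f} {f} (λ _ → refl) (λ i → D-suc i c) N) (conv-*ʳ c f g N)) ⟩
    a * conv f g N + c * conv f g N
      ≡⟨ trans (sym (*-distribʳ-+ (conv f g N) a c)) (cong ((a + c) *_) (conv-D a c N)) ⟩
    (a + c) * D N (a + c)
      ≡⟨ sym (D-suc N (a + c)) ⟩
    ι (suc N) * D (suc N) (a + c) ∎)
    where
    open ≡-Reasoning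
    f g : ℕ → ℚ
    f k = D k a
    g k = D k c

  T-snoc : ∀ f g N → T f g (suc N) ≡ T f g N + conv f g N
  T-snoc f g zero    = eq (f 0) (g 0)
    where
    eq : ∀ a b → a * (b + 0ℚ) + 0ℚ ≡ 0ℚ + a * b
    eq = solve-∀ ℚ-ring
  T-snoc f g (suc N) = trans (cong₂ (λ p q → f 0 * p + q) (PS-snoc g (suc N)) (T-snoc (f ∘ suc) g N))
    (eq (f 0) (PS g (suc N)) (g (suc N)) (T (f ∘ suc) g N) (conv (f ∘ suc) g N))
    where
    eq : ∀ a p g t c → a * (p + g) + (t + c) ≡ a * p + t + (a * g + c)
    eq = solve-∀ ℚ-ring

  T-E : ∀ a c N → T (λ k → D k a) (λ k → D k c) N ≡ E N (a + c)
  T-E a c zero    = refl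
  T-E a c (suc N) = trans (T-snoc (λ k → D k a) (λ k → D k c) N)
    (trans (cong₂ _+_ (T-E a c N) (conv-D a c N)) (sym (PS-snoc (λ k → D k (a + c)) N)))

  -- The error consists of the products outside the triangle, and each is dominated by the
  -- corresponding product of majorants.
  remainder-majorant : ∀ {f f̂ g ĝ} → (∀ i → ∣ f i ∣ ≤ f̂ i) → (∀ i → ∣ g i ∣ ≤ ĝ i) → ∀ {N M} → N ℕ.≤ M →
                       ∣ PS f N * PS g M - T f g N ∣ ≤ PS f̂ N * PS ĝ M - T f̂ ĝ N
  remainder-majorant {g = g} {ĝ} hf hg {zero} {M} _ = ≤-reflexive (trans (cong ∣_∣ (eq (PS g M))) (sym (eq (PS ĝ M))))
    where
    eq : ∀ a → 0ℚ * a - 0ℚ ≡ 0ℚ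
    eq = solve-∀ ℚ-ring
  remainder-majorant {f} {f̂} {g} {ĝ} hf hg {suc N} {M} p = begin
    ∣ (f 0 + PS (f ∘ suc) N) * PS g M - (f 0 * PS g (suc N) + T (f ∘ suc) g N) ∣
      ≡⟨ cong ∣_∣ (eq (f 0) (PS (f ∘ suc) N) (PS g M) (PS g (suc N)) (T (f ∘ suc) g N)) ⟩
    ∣ f 0 * (PS g M - PS g (suc N)) + (PS (f ∘ suc) N * PS g M - T (f ∘ suc) g N) ∣
      ≤⟨ ∣p+q∣≤∣p∣+∣q∣ (f 0 * (PS g M - PS g (suc N))) (PS (f ∘ suc) N * PS g M - T (f ∘ suc) g N) ⟩
    ∣ f 0 * (PS g M - PS g (suc N)) ∣ + ∣ PS (f ∘ suc) N * PS g M - T (f ∘ suc) g N ∣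
      ≤⟨ +-mono-≤ (≤-trans (≤-reflexive (∣p*q∣≡∣p∣*∣q∣ (f 0) (PS g M - PS g (suc N))))
           (*-mono (≤-trans (0≤∣p∣ (f 0)) (hf 0)) (0≤∣p∣ (PS g M - PS g (suc N))) (hf 0) (PS-diff hg p)))
           (remainder-majorant (hf ∘ suc) hg (ℕ.<⇒≤ p)) ⟩
    f̂ 0 * (PS ĝ M - PS ĝ (suc N)) + (PS (f̂ ∘ suc) N * PS ĝ M - T (f̂ ∘ suc) ĝ N)
      ≡⟨ sym (eq (f̂ 0) (PS (f̂ ∘ suc) N) (PS ĝ M) (PS ĝ (suc N)) (T (f̂ ∘ suc) ĝ N)) ⟩
    (f̂ 0 + PS (f̂ ∘ suc) N) * PS ĝ M - (f̂ 0 * PS ĝ (suc N) + T (f̂ ∘ suc) ĝ N) ∎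
    where
    open ≤-Reasoning
    eq : ∀ a p x y t → (a + p) * x - (a * y + t) ≡ a * (x - y) + (p * x - t)
    eq = solve-∀ ℚ-ring

  square≤T : ∀ {f g} → (∀ i → 0ℚ ≤ f i) → (∀ i → 0ℚ ≤ g i) → ∀ h h′ {N} → h ℕ.+ h′ ℕ.≤ N → PS f h * PS g h′ ≤ T f g N
  square≤T {f} {g} pf pg zero h′ {N} p = ≤-trans (≤-reflexive (*-zeroˡ (PS g h′))) (0≤T pf N)
    where
    0≤T : ∀ {f} → (∀ i → 0ℚ ≤ f i) → ∀ N → 0ℚ ≤ T f g N
    0≤T pf zero    = ≤-refl
    0≤T pf (suc N) = 0≤+ (0≤* (pf 0) (0≤PS pg (suc N))) (0≤T (pf ∘ suc) N)
  square≤T {f} {g} pf pg (suc h) h′ {suc N} (ℕ.s≤s p) = ≤-trans (≤-reflexive (*-distribʳ-+ (PS g h′) (f 0) (PS (f ∘ suc) h)))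
    (+-mono-≤ (*-monoˡ (pf 0) (PS-mono pg (ℕ.≤-trans (ℕ.m≤n+m h′ h) (ℕ.≤-trans p (ℕ.n≤1+n N))))) (square≤T (pf ∘ suc) pg h h′ p))

  abstract
    -- By `T-E` the difference is a square minus a triangle. For 2h ≤ N the triangle contains a
    -- square of side h, so the error is at most E N b ² - E h b ², small because E N b converges.
    E-additive : ∀ B ε → 0ℚ < ε → ∃ λ N₀ → ∀ N → N₀ ℕ.≤ N → ∀ {a c} → ∣ a ∣ ≤ ι B → ∣ c ∣ ≤ ι B →
                 ∣ E N a * E N c - E N (a + c) ∣ ≤ ε
    E-additive B ε 0<ε =
      let G , hG = E-bounded B
          δ , 0<δ , δ≤ = share (2 ℕ.* G) 0<ε
          h , hh = E-cauchyᵇ B δ 0<δ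
      in h ℕ.+ h , λ N p a≤ c≤ → ≤-trans (bound G hG N h p (<⇒≤ 0<δ) (hh N (ℕ.≤-trans (ℕ.m≤m+n h h) p)) a≤ c≤) δ≤
      where
      b : ℚ
      b = ι B
      bound : ∀ G → (∀ N → E N b ≤ ι G) → ∀ N h → h ℕ.+ h ℕ.≤ N → ∀ {δ} → 0ℚ ≤ δ → E N b - E h b ≤ δ → ∀ {a c} → ∣ a ∣ ≤ b → ∣ c ∣ ≤ b →
              ∣ E N a * E N c - E N (a + c) ∣ ≤ ι (2 ℕ.* G) * δ
      bound G hG N h p {δ} 0≤δ diff {a} {c} a≤ c≤ = begin
        ∣ E N a * E N c - E N (a + c) ∣
          ≡⟨ cong (λ t → ∣ E N a * E N c - t ∣) (sym (T-E a c N)) ⟩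
        ∣ E N a * E N c - T (λ k → D k a) (λ k → D k c) N ∣
          ≤⟨ remainder-majorant (D-majorant a≤) (D-majorant c≤) (ℕ.≤-refl {N}) ⟩
        E N b * E N b - T (λ k → D k b) (λ k → D k b) N
          ≤⟨ +-monoʳ-≤ (E N b * E N b) (neg-antimono-≤ (square≤T 0≤Db 0≤Db h h p)) ⟩
        E N b * E N b - E h b * E h b
          ≡⟨ factor (E N b) (E h b) ⟩
        (E N b + E h b) * (E N b - E h b)
          ≤⟨ *-mono (0≤+ (0≤ι G) (0≤ι G)) (p≤q⇒0≤q-p (PS-mono 0≤Db (ℕ.≤-trans (ℕ.m≤m+n h h) p))) (+-mono-≤ (hG N) (hG h)) diff ⟩
        (ι G + ι G) * δ
          ≡⟨ cong (_* δ) (trans (sym (ι-+ G G)) (cong (λ z → ι (G ℕ.+ z)) (sym (ℕ.+-identityʳ G)))) ⟩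
        ι (2 ℕ.* G) * δ ∎
        where
        open ≤-Reasoning
        0≤Db : ∀ k → 0ℚ ≤ D k b
        0≤Db k = 0≤D k (0≤ι B)
        factor : ∀ x y → x * x - y * y ≡ (x + y) * (x - y)
        factor = solve-∀ ℚ-ring

  D-mono : ∀ k {a c} → 0ℚ ≤ a → a ≤ c → D k a ≤ D k c
  D-mono zero    _   _   = ≤-refl
  D-mono (suc k) 0≤a a≤c = *-monoˡ (0≤rec (suc k)) (*-mono (≤-trans 0≤a a≤c) (0≤D k 0≤a) a≤c (D-mono k 0≤a a≤c))

  -- The linear term alone gives slope 1 on nonnegative arguments, so the inverse of a Taylor sum
  -- does not expand distances. Order at least 2 ensures that the linear term is present.
  E-expanding : ∀ N {a c} → 0ℚ ≤ a → a ≤ c → c - a ≤ E (2 ℕ.+ N) c - E (2 ℕ.+ N) a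
  E-expanding N {a} {c} 0≤a a≤c = 0≤q-p⇒p≤q (subst (0ℚ ≤_)
      (eq a c (PS (λ k → D (2 ℕ.+ k) a) N) (PS (λ k → D (2 ℕ.+ k) c) N))
      (p≤q⇒0≤q-p (mono N (λ k → D-mono (2 ℕ.+ k) 0≤a a≤c))))
    where
    mono : ∀ N {f g} → (∀ k → f k ≤ g k) → PS f N ≤ PS g N
    mono zero    h = ≤-refl
    mono (suc N) h = +-mono-≤ (h 0) (mono N (h ∘ suc))
    eq : ∀ a c x y → y - x ≡ 1ℚ + (1ℚ * (c * 1ℚ) + y) - (1ℚ + (1ℚ * (a * 1ℚ) + x)) - (c - a)
    eq = solve-∀ ℚ-ring

  E-0 : ∀ N → E (suc N) 0ℚ ≡ 1ℚ
  E-0 N = trans (cong (1ℚ +_) (zeros N)) refl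
    where
    D0 : ∀ k → D (suc k) 0ℚ ≡ 0ℚ
    D0 k = trans (cong (rec (suc k) *_) (*-zeroˡ (D k 0ℚ))) (*-zeroʳ (rec (suc k)))
    PS0 : ∀ N → PS (λ _ → 0ℚ) N ≡ 0ℚ
    PS0 zero    = refl
    PS0 (suc N) = trans (+-identityˡ (PS (λ _ → 0ℚ) N)) (PS0 N)
    zeros : ∀ N → PS (λ k → D (suc k) 0ℚ) N ≡ 0ℚ
    zeros N = trans (PS-cong D0 N) (PS0 N)

  1+q≤E : ∀ N {q} → 0ℚ ≤ q → 1ℚ + q ≤ E (2 ℕ.+ N) q
  1+q≤E N {q} 0≤q = 0≤q-p⇒p≤q (subst (0ℚ ≤_) (trans (cong (λ e → E (2 ℕ.+ N) q - e - (q - 0ℚ)) (E-0 (suc N))) (eq (E (2 ℕ.+ N) q) q))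
      (p≤q⇒0≤q-p (E-expanding N ≤-refl 0≤q)))
    where
    eq : ∀ e q → e - 1ℚ - (q - 0ℚ) ≡ e - (1ℚ + q)
    eq = solve-∀ ℚ-ring

-- Exponential and logarithm of Cauchy reals

module ExpLog where
  open import Data.Fin using (toℕ)
  open import Data.Rational hiding (NonZero)
  open import Data.Rational.Properties
  open import Data.Empty using (⊥)
  import Defs
  open import Defs using (ℝ; seq; cauchy; fromℚ; 0ℝ; 1ℝ; module ℝΣ)
  open Rationals
  open FiniteSums using (∑; ∑-cong)
  open Reals
  open ExponentialSums

  seq-∑ : ∀ {n} (f : Fin n → ℝ) j → seq (ℝΣ.sum f) j ≡ ∑ (λ i → seq (f i) j)
  seq-∑ {zero}  f j = refl
  seq-∑ {suc n} f j = cong (seq (f zero) j +_) (seq-∑ (f ∘ suc) j)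

  seq-^ : ∀ t k j → seq (t ℝΣ.^ k) j ≡ seq t j ^ k
  seq-^ t zero    j = refl
  seq-^ t (suc k) j = cong (seq t j *_) (seq-^ t k j)

  ^/! : ∀ k q → q ^ k * (ℤ.+ 1 / (k !)) {{k ℕ.!≢0}} ≡ D k q
  ^/! k q = *-cancelˡ-≡ (0<ι′ (k !) {{k ℕ.!≢0}}) (trans (eq (ι (k !)) (q ^ k) ((ℤ.+ 1 / (k !)) {{k ℕ.!≢0}}))
      (trans (cong (q ^ k *_) (/-*-ι 1 (k !) {{k ℕ.!≢0}})) (trans (*-identityʳ (q ^ k)) (sym (k!D k)))))
    where
    eq : ∀ a b c → a * (b * c) ≡ b * (c * a)
    eq = solve-∀ ℚ-ring
    eq′ : ∀ a b c → a * b * c ≡ b * (a * c)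
    eq′ = solve-∀ ℚ-ring
    swap : ∀ a b c → a * (b * c) ≡ b * (a * c)
    swap = solve-∀ ℚ-ring
    k!D : ∀ k → ι (k !) * D k q ≡ q ^ k
    k!D zero    = refl
    k!D (suc k) = trans (cong (_* D (suc k) q) (ι-* (suc k) (k !))) (trans (eq′ (ι (suc k)) (ι (k !)) (D (suc k) q))
      (trans (cong (ι (k !) *_) (D-suc k q)) (trans (swap (ι (k !)) q (D k q)) (cong (q *_) (k!D k)))))

  ∑-PS : ∀ n (f : ℕ → ℚ) → ∑ {n} (λ k → f (toℕ k)) ≡ PS f n
  ∑-PS zero    f = refl
  ∑-PS (suc n) f = cong (f 0 +_) (∑-PS n (f ∘ suc))

  partialSum : ℝ → ℕ → ℝ
  partialSum t N = ℝΣ.sum {N} (λ k → (t ℝΣ.^ toℕ k) Defs.* fromℚ ((ℤ.+ 1 / (toℕ k !)) {{toℕ k ℕ.!≢0}}))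

  seq-partialSum : ∀ t N j → seq (partialSum t N) j ≡ E N (seq t j)
  seq-partialSum t N j = trans (seq-∑ {N} _ j)
    (trans (∑-cong {N} (λ k → trans (cong (_* (ℤ.+ 1 / (toℕ k !)) {{toℕ k ℕ.!≢0}}) (seq-^ t (toℕ k) j)) (^/! (toℕ k) (seq t j))))
      (∑-PS N (λ k → D k (seq t j))))

  -- Change the order of the sum first, by uniform convergence on bounded sets, and then the
  -- argument, by the uniform Lipschitz bound.
  exp-cauchy : ∀ t ε → 0ℚ < ε → ∃ λ N → ∀ m n → N ℕ.≤ m → N ℕ.≤ n → ∣ E m (seq t m) - E n (seq t n) ∣ ≤ ε
  exp-cauchy t ε 0<ε =
    let B , N₁ , hB = bounded t
        G , hG = E-bounded B
        δ , 0<δ , δ≤ = share (suc G) 0<ε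
        N₂ , h = E-cauchy B δ 0<δ
        N₃ , c = cauchy t δ 0<δ
    in N₁ ℕ.⊔ (N₂ ℕ.⊔ N₃) , λ m n p q →
       let m₁ = ℕ.m⊔n≤o⇒m≤o N₁ (N₂ ℕ.⊔ N₃) p
           n₁ = ℕ.m⊔n≤o⇒m≤o N₁ (N₂ ℕ.⊔ N₃) q
           m₂₃ = ℕ.m⊔n≤o⇒n≤o N₁ (N₂ ℕ.⊔ N₃) p
           n₂₃ = ℕ.m⊔n≤o⇒n≤o N₁ (N₂ ℕ.⊔ N₃) q
       in ≤-trans (∣-∣-triangle (E m (seq t m)) (E n (seq t m)) (E n (seq t n)))
         (≤-trans (+-mono-≤ (h m n (ℕ.m⊔n≤o⇒m≤o N₂ N₃ m₂₃) (ℕ.m⊔n≤o⇒m≤o N₂ N₃ n₂₃) (hB m m₁))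
           (≤-trans (E-lipschitz B n (hB m m₁) (hB n n₁)) (*-mono (<⇒≤ 0<δ) (0≤PS (λ k → 0≤D k (0≤ι B)) n)
             (<⇒≤ (c m n (ℕ.m⊔n≤o⇒n≤o N₂ N₃ m₂₃) (ℕ.m⊔n≤o⇒n≤o N₂ N₃ n₂₃))) (hG n))))
           (≤-trans (≤-reflexive (trans (eq δ (ι G)) (cong (_* δ) (sym (ι-suc G))))) δ≤))
    where
    eq : ∀ d g → d + d * g ≡ (1ℚ + g) * d
    eq = solve-∀ ℚ-ring

  opaque
    exp : ℝ → ℝ
    exp t = limit (λ k → E k (seq t k)) (exp-cauchy t)

  opaque
    unfolding exp _+ᴿ_

    exp-cong : ∀ {s t} → s ≈ t → exp s ≈ exp t
    exp-cong {s} {t} (eqv h) = eqv λ ε 0<ε →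
      let B , b = bounded s
          B′ , b′ = bounded t
          G , hG = E-bounded (B ℕ.+ B′)
          δ , 0<δ , δ≤ = share G 0<ε
      in (b ∧ b′ ∧ h δ 0<δ) <&> λ {n} (p , q , c) →
         ≤-trans (E-lipschitz (B ℕ.+ B′) n (≤-trans p (ι-mono (ℕ.m≤m+n B B′))) (≤-trans q (ι-mono (ℕ.m≤n+m B′ B))))
           (≤-trans (*-mono (<⇒≤ 0<δ) (0≤PS (λ k → 0≤D k (0≤ι (B ℕ.+ B′))) n) c (hG n)) (≤-trans (≤-reflexive (*-comm δ (ι G))) δ≤))

    exp-+ : ∀ s t → exp (s +ᴿ t) ≈ exp s *ᴿ exp t
    exp-+ s t = ≈-sym (eqv λ ε 0<ε →
      let B , b = bounded s
          B′ , b′ = bounded t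
          N , h = E-additive (B ℕ.+ B′) ε 0<ε
      in (b ∧ b′ ∧ (N , λ n p → p)) <&> λ {n} (p , q , N≤n) →
         h n N≤n (≤-trans p (ι-mono (ℕ.m≤m+n B B′))) (≤-trans q (ι-mono (ℕ.m≤n+m B′ B))))

    exp-0 : exp 0ℝ ≈ 1ℝ
    exp-0 = eventually-≡ (1 , λ { (suc n) _ → E-0 n })

    0≤sqᴿ : ∀ x → 0ℝ ≤ᴿ x *ᴿ x
    0≤sqᴿ x = pointwise-≤ (λ n → 0≤sq (seq x n))

    -- Approximations of u may be slightly negative; then the Lipschitz bound compares with the
    -- value 1 at 0.
    1≤exp : ∀ {u} → 0ℝ ≤ᴿ u → 1ℝ ≤ᴿ exp u
    1≤exp {u} h = leq λ ε 0<ε →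
      let B , b = bounded u
          G , hG = E-bounded B
          δ , 0<δ , δ≤ = share G 0<ε
      in (b ∧ 0≤⇒ {u} h δ 0<δ ∧ (2 , λ n p → p)) <&> λ {n} (p , q , 2≤n) → cases B G hG n 2≤n (<⇒≤ 0<ε) (<⇒≤ 0<δ) δ≤ p q (≤-total 0ℚ (seq u n))
      where
      cases : ∀ B G → (∀ N → E N (ι B) ≤ ι G) → ∀ n → 2 ℕ.≤ n → ∀ {ε δ} → 0ℚ ≤ ε → 0ℚ ≤ δ → ι G * δ ≤ ε → ∀ {q} → ∣ q ∣ ≤ ι B → - δ ≤ q →
              (0ℚ ≤ q) ⊎ (q ≤ 0ℚ) → 1ℚ ≤ E n q + ε
      cases B G hG (suc (suc n)) (ℕ.s≤s (ℕ.s≤s _)) {ε} 0≤ε 0≤δ δ≤ {q} _ _ (inj₁ 0≤q) =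
        ≤-trans (≤-trans (subst (_≤ 1ℚ + q) (+-identityʳ 1ℚ) (+-monoʳ-≤ 1ℚ 0≤q)) (1+q≤E n 0≤q))
          (subst (_≤ E (2 ℕ.+ n) q + ε) (+-identityʳ (E (2 ℕ.+ n) q)) (+-monoʳ-≤ (E (2 ℕ.+ n) q) 0≤ε))
      cases B G hG n@(suc (suc n-2)) (ℕ.s≤s (ℕ.s≤s _)) {ε} {δ} 0≤ε 0≤δ δ≤ {q} q≤ δ≤q (inj₂ q≤0) = ∣∣≤⇒ {1ℚ} {E n q} (begin
        ∣ 1ℚ - E n q ∣            ≡⟨ cong (λ e → ∣ e - E n q ∣) (sym (E-0 (suc n-2))) ⟩
        ∣ E n 0ℚ - E n q ∣        ≤⟨ E-lipschitz B n (0≤ι B) q≤ ⟩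
        ∣ 0ℚ - q ∣ * E n (ι B)    ≤⟨ *-mono 0≤δ (0≤PS (λ k → 0≤D k (0≤ι B)) n) (∣∣-≤ (subst₂ _≤_ (sym (+-identityˡ (- q))) (neg-neg δ) (neg-antimono-≤ δ≤q))
                                       (≤-trans (neg-antimono-≤ 0≤δ) (p≤q⇒0≤q-p q≤0))) (hG n) ⟩
        δ * ι G                   ≡⟨ *-comm δ (ι G) ⟩
        ι G * δ                   ≤⟨ δ≤ ⟩
        ε                         ∎)
        where
        open ≤-Reasoning
        neg-neg : ∀ a → - - a ≡ a
        neg-neg = solve-∀ ℚ-ring

    exp≤1⇒≤0 : ∀ {u} → exp u ≤ᴿ 1ℝ → u ≤ᴿ 0ℝ
    exp≤1⇒≤0 {u} (leq h) = leq λ ε 0<ε → (h ε 0<ε ∧ (2 , λ n p → p)) <&> λ {n} (p , 2≤n) →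
        subst (seq u n ≤_) (sym (+-identityˡ ε)) (bound n 2≤n 0<ε p)
      where
      bound : ∀ n → 2 ℕ.≤ n → ∀ {ε q} → 0ℚ < ε → E n q ≤ 1ℚ + ε → q ≤ ε
      bound (suc (suc n)) (ℕ.s≤s (ℕ.s≤s _)) {ε} {q} 0<ε h with ≤-total 0ℚ q
      ... | inj₂ q≤0 = ≤-trans q≤0 (<⇒≤ 0<ε)
      ... | inj₁ 0≤q = subst₂ _≤_ (cancel q) (cancel ε) (+-monoʳ-≤ (- 1ℚ) (≤-trans (1+q≤E n 0≤q) h))
        where
        cancel : ∀ a → - 1ℚ + (1ℚ + a) ≡ a
        cancel = solve-∀ ℚ-ring

    half-sum : ∀ t → fromℚ ½ *ᴿ t +ᴿ fromℚ ½ *ᴿ t ≈ t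
    half-sum t = pointwise (λ n → halves (seq t n))

    add-sub : ∀ s t → s +ᴿ (t -ᴿ s) ≈ t
    add-sub s t = pointwise (λ n → eq (seq s n) (seq t n))
      where
      eq : ∀ a b → a + (b + - a) ≡ b
      eq = solve-∀ ℚ-ring

    sub-add : ∀ s t → (s -ᴿ t) +ᴿ t ≈ s
    sub-add s t = pointwise (λ n → eq (seq s n) (seq t n))
      where
      eq : ∀ a b → a + - b + b ≡ a
      eq = solve-∀ ℚ-ring

    *ᴿ-identityʳ : ∀ x → x *ᴿ 1ℝ ≈ x
    *ᴿ-identityʳ x = pointwise (λ n → *-identityʳ (seq x n))

    isExp : ∀ {t y} → y ≈ exp t → Defs.IsExp t y
    isExp {t} {y} (eqv h) ε 0<ε =
      let B , b = bounded t
          N , c = E-cauchy B (½ * ε) (half 0<ε)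
      in N , λ n N≤n →
        let close : Ev (λ j → ∣ seq (partialSum t n) j - seq y j ∣ ≤ ε)
            close = (b ∧ h (½ * ε) (half 0<ε) ∧ (N , λ j p → p)) <&> λ {j} (p , q , N≤j) →
              ≤-trans (∣-∣-triangle (seq (partialSum t n) j) (E j (seq t j)) (seq y j))
                (subst (_ ≤_) (halves ε) (+-mono-≤ (subst (λ a → ∣ a - E j (seq t j) ∣ ≤ ½ * ε) (sym (seq-partialSum t n j)) (c n j N≤n N≤j p))
                  (subst (_≤ ½ * ε) (∣-∣-sym (seq y j) (E j (seq t j))) q)))
            weaken : ∀ {a ε ε′} → 0ℚ < ε′ → a ≤ ε → a ≤ ε + ε′
            weaken {a} {ε} {ε′} 0<ε′ p = ≤-trans p (subst (_≤ ε + ε′) (+-identityʳ ε) (+-monoʳ-≤ ε (<⇒≤ 0<ε′)))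
        in (λ ε′ 0<ε′ → close <&> λ {j} p → weaken 0<ε′ (≤-trans (p≤∣p∣ _) p)) ,
           (λ ε′ 0<ε′ → close <&> λ {j} p → weaken 0<ε′ (≤-trans (p≤∣p∣ _) (subst (_≤ ε) (∣-∣-sym (seq (partialSum t n) j) (seq y j)) p)))

    -- Limits are unique: one sufficiently long partial sum is close to both y and `exp t`.
    isExp⁻¹ : ∀ {t y} → Defs.IsExp t y → y ≈ exp t
    isExp⁻¹ {t} {y} h = eqv λ ε 0<ε →
      let δ , 0<δ , δ≤ = share 3 0<ε
          N , c = h δ 0<δ
          N′ , c′ = isExp {t} (≈-refl {exp t}) δ 0<δ
          M = N ℕ.⊔ N′
          u₁ = proj₁ (c M (ℕ.m≤m⊔n N N′)) (½ * δ) (half 0<δ)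
          u₂ = proj₂ (c M (ℕ.m≤m⊔n N N′)) (½ * δ) (half 0<δ)
          v₁ = proj₁ (c′ M (ℕ.m≤n⊔m N N′)) (½ * δ) (half 0<δ)
          v₂ = proj₂ (c′ M (ℕ.m≤n⊔m N N′)) (½ * δ) (half 0<δ)
      in (u₁ ∧ u₂ ∧ v₁ ∧ v₂) <&> λ {j} (p₁ , p₂ , q₁ , q₂) →
         ⇒∣∣≤ {seq y j} {seq (exp t) j} (chain (seq y j) (seq (partialSum t M) j) (seq (exp t) j) δ δ≤ p₂ q₁)
           (chain (seq (exp t) j) (seq (partialSum t M) j) (seq y j) δ δ≤ q₂ p₁)
      where
      chain : ∀ a s b δ {ε} → ι 3 * δ ≤ ε → a + - s ≤ δ + ½ * δ → s + - b ≤ δ + ½ * δ → a ≤ b + ε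
      chain a s b δ δ≤ p q = ≤-trans (≤-reflexive (eq₁ a s b)) (+-monoʳ-≤ b (≤-trans (+-mono-≤ p q) (≤-trans (≤-reflexive (eq₂ δ)) δ≤)))
        where
        eq₁ : ∀ a s b → a ≡ b + (a + - s + (s + - b))
        eq₁ = solve-∀ ℚ-ring
        eq₂ : ∀ δ → δ + ½ * δ + (δ + ½ * δ) ≡ ι 3 * δ
        eq₂ = solve-∀ ℚ-ring

  -- The exponential is the square of its value at t/2.
  0≤exp : ∀ t → 0ℝ ≤ᴿ exp t
  0≤exp t = ≤ᴿ-trans (0≤sqᴿ (exp (fromℚ ½ *ᴿ t)))
    (≈⇒≤ (≈-trans (≈-sym (exp-+ (fromℚ ½ *ᴿ t) (fromℚ ½ *ᴿ t))) (exp-cong (half-sum t))))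

  exp-mono : ∀ {s t} → s ≤ᴿ t → exp s ≤ᴿ exp t
  exp-mono {s} {t} h = ≤ᴿ-trans (≈⇒≤ (≈-sym (*ᴿ-identityʳ (exp s))))
    (≤ᴿ-trans (*ᴿ-monoˡ (0≤exp s) (1≤exp (≤⇒0≤- h))) (≈⇒≤ (≈-trans (≈-sym (exp-+ s (t -ᴿ s))) (exp-cong (add-sub s t)))))

  exp-neg : ∀ t → exp t *ᴿ exp (-ᴿ t) ≈ 1ℝ
  exp-neg t = ≈-trans (≈-sym (exp-+ t (-ᴿ t))) (≈-trans (exp-cong (≈-trans (+ᴿ-comm t (-ᴿ t)) (+ᴿ-inverseˡ t))) exp-0)

  exp-cancel : ∀ {s t} → exp s ≤ᴿ exp t → s ≤ᴿ t
  exp-cancel {s} {t} h = ≤ᴿ-trans (≈⇒≤ (≈-sym (sub-add s t))) (≤ᴿ-trans (+ᴿ-mono (exp≤1⇒≤0 bound) ≤ᴿ-refl) (≈⇒≤ (+ᴿ-identityˡ t)))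
    where
    bound : exp (s -ᴿ t) ≤ᴿ 1ℝ
    bound = ≤ᴿ-trans (≈⇒≤ (exp-+ s (-ᴿ t))) (≤ᴿ-trans (*ᴿ-mono (0≤exp t) (0≤exp (-ᴿ t)) h ≤ᴿ-refl) (≈⇒≤ (exp-neg t)))

  -- The k-th approximation of ln y is the last multiple of 1 / (k + 1) at which the Taylor sum does not exceed y.
  private
    locate : ∀ {P : ℕ → Set} → (∀ i → Dec (P i)) → P 0 → ∀ n → (P n → ⊥) → ∃ λ i → P i × (P (suc i) → ⊥)
    locate P? p₀ zero    ¬pₙ = contradiction p₀ ¬pₙ
    locate P? p₀ (suc n) ¬pₙ with P? n
    ... | yes p = n , p , ¬pₙ
    ... | no ¬p = locate P? p₀ n ¬p

    abstract
      grid : ∀ k y → 1ℚ ≤ y → ∃ λ q → (0ℚ ≤ q) × (E (2 ℕ.+ k) q ≤ y) × (y ≤ E (2 ℕ.+ k) (q + rec (suc k)))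
      grid k y 1≤y =
        let A , y≤A = archimedean y
            i , p , ¬p = locate (λ i → E (2 ℕ.+ k) (ι i * η) ≤? y) start (A ℕ.* suc k) (finish A y≤A)
        in ι i * η , 0≤* (0≤ι i) (0≤rec (suc k)) , p , <⇒≤ (≰⇒> (λ h → ¬p (subst (λ q → E (2 ℕ.+ k) q ≤ y) (step i) h)))
        where
        η : ℚ
        η = rec (suc k)
        start : E (2 ℕ.+ k) (ι 0 * η) ≤ y
        start = subst (_≤ y) (sym (trans (cong (E (2 ℕ.+ k)) (*-zeroˡ η)) (E-0 (suc k)))) 1≤y
        step : ∀ i → ι i * η + η ≡ ι (suc i) * η
        step i = trans (eq (ι i) η) (cong (_* η) (sym (ι-suc i)))
          where
          eq : ∀ a b → a * b + b ≡ (1ℚ + a) * b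
          eq = solve-∀ ℚ-ring
        finish : ∀ A → y ≤ ι A → E (2 ℕ.+ k) (ι (A ℕ.* suc k) * η) ≤ y → ⊥
        finish A y≤A h = <-irrefl refl (≤-<-trans (≤-trans (1+q≤E k (0≤ι A)) (subst (λ q → E (2 ℕ.+ k) q ≤ y) A≡ h))
            (≤-<-trans y≤A (subst (_< 1ℚ + ι A) (+-identityˡ (ι A)) (+-monoˡ-< (ι A) 0<1))))
          where
          eq : ∀ a b c → a * b * c ≡ a * (c * b)
          eq = solve-∀ ℚ-ring
          A≡ : ι (A ℕ.* suc k) * η ≡ ι A
          A≡ = trans (cong (_* η) (ι-* A (suc k))) (trans (eq (ι A) (ι (suc k)) η) (trans (cong (ι A *_) (rec-inverse (suc k))) (*-identityʳ (ι A))))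

    -- Approximations of a real y ≥ 1 may fall below 1, where not even the grid point 0 qualifies;
    -- they are raised to 1 first.
    max₁ : ℚ → ℚ
    max₁ y with 1ℚ ≤? y
    ... | yes _ = y
    ... | no  _ = 1ℚ

    1≤max₁ : ∀ y → 1ℚ ≤ max₁ y
    1≤max₁ y with 1ℚ ≤? y
    ... | yes p = p
    ... | no  _ = ≤-refl

    max₁-close : ∀ {y ε} → 0ℚ ≤ ε → 1ℚ ≤ y + ε → ∣ max₁ y - y ∣ ≤ ε
    max₁-close {y} {ε} 0≤ε h with 1ℚ ≤? y
    ... | yes _ = subst (_≤ ε) (sym (cong ∣_∣ (+-inverseʳ y))) 0≤ε
    ... | no  p = ⇒∣∣≤ h (≤-trans (<⇒≤ (≰⇒> p)) (subst (_≤ 1ℚ + ε) (+-identityʳ 1ℚ) (+-monoʳ-≤ 1ℚ 0≤ε)))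

    max₁-bound : ∀ {y} B → ∣ y ∣ ≤ ι B → max₁ y ≤ ι (suc B)
    max₁-bound {y} B h with 1ℚ ≤? y
    ... | yes _ = ≤-trans (p≤∣p∣ y) (≤-trans h (ι-mono (ℕ.n≤1+n B)))
    ... | no  _ = 1≤ι (suc B)

    module _ (y : ℝ) where

      lnq : ℕ → ℚ
      lnq k = proj₁ (grid k (max₁ (seq y k)) (1≤max₁ (seq y k)))

      0≤lnq : ∀ k → 0ℚ ≤ lnq k
      0≤lnq k = proj₁ (proj₂ (grid k (max₁ (seq y k)) (1≤max₁ (seq y k))))

      E-lnq : ∀ k → E (2 ℕ.+ k) (lnq k) ≤ max₁ (seq y k)
      E-lnq k = proj₁ (proj₂ (proj₂ (grid k (max₁ (seq y k)) (1≤max₁ (seq y k)))))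

      E-lnq⁺ : ∀ k → max₁ (seq y k) ≤ E (2 ℕ.+ k) (lnq k + rec (suc k))
      E-lnq⁺ k = proj₂ (proj₂ (proj₂ (grid k (max₁ (seq y k)) (1≤max₁ (seq y k)))))

      lnq-bound : ∀ B → ∀ k → ∣ seq y k ∣ ≤ ι B → ∣ lnq k ∣ ≤ ι (suc B)
      lnq-bound B k h = subst (_≤ ι (suc B)) (sym (0≤p⇒∣p∣≡p (0≤lnq k))) (≤-trans (≤-trans
        (subst (_≤ 1ℚ + lnq k) (+-identityˡ (lnq k)) (+-monoˡ-≤ (lnq k) 0≤1)) (1+q≤E k (0≤lnq k))) (≤-trans (E-lnq k) (max₁-bound B h)))

      lnq-close : 1ℝ ≤ᴿ y → ∀ ε → 0ℚ < ε → Ev (λ k → ∣ E (2 ℕ.+ k) (lnq k) - seq y k ∣ ≤ ε)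
      lnq-close (leq h) ε 0<ε =
        let B , b = bounded y
            G , hG = E-bounded (2 ℕ.+ B)
            δ , 0<δ , δ≤ = share (suc G) 0<ε
        in (b ∧ h δ 0<δ ∧ rec-null δ 0<δ) <&> λ {k} (p , q , r) →
           ≤-trans (∣-∣-triangle (E (2 ℕ.+ k) (lnq k)) (max₁ (seq y k)) (seq y k))
             (≤-trans (+-mono-≤ (grid-error B G hG k δ (<⇒≤ 0<δ) p r) (max₁-close {seq y k} (<⇒≤ 0<δ) q))
               (≤-trans (≤-reflexive (trans (eq δ (ι G)) (cong (_* δ) (sym (ι-suc G))))) δ≤))
        where
        eq : ∀ d g → d * g + d ≡ (1ℚ + g) * d
        eq = solve-∀ ℚ-ring
        grid-error : ∀ B G → (∀ N → E N (ι (2 ℕ.+ B)) ≤ ι G) → ∀ k δ → 0ℚ ≤ δ → ∣ seq y k ∣ ≤ ι B → rec (suc k) ≤ δ →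
                     ∣ E (2 ℕ.+ k) (lnq k) - max₁ (seq y k) ∣ ≤ δ * ι G
        grid-error B G hG k δ 0≤δ p r = ≤-trans (⇒∣∣≤ {E (2 ℕ.+ k) q} {max₁ (seq y k)} {∣ q + η - q ∣ * E (2 ℕ.+ k) (ι (2 ℕ.+ B))}
            (≤-trans (E-lnq k) (subst (_≤ max₁ (seq y k) + ∣ q + η - q ∣ * E (2 ℕ.+ k) (ι (2 ℕ.+ B))) (+-identityʳ (max₁ (seq y k)))
              (+-monoʳ-≤ (max₁ (seq y k)) (0≤* (0≤∣p∣ (q + η - q)) (0≤PS (λ k → 0≤D k (0≤ι (2 ℕ.+ B))) (2 ℕ.+ k))))))
            (≤-trans (E-lnq⁺ k) (∣∣≤⇒ {E (2 ℕ.+ k) (q + η)} {E (2 ℕ.+ k) q} (E-lipschitz (2 ℕ.+ B) (2 ℕ.+ k) q+η≤ q≤))))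
          (*-mono 0≤δ (0≤PS (λ k → 0≤D k (0≤ι (2 ℕ.+ B))) (2 ℕ.+ k)) (subst (_≤ δ) (sym ∣η∣) r) (hG (2 ℕ.+ k)))
          where
          q η : ℚ
          q = lnq k
          η = rec (suc k)
          cancel : ∀ a b → a + b - a ≡ b
          cancel = solve-∀ ℚ-ring
          ∣η∣ : ∣ q + η - q ∣ ≡ η
          ∣η∣ = trans (cong ∣_∣ (cancel q η)) (0≤p⇒∣p∣≡p (0≤rec (suc k)))
          q≤ : ∣ q ∣ ≤ ι (2 ℕ.+ B)
          q≤ = ≤-trans (lnq-bound B k p) (ι-mono (ℕ.n≤1+n (suc B)))
          η≤1 : η ≤ 1ℚ
          η≤1 = subst₂ _≤_ (*-identityʳ η) (rec-inverse (suc k)) (*-monoˡ (0≤rec (suc k)) (1≤ι (suc k)))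
          q+η≤ : ∣ q + η ∣ ≤ ι (2 ℕ.+ B)
          q+η≤ = ≤-trans (∣p+q∣≤∣p∣+∣q∣ q η) (≤-trans (+-mono-≤ {∣ q ∣} {ι (suc B)} {∣ η ∣} {1ℚ} (lnq-bound B k p) (subst (_≤ 1ℚ) (sym (0≤p⇒∣p∣≡p (0≤rec (suc k)))) η≤1))
            (≤-reflexive (trans (+-comm (ι (suc B)) 1ℚ) (sym (ι-suc (suc B))))))

      expanding : ∀ N {a c} → 0ℚ ≤ a → 0ℚ ≤ c → ∣ a - c ∣ ≤ ∣ E (2 ℕ.+ N) a - E (2 ℕ.+ N) c ∣
      expanding N {a} {c} 0≤a 0≤c with ≤-total a c
      ... | inj₁ a≤c = subst₂ _≤_ (trans (sym (0≤p⇒∣p∣≡p (p≤q⇒0≤q-p a≤c))) (∣-∣-sym c a)) (∣-∣-sym (E (2 ℕ.+ N) c) (E (2 ℕ.+ N) a))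
                         (≤-trans (E-expanding N 0≤a a≤c) (p≤∣p∣ (E (2 ℕ.+ N) c - E (2 ℕ.+ N) a)))
      ... | inj₂ c≤a = subst (_≤ ∣ E (2 ℕ.+ N) a - E (2 ℕ.+ N) c ∣) (sym (0≤p⇒∣p∣≡p (p≤q⇒0≤q-p c≤a)))
                         (≤-trans (E-expanding N 0≤c c≤a) (p≤∣p∣ (E (2 ℕ.+ N) a - E (2 ℕ.+ N) c)))

      -- By `expanding`, two approximations are no further apart than their Taylor values, and these
      -- are compared through y m and y n; one more step adjusts the order of the sum.
      lnq-cauchy : 1ℝ ≤ᴿ y → ∀ ε → 0ℚ < ε → ∃ λ N → ∀ m n → N ℕ.≤ m → N ℕ.≤ n → ∣ lnq m - lnq n ∣ ≤ ε
      lnq-cauchy 1≤y ε 0<ε =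
        let B , N₁ , b = bounded y
            δ , 0<δ , δ≤ = share 4 0<ε
            N₂ , c = lnq-close 1≤y δ 0<δ
            N₃ , h = cauchy y δ 0<δ
            N₄ , e = E-cauchy (suc B) δ 0<δ
            L = N₁ ℕ.⊔ N₂
            R = N₃ ℕ.⊔ N₄
        in L ℕ.⊔ R , λ m n p q →
           let mL = ℕ.m⊔n≤o⇒m≤o L R p
               nL = ℕ.m⊔n≤o⇒m≤o L R q
               mR = ℕ.m⊔n≤o⇒n≤o L R p
               nR = ℕ.m⊔n≤o⇒n≤o L R q
               n₄ = ℕ.m⊔n≤o⇒n≤o N₃ N₄ nR
               m₄ = ℕ.m⊔n≤o⇒n≤o N₃ N₄ mR
           in ≤-trans (expanding m (0≤lnq m) (0≤lnq n)) (≤-trans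
                (four (E (2 ℕ.+ m) (lnq m)) (seq y m) (seq y n) (E (2 ℕ.+ n) (lnq n)) (E (2 ℕ.+ m) (lnq n))
                  (c m (ℕ.m⊔n≤o⇒n≤o N₁ N₂ mL))
                  (<⇒≤ (h m n (ℕ.m⊔n≤o⇒m≤o N₃ N₄ mR) (ℕ.m⊔n≤o⇒m≤o N₃ N₄ nR)))
                  (subst (_≤ δ) (∣-∣-sym (E (2 ℕ.+ n) (lnq n)) (seq y n)) (c n (ℕ.m⊔n≤o⇒n≤o N₁ N₂ nL)))
                  (e (2 ℕ.+ n) (2 ℕ.+ m) (ℕ.m≤n⇒m≤o+n 2 n₄) (ℕ.m≤n⇒m≤o+n 2 m₄) (lnq-bound B n (b n (ℕ.m⊔n≤o⇒m≤o N₁ N₂ nL))))) δ≤)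
        where
        four : ∀ a b c d e {δ} → ∣ a - b ∣ ≤ δ → ∣ b - c ∣ ≤ δ → ∣ c - d ∣ ≤ δ → ∣ d - e ∣ ≤ δ → ∣ a - e ∣ ≤ ι 4 * δ
        four a b c d e {δ} p q r s = ≤-trans (∣-∣-triangle a b e) (≤-trans (+-mono-≤ p (≤-trans (∣-∣-triangle b c e)
          (+-mono-≤ q (≤-trans (∣-∣-triangle c d e) (+-mono-≤ r s))))) (≤-reflexive (eq δ)))
          where
          eq : ∀ δ → δ + (δ + (δ + δ)) ≡ ι 4 * δ
          eq = solve-∀ ℚ-ring

  opaque
    unfolding exp

    ln : ∀ y → 1ℝ ≤ᴿ y → ℝ
    ln y 1≤y = limit (lnq y) (lnq-cauchy y 1≤y)

    exp-ln : ∀ y 1≤y → exp (ln y 1≤y) ≈ y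
    exp-ln y 1≤y = eqv λ ε 0<ε →
      let B , b = bounded y
          N , e = E-cauchy (suc B) (½ * ε) (half 0<ε)
      in (b ∧ lnq-close y 1≤y (½ * ε) (half 0<ε) ∧ (N , λ n p → p)) <&> λ {k} (p , q , N≤k) →
         ≤-trans (∣-∣-triangle (E k (lnq y k)) (E (2 ℕ.+ k) (lnq y k)) (seq y k))
           (subst (_ ≤_) (halves ε) (+-mono-≤ (e k (2 ℕ.+ k) N≤k (ℕ.m≤n⇒m≤o+n 2 N≤k) (lnq-bound y B k p)) q))

    0≤ln : ∀ y 1≤y → 0ℝ ≤ᴿ ln y 1≤y
    0≤ln y 1≤y = pointwise-≤ (0≤lnq y)

-- Scaling a bounded rational vector to p-norm 1

module Normalisation where
  open import Data.Rational hiding (NonZero)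
  open import Data.Rational.Properties
  import Defs
  open import Defs using (ℝ; ℂ; seq; fromℚ; fromℕ; fromℝ; 0ℝ; 1ℝ; recip; module ℝΣ; IsNorm; IsPow; IsModulus)
  open Rationals
  open FiniteSums using (∑)
  open Reals
  open ExpLog

  ∑ᴿ ∏ᴿ : ∀ {n} → (Fin n → ℝ) → ℝ
  ∑ᴿ {zero}  f = 0ℝ
  ∑ᴿ {suc n} f = f zero +ᴿ ∑ᴿ (f ∘ suc)
  ∏ᴿ {zero}  f = 1ℝ
  ∏ᴿ {suc n} f = f zero *ᴿ ∏ᴿ (f ∘ suc)

  opaque
    unfolding _+ᴿ_

    sum≈∑ᴿ : ∀ {n} (f : Fin n → ℝ) → ℝΣ.sum f ≈ ∑ᴿ f
    sum≈∑ᴿ f = pointwise (λ j → trans (seq-∑ f j) (sym (seq-∑ᴿ f j)))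
      where
      seq-∑ᴿ : ∀ {n} (f : Fin n → ℝ) j → seq (∑ᴿ f) j ≡ ∑ (λ i → seq (f i) j)
      seq-∑ᴿ {zero}  f j = refl
      seq-∑ᴿ {suc n} f j = cong (seq (f zero) j +_) (seq-∑ᴿ (f ∘ suc) j)

    *ᴿ-zeroʳ : ∀ x → x *ᴿ 0ℝ ≈ 0ℝ
    *ᴿ-zeroʳ x = pointwise (λ n → *-zeroʳ (seq x n))

    *ᴿ-zeroˡ : ∀ x → 0ℝ *ᴿ x ≈ 0ℝ
    *ᴿ-zeroˡ x = pointwise (λ n → *-zeroˡ (seq x n))

    *ᴿ-distribʳ : ∀ x y z → (y +ᴿ z) *ᴿ x ≈ y *ᴿ x +ᴿ z *ᴿ x
    *ᴿ-distribʳ x y z = pointwise (λ n → *-distribʳ-+ (seq x n) (seq y n) (seq z n))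

    fromℕ-suc-* : ∀ n c → c +ᴿ fromℕ n *ᴿ c ≈ fromℕ (suc n) *ᴿ c
    fromℕ-suc-* n c = pointwise (λ j → trans (eq (seq c j) (ι n)) (cong (_* seq c j) (sym (ι-suc n))))
      where
      eq : ∀ c n → c + n * c ≡ (1ℚ + n) * c
      eq = solve-∀ ℚ-ring

  ∑ᴿ-*ʳ : ∀ {n} (f : Fin n → ℝ) c → ∑ᴿ (λ i → f i *ᴿ c) ≈ ∑ᴿ f *ᴿ c
  ∑ᴿ-*ʳ {zero}  f c = ≈-sym (*ᴿ-zeroˡ c)
  ∑ᴿ-*ʳ {suc n} f c = ≈-trans (+ᴿ-cong ≈-refl (∑ᴿ-*ʳ (f ∘ suc) c)) (≈-sym (*ᴿ-distribʳ c (f zero) (∑ᴿ (f ∘ suc))))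

  0≤∑ᴿ : ∀ {n} {f : Fin n → ℝ} → (∀ i → 0ℝ ≤ᴿ f i) → 0ℝ ≤ᴿ ∑ᴿ f
  0≤∑ᴿ {zero}  h = ≤ᴿ-refl
  0≤∑ᴿ {suc n} h = ≤ᴿ-trans (≈⇒≤ (≈-sym (+ᴿ-identityˡ 0ℝ))) (+ᴿ-mono (h zero) (0≤∑ᴿ (h ∘ suc)))

  term≤∑ᴿ : ∀ {n} {f : Fin n → ℝ} → (∀ i → 0ℝ ≤ᴿ f i) → ∀ i → f i ≤ᴿ ∑ᴿ f
  term≤∑ᴿ {suc n} {f} h zero = ≤ᴿ-trans (≈⇒≤ (≈-trans (≈-sym (+ᴿ-identityˡ (f zero))) (+ᴿ-comm 0ℝ (f zero))))
    (+ᴿ-mono ≤ᴿ-refl (0≤∑ᴿ (h ∘ suc)))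
  term≤∑ᴿ {suc n} {f} h (suc i) = ≤ᴿ-trans (≈⇒≤ (≈-sym (+ᴿ-identityˡ (f (suc i))))) (+ᴿ-mono (h zero) (term≤∑ᴿ (h ∘ suc) i))

  ∑ᴿ-≤ : ∀ {n} {f : Fin n → ℝ} {c} → (∀ i → f i ≤ᴿ c) → ∑ᴿ f ≤ᴿ fromℕ n *ᴿ c
  ∑ᴿ-≤ {zero}      {c = c} h = ≈⇒≤ (≈-sym (*ᴿ-zeroˡ c))
  ∑ᴿ-≤ {suc n} {f} {c} h = ≤ᴿ-trans (+ᴿ-mono (h zero) (∑ᴿ-≤ (h ∘ suc))) (≈⇒≤ (fromℕ-suc-* n c))

  0<⇒0≤ : ∀ {x} → 0ℝ Defs.< x → 0ℝ ≤ᴿ x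
  0<⇒0≤ {x} (η , 0<η , N , h) = leq λ ε 0<ε → N , λ n p →
    ≤-trans (≤-trans (≤-trans (<⇒≤ 0<η) (≤-reflexive (sym (+-identityˡ η)))) (h n p))
      (subst (_≤ seq x n + ε) (+-identityʳ (seq x n)) (+-monoʳ-≤ (seq x n) (<⇒≤ 0<ε)))

  lnℚ : ∀ q → 1ℚ ≤ q → ℝ
  lnℚ q 1≤q = ln (fromℚ q) (fromℚ-mono 1≤q)

  exp-lnℚ : ∀ q 1≤q → exp (lnℚ q 1≤q) ≈ fromℚ q
  exp-lnℚ q 1≤q = exp-ln (fromℚ q) (fromℚ-mono 1≤q)

  lnℚ-mono : ∀ {p q} 1≤p 1≤q → p ≤ q → lnℚ p 1≤p ≤ᴿ lnℚ q 1≤q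
  lnℚ-mono {p} {q} 1≤p 1≤q h = exp-cancel (≤ᴿ-trans (≈⇒≤ (exp-lnℚ p 1≤p)) (≤ᴿ-trans (fromℚ-mono h) (≈⇒≤ (≈-sym (exp-lnℚ q 1≤q)))))

  lnℕ : ∀ n → .{{NonZero n}} → ℝ
  lnℕ n = lnℚ (ι n) (1≤ι n)

  isPow : ∀ x a y t → x ≈ exp t → y ≈ exp (a *ᴿ t) → IsPow x a y
  isPow x a y t h g = inj₂ (t , isExp h , isExp (subst (λ u → y ≈ exp u) (*ᴿ-def a t) g))

  mkNorm : ∀ {n} p 0<p (x : Fin n → ℂ) N a b → (∀ v → IsModulus (x v) (a v)) → (∀ v → IsPow (a v) p (b v)) →
           IsPow (ℝΣ.sum b) (recip p 0<p) N → IsNorm p 0<p x N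
  mkNorm p 0<p x N a b h g k = a , b , h , g , k

  module _ {n : ℕ} .{{_ : NonZero n}} (p : ℝ) (0<p : 0ℝ Defs.< p) (K : ℕ) .{{_ : NonZero K}}
           (x : Fin n → ℚ) (x-bounded : ∀ v → (x v ≡ 0ℚ) ⊎ (1ℚ ≤ ∣ x v ∣ × ∣ x v ∣ ≤ ι K))
           (x-nonzero : ∃ λ v → 1ℚ ≤ ∣ x v ∣) where

    private
      Value : ℚ → Set
      Value q = (q ≡ 0ℚ) ⊎ (1ℚ ≤ ∣ q ∣ × ∣ q ∣ ≤ ι K)

      ρ : ℝ
      ρ = recip p 0<p

      ρp≈1 : ρ *ᴿ p ≈ 1ℝ
      ρp≈1 = recip-inverse p 0<p

      -- |q|^p for an admissible entry. Zero is separate because it has no logarithm, as in the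
      -- first alternative of `IsPow`.
      power : ∀ {q} → Value q → ℝ
      power     (inj₁ _)         = 0ℝ
      power {q} (inj₂ (1≤q , _)) = exp (p *ᴿ lnℚ ∣ q ∣ 1≤q)

      0≤p : 0ℝ ≤ᴿ p
      0≤p = 0<⇒0≤ 0<p

      0≤power : ∀ {q} (c : Value q) → 0ℝ ≤ᴿ power c
      0≤power     (inj₁ _)         = ≤ᴿ-refl
      0≤power {q} (inj₂ (1≤q , _)) = 0≤exp (p *ᴿ lnℚ ∣ q ∣ 1≤q)

      1≤power : ∀ {q} (c : Value q) → 1ℚ ≤ ∣ q ∣ → 1ℝ ≤ᴿ power c
      1≤power (inj₁ refl) 1≤0 = fromℚ-mono 1≤0
      1≤power {q} (inj₂ (1≤q , _)) _ = 1≤exp (0≤ᴿ* 0≤p (0≤ln (fromℚ ∣ q ∣) (fromℚ-mono 1≤q)))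

      power≤ : ∀ {q} (c : Value q) → power c ≤ᴿ exp (p *ᴿ lnℕ K)
      power≤ (inj₁ _)           = 0≤exp (p *ᴿ lnℕ K)
      power≤ (inj₂ (1≤q , q≤K)) = exp-mono (*ᴿ-monoˡ 0≤p (lnℚ-mono 1≤q (1≤ι K) q≤K))

      b₀ : Fin n → ℝ
      b₀ v = power (x-bounded v)

      S : ℝ
      S = ∑ᴿ b₀

      -- One entry of absolute value at least 1 suffices; it makes S large enough for `ln`.
      1≤S : 1ℝ ≤ᴿ S
      1≤S = ≤ᴿ-trans (1≤power (x-bounded (proj₁ x-nonzero)) (proj₂ x-nonzero)) (term≤∑ᴿ (λ v → 0≤power (x-bounded v)) (proj₁ x-nonzero))

      lS : ℝ
      lS = ln S 1≤S

    -- S^(-1/p), the inverse of the p-norm of x.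
    scale : ℝ
    scale = exp (-ᴿ (ρ *ᴿ lS))

    0≤scale : 0ℝ ≤ᴿ scale
    0≤scale = 0≤exp (-ᴿ (ρ *ᴿ lS))

    private
      opaque
        unfolding _+ᴿ_

        modulus : ∀ e q → 0ℝ ≤ᴿ e → IsModulus (fromℝ (e *ᴿ fromℚ q)) (e *ᴿ fromℚ ∣ q ∣)
        modulus e q 0≤e = ≤-out (0≤ᴿ* 0≤e (fromℚ-mono (0≤∣p∣ q))) , ≈-out (pointwise {(e *ᴿ fromℚ ∣ q ∣) *ᴿ (e *ᴿ fromℚ ∣ q ∣)}
            {(e *ᴿ fromℚ q) *ᴿ (e *ᴿ fromℚ q) +ᴿ 0ℝ *ᴿ 0ℝ} (λ n → trans (eq₁ (seq e n) ∣ q ∣) (trans (cong (λ s → seq e n * seq e n * s) (∣∣-sq q)) (eq₂ (seq e n) q))))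
          where
          eq₁ : ∀ e a → e * a * (e * a) ≡ e * e * (a * a)
          eq₁ = solve-∀ ℚ-ring
          eq₂ : ∀ e q → e * e * (q * q) ≡ e * q * (e * q) + 0ℚ * 0ℚ
          eq₂ = solve-∀ ℚ-ring

        zero-modulus : ∀ e {q} → q ≡ 0ℚ → e *ᴿ fromℚ ∣ q ∣ ≈ 0ℝ
        zero-modulus e refl = pointwise (λ n → *-zeroʳ (seq e n))

        exponent : ∀ p ρ l l′ → p *ᴿ (l -ᴿ ρ *ᴿ l′) ≈ p *ᴿ l -ᴿ (ρ *ᴿ p) *ᴿ l′
        exponent p ρ l l′ = pointwise (λ n → eq (seq p n) (seq ρ n) (seq l n) (seq l′ n))
          where
          eq : ∀ p r l m → p * (l + - (r * m)) ≡ p * l + - (r * p * m)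
          eq = solve-∀ ℚ-ring

        exponent′ : ∀ ρ p l k → ρ *ᴿ (l +ᴿ p *ᴿ k) ≈ ρ *ᴿ l +ᴿ (ρ *ᴿ p) *ᴿ k
        exponent′ ρ p l k = pointwise (λ n → eq (seq ρ n) (seq p n) (seq l n) (seq k n))
          where
          eq : ∀ r p l k → r * (l + p * k) ≡ r * l + r * p * k
          eq = solve-∀ ℚ-ring

        rearrange : ∀ {a b c} → a ≤ᴿ b +ᴿ c → -ᴿ b ≤ᴿ c +ᴿ (-ᴿ a)
        rearrange {a} {b} {c} h = ≤ᴿ-trans (≈⇒≤ (pointwise (λ n → eq₁ (seq a n) (seq b n))))
          (≤ᴿ-trans (+ᴿ-mono h (≤ᴿ-refl {(-ᴿ a) +ᴿ (-ᴿ b)})) (≈⇒≤ (pointwise (λ n → eq₂ (seq a n) (seq b n) (seq c n)))))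
          where
          eq₁ : ∀ a b → - b ≡ a + (- a + - b)
          eq₁ = solve-∀ ℚ-ring
          eq₂ : ∀ a b c → b + c + (- a + - b) ≡ c + - a
          eq₂ = solve-∀ ℚ-ring

      base : ∀ {q} (1≤q : 1ℚ ≤ ∣ q ∣) → scale *ᴿ fromℚ ∣ q ∣ ≈ exp (lnℚ ∣ q ∣ 1≤q -ᴿ ρ *ᴿ lS)
      base {q} 1≤q = ≈-sym (≈-trans (exp-+ (lnℚ ∣ q ∣ 1≤q) (-ᴿ (ρ *ᴿ lS)))
        (≈-trans (*ᴿ-cong (exp-lnℚ ∣ q ∣ 1≤q) ≈-refl) (*ᴿ-comm (fromℚ ∣ q ∣) scale)))

      raised : ∀ l → exp (p *ᴿ l) *ᴿ exp (-ᴿ lS) ≈ exp (p *ᴿ (l -ᴿ ρ *ᴿ lS))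
      raised l = ≈-trans (≈-sym (exp-+ (p *ᴿ l) (-ᴿ lS))) (exp-cong (≈-trans
        (+ᴿ-cong ≈-refl (-ᴿ-cong (≈-trans (≈-sym (*ᴿ-identityˡ lS)) (*ᴿ-cong (≈-sym ρp≈1) ≈-refl))))
        (≈-sym (exponent p ρ l lS))))

      pow-zero : ∀ {q} → q ≡ 0ℚ → IsPow (scale *ᴿ fromℚ ∣ q ∣) p (0ℝ *ᴿ exp (-ᴿ lS))
      pow-zero {q} q≡0 = inj₁ (≈-out (zero-modulus scale {q} q≡0) , 0<p , ≈-out (*ᴿ-zeroˡ (exp (-ᴿ lS))))

      pow-nonzero : ∀ {q} (1≤q : 1ℚ ≤ ∣ q ∣) → IsPow (scale *ᴿ fromℚ ∣ q ∣) p (exp (p *ᴿ lnℚ ∣ q ∣ 1≤q) *ᴿ exp (-ᴿ lS))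
      pow-nonzero {q} 1≤q = isPow (scale *ᴿ fromℚ ∣ q ∣) p (exp (p *ᴿ lnℚ ∣ q ∣ 1≤q) *ᴿ exp (-ᴿ lS)) (lnℚ ∣ q ∣ 1≤q -ᴿ ρ *ᴿ lS)
        (base 1≤q) (raised (lnℚ ∣ q ∣ 1≤q))

      pow : ∀ {q} (c : Value q) → IsPow (scale *ᴿ fromℚ ∣ q ∣) p (power c *ᴿ exp (-ᴿ lS))
      pow (inj₁ q≡0)       = pow-zero q≡0
      pow (inj₂ (1≤q , _)) = pow-nonzero 1≤q

      ∑b≈1 : ℝΣ.sum (λ v → power (x-bounded v) *ᴿ exp (-ᴿ lS)) ≈ 1ℝ
      ∑b≈1 = ≈-trans (sum≈∑ᴿ (λ v → power (x-bounded v) *ᴿ exp (-ᴿ lS))) (≈-trans (∑ᴿ-*ʳ b₀ (exp (-ᴿ lS)))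
        (≈-trans (*ᴿ-cong (≈-sym (exp-ln S 1≤S)) ≈-refl) (exp-neg lS)))

      sum-pow : IsPow (ℝΣ.sum (λ v → power (x-bounded v) *ᴿ exp (-ᴿ lS))) (recip p 0<p) 1ℝ
      sum-pow = isPow (ℝΣ.sum (λ v → power (x-bounded v) *ᴿ exp (-ᴿ lS))) (recip p 0<p) 1ℝ 0ℝ (≈-trans ∑b≈1 (≈-sym exp-0)) (≈-trans (≈-sym exp-0) (exp-cong (≈-sym (*ᴿ-zeroʳ ρ))))

    isNorm : IsNorm p 0<p (λ v → fromℝ (scale *ᴿ fromℚ (x v))) 1ℝ
    isNorm = mkNorm p 0<p (λ v → fromℝ (scale *ᴿ fromℚ (x v))) 1ℝ (λ v → scale *ᴿ fromℚ ∣ x v ∣) (λ v → power (x-bounded v) *ᴿ exp (-ᴿ lS))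
      (λ v → modulus scale (x v) 0≤scale) (λ v → pow {x v} (x-bounded v)) sum-pow

    -- S is at most n K^p, so the norm of x is at most K n^(1/p). Compared after taking logarithms.
    scale-lower : exp (-ᴿ (ρ *ᴿ lnℕ n)) ≤ᴿ fromℕ K *ᴿ scale
    scale-lower = ≤ᴿ-trans (exp-mono (rearrange ρlS≤)) (≈⇒≤ (≈-trans (exp-+ (lnℕ K) (-ᴿ (ρ *ᴿ lS))) (*ᴿ-cong (exp-lnℚ (ι K) (1≤ι K)) ≈-refl)))
      where
      lS≤ : lS ≤ᴿ lnℕ n +ᴿ p *ᴿ lnℕ K
      lS≤ = exp-cancel (≤ᴿ-trans (≈⇒≤ (exp-ln S 1≤S)) (≤ᴿ-trans (∑ᴿ-≤ (λ v → power≤ (x-bounded v)))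
        (≈⇒≤ (≈-trans (*ᴿ-cong (≈-sym (exp-lnℚ (ι n) (1≤ι n))) ≈-refl) (≈-sym (exp-+ (lnℕ n) (p *ᴿ lnℕ K)))))))
      ρlS≤ : ρ *ᴿ lS ≤ᴿ ρ *ᴿ lnℕ n +ᴿ lnℕ K
      ρlS≤ = ≤ᴿ-trans (*ᴿ-monoˡ (0≤recip p 0<p) lS≤) (≈⇒≤ (≈-trans (exponent′ ρ p (lnℕ n) (lnℕ K))
        (+ᴿ-cong ≈-refl (≈-trans (*ᴿ-cong ρp≈1 ≈-refl) (*ᴿ-identityˡ (lnℕ K))))))

-- From rational evaluations to the complex form and its suprema

module LowerBounds where
  open import Data.Bool using (true; false; if_then_else_)
  open import Data.List using (length)
  open import Data.List.Membership.DecPropositional using (_∈?_)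
  open import Data.Rational hiding (NonZero)
  open import Data.Rational.Properties
  import Defs
  open import Defs using (ℝ; ℂ; re; im; seq; fromℚ; fromℝ; 0ℝ; 1ℝ; recip; module ℂΣ; IsNorm; IsModulus; _≤ᴸ_; _≈ᶜ_; Hypergraph; edges; image; _≟ˢ_; ∑-tuples; σ; τ; J; λ₂; μ; _*ᶜ_; _-ᶜ_)
  open Rationals
  open FiniteSums
  open EdgeCounting
  open SignVectors
  open Reals
  open ExpLog
  open Normalisation

  -- Field operations act on approximating sequences index by index, so at each index j the complex
  -- σ is literally a rational evaluation with zero imaginary part. No limit argument is needed.
  At : ℕ → ℂ → ℚ → Set
  At j z q = (seq (re z) j ≡ q) × (seq (im z) j ≡ 0ℚ)

  At-* : ∀ j {z w p q} → At j z p → At j w q → At j (z *ᶜ w) (p * q)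
  At-* j {z} {w} {p} {q} (a , b) (c , d) =
    trans (cong₂ _-_ (cong₂ _*_ a c) (cong₂ _*_ b d)) (eq₁ p q) , trans (cong₂ _+_ (cong₂ _*_ a d) (cong₂ _*_ b c)) (eq₂ p q)
    where
    eq₁ : ∀ p q → p * q - 0ℚ * 0ℚ ≡ p * q
    eq₁ = solve-∀ ℚ-ring
    eq₂ : ∀ p q → p * 0ℚ + 0ℚ * q ≡ 0ℚ
    eq₂ = solve-∀ ℚ-ring

  At-- : ∀ j {z w p q} → At j z p → At j w q → At j (z -ᶜ w) (p - q)
  At-- j (a , b) (c , d) = cong₂ _-_ a c , cong₂ _-_ b d

  At-if : ∀ j b z q → At j z q → At j (if b then z else fromℝ 0ℝ) (𝟙 b * q)
  At-if j true  z q (a , b) = trans a (sym (*-identityˡ q)) , b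
  At-if j false z q _       = sym (*-zeroˡ q) , refl

  At-product : ∀ j {k} (z : Fin k → ℂ) (q : Fin k → ℚ) → (∀ i → At j (z i) (q i)) → At j (ℂΣ.product z) (∏ q)
  At-product j {zero}  z q h = refl , refl
  At-product j {suc k} z q h = At-* j {z zero} {ℂΣ.product (z ∘ suc)} (h zero) (At-product j (z ∘ suc) (q ∘ suc) (h ∘ suc))

  At-sum : ∀ j {k} (z : Fin k → ℂ) (q : Fin k → ℚ) → (∀ i → At j (z i) (q i)) → At j (ℂΣ.sum z) (∑ q)
  At-sum j {zero}  z q h = refl , refl
  At-sum j {suc k} z q h =
    cong₂ _+_ (proj₁ (h zero)) (proj₁ (At-sum j (z ∘ suc) (q ∘ suc) (h ∘ suc))) ,
    trans (cong₂ _+_ (proj₂ (h zero)) (proj₂ (At-sum j (z ∘ suc) (q ∘ suc) (h ∘ suc)))) refl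

  At-tuples : ∀ j {n} k (z : (Fin k → Fin n) → ℂ) (q : (Fin k → Fin n) → ℚ) → (∀ t → At j (z t) (q t)) → At j (∑-tuples k z) (∑T k q)
  At-tuples j zero    z q h = h Vector.[]
  At-tuples j (suc k) z q h = At-sum j (λ v → ∑-tuples k (λ t → z (v ◂ t))) (λ v → ∑T k (λ t → q (v ◂ t))) (λ v → At-tuples j k (λ t → z (v ◂ t)) (λ t → q (v ◂ t)) (λ t → h (v ◂ t)))

  seq-∏ᴿ : ∀ {k} (e : Fin k → ℝ) j → seq (∏ᴿ e) j ≡ ∏ (λ i → seq (e i) j)
  seq-∏ᴿ {zero}  e j = refl
  seq-∏ᴿ {suc k} e j = trans (seq-* (e zero) (∏ᴿ (e ∘ suc)) j) (cong (seq (e zero) j *_) (seq-∏ᴿ (e ∘ suc) j))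

  value : ∀ {k n} .{{_ : NonZero n}} → Hypergraph (suc k) n → (Fin (suc k) → ℝ) → (Fin (suc k) → Fin n → ℚ) → ℝ
  value H e x = ∏ᴿ e *ᴿ fromℚ (σℚ H x)

  scaled-at : ∀ e q j → At j (fromℝ (e *ᴿ fromℚ q)) (seq e j * q)
  scaled-at e q j = seq-* e (fromℚ q) j , refl

  module _ {k n : ℕ} .{{_ : NonZero n}} (H : Hypergraph (suc k) n) (e : Fin (suc k) → ℝ) (x : Fin (suc k) → Fin n → ℚ)
           (X : Fin (suc k) → Fin n → ℂ) (X-at : ∀ j i v → At j (X i v) (seq (e i) j * x i v)) where

    private
      y : ℕ → Fin (suc k) → Fin n → ℚ
      y j i v = seq (e i) j * x i v

      At-term : ∀ j (t : Fin (suc k) → Fin n) → At j (ℂΣ.product (λ i → X i (t i))) (∏ (λ i → y j i (t i)))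
      At-term j t = At-product j (λ i → X i (t i)) (λ i → y j i (t i)) (λ i → X-at j i (t i))

      At-edge-term : ∀ j (t : Fin (suc k) → Fin n) → At j (if does (_∈?_ _≟ˢ_ (image t) (edges H)) then ℂΣ.product (λ i → X i (t i)) else fromℝ 0ℝ)
                                (edge H t * ∏ (λ i → y j i (t i)))
      At-edge-term j t = At-if j (does (_∈?_ _≟ˢ_ (image t) (edges H))) (ℂΣ.product (λ i → X i (t i))) (∏ (λ i → y j i (t i))) (At-term j t)

      At-τ : ∀ j → At j (τ H X) (α H * ∑T (suc k) (λ t → edge H t * ∏ (λ i → y j i (t i))))
      At-τ j = subst (λ c → At j (τ H X) (c * ∑T (suc k) (λ t → edge H t * ∏ (λ i → y j i (t i))))) (α-def H)
        (At-* j {fromℝ (fromℚ ((ℤ.+ 1 / ((suc k ℕ.∸ 1) !)) {{(suc k ℕ.∸ 1) ℕ.!≢0}}))}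
          {∑-tuples (suc k) (λ t → if does (_∈?_ _≟ˢ_ (image t) (edges H)) then ℂΣ.product (λ i → X i (t i)) else fromℝ 0ℝ)} (refl , refl)
          (At-tuples j (suc k) (λ t → if does (_∈?_ _≟ˢ_ (image t) (edges H)) then ℂΣ.product (λ i → X i (t i)) else fromℝ 0ℝ)
            (λ t → edge H t * ∏ (λ i → y j i (t i))) (At-edge-term j)))

      At-J : ∀ j → At j (J X) (∑T (suc k) (λ t → ∏ (λ i → y j i (t i))))
      At-J j = At-tuples j (suc k) (λ t → ℂΣ.product (λ i → X i (t i))) (λ t → ∏ (λ i → y j i (t i))) (At-term j)

      At-σ : ∀ j → At j (σ H X) (σℚ H (y j))
      At-σ j = subst (λ c → At j (σ H X) (α H * ∑T (suc k) (λ t → edge H t * ∏ (λ i → y j i (t i))) - c * ∑T (suc k) (λ t → ∏ (λ i → y j i (t i))))) (κ-def H)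
        (At-- j {τ H X} {fromℝ (fromℚ ((ℤ.+ (suc k ℕ.* length (edges H)) / (n ℕ.^ suc k)) {{ℕ.m^n≢0 n (suc k)}})) *ᶜ J X} (At-τ j)
          (At-* j {fromℝ (fromℚ ((ℤ.+ (suc k ℕ.* length (edges H)) / (n ℕ.^ suc k)) {{ℕ.m^n≢0 n (suc k)}}))} {J X} (refl , refl) (At-J j)))

      -- Multilinearity at a fixed index: the scaling factors leave every tuple product in the same
      -- way.
      scaled : ∀ j → σℚ H (y j) ≡ ∏ (λ i → seq (e i) j) * σℚ H x
      scaled j = begin
        σℚ H (y j)
          ≡⟨ σℚ-coef H (y j) ⟩
        ∑T (suc k) (λ t → coef H t * ∏ (λ i → y j i (t i)))
          ≡⟨ ∑T-cong (suc k) (λ t → trans (cong (coef H t *_) (∏-* (λ i → seq (e i) j) (λ i → x i (t i)))) (swap (coef H t) (∏ (λ i → seq (e i) j)) (∏ (λ i → x i (t i))))) ⟩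
        ∑T (suc k) (λ t → ∏ (λ i → seq (e i) j) * (coef H t * ∏ (λ i → x i (t i))))
          ≡⟨ ∑T-*ˡ (suc k) (∏ (λ i → seq (e i) j)) (λ t → coef H t * ∏ (λ i → x i (t i))) ⟩
        ∏ (λ i → seq (e i) j) * ∑T (suc k) (λ t → coef H t * ∏ (λ i → x i (t i)))
          ≡⟨ cong (∏ (λ i → seq (e i) j) *_) (sym (σℚ-coef H x)) ⟩
        ∏ (λ i → seq (e i) j) * σℚ H x ∎
        where
        open ≡-Reasoning
        swap : ∀ a b c → a * (b * c) ≡ b * (a * c)
        swap = solve-∀ ℚ-ring

    private
      seq-value : ∀ j → seq (value H e x) j ≡ seq (re (σ H X)) j
      seq-value j = trans (seq-* (∏ᴿ e) (fromℚ (σℚ H x)) j) (trans (cong (_* σℚ H x) (seq-∏ᴿ e j)) (trans (sym (scaled j)) (sym (proj₁ (At-σ j)))))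

    σ≈value : σ H X ≈ᶜ fromℝ (value H e x)
    σ≈value = ≈-out (pointwise {re (σ H X)} {value H e x} (λ j → sym (seq-value j))) ,
              ≈-out (pointwise {im (σ H X)} {0ℝ} (λ j → proj₂ (At-σ j)))

    modulus-value : 0ℝ ≤ᴿ value H e x → IsModulus (σ H X) (value H e x)
    modulus-value 0≤v = ≤-out 0≤v , ≈-out (pointwise {value H e x Defs.* value H e x} {re (σ H X) Defs.* re (σ H X) Defs.+ im (σ H X) Defs.* im (σ H X)}
      (λ j → trans (eq (seq (value H e x) j)) (cong₂ (λ a b → a * a + b * b) (seq-value j) (sym (proj₂ (At-σ j))))))
      where
      eq : ∀ v → v * v ≡ v * v + 0ℚ * 0ℚ
      eq = solve-∀ ℚ-ring

  0≤∏ᴿ : ∀ {k} {e : Fin k → ℝ} → (∀ i → 0ℝ ≤ᴿ e i) → 0ℝ ≤ᴿ ∏ᴿ e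
  0≤∏ᴿ {zero}  h = fromℚ-mono 0≤1
  0≤∏ᴿ {suc k} h = 0≤ᴿ* (h zero) (0≤∏ᴿ (h ∘ suc))

  opaque
    unfolding _+ᴿ_

    shuffleᴿ : ∀ K e c P → (fromℚ K *ᴿ e) *ᴿ (fromℚ c *ᴿ P) ≈ fromℚ (K * c) *ᴿ (e *ᴿ P)
    shuffleᴿ K e c P = pointwise (λ n → eq K (seq e n) c (seq P n))
      where
      eq : ∀ K e c P → K * e * (c * P) ≡ K * c * (e * P)
      eq = solve-∀ ℚ-ring

    assocℚ : ∀ Q c P → fromℚ Q *ᴿ (fromℚ c *ᴿ P) ≈ P *ᴿ fromℚ (Q * c)
    assocℚ Q c P = pointwise (λ n → eq Q c (seq P n))
      where
      eq : ∀ Q c P → Q * (c * P) ≡ P * (Q * c)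
      eq = solve-∀ ℚ-ring

  -- Each slot loses at most a factor K against `unit`, hence K^r in total.
  ∏ᴿ-lower : ∀ {k} K → 0ℚ ≤ K → {a : ℝ} → 0ℝ ≤ᴿ a → (e : Fin k → ℝ) → (∀ i → 0ℝ ≤ᴿ e i) → (∀ i → a ≤ᴿ fromℚ K *ᴿ e i) →
             ∏ᴿ {k} (λ _ → a) ≤ᴿ fromℚ (K ^ k) *ᴿ ∏ᴿ e
  ∏ᴿ-lower {zero}  K 0≤K 0≤a e 0≤e h = ≈⇒≤ (≈-sym (*ᴿ-identityˡ 1ℝ))
  ∏ᴿ-lower {suc k} K 0≤K 0≤a e 0≤e h = ≤ᴿ-trans (*ᴿ-mono (0≤ᴿ* (fromℚ-mono 0≤K) (0≤e zero)) (0≤∏ᴿ {k} (λ _ → 0≤a)) (h zero) (∏ᴿ-lower K 0≤K 0≤a (e ∘ suc) (0≤e ∘ suc) (h ∘ suc)))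
    (≈⇒≤ (shuffleᴿ K (e zero) (K ^ k) (∏ᴿ (e ∘ suc))))

  module _ {k n : ℕ} .{{_ : NonZero n}} (H : Hypergraph (suc k) n) (p : ℝ) (0<p : 0ℝ Defs.< p) where

    -- n ^ (-1/p)
    unit : ℝ
    unit = exp (-ᴿ (recip p 0<p *ᴿ lnℕ n))

    private
      lower : ∀ K Q (e : Fin (suc k) → ℝ) x → 0ℚ ≤ K → 0ℚ ≤ Q → Q * K ^ suc k ≤ σℚ H x → (∀ i → 0ℝ ≤ᴿ e i) → (∀ i → unit ≤ᴿ fromℚ K *ᴿ e i) →
              fromℚ Q *ᴿ ∏ᴿ {suc k} (λ _ → unit) ≤ᴿ value H e x
      lower K Q e x 0≤K 0≤Q h 0≤e u≤ = ≤ᴿ-trans (*ᴿ-monoˡ (fromℚ-mono 0≤Q) (∏ᴿ-lower K 0≤K (0≤exp (-ᴿ (recip p 0<p *ᴿ lnℕ n))) e 0≤e u≤))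
        (≤ᴿ-trans (≈⇒≤ (assocℚ Q (K ^ suc k) (∏ᴿ e))) (*ᴿ-monoˡ (0≤∏ᴿ 0≤e) (fromℚ-mono h)))

      λ₂-from : ∀ e (x : Fin n → ℚ) → IsNorm p 0<p (λ v → fromℝ (e *ᴿ fromℚ (x v))) 1ℝ →
                ∀ z → z ≤ᴿ value H (λ _ → e) (λ _ → x) → z ≤ᴸ λ₂ H p 0<p
      λ₂-from e x norm z z≤ q q<z =
        value H (λ _ → e) (λ _ → x) , ((λ v → e *ᴿ fromℚ (x v)) , norm , σ≈value H (λ _ → e) (λ _ → x) (λ _ v → fromℝ (e *ᴿ fromℚ (x v))) (λ j _ v → scaled-at e (x v) j)) , <-≤ᴿ-trans {fromℚ q} q<z z≤

      -- The lower cut of a supremum is inhabited through a single choice of vectors. As the value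
      -- is nonnegative, it is its own modulus.
      μ-from : ∀ e (x : Fin (suc k) → Fin n → ℚ) → (∀ i → IsNorm p 0<p (λ v → fromℝ (e i *ᴿ fromℚ (x i v))) 1ℝ) →
               0ℝ ≤ᴿ value H e x → ∀ z → z ≤ᴿ value H e x → z ≤ᴸ μ H p 0<p
      μ-from e x norm 0≤value z z≤ q q<z = value H e x , ((λ i v → fromℝ (e i *ᴿ fromℚ (x i v))) , norm ,
        modulus-value H e x (λ i v → fromℝ (e i *ᴿ fromℚ (x i v))) (λ j i v → scaled-at (e i) (x i v) j) 0≤value) , <-≤ᴿ-trans {fromℚ q} q<z z≤

    λ₂-lower : ∀ K .{{_ : NonZero K}} Q (x : Fin n → ℚ) → (∀ v → (x v ≡ 0ℚ) ⊎ (1ℚ ≤ ∣ x v ∣ × ∣ x v ∣ ≤ ι K)) → (∃ λ v → 1ℚ ≤ ∣ x v ∣) →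
               0ℚ ≤ Q → Q * ι K ^ suc k ≤ σℚ H (λ _ → x) →
               ∀ z → z ≤ᴿ fromℚ Q *ᴿ ∏ᴿ {suc k} (λ _ → unit) → z ≤ᴸ λ₂ H p 0<p
    λ₂-lower K Q x b nz 0≤Q h z z≤ = λ₂-from (scale p 0<p K x b nz) x (isNorm p 0<p K x b nz) z
      (≤ᴿ-trans z≤ (lower (ι K) Q (λ _ → scale p 0<p K x b nz) (λ _ → x) (0≤ι K) 0≤Q h
        (λ _ → 0≤scale p 0<p K x b nz) (λ _ → scale-lower p 0<p K x b nz)))

    μ-lower : ∀ Q (x : Fin (suc k) → Fin n → ℚ) → Signs x → 0ℚ ≤ Q → Q ≤ σℚ H x →
              ∀ z → z ≤ᴿ fromℚ Q *ᴿ ∏ᴿ {suc k} (λ _ → unit) → z ≤ᴸ μ H p 0<p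
    μ-lower Q x s 0≤Q h z z≤ = μ-from (λ i → scale p 0<p 1 (x i) (b i) (nz i)) x (λ i → isNorm p 0<p 1 (x i) (b i) (nz i))
        (0≤ᴿ* (0≤∏ᴿ (λ i → 0≤scale p 0<p 1 (x i) (b i) (nz i))) (fromℚ-mono (≤-trans 0≤Q h)))
        z (≤ᴿ-trans z≤ (lower (ι 1) Q (λ i → scale p 0<p 1 (x i) (b i) (nz i)) x 0≤1 0≤Q
          (subst (_≤ σℚ H x) (sym (trans (cong (Q *_) (1^ (suc k))) (*-identityʳ Q))) h)
          (λ i → 0≤scale p 0<p 1 (x i) (b i) (nz i)) (λ i → scale-lower p 0<p 1 (x i) (b i) (nz i))))
      where
      vertex : ∀ n → .{{NonZero n}} → Fin n
      vertex (suc n) = zero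
      b : ∀ i v → (x i v ≡ 0ℚ) ⊎ (1ℚ ≤ ∣ x i v ∣ × ∣ x i v ∣ ≤ ι 1)
      b i v = inj₂ (≤-reflexive (sym (s i v)) , ≤-reflexive (s i v))
      nz : ∀ i → ∃ λ v → 1ℚ ≤ ∣ x i v ∣
      nz i = vertex n , ≤-reflexive (sym (s i (vertex n)))
      1^ : ∀ k → 1ℚ ^ k ≡ 1ℚ
      1^ zero    = refl
      1^ (suc k) = trans (*-identityˡ (1ℚ ^ k)) (1^ k)

-- Square roots, powers of n and the constant c

module Assembly where
  open import Data.Rational hiding (NonZero)
  open import Data.Rational.Properties
  import Defs
  open import Defs using (ℝ; seq; fromℚ; fromℕ; 0ℝ; 1ℝ; recip; IsPow; IsSqrt; _≤ᴸ_; Hypergraph; Regular; λ₂; μ)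
  open Rationals
  open IntegerSqrt
  open SignVectors
  open TestVectors
  open Reals
  open ExpLog
  open Normalisation
  open LowerBounds

  -- √d is exp of half the logarithm; d = 0 is separate because it has no logarithm. The last
  -- component compares √d with the integer stand-in.
  sqrt : ∀ d → ∃ λ s → IsSqrt (fromℕ d) s × (0ℝ ≤ᴿ s) × (∀ t → d ℕ.≤ t ℕ.* t → s ≤ᴿ fromℕ t)
  sqrt zero = 0ℝ , (≤-out (≤ᴿ-refl {0ℝ}) , ≈-out (pointwise {0ℝ Defs.* 0ℝ} {fromℕ 0} (λ _ → refl))) , ≤ᴿ-refl , λ t _ → fromℚ-mono (0≤ι t)
  sqrt d@(suc _) = s , (≤-out 0≤s , ≈-out (subst (_≈ fromℕ d) (*ᴿ-def s s) s²≈d)) , 0≤s , λ t d≤t² →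
      sq-cancelᴿ (0≤ι t) (≤ᴿ-trans (≈⇒≤ s²≈d) (fromℚ-mono (≤-trans (ι-mono d≤t²) (≤-reflexive (ι-* t t)))))
    where
    s : ℝ
    s = exp (fromℚ ½ *ᴿ lnℕ d)
    0≤s : 0ℝ ≤ᴿ s
    0≤s = 0≤exp (fromℚ ½ *ᴿ lnℕ d)
    s²≈d : s *ᴿ s ≈ fromℕ d
    s²≈d = ≈-trans (≈-sym (exp-+ (fromℚ ½ *ᴿ lnℕ d) (fromℚ ½ *ᴿ lnℕ d))) (≈-trans (exp-cong (half-sum (lnℕ d))) (exp-lnℚ (ι d) (1≤ι d)))

  opaque
    unfolding _+ᴿ_

    two-thirds : ∀ t → fromℚ (ℤ.+ 2 / 3) *ᴿ t +ᴿ (fromℚ (ℤ.+ 2 / 3) *ᴿ t +ᴿ fromℚ (ℤ.+ 2 / 3) *ᴿ t) ≈ t +ᴿ t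
    two-thirds t = pointwise (λ n → eq (seq t n))
      where
      eq : ∀ t → ℤ.+ 2 / 3 * t + (ℤ.+ 2 / 3 * t + ℤ.+ 2 / 3 * t) ≡ t + t
      eq = solve-∀ ℚ-ring

    exponent₁ : ∀ r ρ l → (1ℝ Defs.- fromℕ r Defs.* ρ) *ᴿ l ≈ l +ᴿ fromℕ r *ᴿ (-ᴿ (ρ *ᴿ l))
    exponent₁ r ρ l = pointwise (λ n → eq (ι r) (seq ρ n) (seq l n))
      where
      eq : ∀ r p l → (1ℚ + - (r * p)) * l ≡ l + r * - (p * l)
      eq = solve-∀ ℚ-ring

    exponent₀ : ∀ r ρ l → (Defs.- (fromℕ r Defs.* ρ)) *ᴿ l ≈ fromℕ r *ᴿ (-ᴿ (ρ *ᴿ l))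
    exponent₀ r ρ l = pointwise (λ n → eq (ι r) (seq ρ n) (seq l n))
      where
      eq : ∀ r p l → - (r * p) * l ≡ r * - (p * l)
      eq = solve-∀ ℚ-ring

    exponent-r : ∀ r ρ l → fromℕ r *ᴿ (-ᴿ (ρ *ᴿ l)) ≈ -ᴿ ((ρ *ᴿ fromℕ r) *ᴿ l)
    exponent-r r ρ l = pointwise (λ n → eq (ι r) (seq ρ n) (seq l n))
      where
      eq : ∀ r p l → r * - (p * l) ≡ - (p * r * l)
      eq = solve-∀ ℚ-ring

    exponent-suc : ∀ r u → u +ᴿ fromℕ r *ᴿ u ≈ fromℕ (suc r) *ᴿ u
    exponent-suc r u = fromℕ-suc-* r u

    gather : ∀ c n P t → (fromℚ c *ᴿ (fromℕ n *ᴿ P)) *ᴿ fromℕ t ≈ fromℚ (c * (ι n * ι t)) *ᴿ P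
    gather c n P t = pointwise (λ j → eq c (ι n) (seq P j) (ι t))
      where
      eq : ∀ c n P t → c * (n * P) * t ≡ c * (n * t) * P
      eq = solve-∀ ℚ-ring

    gather₀ : ∀ c d P → fromℚ c *ᴿ fromℕ d *ᴿ P ≈ fromℚ (c * ι d) *ᴿ P
    gather₀ c d P = pointwise (λ j → refl)

    gather₁ : ∀ c d n P → fromℚ c *ᴿ fromℚ (ι d * rec n) *ᴿ (fromℕ n *ᴿ P) ≈ fromℚ (rec n * ι n) *ᴿ (fromℚ (c * ι d) *ᴿ P)
    gather₁ c d n P = pointwise (λ j → eq c (ι d) (rec n) (ι n) (seq P j))
      where
      eq : ∀ c d v n P → c * (d * v) * (n * P) ≡ v * n * (c * d * P)
      eq = solve-∀ ℚ-ring

    *ᴿ≈* : ∀ x y → x Defs.* y ≈ x *ᴿ y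
    *ᴿ≈* x y = pointwise (λ _ → refl)

  -- Cubes the real hypothesis d ≤ n^(2/3) into a statement about naturals. The witness b is
  -- identified as exp of 2/3 of a logarithm of n, so b³ = n².
  cube : ∀ n .{{_ : NonZero n}} d b → IsPow (fromℕ n) (fromℚ (ℤ.+ 2 / 3)) b → fromℕ d Defs.≤ b → d ℕ.* (d ℕ.* d) ℕ.≤ n ℕ.* n
  cube n d b (inj₁ (n≈0 , _)) _ = contradiction (fromℚ-cancel (≈⇒≤ (eqv {fromℕ n} {0ℝ} n≈0))) (λ h → <-irrefl refl (<-≤-trans (0<ι′ n) h))
  cube n d b (inj₂ (t , n=exp , b=exp)) d≤b = ι-cancel (fromℚ-cancel (≤ᴿ-trans (≈⇒≤ d³) (≤ᴿ-trans
      (*ᴿ-mono 0≤b (0≤ᴿ* 0≤d 0≤d) d≤ (*ᴿ-mono 0≤b 0≤d d≤ d≤)) (≈⇒≤ b³≈n²))))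
    where
    u : ℝ
    u = fromℚ (ℤ.+ 2 / 3) *ᴿ t
    n≈ : fromℕ n ≈ exp t
    n≈ = isExp⁻¹ n=exp
    b≈ : b ≈ exp u
    b≈ = ≈-trans (isExp⁻¹ b=exp) (exp-cong (*ᴿ≈* (fromℚ (ℤ.+ 2 / 3)) t))
    d≤ : fromℕ d ≤ᴿ b
    d≤ = leq d≤b
    0≤d : 0ℝ ≤ᴿ fromℕ d
    0≤d = fromℚ-mono (0≤ι d)
    0≤b : 0ℝ ≤ᴿ b
    0≤b = ≤ᴿ-trans 0≤d d≤
    d³ : fromℚ (ι (d ℕ.* (d ℕ.* d))) ≈ fromℕ d *ᴿ (fromℕ d *ᴿ fromℕ d)
    d³ = ≈-sym (≈-trans (*ᴿ-cong ≈-refl (fromℚ-* (ι d) (ι d))) (≈-trans (fromℚ-* (ι d) (ι d * ι d))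
      (subst (λ q → fromℚ (ι d * (ι d * ι d)) ≈ fromℚ q) (sym (trans (ι-* d (d ℕ.* d)) (cong (ι d *_) (ι-* d d)))) ≈-refl)))
    b³≈n² : b *ᴿ (b *ᴿ b) ≈ fromℚ (ι (n ℕ.* n))
    b³≈n² = ≈-trans (*ᴿ-cong b≈ (*ᴿ-cong b≈ b≈)) (≈-trans (*ᴿ-cong ≈-refl (≈-sym (exp-+ u u))) (≈-trans (≈-sym (exp-+ u (u +ᴿ u)))
      (≈-trans (exp-cong (two-thirds t)) (≈-trans (exp-+ t t) (≈-trans (*ᴿ-cong (≈-sym n≈) (≈-sym n≈)) (≈-trans (fromℚ-* (ι n) (ι n))
        (subst (λ q → fromℚ (ι n * ι n) ≈ fromℚ q) (sym (ι-* n n)) ≈-refl)))))))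

  exp-∏ : ∀ r u → ∏ᴿ {r} (λ _ → exp u) ≈ exp (fromℕ r *ᴿ u)
  exp-∏ zero    u = ≈-trans (≈-sym exp-0) (exp-cong (≈-sym (*ᴿ-zeroˡ u)))
  exp-∏ (suc r) u = ≈-trans (*ᴿ-cong ≈-refl (exp-∏ r u)) (≈-trans (≈-sym (exp-+ u (fromℕ r *ᴿ u))) (exp-cong (exponent-suc r u)))

  abstract
    -- One denominator for all three parts: 5^r pays for the normalisation of entries up to 5, the
    -- other factors for the rational estimates.
    C₀ : ℕ → ℕ
    C₀ l = 5 ℕ.^ (suc (suc (suc l))) ℕ.* (K₁ l ℕ.* K₂ l)

    C₀≢0 : ∀ l → NonZero (C₀ l)
    C₀≢0 l = ℕ.m*n≢0 (5 ℕ.^ (suc (suc (suc l)))) (K₁ l ℕ.* K₂ l) {{ℕ.m^n≢0 5 (suc (suc (suc l)))}} {{ℕ.m*n≢0 (K₁ l) (K₂ l) {{K₁≢0 l}} {{K₂≢0 l}}}}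

    5^K₁≤C₀ : ∀ l → 5 ℕ.^ (suc (suc (suc l))) ℕ.* K₁ l ℕ.≤ C₀ l
    5^K₁≤C₀ l = ℕ.*-monoʳ-≤ (5 ℕ.^ (suc (suc (suc l)))) (ℕ.m≤m*n (K₁ l) (K₂ l) {{K₂≢0 l}})

    K₂≤C₀ : ∀ l → K₂ l ℕ.≤ C₀ l
    K₂≤C₀ l = ℕ.≤-trans (ℕ.m≤n*m (K₂ l) (K₁ l) {{K₁≢0 l}}) (ℕ.m≤n*m (K₁ l ℕ.* K₂ l) (5 ℕ.^ (suc (suc (suc l)))) {{ℕ.m^n≢0 5 (suc (suc (suc l)))}})

  c₀ : ℕ → ℚ
  c₀ l = rec (C₀ l)

  0<c₀ : ∀ l → 0ℚ < c₀ l
  0<c₀ l = 0<rec (C₀ l) {{C₀≢0 l}}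

  0≤c₀ : ∀ l → 0ℚ ≤ c₀ l
  0≤c₀ l = 0≤rec (C₀ l)

  c₀*≤1 : ∀ l {A} → A ℕ.≤ C₀ l → c₀ l * ι A ≤ 1ℚ
  c₀*≤1 l {A} h = ≤-trans (*-monoˡ (0≤c₀ l) (ι-mono h)) (≤-reflexive (rec-inverse (C₀ l) {{C₀≢0 l}}))

  -- Divides a rational estimate by its constant A and by the normalisation cost X; both fit into
  -- the denominator `C₀`.
  shrink : ∀ l X A .{{_ : NonZero A}} {m s} → X ℕ.* A ℕ.≤ C₀ l → 0ℚ ≤ m → m ≤ ι A * s → c₀ l * m * ι X ≤ s
  shrink l X A {m} {s} XA≤ 0≤m h = begin
    c₀ l * m * ι X           ≡⟨ eq₁ (c₀ l) m (ι X) ⟩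
    c₀ l * ι X * m           ≤⟨ *-monoˡ (0≤* (0≤c₀ l) (0≤ι X)) h ⟩
    c₀ l * ι X * (ι A * s)   ≡⟨ trans (eq₂ (c₀ l) (ι X) (ι A) s) (cong (λ q → c₀ l * q * s) (sym (ι-* X A))) ⟩
    c₀ l * ι (X ℕ.* A) * s   ≤⟨ *-monoʳ (*-cancelˡ (0<ι′ A) (≤-trans (≤-reflexive (*-zeroʳ (ι A))) (≤-trans 0≤m h))) (c₀*≤1 l XA≤) ⟩
    1ℚ * s                   ≡⟨ *-identityˡ s ⟩
    s                        ∎
    where
    open ≤-Reasoning
    eq₁ : ∀ c m x → c * m * x ≡ c * x * m
    eq₁ = solve-∀ ℚ-ring
    eq₂ : ∀ c x a s → c * x * (a * s) ≡ c * (x * a) * s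
    eq₂ = solve-∀ ℚ-ring

  module _ {l n : ℕ} .{{_ : NonZero n}} (H : Hypergraph (suc (suc (suc l))) n) {d : ℕ} (reg : Regular d H) (p : ℝ) (0<p : 0ℝ Defs.< p) where

    private
      r t : ℕ
      r = suc (suc (suc l))
      t = proj₁ (sqrt-approx d)

      d≤t² : d ℕ.≤ t ℕ.* t
      d≤t² = proj₁ (proj₂ (sqrt-approx d))

      t²≤4d : t ℕ.* t ℕ.≤ 4 ℕ.* d
      t²≤4d = proj₂ (proj₂ (sqrt-approx d))

      m : ℚ
      m = ι n * ι t

      0≤m : 0ℚ ≤ m
      0≤m = 0≤* (0≤ι n) (0≤ι t)

    -- n ^ (-r/p)
    P : ℝ
    P = ∏ᴿ {suc (suc (suc l))} (λ _ → unit H p 0<p)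

    0≤P : 0ℝ ≤ᴿ P
    0≤P = 0≤∏ᴿ {suc (suc (suc l))} (λ _ → 0≤exp (-ᴿ (recip p 0<p *ᴿ lnℕ n)))

    λ₂-bound : d ℕ.* (d ℕ.* d) ℕ.≤ n ℕ.* n → ∀ z → z ≤ᴿ fromℚ (c₀ l * (ι n * ι (proj₁ (sqrt-approx d)))) *ᴿ P → z ≤ᴸ λ₂ H p 0<p
    λ₂-bound h =
      let y , b , nz , σ≥ = part-i H {d} {t} reg d≤t² t²≤4d h
      in λ₂-lower H p 0<p 5 (c₀ l * m) y b nz (0≤* (0≤c₀ l) 0≤m)
           (subst (λ q → c₀ l * m * q ≤ σℚ H (λ _ → y)) (ι-^ 5 r) (shrink l (5 ℕ.^ r) (K₁ l) {{K₁≢0 l}} (5^K₁≤C₀ l) 0≤m σ≥))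

    μ-bound : 4 ℕ.* d ℕ.< n ℕ.^ 2 → ∀ z → z ≤ᴿ fromℚ (c₀ l * (ι n * ι (proj₁ (sqrt-approx d)))) *ᴿ P → z ≤ᴸ μ H p 0<p
    μ-bound h =
      let x , s , σ≥ = part-ii H {d} {t} reg d≤t² t²≤4d h
      in μ-lower H p 0<p (c₀ l * m) x s (0≤* (0≤c₀ l) 0≤m)
           (subst (_≤ σℚ H x) (*-identityʳ (c₀ l * m)) (shrink l 1 (K₂ l) {{K₂≢0 l}} (ℕ.≤-trans (ℕ.≤-reflexive (ℕ.*-identityˡ (K₂ l))) (K₂≤C₀ l)) 0≤m σ≥))

    μ-bound₀ : ∀ z → z ≤ᴿ fromℚ (c₀ l * ι d) *ᴿ P → z ≤ᴸ μ H p 0<p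
    μ-bound₀ =
      let x , s , σ≥ = signs-≥-d H reg
      in μ-lower H p 0<p (c₀ l * ι d) x s (0≤* (0≤c₀ l) (0≤ι d))
           (subst (_≤ σℚ H x) (*-identityʳ (c₀ l * ι d)) (shrink l 1 1 (ℕ.>-nonZero⁻¹ (C₀ l) {{C₀≢0 l}}) (0≤ι d) (≤-trans σ≥ (≤-reflexive (sym (*-identityˡ (σℚ H x)))))))

    P-exp : P ≈ exp (fromℕ (suc (suc (suc l))) *ᴿ (-ᴿ (recip p 0<p *ᴿ lnℕ n)))
    P-exp = exp-∏ (suc (suc (suc l))) (-ᴿ (recip p 0<p *ᴿ lnℕ n))

    y₁ y₀ : ℝ
    y₁ = exp ((1ℝ Defs.- fromℕ (suc (suc (suc l))) Defs.* recip p 0<p) *ᴿ lnℕ n)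
    y₀ = exp ((Defs.- (fromℕ (suc (suc (suc l))) Defs.* recip p 0<p)) *ᴿ lnℕ n)

    y₁-pow : IsPow (fromℕ n) (1ℝ Defs.- fromℕ (suc (suc (suc l))) Defs.* recip p 0<p) y₁
    y₁-pow = isPow (fromℕ n) (1ℝ Defs.- fromℕ (suc (suc (suc l))) Defs.* recip p 0<p) y₁ (lnℕ n) (≈-sym (exp-lnℚ (ι n) (1≤ι n))) ≈-refl

    y₀-pow : IsPow (fromℕ n) (Defs.- (fromℕ (suc (suc (suc l))) Defs.* recip p 0<p)) y₀
    y₀-pow = isPow (fromℕ n) (Defs.- (fromℕ (suc (suc (suc l))) Defs.* recip p 0<p)) y₀ (lnℕ n) (≈-sym (exp-lnℚ (ι n) (1≤ι n))) ≈-refl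

    y₁≈nP : y₁ ≈ fromℕ n *ᴿ P
    y₁≈nP = ≈-trans (exp-cong (exponent₁ (suc (suc (suc l))) (recip p 0<p) (lnℕ n))) (≈-trans (exp-+ (lnℕ n) (fromℕ (suc (suc (suc l))) *ᴿ (-ᴿ (recip p 0<p *ᴿ lnℕ n))))
      (*ᴿ-cong (exp-lnℚ (ι n) (1≤ι n)) (≈-sym P-exp)))

    y₀≈P : y₀ ≈ P
    y₀≈P = ≈-trans (exp-cong (exponent₀ (suc (suc (suc l))) (recip p 0<p) (lnℕ n))) (≈-sym P-exp)

    general : ∀ s → 0ℝ ≤ᴿ s → s ≤ᴿ fromℕ (proj₁ (sqrt-approx d)) →
              fromℚ (c₀ l) *ᴿ y₁ *ᴿ s ≤ᴿ fromℚ (c₀ l * (ι n * ι (proj₁ (sqrt-approx d)))) *ᴿ P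
    general s 0≤s s≤t = ≤ᴿ-trans (*ᴿ-mono (0≤ᴿ* (fromℚ-mono (0≤c₀ l)) (0≤ᴿ* (fromℚ-mono (0≤ι n)) 0≤P)) 0≤s
      (≈⇒≤ (*ᴿ-cong ≈-refl y₁≈nP)) s≤t) (≈⇒≤ (gather (c₀ l) n P (proj₁ (sqrt-approx d))))

    general₀ : fromℚ (c₀ l) *ᴿ fromℕ d *ᴿ y₀ ≤ᴿ fromℚ (c₀ l * ι d) *ᴿ P
    general₀ = ≈⇒≤ (≈-trans (*ᴿ-cong ≈-refl y₀≈P) (gather₀ (c₀ l) d P))

    module _ (p≈r : p ≈ fromℕ (suc (suc (suc l)))) where

      -- At p = r the factor n^(-r/p) is 1/n, which is how the bounds for general p yield those for
      -- p = r.
      nP≈1 : fromℕ n *ᴿ P ≈ 1ℝ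
      nP≈1 = ≈-trans (*ᴿ-cong (≈-sym (exp-lnℚ (ι n) (1≤ι n))) (≈-trans P-exp (exp-cong (≈-trans (exponent-r (suc (suc (suc l))) (recip p 0<p) (lnℕ n))
        (-ᴿ-cong (≈-trans (*ᴿ-cong (≈-trans (*ᴿ-cong ≈-refl (≈-sym p≈r)) (recip-inverse p 0<p)) ≈-refl) (*ᴿ-identityˡ (lnℕ n)))))))) (exp-neg (lnℕ n))

      special : ∀ s → 0ℝ ≤ᴿ s → s ≤ᴿ fromℕ (proj₁ (sqrt-approx d)) →
                fromℚ (c₀ l) *ᴿ s ≤ᴿ fromℚ (c₀ l * (ι n * ι (proj₁ (sqrt-approx d)))) *ᴿ P
      special s 0≤s s≤t = ≤ᴿ-trans (≈⇒≤ (*ᴿ-cong (≈-trans (≈-sym (*ᴿ-identityʳ (fromℚ (c₀ l)))) (*ᴿ-cong ≈-refl (≈-sym nP≈1))) ≈-refl))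
        (≤ᴿ-trans (*ᴿ-mono (0≤ᴿ* (fromℚ-mono (0≤c₀ l)) (0≤ᴿ* (fromℚ-mono (0≤ι n)) 0≤P)) 0≤s ≤ᴿ-refl s≤t) (≈⇒≤ (gather (c₀ l) n P (proj₁ (sqrt-approx d)))))

      special₀ : fromℚ (c₀ l) *ᴿ fromℚ (ℤ.+ d / n) ≤ᴿ fromℚ (c₀ l * ι d) *ᴿ P
      special₀ = ≈⇒≤ (≈-trans (≈-trans (≈-sym (*ᴿ-identityʳ (fromℚ (c₀ l) *ᴿ fromℚ (ℤ.+ d / n)))) (*ᴿ-cong (*ᴿ-cong ≈-refl (fromℚ-cong d/n)) (≈-sym nP≈1)))
        (≈-trans (gather₁ (c₀ l) d n P) (≈-trans (*ᴿ-cong (fromℚ-cong (rec-inverse n)) ≈-refl) (*ᴿ-identityˡ (fromℚ (c₀ l * ι d) *ᴿ P)))))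
        where
        fromℚ-cong : ∀ {q q′} → q ≡ q′ → fromℚ q ≈ fromℚ q′
        fromℚ-cong refl = ≈-refl
        eq : ∀ a b c → a * (b * c) ≡ c * a * b
        eq = solve-∀ ℚ-ring
        d/n : ℤ.+ d / n ≡ ι d * rec n
        d/n = *-cancelˡ-≡ (0<ι′ n) (trans (*-comm (ι n) (ℤ.+ d / n)) (trans (/-*-ι d n) (sym (trans (eq (ι n) (ι d) (rec n)) (trans (cong (_* ι d) (rec-inverse n)) (*-identityˡ (ι d)))))))

-- The theorem

open import Defs
open import Data.Integer using (+_)
open import Data.Nat.Combinatorics using (_C_)
open import Data.Rational using (_/_)
open IntegerSqrt using (sqrt-approx)
open Reals using (*ᴿ-def; ≈-refl; _≤ᴿ_) renaming (_*ᴿ_ to _·_)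
open Assembly

-- Leaves the opaque multiplication, in which estimates were proved, for the one of the statement.
raw₂ : ∀ x y z (L : LowerReal) → x · y · z ≤ᴸ L → x * y * z ≤ᴸ L
raw₂ x y z L = subst (_≤ᴸ L) (trans (*ᴿ-def (x · y) z) (cong (_* z) (*ᴿ-def x y)))

raw₁ : ∀ x y (L : LowerReal) → x · y ≤ᴸ L → x * y ≤ᴸ L
raw₁ x y L = subst (_≤ᴸ L) (*ᴿ-def x y)

0<c : ∀ l → 0ℝ < fromℚ (c₀ l)
0<c l = c₀ l , 0<c₀ l , 0 , λ _ _ → ≤-reflexive (+-identityˡ (c₀ l))
  where open import Data.Rational.Properties using (≤-reflexive; +-identityˡ)

module _ {l n d : ℕ} .{{_ : NonZero n}} (H : Hypergraph (suc (suc (suc l))) n) (reg : Regular d H)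
         (s : ℝ) (s-sqrt : IsSqrt (fromℕ d) s) (0≤s : 0ℝ ≤ᴿ s) (s≤t : s ≤ᴿ fromℕ (proj₁ (sqrt-approx d))) where


  part-i-r : (0<r : 0ℝ < fromℕ (suc (suc (suc l)))) → d ℕ.* (d ℕ.* d) ℕ.≤ n ℕ.* n →
          ∃ λ s → IsSqrt (fromℕ d) s × (fromℚ (c₀ l) * s ≤ᴸ λ₂ H (fromℕ (suc (suc (suc l)))) 0<r)
  part-i-r 0<r h = s , s-sqrt , raw₁ (fromℚ (c₀ l)) s (λ₂ H (fromℕ (suc (suc (suc l)))) 0<r)
    (λ₂-bound H reg (fromℕ (suc (suc (suc l)))) 0<r h (fromℚ (c₀ l) · s) (special H reg (fromℕ (suc (suc (suc l)))) 0<r ≈-refl s 0≤s s≤t))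

  part-i-p : ∀ p (0<p : 0ℝ < p) → d ℕ.* (d ℕ.* d) ℕ.≤ n ℕ.* n →
          ∃ λ y → ∃ λ s → IsPow (fromℕ n) (1ℝ - fromℕ (suc (suc (suc l))) * recip p 0<p) y × IsSqrt (fromℕ d) s ×
            (fromℚ (c₀ l) * y * s ≤ᴸ λ₂ H p 0<p)
  part-i-p p 0<p h = y₁ H reg p 0<p , s , y₁-pow H reg p 0<p , s-sqrt , raw₂ (fromℚ (c₀ l)) (y₁ H reg p 0<p) s (λ₂ H p 0<p)
    (λ₂-bound H reg p 0<p h (fromℚ (c₀ l) · y₁ H reg p 0<p · s) (general H reg p 0<p s 0≤s s≤t))

  part-ii-r : (0<r : 0ℝ < fromℕ (suc (suc (suc l)))) → 4 ℕ.* d ℕ.< n ℕ.^ 2 →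
           ∃ λ s → IsSqrt (fromℕ d) s × (fromℚ (c₀ l) * s ≤ᴸ μ H (fromℕ (suc (suc (suc l)))) 0<r)
  part-ii-r 0<r h = s , s-sqrt , raw₁ (fromℚ (c₀ l)) s (μ H (fromℕ (suc (suc (suc l)))) 0<r)
    (μ-bound H reg (fromℕ (suc (suc (suc l)))) 0<r h (fromℚ (c₀ l) · s) (special H reg (fromℕ (suc (suc (suc l)))) 0<r ≈-refl s 0≤s s≤t))

  part-ii-p : ∀ p (0<p : 0ℝ < p) → 4 ℕ.* d ℕ.< n ℕ.^ 2 →
           ∃ λ y → ∃ λ s → IsPow (fromℕ n) (1ℝ - fromℕ (suc (suc (suc l))) * recip p 0<p) y × IsSqrt (fromℕ d) s ×
             (fromℚ (c₀ l) * y * s ≤ᴸ μ H p 0<p)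
  part-ii-p p 0<p h = y₁ H reg p 0<p , s , y₁-pow H reg p 0<p , s-sqrt , raw₂ (fromℚ (c₀ l)) (y₁ H reg p 0<p) s (μ H p 0<p)
    (μ-bound H reg p 0<p h (fromℚ (c₀ l) · y₁ H reg p 0<p · s) (general H reg p 0<p s 0≤s s≤t))

  part-iii-r : (0<r : 0ℝ < fromℕ (suc (suc (suc l)))) → fromℚ (c₀ l) * fromℚ (+ d / n) ≤ᴸ μ H (fromℕ (suc (suc (suc l)))) 0<r
  part-iii-r 0<r = raw₁ (fromℚ (c₀ l)) (fromℚ (+ d / n)) (μ H (fromℕ (suc (suc (suc l)))) 0<r)
    (μ-bound₀ H reg (fromℕ (suc (suc (suc l)))) 0<r (fromℚ (c₀ l) · fromℚ (+ d / n)) (special₀ H reg (fromℕ (suc (suc (suc l)))) 0<r ≈-refl))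

  part-iii-p : ∀ p (0<p : 0ℝ < p) →
            ∃ λ y → IsPow (fromℕ n) (- (fromℕ (suc (suc (suc l))) * recip p 0<p)) y × (fromℚ (c₀ l) * fromℕ d * y ≤ᴸ μ H p 0<p)
  part-iii-p p 0<p = y₀ H reg p 0<p , y₀-pow H reg p 0<p , raw₂ (fromℚ (c₀ l)) (fromℕ d) (y₀ H reg p 0<p) (μ H p 0<p)
    (μ-bound₀ H reg p 0<p (fromℚ (c₀ l) · fromℕ d · y₀ H reg p 0<p) (general₀ H reg p 0<p))

theorem1p8 :
    ∀ (r : ℕ) (3≤r : 3 ℕ.≤ r) →
    Σ ℝ λ c → (0ℝ < c) ×
      (∀ (n d : ℕ) .{{_ : NonZero n}} (H : Hypergraph r n) → Regular d H →
        -- (i)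
        ((∃ λ b → IsPow (fromℕ n) (fromℚ (+ 2 / 3)) b × (fromℕ d ≤ b)) →
          (∃ λ s → IsSqrt (fromℕ d) s ×
            (c * s ≤ᴸ λ₂ H (fromℕ r) (0<fromℕ 3≤r))) ×
          (∀ (p : ℝ) (1≤p : 1ℝ ≤ p) →
            ∃ λ y → ∃ λ s →
              IsPow (fromℕ n) (1ℝ - fromℕ r * recip p (1≤⇒0< p 1≤p)) y ×
              IsSqrt (fromℕ d) s ×
              (c * y * s ≤ᴸ λ₂ H p (1≤⇒0< p 1≤p)))) ×
        -- (ii)
        (4 ℕ.* d ℕ.< n ℕ.^ 2 →
          (∃ λ s → IsSqrt (fromℕ d) s ×
            (c * s ≤ᴸ μ H (fromℕ r) (0<fromℕ 3≤r))) ×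
          (∀ (p : ℝ) (1≤p : 1ℝ ≤ p) →
            ∃ λ y → ∃ λ s →
              IsPow (fromℕ n) (1ℝ - fromℕ r * recip p (1≤⇒0< p 1≤p)) y ×
              IsSqrt (fromℕ d) s ×
              (c * y * s ≤ᴸ μ H p (1≤⇒0< p 1≤p)))) ×
        -- (iii)
        (4 ℕ.≤ r → n ℕ.^ 2 ℕ.≤ 4 ℕ.* d → 2 ℕ.* d ℕ.≤ (n ∸ 1) C (r ∸ 1) →
          (c * fromℚ (+ d / n) ≤ᴸ μ H (fromℕ r) (0<fromℕ 3≤r)) ×
          (∀ (p : ℝ) (1≤p : 1ℝ ≤ p) →
            ∃ λ y →
              IsPow (fromℕ n) (- (fromℕ r * recip p (1≤⇒0< p 1≤p))) y ×
              (c * fromℕ d * y ≤ᴸ μ H p (1≤⇒0< p 1≤p)))))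
theorem1p8 zero                ()
theorem1p8 (suc zero)          (s≤s ())
theorem1p8 (suc (suc zero))    (s≤s (s≤s ()))
-- The constant is 1/`C₀ l` with l = r - 3, chosen before n, d and H.
theorem1p8 (suc (suc (suc l))) 3≤r = fromℚ (c₀ l) , 0<c l , λ n d H reg →
  let s , s-sqrt , 0≤s , s≤ = sqrt d
      s≤t = s≤ (proj₁ (sqrt-approx d)) (proj₁ (proj₂ (sqrt-approx d)))
      0<r = 0<fromℕ 3≤r
  in
  (λ (b , b-pow , d≤b) → let d³≤n² = cube n d b b-pow d≤b in
     part-i-r H reg s s-sqrt 0≤s s≤t 0<r d³≤n² , λ p 1≤p → part-i-p H reg s s-sqrt 0≤s s≤t p (1≤⇒0< p 1≤p) d³≤n²) ,
  (λ 4d<n² → part-ii-r H reg s s-sqrt 0≤s s≤t 0<r 4d<n² , λ p 1≤p → part-ii-p H reg s s-sqrt 0≤s s≤t p (1≤⇒0< p 1≤p) 4d<n²) ,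
  (λ _ _ _ → part-iii-r H reg s s-sqrt 0≤s s≤t 0<r , λ p 1≤p → part-iii-p H reg s s-sqrt 0≤s s≤t p (1≤⇒0< p 1≤p))
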